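{- Let $n\ge2$. On the set $\bigsqcup_{\lambda,\rho\in\mathbb S}\mathrm{SST}(\lambda/\rho,n)^2$, the families of Kashiwara operators $\{E^{(1)}_i,F^{(1)}_i:0\le i\le n-1\}$ and $\{E^{(2)}_i,F^{(2)}_i:0\le i\le n-1\}$ commute with each other, i.e. $G^{(1)}\circ G^{(2)}=G^{(2)}\circ G^{(1)}$ for every $G^{(1)}$ in the first family and $G^{(2)}$ in the second (with the convention $G(\mathbf 0)=\mathbf 0$). That is, they equip $\bigsqcup_{\lambda,\rho}\mathrm{SST}(\lambda/\rho,n)^2$ with an $(\widehat{\mathfrak{sl}}_n\oplus\widehat{\mathfrak{sl}}_n)$-crystal structure.
   Context: A signature of length $\ell\ge0$ is a sequence of integers $\lambda=(\lambda_1\ge\dots\ge\lambda_\ell)$; $\mathbb S_\ell$ is the set of these, $\mathbb S=\bigsqcup_{\ell\ge0}\mathbb S_\ell$. Conjugate: $\lambda'_x=\#\{j:\lambda_j\ge x\}$, $x\in\mathbb Z$. $\kappa\preceq\mu$ (same length) means $\mu_1\ge\kappa_1\ge\mu_2\ge\kappa_2\ge\cdots$, equivalently $\mu'_x-\kappa'_x\in\{0,1\}$ for all $x$. For $\kappa\preceq\mu$, $\kappa\preceq\lambda$ in $\mathbb S_\ell$ put $a_x=\mu'_x-\kappa'_x$, $b_x=\lambda'_x-\kappa'_x$, $c_x=\max\{0,a_x+b_x+c_{x-1}-1\}$ with $c_x=0$ for $x\ll0$; $\overline{\mathsf F}(\kappa,\mu,\lambda)=\nu\in\mathbb S_\ell$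 is given by $\nu'_x=\mu'_x+\lambda'_x-\kappa'_x+c_{x-1}-c_x$. $\mathscr C_n=\mathbb Z^2/\sim$, $(x,y)\sim(x+kn,y-kn)$, $k\in\mathbb Z$. A Fomin field is a map $\boldsymbol\lambda:\mathscr C_n\to\mathbb S_\ell$ with $\boldsymbol\lambda(p)\preceq\boldsymbol\lambda(p+\mathbf e_i)$ ($i=1,2$) and $\boldsymbol\lambda(p+\mathbf e_1+\mathbf e_2)=\overline{\mathsf F}(\boldsymbol\lambda(p),\boldsymbol\lambda(p+\mathbf e_1),\boldsymbol\lambda(p+\mathbf e_2))$. For $\rho,\lambda$ of the same length, $P\in\mathrm{SST}(\lambda/\rho,n)$ is a chain $\rho=\lambda^{(0)}\preceq\dots\preceq\lambda^{(n)}=\lambda$; equivalently a filling where cells $(j,k)$ (row $j$, column $k$) with $\lambda^{(i-1)}_j<k\le\lambda^{(i)}_j$ have label $i$. For $P=(\lambda^{(i)})_i$, $Q=(\mu^{(i)})_i$ in $\mathrm{SST}(\lambda/\rho,n)$, $\boldsymbol\lambda[P,Q]$ is the unique Fomin field on $\mathscr C_n$ with $\boldsymbol\lambda(i,0)=\lambda^{(i)}$, $\boldsymbol\lambda(0,i)=\mu^{(i)}$, $0\le i\le n$. With $\boldsymbol\lambda=\boldsymbol\lambda[P,Q]$, $\iota_1(P,Q)=\big((\boldsymbol\lambda(1+i,0))_{i=0}^n,(\boldsymbol\lambda(1,i))_{i=0}^n\big)$ and $\iota_2(P,Q)=\big((\boldsymbol\lambda(i,1))_{i=0}^n,(\boldsymbol\lambda(0,1+i))_{i=0}^n\big)$;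 both are invertible. Kashiwara operators. For $1\le i\le n-1$ and a tableau $P$, take its row reading word (rows concatenated from bottom to top), replace each $i$ by ")" and each $i+1$ by "(", ignore other letters, delete successively adjacent pairs "(" ")" until the remaining string is $)\cdots)(\cdots($. $e_i(P)$ changes the $i+1$ of the leftmost remaining "(" into $i$ ($\mathbf 0$ if none); $f_i(P)$ changes the $i$ of the rightmost remaining ")" into $i+1$ ($\mathbf 0$ if none). On pairs, for $1\le i\le n-1$: $E^{(1)}_i=e_i\times\mathbf 1$, $F^{(1)}_i=f_i\times\mathbf 1$, $E^{(2)}_i=\mathbf 1\times e_i$, $F^{(2)}_i=\mathbf 1\times f_i$; and $E^{(k)}_0=\iota_k\circ E^{(k)}_1\circ\iota_k^{ -1}$, $F^{(k)}_0=\iota_k\circ F^{(k)}_1\circ\iota_k^{ -1}$ for $k=1,2$. Crystal structure means: for each $k$, with weight $\mathrm{wt}^{(k)}\in\mathbb Z^n$ counting the labels $1,\dots,n$ in the $k$-th tableau, $F_i^{(k)}(b)=b'$ iff $E_i^{(k)}(b')=b$; then $\mathrm{wt}^{(k)}(b')=\mathrm{wt}^{(k)}(b)-\epsilon_i+\epsilon_{i+1}$ (standard basis, $\epsilon_0=\epsilon_n$); and $\varphi_i-\varepsilon_i=\langle\epsilon_i-\epsilon_{i+1},\mathrm{wt}^{(k)}\rangle$ where $\varepsilon_i(b)=\max\{m:(E_i^{(k)})^mb\ne\mathbf 0\}$, $\varphi_i(b)=\max\{m:(F_i^{(k)})^mb\neq\mathbf 0\}$; the two structures commute. -}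

module Defs where

open import Data.Empty using (⊥-elim)
open import Data.Fin as Fin using (Fin; zero; suc; toℕ; fromℕ; fromℕ<; inject₁; opposite)
import Data.Fin.Properties as Fin
open import Data.Integer as ℤ using (ℤ; +_; -[1+_]; 0ℤ; 1ℤ; _+_; _-_; _*_; -_; _⊔_; ∣_∣)
import Data.Integer.DivMod as ℤ
import Data.Integer.Properties as ℤ
open import Data.Integer.Tactic.RingSolver using (solve-∀)
open import Data.List as List using (List; []; _∷_; _++_; concat; mapMaybe; filter; foldr; length; reverse; replicate)
import Data.List.Properties as List
open import Data.List.Membership.Propositional using (_∈_; _∉_)
import Data.List.Membership.Propositional.Properties as ∈
open import Data.List.Relation.Unary.Any using (here; there)
open import Data.Maybe as Maybe using (Maybe; just; nothing; _>>=_)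
open import Data.Nat as ℕ using (ℕ; zero; suc; _∸_; z≤n; s≤s)
import Data.Nat.Properties as ℕ
open import Data.Product using (Σ; ∃; ∃-syntax; _×_; _,_; proj₁; proj₂)
open import Data.Sum using (_⊎_; inj₁; inj₂)
open import Data.Vec as Vec using (Vec; []; _∷_; lookup; count; tabulate; _[_]≔_)
import Data.Vec.Properties as Vec
open import Function using (_∘_; id; _⇔_)
open import Relation.Binary.PropositionalEquality using (_≡_; _≢_; refl; sym; trans; cong; cong₂; subst; subst₂; module ≡-Reasoning)
open import Relation.Nullary using (¬_; Dec; yes; no; contradiction)
open import Relation.Nullary.Decidable using (recompute)

record Signature (ℓ : ℕ) : Set where
  constructor signature
  field
    parts       : Vec ℤ ℓ
    .decreasing : ∀ i j → i Fin.≤ j → lookup parts j ℤ.≤ lookup parts i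

open Signature public using (parts)

part : ∀ {ℓ} → Signature ℓ → Fin ℓ → ℤ
part μ = lookup (parts μ)

conjℕ : ∀ {ℓ} → Signature ℓ → ℤ → ℕ
conjℕ μ x = count (x ℤ.≤?_) (parts μ)

-- λ′ₓ as an integer
conj : ∀ {ℓ} → Signature ℓ → ℤ → ℤ
conj μ x = + conjℕ μ x

infix 4 _⪯_

record _⪯_ {ℓ} (κ μ : Signature ℓ) : Set where
  constructor interlace
  field
    below : ∀ j → part κ j ℤ.≤ part μ j
    above : ∀ j k → toℕ k ≡ suc (toℕ j) → part μ k ℤ.≤ part κ j

-- The graph of F̄, with θ written for λ: when κ ⪯ μ and κ ⪯ θ, such a ν exists
-- (`fomin`), is unique (`fomin-unique`), and is F̄(κ, μ, λ).  The carry is c,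
-- the bracketed differences are aₓ and bₓ.
record FominRule {ℓ} (κ μ θ ν : Signature ℓ) : Set where
  field
    carry      : ℤ → ℤ
    carry-init : ∃[ N ] ∀ x → x ℤ.≤ N → carry x ≡ 0ℤ
    carry-step : ∀ x → carry x ≡
      0ℤ ⊔ ((conj μ x - conj κ x) + (conj θ x - conj κ x) + carry (x - 1ℤ) - 1ℤ)
    conj-ν     : ∀ x → conj ν x ≡
      conj μ x + conj θ x - conj κ x + carry (x - 1ℤ) - carry x

module _ {ℓ : ℕ} where

  signature-≡ : {μ ν : Signature ℓ} → parts μ ≡ parts ν → μ ≡ ν
  signature-≡ refl = refl

  _≟ˢ_ : (μ ν : Signature ℓ) → Dec (μ ≡ ν)
  μ ≟ˢ ν with Vec.≡-dec ℤ._≟_ (parts μ) (parts ν)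
  ... | yes p = yes (signature-≡ p)
  ... | no ¬p = no (¬p ∘ cong parts)

  part-≡ : {μ ν : Signature ℓ} → (∀ j → part μ j ≡ part ν j) → μ ≡ ν
  part-≡ {μ} {ν} eq = signature-≡ (begin
    parts μ             ≡⟨ Vec.tabulate∘lookup (parts μ) ⟨
    tabulate (part μ)   ≡⟨ Vec.tabulate-cong eq ⟩
    tabulate (part ν)   ≡⟨ Vec.tabulate∘lookup (parts ν) ⟩
    parts ν             ∎)
    where open ≡-Reasoning

  decr : (μ : Signature ℓ) → ∀ i j → i Fin.≤ j → part μ j ℤ.≤ part μ i
  decr (signature v d) i j i≤j = recompute (lookup v j ℤ.≤? lookup v i) (d i j i≤j)

private
  count⇒ : ∀ {ℓ} x (v : Vec ℤ ℓ) → (∀ i j → i Fin.≤ j → lookup v j ℤ.≤ lookup v i) →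
           ∀ k → toℕ k ℕ.< count (x ℤ.≤?_) v → x ℤ.≤ lookup v k
  count⇒ x (p ∷ v) d k k< with x ℤ.≤? p
  count⇒ x (p ∷ v) d zero k< | yes x≤p = x≤p
  count⇒ x (p ∷ v) d (suc k) (s≤s k<) | yes x≤p =
    count⇒ x v (λ i j i≤j → d (suc i) (suc j) (s≤s i≤j)) k k<
  count⇒ x (p ∷ v) d (suc k) k< | no x≰p =
    count⇒ x v (λ i j i≤j → d (suc i) (suc j) (s≤s i≤j)) k (ℕ.<-trans (ℕ.n<1+n _) k<)
  count⇒ x (p ∷ q ∷ v) d zero k< | no x≰p =
    ⊥-elim (x≰p (ℤ.≤-trans
      (count⇒ x (q ∷ v) (λ i j i≤j → d (suc i) (suc j) (s≤s i≤j)) zero k<)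
      (d zero (suc zero) z≤n)))

  count⇐ : ∀ {ℓ} x (v : Vec ℤ ℓ) → (∀ i j → i Fin.≤ j → lookup v j ℤ.≤ lookup v i) →
           ∀ k → x ℤ.≤ lookup v k → toℕ k ℕ.< count (x ℤ.≤?_) v
  count⇐ x (p ∷ v) d k x≤ with x ℤ.≤? p
  count⇐ x (p ∷ v) d zero x≤ | yes x≤p = s≤s z≤n
  count⇐ x (p ∷ v) d (suc k) x≤ | yes x≤p =
    s≤s (count⇐ x v (λ i j i≤j → d (suc i) (suc j) (s≤s i≤j)) k x≤)
  ... | no x≰p = ⊥-elim (x≰p (ℤ.≤-trans x≤ (d zero k z≤n)))

  count≤ : ∀ {ℓ} x (v : Vec ℤ ℓ) → count (x ℤ.≤?_) v ℕ.≤ ℓ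
  count≤ x [] = z≤n
  count≤ x (p ∷ v) with x ℤ.≤? p
  ... | yes _ = s≤s (count≤ x v)
  ... | no  _ = ℕ.m≤n⇒m≤1+n (count≤ x v)

  lowerBound : ∀ {ℓ} (v : Vec ℤ ℓ) → ∃[ N ] ∀ k → N ℤ.≤ lookup v k
  lowerBound [] = 0ℤ , λ ()
  lowerBound (p ∷ v) with lowerBound v
  ... | N , N≤ = p ℤ.⊓ N , λ { zero → ℤ.i⊓j≤i p N ; (suc k) → ℤ.≤-trans (ℤ.i⊓j≤j p N) (N≤ k) }

  upperBound : ∀ {ℓ} (v : Vec ℤ ℓ) → ∃[ M ] ∀ k → lookup v k ℤ.≤ M
  upperBound [] = 0ℤ , λ ()
  upperBound (p ∷ v) with upperBound v
  ... | M , ≤M = p ⊔ M , λ { zero → ℤ.i≤i⊔j p M ; (suc k) → ℤ.≤-trans (≤M k) (ℤ.i≤j⊔i p M) }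

  segment : ∀ {ℓ m n} → m ℕ.≤ ℓ → (∀ (k : Fin ℓ) → toℕ k ℕ.< m → toℕ k ℕ.< n) → m ℕ.≤ n
  segment {m = zero} m≤ℓ f = z≤n
  segment {m = suc m} {n} m≤ℓ f =
    subst (ℕ._< n) (Fin.toℕ-fromℕ< m≤ℓ)
      (f (fromℕ< m≤ℓ) (subst (ℕ._< suc m) (sym (Fin.toℕ-fromℕ< m≤ℓ)) ℕ.≤-refl))

module _ {ℓ : ℕ} (μ : Signature ℓ) where

  conj⇒ : ∀ x k → toℕ k ℕ.< conjℕ μ x → x ℤ.≤ part μ k
  conj⇒ x k = count⇒ x (parts μ) (decr μ) k

  conj⇐ : ∀ x k → x ℤ.≤ part μ k → toℕ k ℕ.< conjℕ μ x
  conj⇐ x k = count⇐ x (parts μ) (decr μ) k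

  conj≤ : ∀ x → conjℕ μ x ℕ.≤ ℓ
  conj≤ x = count≤ x (parts μ)

  conj-antitone : ∀ {x y} → x ℤ.≤ y → conjℕ μ y ℕ.≤ conjℕ μ x
  conj-antitone {x} {y} x≤y =
    segment (conj≤ y) λ k k< → conj⇐ x k (ℤ.≤-trans x≤y (conj⇒ y k k<))

  conj-low : ∃[ N ] ∀ x → x ℤ.≤ N → conjℕ μ x ≡ ℓ
  conj-low with lowerBound (parts μ)
  ... | N , N≤ = N , λ x x≤N → ℕ.≤-antisym (conj≤ x)
    (segment ℕ.≤-refl λ k _ → conj⇐ x k (ℤ.≤-trans x≤N (N≤ k)))

  conj-high : ∃[ M ] ∀ x → M ℤ.< x → conjℕ μ x ≡ 0
  conj-high with upperBound (parts μ)
  ... | M , ≤M = M , λ x M<x → ℕ.n≤0⇒n≡0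
    (segment (conj≤ x) λ k k< → ⊥-elim (ℤ.<⇒≱ M<x (ℤ.≤-trans (conj⇒ x k k<) (≤M k))))

module _ {ℓ : ℕ} {κ μ : Signature ℓ} where

  conj-injective : (∀ x → conjℕ κ x ≡ conjℕ μ x) → κ ≡ μ
  conj-injective eq = part-≡ λ j → ℤ.≤-antisym
    (conj⇒ μ _ j (subst (toℕ j ℕ.<_) (eq _) (conj⇐ κ _ j ℤ.≤-refl)))
    (conj⇒ κ _ j (subst (toℕ j ℕ.<_) (sym (eq _)) (conj⇐ μ _ j ℤ.≤-refl)))

  ⪯⇒≤ : κ ⪯ μ → ∀ x → conjℕ κ x ℕ.≤ conjℕ μ x
  ⪯⇒≤ κ⪯μ x = segment (conj≤ κ x) λ k k< →
    conj⇐ μ x k (ℤ.≤-trans (conj⇒ κ x k k<) (_⪯_.below κ⪯μ k))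

  ⪯⇒≤1+ : κ ⪯ μ → ∀ x → conjℕ μ x ℕ.≤ suc (conjℕ κ x)
  ⪯⇒≤1+ κ⪯μ x = segment (conj≤ μ x) λ
    { zero    k< → s≤s z≤n
    ; (suc k) k< → s≤s (subst (ℕ._< conjℕ κ x) (Fin.toℕ-inject₁ k)
        (conj⇐ κ x (inject₁ k) (ℤ.≤-trans (conj⇒ μ x (suc k) k<)
          (_⪯_.above κ⪯μ (inject₁ k) (suc k) (cong suc (sym (Fin.toℕ-inject₁ k))))))) }

  conj⇒⪯ : (∀ x → conjℕ κ x ℕ.≤ conjℕ μ x) → (∀ x → conjℕ μ x ℕ.≤ suc (conjℕ κ x)) → κ ⪯ μ
  conj⇒⪯ lo hi = interlace
    (λ j → conj⇒ μ _ j (ℕ.≤-trans (conj⇐ κ _ j ℤ.≤-refl) (lo _)))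
    (λ j k k≡ → conj⇒ κ _ j (ℕ.s≤s⁻¹ (ℕ.≤-trans
      (subst (λ t → suc t ℕ.≤ conjℕ μ (part μ k)) k≡ (conj⇐ μ _ k ℤ.≤-refl)) (hi _))))

⪯-refl : ∀ {ℓ} {μ : Signature ℓ} → μ ⪯ μ
⪯-refl {μ = μ} = interlace (λ _ → ℤ.≤-refl)
  (λ j k k≡ → decr μ j k (subst (toℕ j ℕ.≤_) (sym k≡) (ℕ.n≤1+n _)))

⪯-irr : ∀ {ℓ} {κ μ : Signature ℓ} → .(κ ⪯ μ) → κ ⪯ μ
⪯-irr {κ = κ} {μ} p = interlace
  (λ j → recompute (part κ j ℤ.≤? part μ j) (b p j))
  (λ j k k≡ → recompute (part μ k ℤ.≤? part κ j) (_⪯_.above p j k k≡))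
  where
  b : κ ⪯ μ → ∀ j → part κ j ℤ.≤ part μ j
  b = _⪯_.below

private
  split : ∀ x N → (x ℤ.≤ N) ⊎ (∃[ j ] x ≡ N + + suc j)
  split x N with x ℤ.≤? N
  ... | yes x≤N = inj₁ x≤N
  ... | no  x≰N with x - N in eq
  ...   | + zero = ⊥-elim (x≰N (ℤ.≤-reflexive (ℤ.i-j≡0⇒i≡j x N eq)))
  ...   | -[1+ n ] = ⊥-elim (x≰N (ℤ.i-j≤0⇒i≤j (subst (ℤ._≤ 0ℤ) (sym eq) ℤ.-≤+)))
  ...   | + suc j = inj₂ (j , trans (lemma x N) (cong (λ t → N + t) eq))
    where
    lemma : ∀ x N → x ≡ N + (x - N)
    lemma = solve-∀

  N+j-1 : ∀ N (j : ℤ) → N + (1ℤ + j) - 1ℤ ≡ N + j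
  N+j-1 = solve-∀

  ≤+ : ∀ N j → N ℤ.≤ N + + j
  ≤+ N j = ℤ.i≤i+j N (+ j)

  <+ : ∀ N j → N ℤ.< N + + suc j
  <+ N j = ℤ.≤-<-trans (ℤ.≤-reflexive (sym (ℤ.+-identityʳ N)))
    (ℤ.+-monoʳ-< N (ℤ.+<+ (s≤s z≤n)))

-- A signature from its conjugate g
module FromConj {ℓ : ℕ} (g : ℤ → ℕ) (N : ℤ) (K : ℕ)
  (anti : ∀ {x y} → x ℤ.≤ y → g y ℕ.≤ g x)
  (low : ∀ x → x ℤ.≤ N → g x ≡ ℓ)
  (high : ∀ k → K ℕ.< k → g (N + + k) ≡ 0) where

  private
    top : ℕ → ℕ → ℕ
    top zero    j = 0
    top (suc b) j with j ℕ.<? g (N + + suc b)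
    ... | yes _ = suc b
    ... | no  _ = top b j

    top-< : ∀ b j → j ℕ.< ℓ → j ℕ.< g (N + + top b j)
    top-< zero j j<ℓ = subst (j ℕ.<_)
      (sym (low (N + + 0) (ℤ.≤-reflexive (ℤ.+-identityʳ N)))) j<ℓ
    top-< (suc b) j j<ℓ with j ℕ.<? g (N + + suc b)
    ... | yes p = p
    ... | no  _ = top-< b j j<ℓ

    top-max : ∀ b j k → k ℕ.≤ b → j ℕ.< g (N + + k) → k ℕ.≤ top b j
    top-max zero    j k k≤b j< = k≤b
    top-max (suc b) j k k≤b j< with j ℕ.<? g (N + + suc b)
    ... | yes _ = k≤b
    ... | no ¬p = top-max b j k
      (ℕ.s≤s⁻¹ (ℕ.≤∧≢⇒< k≤b λ { refl → ¬p j< })) j<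

    row : Fin ℓ → ℤ
    row j = N + + top K (toℕ j)

    row⇒ : ∀ x j → x ℤ.≤ row j → toℕ j ℕ.< g x
    row⇒ x j x≤ = ℕ.≤-trans (top-< K (toℕ j) (Fin.toℕ<n j)) (anti x≤)

    row⇐ : ∀ x j → toℕ j ℕ.< g x → x ℤ.≤ row j
    row⇐ x j j< with split x N
    ... | inj₁ x≤N = ℤ.≤-trans x≤N (≤+ N _)
    ... | inj₂ (k , refl) with suc k ℕ.≤? K
    ...   | yes k≤K = ℤ.+-monoʳ-≤ N (ℤ.+≤+ (top-max K (toℕ j) (suc k) k≤K j<))
    ...   | no  k≰K = contradiction (subst (toℕ j ℕ.<_) (high (suc k) (ℕ.≰⇒> k≰K)) j<) λ ()

    g≤ : ∀ x → g x ℕ.≤ ℓ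
    g≤ x with ℤ.≤-total x N
    ... | inj₁ x≤N = ℕ.≤-reflexive (low x x≤N)
    ... | inj₂ N≤x = ℕ.≤-trans (anti N≤x) (ℕ.≤-reflexive (low N ℤ.≤-refl))

  fromConj : Signature ℓ
  fromConj = signature (tabulate row) λ i j i≤j →
    subst₂ ℤ._≤_ (sym (Vec.lookup∘tabulate row j)) (sym (Vec.lookup∘tabulate row i))
      (row⇐ (row j) i (ℕ.≤-<-trans i≤j (row⇒ (row j) j ℤ.≤-refl)))

  conj-fromConj : ∀ x → conjℕ fromConj x ≡ g x
  conj-fromConj x = ℕ.≤-antisym
    (segment (conj≤ fromConj x) λ k k< → row⇒ x k
      (subst (x ℤ.≤_) (Vec.lookup∘tabulate row k) (conj⇒ fromConj x k k<)))
    (segment (g≤ x) λ k k< → conj⇐ fromConj x k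
      (subst (x ℤ.≤_) (sym (Vec.lookup∘tabulate row k)) (row⇐ x k k<)))

private
  pos : ℤ → ℕ
  pos (+ j)    = j
  pos -[1+ _ ] = 0

  pos-≤0 : ∀ {i} → i ℤ.≤ 0ℤ → pos i ≡ 0
  pos-≤0 {+ j} (ℤ.+≤+ z≤n) = refl
  pos-≤0 { -[1+ j ]} _ = refl

  x-1≤x : ∀ x → x - 1ℤ ℤ.≤ x
  x-1≤x x = ℤ.i-j≤i x 1ℤ

  antitone : (g : ℤ → ℕ) → (∀ x → g (x + 1ℤ) ℕ.≤ g x) → ∀ {x y} → x ℤ.≤ y → g y ℕ.≤ g x
  antitone g step {x} {y} x≤y with split y x
  ... | inj₁ y≤x = ℕ.≤-reflexive (cong g (ℤ.≤-antisym y≤x x≤y))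
  ... | inj₂ (j , refl) = go (suc j)
    where
    go : ∀ j → g (x + + j) ℕ.≤ g x
    go zero    = ℕ.≤-reflexive (cong g (ℤ.+-identityʳ x))
    go (suc j) = ℕ.≤-trans
      (ℕ.≤-reflexive (cong g (lemma x (+ j))))
      (ℕ.≤-trans (step (x + + j)) (go j))
      where
      lemma : ∀ x j → x + (1ℤ + j) ≡ x + j + 1ℤ
      lemma = solve-∀

  ∸-to-⊔ : ∀ t → + (t ∸ 1) ≡ 0ℤ ⊔ (+ t - 1ℤ)
  ∸-to-⊔ zero    = refl
  ∸-to-⊔ (suc t) = refl

  ∸-to-- : ∀ {m k} → k ℕ.≤ m → + (m ∸ k) ≡ + m - + k
  ∸-to-- {m} {k} k≤m = trans (sym (ℤ.⊖-≥ k≤m)) (sym (ℤ.m-n≡m⊖n m k))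

  min+pred : ∀ t → + (t ℕ.⊓ 1) ≡ + t - + (t ∸ 1)
  min+pred zero = refl
  min+pred (suc t) = trans (cong (λ s → + suc s) (ℕ.⊓-zeroʳ t)) (lemma (+ t))
    where
    lemma : ∀ t → 1ℤ ≡ (1ℤ + t) - t
    lemma = solve-∀

module Fomin {ℓ : ℕ} {κ μ θ : Signature ℓ} (κ⪯μ : κ ⪯ μ) (κ⪯θ : κ ⪯ θ) where

  private
    k m l : ℤ → ℕ
    k = conjℕ κ
    m = conjℕ μ
    l = conjℕ θ

    arrivals : ℤ → ℕ
    arrivals x = (m x ∸ k x) ℕ.+ (l x ∸ k x)

    N M : ℤ
    N = proj₁ (conj-low κ)
    M = proj₁ (conj-high μ) ⊔ proj₁ (conj-high θ)

    k-low : ∀ x → x ℤ.≤ N → k x ≡ ℓ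
    k-low = proj₂ (conj-low κ)

    arrivals-low : ∀ x → x ℤ.≤ N → arrivals x ≡ 0
    arrivals-low x x≤N = cong₂ ℕ._+_
      (ℕ.m≤n⇒m∸n≡0 (ℕ.≤-trans (conj≤ μ x) (ℕ.≤-reflexive (sym (k-low x x≤N)))))
      (ℕ.m≤n⇒m∸n≡0 (ℕ.≤-trans (conj≤ θ x) (ℕ.≤-reflexive (sym (k-low x x≤N)))))

    m-high : ∀ x → M ℤ.< x → m x ≡ 0
    m-high x M<x = proj₂ (conj-high μ) x (ℤ.≤-<-trans (ℤ.i≤i⊔j _ _) M<x)

    l-high : ∀ x → M ℤ.< x → l x ≡ 0
    l-high x M<x = proj₂ (conj-high θ) x (ℤ.≤-<-trans (ℤ.i≤j⊔i _ _) M<x)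

    k-high : ∀ x → M ℤ.< x → k x ≡ 0
    k-high x M<x = ℕ.n≤0⇒n≡0 (subst (k x ℕ.≤_) (m-high x M<x) (⪯⇒≤ κ⪯μ x))

    arrivals-high : ∀ x → M ℤ.< x → arrivals x ≡ 0
    arrivals-high x M<x rewrite m-high x M<x | l-high x M<x | k-high x M<x = refl

    queue : ℕ → ℕ
    queue zero    = 0
    queue (suc j) = (arrivals (N + + suc j) ℕ.+ queue j) ∸ 1

    c : ℤ → ℕ
    c x = queue (pos (x - N))

    c-low : ∀ x → x ℤ.≤ N → c x ≡ 0
    c-low x x≤N = cong queue (pos-≤0 (ℤ.i≤j⇒i-j≤0 x≤N))

    c-queue : ∀ j → c (N + + j) ≡ queue j
    c-queue j = cong (queue ∘ pos) (lemma N (+ j))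
      where
      lemma : ∀ N j → N + j - N ≡ j
      lemma = solve-∀

    total : ℤ → ℕ
    total x = arrivals x ℕ.+ c (x - 1ℤ)

    c-step : ∀ x → c x ≡ total x ∸ 1
    c-step x with split x N
    ... | inj₁ x≤N = trans (c-low x x≤N) (sym (cong₂ (λ s t → (s ℕ.+ t) ∸ 1)
      (arrivals-low x x≤N) (c-low (x - 1ℤ) (ℤ.≤-trans (x-1≤x x) x≤N))))
    ... | inj₂ (j , refl) = trans (c-queue (suc j))
      (cong (λ t → (arrivals (N + + suc j) ℕ.+ t) ∸ 1)
        (sym (trans (cong c (N+j-1 N (+ j))) (c-queue j))))

    c-high : ∀ j → c (M + + j) ≡ c M ∸ j
    c-high zero    = cong c (ℤ.+-identityʳ M)
    c-high (suc j) = trans (c-step (M + + suc j)) (trans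
      (cong₂ (λ s t → (s ℕ.+ t) ∸ 1) (arrivals-high (M + + suc j) (<+ M j))
        (trans (cong c (N+j-1 M (+ j))) (c-high j)))
      (trans (ℕ.∸-+-assoc (c M) j 1) (cong (c M ∸_) (ℕ.+-comm j 1))))

    g : ℤ → ℕ
    g x = k x ℕ.+ (total x ℕ.⊓ 1)

    g-low : ∀ x → x ℤ.≤ N → g x ≡ ℓ
    g-low x x≤N = trans (cong₂ (λ s t → s ℕ.+ (t ℕ.⊓ 1)) (k-low x x≤N)
      (cong₂ ℕ._+_ (arrivals-low x x≤N) (c-low _ (ℤ.≤-trans (x-1≤x x) x≤N))))
      (ℕ.+-identityʳ ℓ)

    M′ : ℤ
    M′ = M + + c M

    g-high : ∀ x → M′ ℤ.< x → g x ≡ 0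
    g-high x M′<x with split x M′
    ... | inj₁ x≤M′ = ⊥-elim (ℤ.<⇒≱ M′<x x≤M′)
    ... | inj₂ (j , refl) = cong₂ (λ s t → s ℕ.+ (t ℕ.⊓ 1)) (k-high x′ M<x′)
      (cong₂ ℕ._+_ (arrivals-high x′ M<x′) (trans (cong c x′-1)
        (trans (c-high (c M ℕ.+ j)) (ℕ.m≤n⇒m∸n≡0 (ℕ.m≤m+n (c M) j)))))
      where
      x′ : ℤ
      x′ = M′ + + suc j
      M<x′ : M ℤ.< x′
      M<x′ = ℤ.≤-<-trans (≤+ M (c M)) (<+ M′ j)
      x′-1 : x′ - 1ℤ ≡ M + + (c M ℕ.+ j)
      x′-1 = trans (N+j-1 M′ (+ j)) (trans (ℤ.+-assoc M (+ c M) (+ j)) refl)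

    -- If nothing is served at x, the queue is empty and μ, θ, κ agree there.
    g-step : ∀ x → g (x + 1ℤ) ℕ.≤ g x
    g-step x with total x in eq
    ... | suc t = ℕ.+-mono-≤ (conj-antitone κ (ℤ.i≤i+j x 1ℤ))
      (ℕ.≤-trans (ℕ.m⊓n≤n (total (x + 1ℤ)) 1) (ℕ.≤-reflexive (sym (cong suc (ℕ.⊓-zeroʳ t)))))
    ... | zero = subst (g (x + 1ℤ) ℕ.≤_) (sym (ℕ.+-identityʳ (k x)))
        (go (total (x + 1ℤ)) refl)
      where
      cx : c (x + 1ℤ - 1ℤ) ≡ 0
      cx = trans (cong c (lemma x)) (trans (c-step x) (cong (_∸ 1) eq))
        where
        lemma : ∀ x → x + 1ℤ - 1ℤ ≡ x
        lemma = solve-∀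
      ax : arrivals x ≡ 0
      ax = ℕ.m+n≡0⇒m≡0 (arrivals x) eq
      mx : m x ℕ.≤ k x
      mx = ℕ.m∸n≡0⇒m≤n (ℕ.m+n≡0⇒m≡0 (m x ∸ k x) ax)
      lx : l x ℕ.≤ k x
      lx = ℕ.m∸n≡0⇒m≤n (ℕ.m+n≡0⇒n≡0 (m x ∸ k x) ax)
      x′ : ℤ
      x′ = x + 1ℤ
      x≤x′ : x ℤ.≤ x′
      x≤x′ = ℤ.i≤i+j x 1ℤ
      strict : ∀ {s t} → s ∸ t ≢ 0 → suc t ℕ.≤ s
      strict {s} {t} ne = ℕ.≰⇒> λ s≤t → ne (ℕ.m≤n⇒m∸n≡0 s≤t)
      strict⁺ : arrivals x′ ≢ 0 → suc (k x′) ℕ.≤ k x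
      strict⁺ ne with m x′ ∸ k x′ ℕ.≟ 0
      ... | no m≢ = ℕ.≤-trans (strict m≢) (ℕ.≤-trans (conj-antitone μ x≤x′) mx)
      ... | yes m≡ with l x′ ∸ k x′ ℕ.≟ 0
      ...   | no l≢ = ℕ.≤-trans (strict l≢) (ℕ.≤-trans (conj-antitone θ x≤x′) lx)
      ...   | yes l≡ = ⊥-elim (ne (cong₂ ℕ._+_ m≡ l≡))
      go : ∀ t → total x′ ≡ t → k x′ ℕ.+ (t ℕ.⊓ 1) ℕ.≤ k x
      go zero    _  = ℕ.≤-trans (ℕ.≤-reflexive (ℕ.+-identityʳ (k x′))) (conj-antitone κ x≤x′)
      go (suc t) eq′ = ℕ.≤-trans (ℕ.≤-reflexive
        (trans (cong (λ s → k x′ ℕ.+ suc s) (ℕ.⊓-zeroʳ t)) (ℕ.+-comm (k x′) 1)))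
        (strict⁺ λ a≡0 → contradiction (trans (sym eq′) (cong₂ ℕ._+_ a≡0 cx)) λ ())

    K : ℕ
    K = ∣ M′ - N ∣

    high : ∀ j → K ℕ.< j → g (N + + j) ≡ 0
    high j K<j = g-high (N + + j) (subst (ℤ._< N + + j) (lemma N M′)
      (ℤ.+-monoʳ-< N (ℤ.≤-<-trans (i≤∣i∣ (M′ - N)) (ℤ.+<+ K<j))))
      where
      lemma : ∀ N M → N + (M - N) ≡ M
      lemma = solve-∀
      i≤∣i∣ : ∀ i → i ℤ.≤ + ∣ i ∣
      i≤∣i∣ (+ n) = ℤ.≤-refl
      i≤∣i∣ -[1+ n ] = ℤ.-≤+

    module G = FromConj g N K (antitone g g-step) g-low high

  F̄ : Signature ℓ
  F̄ = G.fromConj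

  private
    k+δ≤ : ∀ {μ} → κ ⪯ μ → ∀ x → (conjℕ μ x ∸ k x ≢ 0 → total x ≢ 0) → conjℕ μ x ℕ.≤ g x
    k+δ≤ {μ} κ⪯μ x t≢0 with conjℕ μ x ∸ k x ℕ.≟ 0
    ... | yes m≡ = ℕ.≤-trans (ℕ.m∸n≡0⇒m≤n m≡) (ℕ.m≤m+n (k x) _)
    ... | no  m≢ with total x | t≢0 m≢
    ...   | zero  | ne = contradiction refl ne
    ...   | suc t | _  = ℕ.≤-trans (⪯⇒≤1+ κ⪯μ x) (ℕ.≤-reflexive
      (trans (ℕ.+-comm 1 (k x)) (cong (λ s → k x ℕ.+ suc s) (sym (ℕ.⊓-zeroʳ t)))))

    g≤1+ : ∀ {μ} → κ ⪯ μ → ∀ x → g x ℕ.≤ suc (conjℕ μ x)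
    g≤1+ κ⪯μ x = ℕ.≤-trans (ℕ.+-mono-≤ (⪯⇒≤ κ⪯μ x) (ℕ.m⊓n≤n (total x) 1))
      (ℕ.≤-reflexive (ℕ.+-comm _ 1))

  μ⪯F̄ : μ ⪯ F̄
  μ⪯F̄ = conj⇒⪯
    (λ x → subst (m x ℕ.≤_) (sym (G.conj-fromConj x)) (k+δ≤ κ⪯μ x
      λ ne t≡0 → ne (ℕ.m+n≡0⇒m≡0 _ (ℕ.m+n≡0⇒m≡0 (arrivals x) t≡0))))
    (λ x → subst (ℕ._≤ suc (m x)) (sym (G.conj-fromConj x)) (g≤1+ κ⪯μ x))

  θ⪯F̄ : θ ⪯ F̄
  θ⪯F̄ = conj⇒⪯
    (λ x → subst (l x ℕ.≤_) (sym (G.conj-fromConj x)) (k+δ≤ κ⪯θ x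
      λ ne t≡0 → ne (ℕ.m+n≡0⇒n≡0 (m x ∸ k x) (ℕ.m+n≡0⇒m≡0 (arrivals x) t≡0))))
    (λ x → subst (ℕ._≤ suc (l x)) (sym (G.conj-fromConj x)) (g≤1+ κ⪯θ x))

  F̄-rule : FominRule κ μ θ F̄
  F̄-rule = record
    { carry      = λ x → + c x
    ; carry-init = N , λ x x≤N → cong +_ (c-low x x≤N)
    ; carry-step = λ x → trans (cong +_ (c-step x)) (trans (∸-to-⊔ (total x))
        (cong (λ t → 0ℤ ⊔ (t - 1ℤ)) (total-ℤ x)))
    ; conj-ν     = λ x → begin
        + conjℕ F̄ x                      ≡⟨ cong +_ (G.conj-fromConj x) ⟩
        + k x + + (total x ℕ.⊓ 1)        ≡⟨ cong (λ t → + k x + t) (min+pred (total x)) ⟩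
        + k x + (+ total x - + (total x ∸ 1))
          ≡⟨ cong₂ (λ s t → + k x + (s - + t)) (total-ℤ x) (sym (c-step x)) ⟩
        + k x + ((+ m x - + k x) + (+ l x - + k x) + + c (x - 1ℤ) - + c x)
          ≡⟨ lemma (+ k x) (+ m x) (+ l x) (+ c (x - 1ℤ)) (+ c x) ⟩
        + m x + + l x - + k x + + c (x - 1ℤ) - + c x ∎
    }
    where
    open ≡-Reasoning
    total-ℤ : ∀ x → + total x ≡ (+ m x - + k x) + (+ l x - + k x) + + c (x - 1ℤ)
    total-ℤ x = cong₂ (λ s t → s + t + + c (x - 1ℤ))
      (∸-to-- (⪯⇒≤ κ⪯μ x)) (∸-to-- (⪯⇒≤ κ⪯θ x))
    lemma : ∀ k m l c′ c → k + ((m - k) + (l - k) + c′ - c) ≡ m + l - k + c′ - c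
    lemma = solve-∀

fomin : ∀ {ℓ} {κ μ θ : Signature ℓ} → κ ⪯ μ → κ ⪯ θ →
        ∃[ ν ] FominRule κ μ θ ν × μ ⪯ ν × θ ⪯ ν
fomin κ⪯μ κ⪯θ = F̄ , F̄-rule , μ⪯F̄ , θ⪯F̄
  where open Fomin κ⪯μ κ⪯θ

fomin-unique : ∀ {ℓ} {κ μ θ ν ν′ : Signature ℓ} →
               FominRule κ μ θ ν → FominRule κ μ θ ν′ → ν ≡ ν′
fomin-unique {κ = κ} {μ} {θ} {ν} {ν′} r r′ = conj-injective λ x → ℤ.+-injective (begin
  conj ν x                                                       ≡⟨ R.conj-ν x ⟩
  conj μ x + conj θ x - conj κ x + R.carry (x - 1ℤ) - R.carry x
    ≡⟨ cong₂ (λ s t → conj μ x + conj θ x - conj κ x + s - t) (same (x - 1ℤ)) (same x) ⟩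
  conj μ x + conj θ x - conj κ x + R′.carry (x - 1ℤ) - R′.carry x ≡⟨ R′.conj-ν x ⟨
  conj ν′ x ∎)
  where
  open ≡-Reasoning
  module R = FominRule r
  module R′ = FominRule r′
  N : ℤ
  N = proj₁ R.carry-init ℤ.⊓ proj₁ R′.carry-init
  same-low : ∀ x → x ℤ.≤ N → R.carry x ≡ R′.carry x
  same-low x x≤N = trans
    (proj₂ R.carry-init x (ℤ.≤-trans x≤N (ℤ.i⊓j≤i _ _)))
    (sym (proj₂ R′.carry-init x (ℤ.≤-trans x≤N (ℤ.i⊓j≤j _ _))))
  step : ∀ x → R.carry (x - 1ℤ) ≡ R′.carry (x - 1ℤ) → R.carry x ≡ R′.carry x
  step x eq = trans (R.carry-step x) (trans
    (cong (λ t → 0ℤ ⊔ ((conj μ x - conj κ x) + (conj θ x - conj κ x) + t - 1ℤ)) eq)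
    (sym (R′.carry-step x)))
  go : ∀ j → R.carry (N + + j) ≡ R′.carry (N + + j)
  go zero    = same-low (N + + 0) (ℤ.≤-reflexive (ℤ.+-identityʳ N))
  go (suc j) = step (N + + suc j)
    (subst (λ y → R.carry y ≡ R′.carry y) (sym (N+j-1 N (+ j))) (go j))
  same : ∀ x → R.carry x ≡ R′.carry x
  same x with split x N
  ... | inj₁ x≤N = same-low x x≤N
  ... | inj₂ (j , refl) = go (suc j)

-- The local rule is reversible: it is carried to its own inverse by
-- (λ₁, …, λ_ℓ) ↦ (-λ_ℓ, …, -λ₁).

dual : ∀ {ℓ} → Signature ℓ → Signature ℓ
dual {ℓ} μ = signature (tabulate row) λ i j i≤j →
  subst₂ ℤ._≤_ (sym (Vec.lookup∘tabulate row j)) (sym (Vec.lookup∘tabulate row i))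
    (ℤ.neg-mono-≤ (decr μ (opposite j) (opposite i) (subst₂ ℕ._≤_
      (sym (Fin.opposite-prop j)) (sym (Fin.opposite-prop i))
      (ℕ.∸-monoʳ-≤ ℓ (s≤s i≤j)))))
  where
  row : Fin ℓ → ℤ
  row j = - part μ (opposite j)

private
  opp< : ∀ {ℓ} (k : Fin ℓ) → ℓ ∸ toℕ (opposite k) ≡ suc (toℕ k)
  opp< {ℓ} k = trans (cong (ℓ ∸_) (Fin.opposite-prop k)) (ℕ.m∸[m∸n]≡n (Fin.toℕ<n k))

  ¬1-x≤⇒ : ∀ x p → ¬ (1ℤ - x ℤ.≤ p) → x ℤ.≤ - p
  ¬1-x≤⇒ x p ¬le with split (- p + 1ℤ) x
  ... | inj₁ le = ⊥-elim (¬le (subst₂ ℤ._≤_ (lemma₁ x p) (lemma₂ x p)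
      (ℤ.+-monoʳ-≤ (p - x) le)))
    where
    lemma₁ : ∀ x p → p - x + (- p + 1ℤ) ≡ 1ℤ - x
    lemma₁ = solve-∀
    lemma₂ : ∀ x p → p - x + x ≡ p
    lemma₂ = solve-∀
  ... | inj₂ (j , eq) = ℤ.≤-trans (≤+ x j) (ℤ.≤-reflexive (sym
      (trans (sym (lemma p)) (trans (cong (_- 1ℤ) eq) (N+j-1 x (+ j))))))
    where
    lemma : ∀ p → - p + 1ℤ - 1ℤ ≡ - p
    lemma = solve-∀

  x≤-⇒¬ : ∀ x p → x ℤ.≤ - p → ¬ (1ℤ - x ℤ.≤ p)
  x≤-⇒¬ x p x≤ le = ℤ.<⇒≱ (ℤ.+<+ (s≤s z≤n))
    (subst₂ ℤ._≤_ (lemma₁ x) (lemma₂ p) (ℤ.+-mono-≤ le x≤))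
    where
    lemma₁ : ∀ x → 1ℤ - x + x ≡ 1ℤ
    lemma₁ = solve-∀
    lemma₂ : ∀ p → p + - p ≡ 0ℤ
    lemma₂ = solve-∀

conj-dual : ∀ {ℓ} (μ : Signature ℓ) x → conjℕ (dual μ) x ≡ ℓ ∸ conjℕ μ (1ℤ - x)
conj-dual {ℓ} μ x = ℕ.≤-antisym
  (segment (conj≤ (dual μ) x) λ k k< →
    subst (ℕ._≤ ℓ ∸ conjℕ μ (1ℤ - x)) (opp< k) (ℕ.∸-monoʳ-≤ ℓ (ℕ.≮⇒≥ λ o< →
      x≤-⇒¬ x _ (subst (x ℤ.≤_) (Vec.lookup∘tabulate _ k) (conj⇒ (dual μ) x k k<))
        (conj⇒ μ (1ℤ - x) (opposite k) o<))))
  (segment (ℕ.m∸n≤m ℓ (conjℕ μ (1ℤ - x))) λ k k< →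
    conj⇐ (dual μ) x k (subst (x ℤ.≤_) (sym (Vec.lookup∘tabulate _ k))
      (¬1-x≤⇒ x _ λ le → ℕ.<⇒≱ (conj⇐ μ (1ℤ - x) (opposite k) le)
        (subst₂ ℕ._≤_ (ℕ.m∸[m∸n]≡n (conj≤ μ (1ℤ - x))) (sym (Fin.opposite-prop k))
          (ℕ.∸-monoʳ-≤ ℓ k<)))))

dual-involutive : ∀ {ℓ} (μ : Signature ℓ) → dual (dual μ) ≡ μ
dual-involutive {ℓ} μ = conj-injective λ x → begin
  conjℕ (dual (dual μ)) x               ≡⟨ conj-dual (dual μ) x ⟩
  ℓ ∸ conjℕ (dual μ) (1ℤ - x)           ≡⟨ cong (ℓ ∸_) (conj-dual μ (1ℤ - x)) ⟩
  ℓ ∸ (ℓ ∸ conjℕ μ (1ℤ - (1ℤ - x)))     ≡⟨ ℕ.m∸[m∸n]≡n (conj≤ μ _) ⟩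
  conjℕ μ (1ℤ - (1ℤ - x))               ≡⟨ cong (conjℕ μ) (lemma x) ⟩
  conjℕ μ x                             ∎
  where
  open ≡-Reasoning
  lemma : ∀ x → 1ℤ - (1ℤ - x) ≡ x
  lemma = solve-∀

dual-⪯ : ∀ {ℓ} {κ μ : Signature ℓ} → κ ⪯ μ → dual μ ⪯ dual κ
dual-⪯ {ℓ} {κ} {μ} κ⪯μ = conj⇒⪯
  (λ x → subst₂ ℕ._≤_ (sym (conj-dual μ x)) (sym (conj-dual κ x))
    (ℕ.∸-monoʳ-≤ ℓ (⪯⇒≤ κ⪯μ (1ℤ - x))))
  (λ x → subst₂ (λ s t → s ℕ.≤ suc t) (sym (conj-dual κ x)) (sym (conj-dual μ x))
    (ℕ.≤-trans (bound (conjℕ κ (1ℤ - x)) (conj≤ κ (1ℤ - x)))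
      (s≤s (ℕ.∸-monoʳ-≤ ℓ (⪯⇒≤1+ κ⪯μ (1ℤ - x))))))
  where
  bound : ∀ {ℓ} k → k ℕ.≤ ℓ → ℓ ∸ k ℕ.≤ suc (ℓ ∸ suc k)
  bound {zero}  zero    _ = z≤n
  bound {suc ℓ} zero    _ = ℕ.≤-refl
  bound {suc ℓ} (suc k) (s≤s p) = bound k p

conj-dual-ℤ : ∀ {ℓ} (μ : Signature ℓ) x → conj (dual μ) x ≡ + ℓ - conj μ (1ℤ - x)
conj-dual-ℤ {ℓ} μ x = trans (cong +_ (conj-dual μ x)) (∸-to-- (conj≤ μ (1ℤ - x)))

private
  -- One site: k, k + α, k + β are the conjugates of κ, μ, θ, and γ is the
  -- incoming carry.
  reverse-site : ∀ (α β γ : ℕ) {v k : ℤ} c → c ≡ 0ℤ ⊔ (+ α + + β + + γ - 1ℤ) →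
    v ≡ k + (+ α + + β + + γ - c) → + γ ≡ 0ℤ ⊔ (v - k + + γ - 1ℤ)
  reverse-site α β γ {v} {k} c eq veq = go (α ℕ.+ β ℕ.+ γ) refl
    where
    go : ∀ t → α ℕ.+ β ℕ.+ γ ≡ t → + γ ≡ 0ℤ ⊔ (v - k + + γ - 1ℤ)
    go zero teq = subst (λ γ → + γ ≡ 0ℤ ⊔ (v - k + + γ - 1ℤ)) (sym γ≡0)
        (cong (λ t → 0ℤ ⊔ t) {x = -[1+ 0 ]}
          (trans (lemma k) (cong (λ t → t - k + 0ℤ - 1ℤ) (sym v≡k))))
      where
      γ≡0 : γ ≡ 0
      γ≡0 = ℕ.m+n≡0⇒n≡0 (α ℕ.+ β) teq
      c≡0 : c ≡ 0ℤ
      c≡0 = trans eq (cong (λ t → 0ℤ ⊔ (+ t - 1ℤ)) teq)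
      v≡k : v ≡ k + 0ℤ
      v≡k = trans veq (cong (λ t → k + t) (cong₂ (λ s t → + s - t) teq c≡0))
      lemma : ∀ k → -[1+ 0 ] ≡ (k + 0ℤ) - k + 0ℤ - 1ℤ
      lemma = solve-∀
    go (suc t) teq = trans (lemma k (+ γ)) (cong (λ t → 0ℤ ⊔ (t - k + + γ - 1ℤ)) (sym v≡k+1))
      where
      c≡t : c ≡ + t
      c≡t = trans eq (cong (λ t → 0ℤ ⊔ (+ t - 1ℤ)) teq)
      v≡k+1 : v ≡ k + 1ℤ
      v≡k+1 = trans veq (cong (λ t → k + t)
        (trans (cong₂ (λ s t → + s - t) teq c≡t) (lemma′ (+ t))))
        where
        lemma′ : ∀ t → (1ℤ + t) - t ≡ 1ℤ
        lemma′ = solve-∀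
      lemma : ∀ k γ → 0ℤ ⊔ γ ≡ 0ℤ ⊔ ((k + 1ℤ) - k + γ - 1ℤ)
      lemma k γ = cong (λ t → 0ℤ ⊔ t) (lemma″ k γ)
        where
        lemma″ : ∀ k γ → γ ≡ (k + 1ℤ) - k + γ - 1ℤ
        lemma″ = solve-∀

  reverse-step : ∀ {ℓ k m l v c′ c m* l* v* : ℤ} → m* ≡ ℓ - m → l* ≡ ℓ - l → v* ≡ ℓ - v →
    v ≡ m + l - k + c′ - c → v - k + c′ - 1ℤ ≡ (m* - v*) + (l* - v*) + c - 1ℤ
  reverse-step {ℓ} {k} {m} {l} {_} {c′} {c} refl refl refl refl = go ℓ k m l c′ c
    where
    go : ∀ ℓ k m l c′ c → (m + l - k + c′ - c) - k + c′ - 1ℤ ≡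
      (ℓ - m - (ℓ - (m + l - k + c′ - c))) + (ℓ - l - (ℓ - (m + l - k + c′ - c))) + c - 1ℤ
    go = solve-∀

  reverse-conj : ∀ {ℓ k m l v c′ c k* m* l* v* : ℤ} →
    k* ≡ ℓ - k → m* ≡ ℓ - m → l* ≡ ℓ - l → v* ≡ ℓ - v →
    v ≡ m + l - k + c′ - c → k* ≡ m* + l* - v* + c - c′
  reverse-conj {ℓ} {k} {m} {l} {_} {c′} {c} refl refl refl refl refl = go ℓ k m l c′ c
    where
    go : ∀ ℓ k m l c′ c → ℓ - k ≡ (ℓ - m) + (ℓ - l) - (ℓ - (m + l - k + c′ - c)) + c - c′
    go = solve-∀

module _ {ℓ : ℕ} {κ μ θ ν : Signature ℓ} (κ⪯μ : κ ⪯ μ) (κ⪯θ : κ ⪯ θ) (r : FominRule κ μ θ ν) where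

  private
    module R = FominRule r

    c : ℤ → ℤ
    c = R.carry

    nonneg : ∀ x → ∃[ γ ] c x ≡ + γ
    nonneg x = ∣ c x ∣ , sym (ℤ.0≤i⇒+∣i∣≡i (subst (0ℤ ℤ.≤_) (sym (R.carry-step x)) (ℤ.i≤i⊔j 0ℤ _)))

    site : ∀ y → c (y - 1ℤ) ≡ 0ℤ ⊔ (conj ν y - conj κ y + c (y - 1ℤ) - 1ℤ)
    site y with nonneg (y - 1ℤ)
    ... | γ , γ≡ = subst (λ t → t ≡ 0ℤ ⊔ (conj ν y - conj κ y + t - 1ℤ)) (sym γ≡)
        (reverse-site (conjℕ μ y ∸ conjℕ κ y) (conjℕ θ y ∸ conjℕ κ y) γ {conj ν y} {conj κ y} (c y)
          (trans (R.carry-step y) (cong (λ t → 0ℤ ⊔ (t - 1ℤ)) total))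
          (begin
            conj ν y
              ≡⟨ R.conj-ν y ⟩
            conj μ y + conj θ y - conj κ y + c (y - 1ℤ) - c y
              ≡⟨ lemma (conj κ y) (conj μ y) (conj θ y) (c (y - 1ℤ)) (c y) ⟩
            conj κ y + ((conj μ y - conj κ y) + (conj θ y - conj κ y) + c (y - 1ℤ) - c y)
              ≡⟨ cong (λ t → conj κ y + (t - c y)) total ⟩
            conj κ y + (+ (conjℕ μ y ∸ conjℕ κ y) + + (conjℕ θ y ∸ conjℕ κ y) + + γ - c y) ∎))
      where
      open ≡-Reasoning
      total : (conj μ y - conj κ y) + (conj θ y - conj κ y) + c (y - 1ℤ) ≡
              + (conjℕ μ y ∸ conjℕ κ y) + + (conjℕ θ y ∸ conjℕ κ y) + + γ
      total = cong₂ _+_ (cong₂ _+_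
        (sym (∸-to-- (⪯⇒≤ κ⪯μ y))) (sym (∸-to-- (⪯⇒≤ κ⪯θ y)))) γ≡
      lemma : ∀ k m l c′ c → m + l - k + c′ - c ≡ k + ((m - k) + (l - k) + c′ - c)
      lemma = solve-∀

  carry-final : ∃[ M ] ∀ x → M ℤ.< x → c x ≡ 0ℤ
  carry-final = M , λ x M<x → fixpoint (c x) (begin
      c x                                          ≡⟨ R.carry-step x ⟩
      0ℤ ⊔ ((conj μ x - conj κ x) + (conj θ x - conj κ x) + c (x - 1ℤ) - 1ℤ)
        ≡⟨ cong (λ t → 0ℤ ⊔ t) (lemma (conj κ x) (conj μ x) (conj θ x) (c (x - 1ℤ)) (c x)) ⟩
      0ℤ ⊔ ((conj μ x + conj θ x - conj κ x + c (x - 1ℤ) - c x) - conj κ x + c x - 1ℤ)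
        ≡⟨ cong (λ t → 0ℤ ⊔ (t - conj κ x + c x - 1ℤ)) (R.conj-ν x) ⟨
      0ℤ ⊔ (conj ν x - conj κ x + c x - 1ℤ)
        ≡⟨ cong₂ (λ s t → 0ℤ ⊔ (+ s - + t + c x - 1ℤ))
             (proj₂ (conj-high ν) x (ℤ.≤-<-trans (ℤ.i≤i⊔j _ _) M<x))
             (proj₂ (conj-high κ) x (ℤ.≤-<-trans (ℤ.i≤j⊔i _ _) M<x)) ⟩
      0ℤ ⊔ (0ℤ - 0ℤ + c x - 1ℤ)                    ≡⟨ cong (λ t → 0ℤ ⊔ (t - 1ℤ)) (ℤ.+-identityˡ (c x)) ⟩
      0ℤ ⊔ (c x - 1ℤ) ∎)
    where
    open ≡-Reasoning
    M : ℤ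
    M = proj₁ (conj-high ν) ⊔ proj₁ (conj-high κ)
    lemma : ∀ k m l c′ c → (m - k) + (l - k) + c′ - 1ℤ ≡ (m + l - k + c′ - c) - k + c - 1ℤ
    lemma = solve-∀
    fixpoint : ∀ i → i ≡ 0ℤ ⊔ (i - 1ℤ) → i ≡ 0ℤ
    fixpoint (+ zero) _ = refl
    fixpoint (+ suc n) eq = contradiction (ℤ.+-injective eq) ℕ.1+n≢n
    fixpoint -[1+ n ] ()

  dual-rule : FominRule (dual ν) (dual μ) (dual θ) (dual κ)
  dual-rule = record
    { carry = λ x → c (1ℤ - x - 1ℤ)
    ; carry-init = - proj₁ carry-final - 1ℤ , λ x x≤ → proj₂ carry-final _ (low x x≤)
    ; carry-step = λ x → trans (site (1ℤ - x))
        (cong (λ t → 0ℤ ⊔ t) (trans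
          (reverse-step {+ ℓ} {conj κ (1ℤ - x)} {conj μ (1ℤ - x)} {conj θ (1ℤ - x)} {conj ν (1ℤ - x)}
            {c (1ℤ - x - 1ℤ)} {c (1ℤ - x)} (conj-dual-ℤ μ x) (conj-dual-ℤ θ x) (conj-dual-ℤ ν x) (R.conj-ν (1ℤ - x)))
          (cong (λ t → (conj (dual μ) x - conj (dual ν) x) + (conj (dual θ) x - conj (dual ν) x) + t - 1ℤ)
            (sym (cong c (next x))))))
    ; conj-ν = λ x → trans
        (reverse-conj {+ ℓ} {conj κ (1ℤ - x)} {conj μ (1ℤ - x)} {conj θ (1ℤ - x)} {conj ν (1ℤ - x)}
            {c (1ℤ - x - 1ℤ)} {c (1ℤ - x)} (conj-dual-ℤ κ x) (conj-dual-ℤ μ x) (conj-dual-ℤ θ x) (conj-dual-ℤ ν x) (R.conj-ν (1ℤ - x)))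
        (cong (λ t → conj (dual μ) x + conj (dual θ) x - conj (dual ν) x + t - c (1ℤ - x - 1ℤ))
          (sym (cong c (next x))))
    }
    where
    next : ∀ x → 1ℤ - (x - 1ℤ) - 1ℤ ≡ 1ℤ - x
    next = solve-∀
    low : ∀ x → x ℤ.≤ - proj₁ carry-final - 1ℤ → proj₁ carry-final ℤ.< 1ℤ - x - 1ℤ
    low x x≤ = ℤ.<-≤-trans (<+ M 0) (subst₂ ℤ._≤_ (lemma₁ M) (lemma₂ x) (ℤ.neg-mono-≤ x≤))
      where
      M : ℤ
      M = proj₁ carry-final
      lemma₁ : ∀ M → - (- M - 1ℤ) ≡ M + 1ℤ
      lemma₁ = solve-∀
      lemma₂ : ∀ x → - x ≡ 1ℤ - x - 1ℤ
      lemma₂ = solve-∀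

fomin⁻¹ : ∀ {ℓ} {μ θ ν : Signature ℓ} → μ ⪯ ν → θ ⪯ ν →
          ∃[ κ ] FominRule κ μ θ ν × κ ⪯ μ × κ ⪯ θ
fomin⁻¹ {ℓ} {μ} {θ} {ν} μ⪯ν θ⪯ν =
  from (fomin (dual-⪯ μ⪯ν) (dual-⪯ θ⪯ν))
  where
  from : (∃[ κ ] FominRule (dual ν) (dual μ) (dual θ) κ × dual μ ⪯ κ × dual θ ⪯ κ) →
         ∃[ κ ] FominRule κ μ θ ν × κ ⪯ μ × κ ⪯ θ
  from (κ* , rule , μ*⪯κ* , θ*⪯κ*) =
    dual κ* , rule₃ , subst (dual κ* ⪯_) (dual-involutive μ) (dual-⪯ μ*⪯κ*)
                    , subst (dual κ* ⪯_) (dual-involutive θ) (dual-⪯ θ*⪯κ*)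
    where
    rule₁ : FominRule (dual κ*) (dual (dual μ)) (dual (dual θ)) (dual (dual ν))
    rule₁ = dual-rule {κ = dual ν} {dual μ} {dual θ} {κ*} (dual-⪯ μ⪯ν) (dual-⪯ θ⪯ν) rule
    rule₂ : FominRule (dual κ*) μ θ (dual (dual ν))
    rule₂ = subst₂ (λ μ θ → FominRule (dual κ*) μ θ (dual (dual ν)))
      (dual-involutive μ) (dual-involutive θ) rule₁
    rule₃ : FominRule (dual κ*) μ θ ν
    rule₃ = subst (FominRule (dual κ*) μ θ) (dual-involutive ν) rule₂

fomin⁻¹-unique : ∀ {ℓ} {κ κ′ μ θ ν : Signature ℓ} →
  κ ⪯ μ → κ ⪯ θ → κ′ ⪯ μ → κ′ ⪯ θ →
  FominRule κ μ θ ν → FominRule κ′ μ θ ν → κ ≡ κ′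
fomin⁻¹-unique {κ = κ} {κ′} {μ} {θ} {ν} p q p′ q′ r r′ =
  trans (sym (dual-involutive κ)) (trans
    (cong dual (fomin-unique {κ = dual ν} {dual μ} {dual θ} {dual κ} {dual κ′}
      (dual-rule p q r) (dual-rule p′ q′ r′)))
    (dual-involutive κ′))

-- Maps on 𝒞ₙ are maps on ℤ² invariant under (x , y) ↦ (x + kn , y - kn).
record FominField (n ℓ : ℕ) : Set where
  field
    at       : ℤ → ℤ → Signature ℓ
    periodic : ∀ x y k → at (x + k * + n) (y - k * + n) ≡ at x y
    at-e₁    : ∀ x y → at x y ⪯ at (x + 1ℤ) y
    at-e₂    : ∀ x y → at x y ⪯ at x (y + 1ℤ)
    square   : ∀ x y →
      FominRule (at x y) (at (x + 1ℤ) y) (at x (y + 1ℤ)) (at (x + 1ℤ) (y + 1ℤ))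

-- SST θ ρ n is SST(θ/ρ, n).
record SST {ℓ} (θ ρ : Signature ℓ) (n : ℕ) : Set where
  constructor tableau
  field
    chain   : Vec (Signature ℓ) (suc n)
    .inner  : lookup chain zero ≡ ρ
    .outer  : lookup chain (fromℕ n) ≡ θ
    .strips : ∀ i → lookup chain (inject₁ i) ⪯ lookup chain (suc i)

open SST public using (chain)

layer : ∀ {ℓ} {θ ρ : Signature ℓ} {n} → SST θ ρ n → Fin (suc n) → Signature ℓ
layer P = lookup (chain P)

-- An element of ⨆ SST(λ/ρ, n)², over all ℓ and all λ, ρ of length ℓ
record Pair (n : ℕ) : Set where
  constructor pair
  field
    {size}        : ℕ
    {outer inner} : Signature size
    P Q           : SST outer inner n

tableau-≡ : ∀ {ℓ} {θ ρ : Signature ℓ} {n} {P P′ : SST θ ρ n} → chain P ≡ chain P′ → P ≡ P′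
tableau-≡ refl = refl

inner≡ : ∀ {ℓ} {θ ρ : Signature ℓ} {n} (P : SST θ ρ n) → layer P zero ≡ ρ
inner≡ {ρ = ρ} (tableau c i _ _) = recompute (lookup c zero ≟ˢ ρ) i

outer≡ : ∀ {ℓ} {θ ρ : Signature ℓ} {n} (P : SST θ ρ n) → layer P (fromℕ n) ≡ θ
outer≡ {θ = θ} (tableau c _ o _) = recompute (lookup c (fromℕ _) ≟ˢ θ) o

strip : ∀ {ℓ} {θ ρ : Signature ℓ} {n} (P : SST θ ρ n) → ∀ i → layer P (inject₁ i) ⪯ layer P (suc i)
strip (tableau c _ _ s) i = ⪯-irr (s i)

pair-≡ : ∀ {n ℓ} {θ ρ θ′ ρ′ : Signature ℓ} {P Q : SST θ ρ n} {P′ Q′ : SST θ′ ρ′ n} →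
         chain P ≡ chain P′ → chain Q ≡ chain Q′ → pair P Q ≡ pair P′ Q′
pair-≡ {P = P} {Q} {P′} {Q′} p q = go
  (trans (sym (outer≡ P)) (trans (cong (λ c → lookup c (fromℕ _)) p) (outer≡ P′)))
  (trans (sym (inner≡ P)) (trans (cong (λ c → lookup c zero) p) (inner≡ P′)))
  P Q P′ Q′ p q
  where
  go : ∀ {n ℓ} {θ ρ θ′ ρ′ : Signature ℓ} → θ ≡ θ′ → ρ ≡ ρ′ →
       (P Q : SST θ ρ n) (P′ Q′ : SST θ′ ρ′ n) →
       chain P ≡ chain P′ → chain Q ≡ chain Q′ → pair P Q ≡ pair P′ Q′
  go refl refl P Q P′ Q′ p q = cong₂ pair (tableau-≡ p) (tableau-≡ q)

module _ {n ℓ : ℕ} (Λ : FominField n ℓ) where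
  open FominField Λ

  private
    +suc : ∀ x i → x + i + 1ℤ ≡ x + (1ℤ + i)
    +suc = solve-∀

    close : ∀ x y → at x (y + + n) ≡ at (x + + n) y
    close x y = trans (sym (periodic x (y + + n) 1ℤ))
      (cong₂ at (lemma₁ x (+ n)) (lemma₂ y (+ n)))
      where
      lemma₁ : ∀ x n → x + 1ℤ * n ≡ x + n
      lemma₁ = solve-∀
      lemma₂ : ∀ y n → y + n - 1ℤ * n ≡ y
      lemma₂ = solve-∀

    along : (f : ℕ → Signature ℓ) → (∀ i → f i ⪯ f (suc i)) → SST (f n) (f 0) n
    along f f⪯ = tableau v refl
      (trans (Vec.lookup∘tabulate (f ∘ toℕ) (fromℕ n)) (cong f (Fin.toℕ-fromℕ n)))
      (λ i → subst₂ _⪯_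
        (sym (trans (Vec.lookup∘tabulate (f ∘ toℕ) (inject₁ i)) (cong f (Fin.toℕ-inject₁ i))))
        (sym (Vec.lookup∘tabulate (f ∘ toℕ) (suc i)))
        (f⪯ (toℕ i)))
      where
      v : Vec (Signature ℓ) (suc n)
      v = tabulate (f ∘ toℕ)

    retype : ∀ {θ ρ θ′ ρ′ : Signature ℓ} → θ ≡ θ′ → ρ ≡ ρ′ → SST θ ρ n → SST θ′ ρ′ n
    retype p q (tableau c i o s) = tableau c (trans i q) (trans o p) s

  -- (Λ(x + i, y))ᵢ and (Λ(x, y + i))ᵢ, for 0 ≤ i ≤ n
  read₁ read₂ : ∀ x y → SST (at (x + + n) y) (at x y) n
  read₁ x y = retype refl (cong (λ t → at t y) (ℤ.+-identityʳ x)) (along (λ i → at (x + + i) y)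
    λ i → subst (λ t → at (x + + i) y ⪯ at t y) (+suc x (+ i)) (at-e₁ (x + + i) y))
  read₂ x y = retype (close x y) (cong (at x) (ℤ.+-identityʳ y)) (along (λ i → at x (y + + i))
    λ i → subst (λ t → at x (y + + i) ⪯ at x t) (+suc y (+ i)) (at-e₂ x (y + + i)))

  read : ℤ → ℤ → Pair n
  read x y = pair (read₁ x y) (read₂ x y)

read-cong : ∀ {n ℓ} (Λ Λ′ : FominField n ℓ) {x y x′ y′} →
  (∀ i → FominField.at Λ (x + + i) y ≡ FominField.at Λ′ (x′ + + i) y′) →
  (∀ i → FominField.at Λ x (y + + i) ≡ FominField.at Λ′ x′ (y′ + + i)) →
  read Λ x y ≡ read Λ′ x′ y′
read-cong Λ Λ′ eq₁ eq₂ = pair-≡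
  (Vec.tabulate-cong (λ i → eq₁ (toℕ i)))
  (Vec.tabulate-cong (λ i → eq₂ (toℕ i)))

private
  data Chain {ℓ} : Signature ℓ → Signature ℓ → ℕ → Set where
    []  : ∀ {μ} → Chain μ μ 0
    _∷_ : ∀ {κ μ ν n} → κ ⪯ μ → Chain μ ν n → Chain κ ν (suc n)

  infixl 9 _!_
  _!_ : ∀ {ℓ n} {κ ν : Signature ℓ} → Chain κ ν n → ℕ → Signature ℓ
  _!_ {κ = κ} c zero = κ
  _!_ {κ = κ} [] (suc i) = κ
  (_ ∷ c) ! suc i = c ! i

  !-last : ∀ {ℓ n} {κ ν : Signature ℓ} (c : Chain κ ν n) → c ! n ≡ ν
  !-last []      = refl
  !-last (_ ∷ c) = !-last c

  !-⪯ : ∀ {ℓ n} {κ ν : Signature ℓ} (c : Chain κ ν n) → ∀ i → c ! i ⪯ c ! suc i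
  !-⪯ []      zero    = ⪯-refl
  !-⪯ []      (suc i) = ⪯-refl
  !-⪯ (p ∷ c) zero    = p
  !-⪯ (p ∷ c) (suc i) = !-⪯ c i

  record Ladder {ℓ n} {κ θ μ ν : Signature ℓ} (c : Chain κ θ n) (d : Chain μ ν n) : Set where
    field
      rung : ∀ i → c ! i ⪯ d ! i
      rule : ∀ i → i ℕ.< n → FominRule (c ! i) (d ! i) (c ! suc i) (d ! suc i)

  ladder-[] : ∀ {ℓ} {κ μ : Signature ℓ} → κ ⪯ μ → Ladder ([] {μ = κ}) ([] {μ = μ})
  ladder-[] κ⪯μ = record { rung = λ { zero → κ⪯μ ; (suc i) → κ⪯μ } ; rule = λ _ () }

  ladder-∷ : ∀ {ℓ n} {κ μ κ₁ μ₁ θ ν : Signature ℓ} {c : Chain κ₁ θ n} {d : Chain μ₁ ν n} →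
    κ ⪯ μ → FominRule κ μ κ₁ μ₁ → (κ⪯κ₁ : κ ⪯ κ₁) (μ⪯μ₁ : μ ⪯ μ₁) →
    Ladder c d → Ladder (κ⪯κ₁ ∷ c) (μ⪯μ₁ ∷ d)
  ladder-∷ κ⪯μ r _ _ l = record
    { rung = λ { zero → κ⪯μ ; (suc i) → Ladder.rung l i }
    ; rule = λ { zero _ → r ; (suc i) (s≤s i<) → Ladder.rule l i i< }
    }

  Up : ∀ {ℓ n} {κ θ : Signature ℓ} → Chain κ θ n → Signature ℓ → Set
  Up {ℓ} {n} {θ = θ} c μ = Σ (Signature ℓ) λ ν → θ ⪯ ν × Σ (Chain μ ν n) (Ladder c)

  up : ∀ {ℓ n} {κ θ μ : Signature ℓ} (c : Chain κ θ n) → κ ⪯ μ → Up c μ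
  up {μ = μ} [] κ⪯μ = μ , κ⪯μ , [] , ladder-[] κ⪯μ
  up {κ = κ} {θ} {μ} (_∷_ {μ = κ₁} κ⪯κ₁ c) κ⪯μ =
    extend (fomin {κ = κ} {μ} {κ₁} κ⪯μ κ⪯κ₁)
    where
    extend : (∃[ μ₁ ] FominRule κ μ κ₁ μ₁ × μ ⪯ μ₁ × κ₁ ⪯ μ₁) → Up (κ⪯κ₁ ∷ c) μ
    extend (μ₁ , r , μ⪯μ₁ , κ₁⪯μ₁) = glue (up c κ₁⪯μ₁)
      where
      glue : Up c μ₁ → Up (κ⪯κ₁ ∷ c) μ
      glue (ν , θ⪯ν , d , l) = ν , θ⪯ν , μ⪯μ₁ ∷ d , ladder-∷ κ⪯μ r κ⪯κ₁ μ⪯μ₁ l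

  Down : ∀ {ℓ n} {μ ν : Signature ℓ} → Signature ℓ → Chain μ ν n → Set
  Down {ℓ} {n} {μ} θ d = Σ (Signature ℓ) λ κ → κ ⪯ μ × Σ (Chain κ θ n) (λ c → Ladder c d)

  down : ∀ {ℓ n} {θ μ ν : Signature ℓ} (d : Chain μ ν n) → θ ⪯ ν → Down θ d
  down {θ = θ} [] θ⪯ν = θ , θ⪯ν , [] , ladder-[] θ⪯ν
  down {θ = θ} {μ} (_∷_ {μ = μ₁} μ⪯μ₁ d) θ⪯ν = extend (down d θ⪯ν)
    where
    extend : Down θ d → Down θ (μ⪯μ₁ ∷ d)
    extend (κ₁ , κ₁⪯μ₁ , c , l) = glue (fomin⁻¹ {μ = μ} {κ₁} {μ₁} μ⪯μ₁ κ₁⪯μ₁)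
      where
      glue : (∃[ κ ] FominRule κ μ κ₁ μ₁ × κ ⪯ μ × κ ⪯ κ₁) → Down θ (μ⪯μ₁ ∷ d)
      glue (κ , r , κ⪯μ , κ⪯κ₁) = κ , κ⪯μ , κ⪯κ₁ ∷ c , ladder-∷ κ⪯μ r κ⪯κ₁ μ⪯μ₁ l

  snoc : ∀ {ℓ n} {κ μ ν : Signature ℓ} → Chain κ μ n → μ ⪯ ν → Chain κ ν (suc n)
  snoc []      q = q ∷ []
  snoc (p ∷ c) q = p ∷ snoc c q

  snoc-! : ∀ {ℓ n} {κ μ ν : Signature ℓ} (c : Chain κ μ n) (q : μ ⪯ ν) →
           ∀ i → i ℕ.≤ n → snoc c q ! i ≡ c ! i
  snoc-! c       q zero    _       = refl
  snoc-! (p ∷ c) q (suc i) (s≤s i≤) = snoc-! c q i i≤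

  Unsnoc : ∀ {ℓ n} {κ ν : Signature ℓ} → Chain κ ν (suc n) → Set
  Unsnoc {ℓ} {n} {κ} {ν} c =
    Σ (Signature ℓ) λ μ → Σ (Chain κ μ n) λ d → Σ (μ ⪯ ν) λ q → snoc d q ≡ c

  unsnoc : ∀ {ℓ n} {κ ν : Signature ℓ} (c : Chain κ ν (suc n)) → Unsnoc c
  unsnoc {κ = κ} (p ∷ [])    = κ , [] , p , refl
  unsnoc (p ∷ (q ∷ c)) = cons (unsnoc (q ∷ c))
    where
    cons : Unsnoc (q ∷ c) → Unsnoc (p ∷ (q ∷ c))
    cons (μ , d , r , eq) = μ , p ∷ d , r , cong (p ∷_) eq

  record State (n ℓ : ℕ) : Set where
    constructor state
    field
      {bot top} : Signature ℓ
      row col   : Chain bot top n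

  open State

  record Next {n ℓ} (s t : State n ℓ) : Set where
    field
      shift  : ∀ i → i ℕ.< n → row t ! i ≡ row s ! suc i
      ladder : Ladder (col s) (col t)

  forth : ∀ {m ℓ} (s : State (suc m) ℓ) → Σ (State (suc m) ℓ) (Next s)
  forth (state (_∷_ {μ = μ} κ⪯μ r) c) = finish (up c κ⪯μ)
    where
    finish : Up c μ → Σ (State _ _) (Next (state (κ⪯μ ∷ r) c))
    finish (ν , θ⪯ν , d , l) = state (snoc r θ⪯ν) d , record
      { shift = λ { i (s≤s i≤) → snoc-! r θ⪯ν i i≤ } ; ladder = l }

  back : ∀ {m ℓ} (t : State (suc m) ℓ) → Σ (State (suc m) ℓ) λ s → Next s t
  back (state {ν} r d) = split-row r (unsnoc r)
    where
    split-row : ∀ r → Unsnoc r → Σ (State _ _) λ s → Next s (state r d)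
    split-row _ (θ , r₀ , θ⪯ν , refl) = finish (down d θ⪯ν)
      where
      finish : Down θ d → Σ (State _ _) λ s → Next s (state (snoc r₀ θ⪯ν) d)
      finish (κ , κ⪯μ , c , l) = state (κ⪯μ ∷ r₀) c , record
        { shift = λ { i (s≤s i≤) → snoc-! r₀ θ⪯ν i i≤ } ; ladder = l }

  remainder-unique : ∀ {n} r i q k → r ℕ.< n → i ℕ.< n →
    + r + q * + n ≡ + i + k * + n → r ≡ i
  remainder-unique {n} r i q k r<n i<n eq =
    ℤ.+-injective (ℤ.i-j≡0⇒i≡j (+ r) (+ i) (ℤ.∣i∣≡0⇒i≡0 (small ∣ k - q ∣ (begin
      ∣ + r - + i ∣              ≡⟨ cong ∣_∣ diff ⟩
      ∣ (k - q) * + n ∣          ≡⟨ ℤ.abs-* (k - q) (+ n) ⟩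
      ∣ k - q ∣ ℕ.* n            ∎))))
    where
    open ≡-Reasoning
    lemma₁ : ∀ r i q n → r - i ≡ (r + q * n) - i - q * n
    lemma₁ = solve-∀
    lemma₂ : ∀ i k q n → (i + k * n) - i - q * n ≡ (k - q) * n
    lemma₂ = solve-∀
    diff : + r - + i ≡ (k - q) * + n
    diff = trans (lemma₁ (+ r) (+ i) q (+ n))
      (trans (cong (λ t → t - + i - q * + n) eq) (lemma₂ (+ i) k q (+ n)))
    bound : ∣ + r - + i ∣ ℕ.< n
    bound = subst (ℕ._< n) (cong ∣_∣ (sym (ℤ.[+m]-[+n]≡m⊖n r i)))
      (ℕ.≤-<-trans (ℤ.∣m⊝n∣≤m⊔n r i) (ℕ.⊔-lub r<n i<n))
    small : ∀ t → ∣ + r - + i ∣ ≡ t ℕ.* n → ∣ + r - + i ∣ ≡ 0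
    small zero    e = e
    small (suc t) e = ⊥-elim (ℕ.<⇒≱ bound (subst (n ℕ.≤_) (sym e) (ℕ.m≤m+n n _)))

  module Grow {m ℓ : ℕ} (s₀ : State (suc m) ℓ) where

    n : ℕ
    n = suc m

    forthⁿ backⁿ : ℕ → State n ℓ
    forthⁿ zero    = s₀
    forthⁿ (suc j) = proj₁ (forth (forthⁿ j))
    backⁿ zero    = s₀
    backⁿ (suc j) = proj₁ (back (backⁿ j))

    st : ℤ → State n ℓ
    st (+ j)    = forthⁿ j
    st -[1+ j ] = backⁿ (suc j)

    next : ∀ z → Next (st z) (st (z + 1ℤ))
    next (+ j) = subst (λ i → Next (st (+ j)) (st (+ i))) (ℕ.+-comm 1 j) (proj₂ (forth (forthⁿ j)))
    next -[1+ zero ]  = proj₂ (back (backⁿ 0))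
    next -[1+ suc j ] = proj₂ (back (backⁿ (suc j)))

    !-zero : ∀ {κ ν : Signature ℓ} {n} (c : Chain κ ν n) → c ! 0 ≡ κ
    !-zero []      = refl
    !-zero (_ ∷ _) = refl

    bottom : ∀ i z → i ℕ.≤ n → row (st z) ! i ≡ col (st (z + + i)) ! 0
    bottom zero z _ = trans (!-zero (row (st z)))
      (trans (sym (!-zero (col (st z)))) (cong (λ t → col (st t) ! 0) (sym (ℤ.+-identityʳ z))))
    bottom (suc i) z i<n = trans (sym (Next.shift (next z) i i<n))
      (trans (bottom i (z + 1ℤ) (ℕ.<⇒≤ i<n))
        (cong (λ t → col (st t) ! 0) (ℤ.+-assoc z 1ℤ (+ i))))

    wrap : ∀ z → col (st z) ! n ≡ col (st (z + + n)) ! 0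
    wrap z = trans (!-last (col (st z))) (trans (sym (!-last (row (st z)))) (bottom n z ℕ.≤-refl))

    at : ℤ → ℤ → Signature ℓ
    at x y = col (st (x + y - + (y ℤ.%ℕ n))) ! (y ℤ.%ℕ n)

    at-≡ : ∀ x y i k → i ℕ.≤ n → y ≡ + i + k * + n → at x y ≡ col (st (x + y - + i)) ! i
    at-≡ x y i k i≤n eq with i ℕ.≟ n
    ... | no  i≢n = cong (λ r → col (st (x + y - + r)) ! r)
      (remainder-unique (y ℤ.%ℕ n) i (y ℤ./ℕ n) k (ℤ.n%ℕd<d y n) (ℕ.≤∧≢⇒< i≤n i≢n)
        (trans (sym (ℤ.a≡a%ℕn+[a/ℕn]*n y n)) eq))
    ... | yes refl = trans
      (cong (λ r → col (st (x + y - + r)) ! r)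
        (remainder-unique (y ℤ.%ℕ n) 0 (y ℤ./ℕ n) (k + 1ℤ) (ℤ.n%ℕd<d y n) (s≤s z≤n)
          (trans (sym (ℤ.a≡a%ℕn+[a/ℕn]*n y n)) (trans eq (lemma₁ k (+ n))))))
      (trans (cong (λ t → col (st t) ! 0) (lemma₂ (x + y) (+ n)))
        (sym (wrap (x + y - + n))))
      where
      lemma₁ : ∀ k n → n + k * n ≡ 0ℤ + (k + 1ℤ) * n
      lemma₁ = solve-∀
      lemma₂ : ∀ z n → z - 0ℤ ≡ z - n + n
      lemma₂ = solve-∀

    module At (x y : ℤ) where
      r : ℕ
      r = y ℤ.%ℕ n
      s : ℤ
      s = x + y - + r
      r<n : r ℕ.< n
      r<n = ℤ.n%ℕd<d y n
      y≡ : y ≡ + r + (y ℤ./ℕ n) * + n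
      y≡ = ℤ.a≡a%ℕn+[a/ℕn]*n y n
      right : at (x + 1ℤ) y ≡ col (st (s + 1ℤ)) ! r
      right = cong (λ t → col (st t) ! r) (lemma x y (+ r))
        where
        lemma : ∀ x y r → x + 1ℤ + y - r ≡ x + y - r + 1ℤ
        lemma = solve-∀
      y+1≡ : y + 1ℤ ≡ + suc r + (y ℤ./ℕ n) * + n
      y+1≡ = trans (cong (_+ 1ℤ) y≡) (lemma (+ r) ((y ℤ./ℕ n) * + n))
        where
        lemma : ∀ r t → r + t + 1ℤ ≡ 1ℤ + r + t
        lemma = solve-∀
      above : at x (y + 1ℤ) ≡ col (st s) ! suc r
      above = trans (at-≡ x (y + 1ℤ) (suc r) (y ℤ./ℕ n) r<n y+1≡)
        (cong (λ t → col (st t) ! suc r) (lemma x y (+ r)))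
        where
        lemma : ∀ x y r → x + (y + 1ℤ) - (1ℤ + r) ≡ x + y - r
        lemma = solve-∀
      corner : at (x + 1ℤ) (y + 1ℤ) ≡ col (st (s + 1ℤ)) ! suc r
      corner = trans (at-≡ (x + 1ℤ) (y + 1ℤ) (suc r) (y ℤ./ℕ n) r<n y+1≡)
        (cong (λ t → col (st t) ! suc r) (lemma x y (+ r)))
        where
        lemma : ∀ x y r → x + 1ℤ + (y + 1ℤ) - (1ℤ + r) ≡ x + y - r + 1ℤ
        lemma = solve-∀

    field₀ : FominField n ℓ
    field₀ = record
      { at = at
      ; periodic = λ x y k → trans
          (at-≡ (x + k * + n) (y - k * + n) (At.r x y) (y ℤ./ℕ n - k) (ℕ.<⇒≤ (At.r<n x y))
            (trans (cong (_- k * + n) (At.y≡ x y)) (lemma₁ (+ At.r x y) (y ℤ./ℕ n) k (+ n))))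
          (cong (λ t → col (st t) ! At.r x y) (lemma₂ x y (k * + n) (+ At.r x y)))
      ; at-e₁ = λ x y → subst (at x y ⪯_) (sym (At.right x y))
          (Ladder.rung (Next.ladder (next (At.s x y))) (At.r x y))
      ; at-e₂ = λ x y → subst (at x y ⪯_) (sym (At.above x y))
          (!-⪯ (col (st (At.s x y))) (At.r x y))
      ; square = λ x y → subst (FominRule (at x y) (at (x + 1ℤ) y) (at x (y + 1ℤ))) (sym (At.corner x y))
          (subst₂ (λ μ θ → FominRule (at x y) μ θ (col (st (At.s x y + 1ℤ)) ! suc (At.r x y)))
            (sym (At.right x y)) (sym (At.above x y))
            (Ladder.rule (Next.ladder (next (At.s x y))) (At.r x y) (At.r<n x y)))
      }
      where
      lemma₁ : ∀ r q k n → r + q * n - k * n ≡ r + (q - k) * n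
      lemma₁ = solve-∀
      lemma₂ : ∀ x y t r → x + t + (y - t) - r ≡ x + y - r
      lemma₂ = solve-∀

    at-row : ∀ i → i ℕ.≤ n → at (+ i) 0ℤ ≡ row s₀ ! i
    at-row i i≤n = trans (at-≡ (+ i) 0ℤ 0 0ℤ z≤n refl)
      (trans (cong (λ t → col (st t) ! 0) (lemma (+ i))) (sym (bottom i 0ℤ i≤n)))
      where
      lemma : ∀ i → i + 0ℤ - 0ℤ ≡ 0ℤ + i
      lemma = solve-∀

    at-col : ∀ i → i ℕ.≤ n → at 0ℤ (+ i) ≡ col s₀ ! i
    at-col i i≤n = trans (at-≡ 0ℤ (+ i) i 0ℤ i≤n (sym (ℤ.+-identityʳ (+ i))))
      (cong (λ t → col (st t) ! i) (lemma (+ i)))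
      where
      lemma : ∀ i → 0ℤ + i - i ≡ 0ℤ
      lemma = solve-∀

  toChain : ∀ {ℓ n} (v : Vec (Signature ℓ) (suc n)) →
    (∀ i → lookup v (inject₁ i) ⪯ lookup v (suc i)) →
    Chain (lookup v zero) (lookup v (fromℕ n)) n
  toChain (σ ∷ [])    _ = []
  toChain (σ ∷ τ ∷ v) p = p zero ∷ toChain (τ ∷ v) (p ∘ suc)

  toChain-! : ∀ {ℓ n} (v : Vec (Signature ℓ) (suc n)) p i → toChain v p ! toℕ i ≡ lookup v i
  toChain-! (σ ∷ [])    p zero    = refl
  toChain-! (σ ∷ τ ∷ v) p zero    = refl
  toChain-! (σ ∷ τ ∷ v) p (suc i) = toChain-! (τ ∷ v) (p ∘ suc) i

  chainOf : ∀ {ℓ n} {θ ρ : Signature ℓ} → (P : SST θ ρ n) →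
    Σ (Chain ρ θ n) λ c → ∀ i → c ! toℕ i ≡ layer P i
  chainOf P = go (inner≡ P) (outer≡ P) (toChain (chain P) (strip P)) (toChain-! (chain P) (strip P))
    where
    go : ∀ {ρ θ ρ′ θ′} → ρ ≡ ρ′ → θ ≡ θ′ → (c : Chain ρ θ _) →
      (∀ i → c ! toℕ i ≡ layer P i) → Σ (Chain ρ′ θ′ _) λ c → ∀ i → c ! toℕ i ≡ layer P i
    go refl refl c eq = c , eq

  start : ∀ {m} (b : Pair (suc m)) → State (suc m) (Pair.size b)
  start (pair P Q) = state (proj₁ (chainOf P)) (proj₁ (chainOf Q))

-- `field-P`, `field-Q` and `field-unique` characterise λ[ pair P Q ].
opaque
  λ[_] : ∀ {m} (b : Pair (suc m)) → FominField (suc m) (Pair.size b)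
  λ[ b ] = Grow.field₀ (start b)

  field-P : ∀ {m} (b : Pair (suc m)) → ∀ i → FominField.at λ[ b ] (+ toℕ i) 0ℤ ≡ layer (Pair.P b) i
  field-P b i = trans (Grow.at-row (start b) (toℕ i) (ℕ.s≤s⁻¹ (Fin.toℕ<n i)))
    (proj₂ (chainOf (Pair.P b)) i)

  field-Q : ∀ {m} (b : Pair (suc m)) → ∀ i → FominField.at λ[ b ] 0ℤ (+ toℕ i) ≡ layer (Pair.Q b) i
  field-Q b i = trans (Grow.at-col (start b) (toℕ i) (ℕ.s≤s⁻¹ (Fin.toℕ<n i)))
    (proj₂ (chainOf (Pair.Q b)) i)

module _ {m ℓ : ℕ} (F G : FominField (suc m) ℓ) where

  private
    n : ℕ
    n = suc m

    module F = FominField F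
    module G = FominField G

    infix 4 _≈_
    _≈_ : ℤ → ℤ → Set
    x ≈ y = F.at x y ≡ G.at x y

    record Agree (x : ℤ) : Set where
      field
        horizontal : ∀ i → i ℕ.≤ n → x + + i ≈ 0ℤ
        vertical   : ∀ i → i ℕ.≤ n → x ≈ + i

    open Agree

    move : ∀ k {x y} → x ≈ y → x + k * + n ≈ y - k * + n
    move k {x} {y} eq = trans (F.periodic x y k) (trans eq (sym (G.periodic x y k)))

    turn : ∀ {x} → x ≈ + n → x + + n ≈ 0ℤ
    turn {x} eq = subst₂ _≈_ (lemma₁ x (+ n)) (lemma₂ (+ n)) (move 1ℤ eq)
      where
      lemma₁ : ∀ x n → x + 1ℤ * n ≡ x + n
      lemma₁ = solve-∀
      lemma₂ : ∀ n → n - 1ℤ * n ≡ 0ℤ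
      lemma₂ = solve-∀

    turn⁻¹ : ∀ {x} → x + + n ≈ 0ℤ → x ≈ + n
    turn⁻¹ {x} eq = subst₂ _≈_ (lemma₁ x (+ n)) (lemma₂ (+ n)) (move -[1+ 0 ] eq)
      where
      lemma₁ : ∀ x n → x + n + -[1+ 0 ] * n ≡ x
      lemma₁ = solve-∀
      lemma₂ : ∀ n → 0ℤ - -[1+ 0 ] * n ≡ n
      lemma₂ = solve-∀

    square⁺ : ∀ {x y} → x ≈ y → x + 1ℤ ≈ y → x ≈ y + 1ℤ → x + 1ℤ ≈ y + 1ℤ
    square⁺ {x} {y} a b c = fomin-unique
      {κ = G.at x y} {G.at (x + 1ℤ) y} {G.at x (y + 1ℤ)}
      (subst (λ κ → FominRule κ _ _ _) a
        (subst₂ (λ μ θ → FominRule (F.at x y) μ θ (F.at (x + 1ℤ) (y + 1ℤ))) b c (F.square x y)))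
      (G.square x y)

    square⁻ : ∀ {x y} → x + 1ℤ ≈ y → x ≈ y + 1ℤ → x + 1ℤ ≈ y + 1ℤ → x ≈ y
    square⁻ {x} {y} b c d = fomin⁻¹-unique
      {κ = F.at x y} {G.at x y} {G.at (x + 1ℤ) y} {G.at x (y + 1ℤ)} {G.at (x + 1ℤ) (y + 1ℤ)}
      (subst (F.at x y ⪯_) b (F.at-e₁ x y)) (subst (F.at x y ⪯_) c (F.at-e₂ x y))
      (G.at-e₁ x y) (G.at-e₂ x y)
      (subst (λ ν → FominRule (F.at x y) (G.at (x + 1ℤ) y) (G.at x (y + 1ℤ)) ν) d
        (subst₂ (λ μ θ → FominRule (F.at x y) μ θ (F.at (x + 1ℤ) (y + 1ℤ))) b c (F.square x y)))
      (G.square x y)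

    suc≡ : ∀ i → + suc i ≡ + i + 1ℤ
    suc≡ i = cong +_ (ℕ.+-comm 1 i)

    +suc≡ : ∀ x i → x + (1ℤ + i) ≡ x + 1ℤ + i
    +suc≡ = solve-∀

    agree⁺ : ∀ x → Agree x → Agree (x + 1ℤ)
    agree⁺ x a = record { horizontal = h ; vertical = v }
      where
      v : ∀ i → i ℕ.≤ n → x + 1ℤ ≈ + i
      v zero    _   = horizontal a 1 (s≤s z≤n)
      v (suc i) i<n = subst (x + 1ℤ ≈_) (sym (suc≡ i)) (square⁺ {x} {+ i}
        (vertical a i (ℕ.<⇒≤ i<n)) (v i (ℕ.<⇒≤ i<n))
        (subst (x ≈_) (suc≡ i) (vertical a (suc i) i<n)))
      h : ∀ i → i ℕ.≤ n → x + 1ℤ + + i ≈ 0ℤ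
      h i i≤n with i ℕ.≟ n
      ... | yes refl = turn (v n ℕ.≤-refl)
      ... | no  i≢n  = subst (_≈ 0ℤ) (+suc≡ x (+ i)) (horizontal a (suc i) (ℕ.≤∧≢⇒< i≤n i≢n))

    agree⁻ : ∀ x → Agree (x + 1ℤ) → Agree x
    agree⁻ x a = record { horizontal = h ; vertical = v }
      where
      h⁺ : ∀ i → suc i ℕ.≤ n → x + + suc i ≈ 0ℤ
      h⁺ i i<n = subst (_≈ 0ℤ) (sym (+suc≡ x (+ i))) (horizontal a i (ℕ.<⇒≤ i<n))
      descend : ∀ j i → i ℕ.+ j ≡ n → x ≈ + i
      descend zero i eq = subst (λ i → x ≈ + i) (trans (sym eq) (ℕ.+-identityʳ i))
        (turn⁻¹ (h⁺ m ℕ.≤-refl))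
      descend (suc j) i eq = square⁻ {x} {+ i}
        (vertical a i (ℕ.<⇒≤ i<n))
        (subst (x ≈_) (suc≡ i) (descend j (suc i) (trans (sym (ℕ.+-suc i j)) eq)))
        (subst (x + 1ℤ ≈_) (suc≡ i) (vertical a (suc i) i<n))
        where
        i<n : i ℕ.< n
        i<n = subst (suc i ℕ.≤_) (trans (sym (ℕ.+-suc i j)) eq) (s≤s (ℕ.m≤m+n i j))
      v : ∀ i → i ℕ.≤ n → x ≈ + i
      v i i≤n = descend (n ∸ i) i (ℕ.m+[n∸m]≡n i≤n)
      h : ∀ i → i ℕ.≤ n → x + + i ≈ 0ℤ
      h zero    _   = subst (_≈ 0ℤ) (sym (ℤ.+-identityʳ x)) (v 0 z≤n)
      h (suc i) i<n = h⁺ i i<n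

    agree : Agree 0ℤ → ∀ x → Agree x
    agree a (+ zero)  = a
    agree a (+ suc j) = subst Agree (sym (suc≡ j)) (agree⁺ (+ j) (agree a (+ j)))
    agree a -[1+ zero ]  = agree⁻ -[1+ zero ] a
    agree a -[1+ suc j ] = agree⁻ -[1+ suc j ] (agree a -[1+ j ])

  field-unique : (∀ i → i ℕ.≤ suc m → F.at (+ i) 0ℤ ≡ G.at (+ i) 0ℤ) →
                 (∀ i → i ℕ.≤ suc m → F.at 0ℤ (+ i) ≡ G.at 0ℤ (+ i)) →
                 ∀ x y → F.at x y ≡ G.at x y
  field-unique h v x y = subst₂ _≈_ (lemma₁ x q (+ n)) (sym y≡)
      (move (- q) (vertical (agree a (x + q * + n)) r (ℕ.<⇒≤ (ℤ.n%ℕd<d y n))))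
    where
    r : ℕ
    r = y ℤ.%ℕ n
    q : ℤ
    q = y ℤ./ℕ n
    a : Agree 0ℤ
    a = record { horizontal = h ; vertical = v }
    lemma₁ : ∀ x q n → x + q * n + - q * n ≡ x
    lemma₁ = solve-∀
    y≡ : y ≡ + r - - q * + n
    y≡ = trans (ℤ.a≡a%ℕn+[a/ℕn]*n y n) (lemma (+ r) q (+ n))
      where
      lemma : ∀ r q n → r + q * n ≡ r - - q * n
      lemma = solve-∀

shift : ∀ {n ℓ} → FominField n ℓ → ℤ → ℤ → FominField n ℓ
shift {n} Λ x y = record
  { at       = λ u v → at (x + u) (y + v)
  ; periodic = λ u v k → trans
      (cong₂ at (sym (ℤ.+-assoc x u (k * + n))) (sym (ℤ.+-assoc y v (- (k * + n)))))
      (periodic (x + u) (y + v) k)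
  ; at-e₁    = λ u v → subst (λ t → at (x + u) (y + v) ⪯ at t (y + v)) (ℤ.+-assoc x u 1ℤ)
      (at-e₁ (x + u) (y + v))
  ; at-e₂    = λ u v → subst (λ t → at (x + u) (y + v) ⪯ at (x + u) t) (ℤ.+-assoc y v 1ℤ)
      (at-e₂ (x + u) (y + v))
  ; square   = λ u v → subst₂ (λ s t → FominRule (at (x + u) (y + v)) (at s (y + v)) (at (x + u) t) (at s t))
      (ℤ.+-assoc x u 1ℤ) (ℤ.+-assoc y v 1ℤ) (square (x + u) (y + v))
  }
  where open FominField Λ

field-read : ∀ {m ℓ} (Λ : FominField (suc m) ℓ) x y u v →
  FominField.at λ[ read Λ x y ] u v ≡ FominField.at Λ (x + u) (y + v)
field-read {m} Λ x y = field-unique λ[ read Λ x y ] (shift Λ x y) h v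
  where
  open FominField Λ
  h : ∀ i → i ℕ.≤ suc m → FominField.at λ[ read Λ x y ] (+ i) 0ℤ ≡ at (x + + i) (y + 0ℤ)
  h i i≤ = subst (λ k → FominField.at λ[ read Λ x y ] (+ k) 0ℤ ≡ at (x + + k) (y + 0ℤ))
    (Fin.toℕ-fromℕ< (s≤s i≤))
    (trans (field-P (read Λ x y) (fromℕ< (s≤s i≤))) (trans
      (Vec.lookup∘tabulate (λ k → at (x + + toℕ k) y) (fromℕ< (s≤s i≤)))
      (cong (at _) (sym (ℤ.+-identityʳ y)))))
  v : ∀ i → i ℕ.≤ suc m → FominField.at λ[ read Λ x y ] 0ℤ (+ i) ≡ at (x + 0ℤ) (y + + i)
  v i i≤ = subst (λ k → FominField.at λ[ read Λ x y ] 0ℤ (+ k) ≡ at (x + 0ℤ) (y + + k))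
    (Fin.toℕ-fromℕ< (s≤s i≤))
    (trans (field-Q (read Λ x y) (fromℕ< (s≤s i≤))) (trans
      (Vec.lookup∘tabulate (λ k → at x (y + + toℕ k)) (fromℕ< (s≤s i≤)))
      (cong (λ t → at t _) (sym (ℤ.+-identityʳ x)))))

read-field : ∀ {m} (b : Pair (suc m)) → read λ[ b ] 0ℤ 0ℤ ≡ b
read-field b@(pair P Q) = pair-≡
  (trans (Vec.tabulate-cong (field-P b)) (Vec.tabulate∘lookup (chain P)))
  (trans (Vec.tabulate-cong (field-Q b)) (Vec.tabulate∘lookup (chain Q)))

-- The inverses are justified by `ι₁-inverseˡ`, …, `ι₂-inverseʳ`.
ι₁ ι₁⁻¹ ι₂ ι₂⁻¹ : ∀ {m} → Pair (suc m) → Pair (suc m)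
ι₁   b = read λ[ b ] 1ℤ 0ℤ
ι₁⁻¹ b = read λ[ b ] (- 1ℤ) 0ℤ
ι₂   b = read λ[ b ] 0ℤ 1ℤ
ι₂⁻¹ b = read λ[ b ] 0ℤ (- 1ℤ)

private
  read-read : ∀ {m} (b : Pair (suc m)) x y x′ y′ → x + x′ ≡ 0ℤ → y + y′ ≡ 0ℤ →
    read λ[ read λ[ b ] x y ] x′ y′ ≡ b
  read-read b x y x′ y′ p q = trans
    (read-cong λ[ read λ[ b ] x y ] λ[ b ] {x′} {y′} {0ℤ} {0ℤ}
      (λ i → trans (field-read λ[ b ] x y (x′ + + i) y′)
        (cong₂ at (trans (sym (ℤ.+-assoc x x′ (+ i))) (cong (_+ + i) p)) q))
      (λ i → trans (field-read λ[ b ] x y x′ (y′ + + i))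
        (cong₂ at p (trans (sym (ℤ.+-assoc y y′ (+ i))) (cong (_+ + i) q)))))
    (read-field b)
    where open FominField λ[ b ]

ι₁-inverseˡ : ∀ {m} (b : Pair (suc m)) → ι₁⁻¹ (ι₁ b) ≡ b
ι₁-inverseˡ b = read-read b 1ℤ 0ℤ (- 1ℤ) 0ℤ refl refl

ι₁-inverseʳ : ∀ {m} (b : Pair (suc m)) → ι₁ (ι₁⁻¹ b) ≡ b
ι₁-inverseʳ b = read-read b (- 1ℤ) 0ℤ 1ℤ 0ℤ refl refl

ι₂-inverseˡ : ∀ {m} (b : Pair (suc m)) → ι₂⁻¹ (ι₂ b) ≡ b
ι₂-inverseˡ b = read-read b 0ℤ 1ℤ 0ℤ (- 1ℤ) refl refl

ι₂-inverseʳ : ∀ {m} (b : Pair (suc m)) → ι₂ (ι₂⁻¹ b) ≡ b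
ι₂-inverseʳ b = read-read b 0ℤ (- 1ℤ) 0ℤ 1ℤ refl refl

-- For tableaux with labels 1, …, n, where n = suc m, label t + 1 is
-- represented by t : Fin n, and the operators eᵢ₊₁, fᵢ₊₁ by i : Fin m.

-- A letter of the reading word is a pair (row , label).
Letter : ℕ → ℕ → Set
Letter ℓ n = Fin ℓ × Fin n

mult : ∀ {ℓ n} {θ ρ : Signature ℓ} → SST θ ρ n → Fin ℓ → Fin n → ℕ
mult P j t = ∣ part (layer P (suc t)) j - part (layer P (inject₁ t)) j ∣

rowWord : ∀ {ℓ n} {θ ρ : Signature ℓ} → SST θ ρ n → Fin ℓ → List (Letter ℓ n)
rowWord P j = concat (List.tabulate λ t → replicate (mult P j t) (j , t))

readingWord : ∀ {ℓ n} {θ ρ : Signature ℓ} → SST θ ρ n → List (Letter ℓ n)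
readingWord P = concat (reverse (List.tabulate (rowWord P)))

-- `closing` is ")" and `opening` is "(".
data Bracket (ℓ : ℕ) : Set where
  closing opening : Fin ℓ → Bracket ℓ

bracket : ∀ {ℓ m} → Fin m → Letter ℓ (suc m) → Maybe (Bracket ℓ)
bracket i (j , t) with t Fin.≟ inject₁ i | t Fin.≟ suc i
... | yes _ | _     = just (closing j)
... | no _  | yes _ = just (opening j)
... | no _  | no _  = nothing

brackets : ∀ {ℓ m} {θ ρ : Signature ℓ} → Fin m → SST θ ρ (suc m) → List (Bracket ℓ)
brackets i P = mapMaybe (bracket i) (readingWord P)

cancel : ∀ {ℓ} → Bracket ℓ → List (Bracket ℓ) → List (Bracket ℓ)
cancel (opening _) (closing _ ∷ w) = w
cancel b           w               = b ∷ w

-- Each `cancel` deletes at most one adjacent pair "(" ")"; none survives, so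
-- the reduced word has the form ")…)(…(".
reduce : ∀ {ℓ} → List (Bracket ℓ) → List (Bracket ℓ)
reduce = foldr cancel []

leftmostOpening : ∀ {ℓ} → List (Bracket ℓ) → Maybe (Fin ℓ)
leftmostOpening []              = nothing
leftmostOpening (opening j ∷ w) = just j
leftmostOpening (closing _ ∷ w) = leftmostOpening w

rightmostClosing : ∀ {ℓ} → List (Bracket ℓ) → Maybe (Fin ℓ)
rightmostClosing []              = nothing
rightmostClosing (opening _ ∷ w) = rightmostClosing w
rightmostClosing (closing j ∷ w) = rightmostClosing w Maybe.<∣> just j

leftmostOpening-∈ : ∀ {ℓ} (w : List (Bracket ℓ)) {j} → leftmostOpening w ≡ just j → opening j ∈ w
leftmostOpening-∈ (opening j ∷ w) refl = here refl
leftmostOpening-∈ (closing _ ∷ w) eq   = there (leftmostOpening-∈ w eq)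

rightmostClosing-∈ : ∀ {ℓ} (w : List (Bracket ℓ)) {j} → rightmostClosing w ≡ just j → closing j ∈ w
rightmostClosing-∈ (opening _ ∷ w) eq = there (rightmostClosing-∈ w eq)
rightmostClosing-∈ (closing k ∷ w) eq with rightmostClosing w in eq′
rightmostClosing-∈ (closing k ∷ w) refl | just j  = there (rightmostClosing-∈ w eq′)
rightmostClosing-∈ (closing k ∷ w) refl | nothing = here refl

stack : ∀ {A : Set} {ℓ} → (Fin ℓ → List A) → List A
stack {ℓ = zero}  f = []
stack {ℓ = suc ℓ} f = stack (f ∘ suc) ++ f zero

stack-≡ : ∀ {A : Set} {ℓ} (f : Fin ℓ → List A) → concat (reverse (List.tabulate f)) ≡ stack f
stack-≡ {ℓ = zero}  f = refl
stack-≡ {ℓ = suc ℓ} f = begin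
  concat (reverse (f zero ∷ List.tabulate (f ∘ suc)))
    ≡⟨ cong concat (List.unfold-reverse (f zero) (List.tabulate (f ∘ suc))) ⟩
  concat (reverse (List.tabulate (f ∘ suc)) ++ f zero ∷ [])
    ≡⟨ List.concat-++ (reverse (List.tabulate (f ∘ suc))) (f zero ∷ []) ⟨
  concat (reverse (List.tabulate (f ∘ suc))) ++ (f zero ++ [])
    ≡⟨ cong₂ _++_ (stack-≡ (f ∘ suc)) (List.++-identityʳ (f zero)) ⟩
  stack f ∎
  where open ≡-Reasoning

stack-cong : ∀ {A : Set} {ℓ} {f g : Fin ℓ → List A} → (∀ j → f j ≡ g j) → stack f ≡ stack g
stack-cong {ℓ = zero}  eq = refl
stack-cong {ℓ = suc ℓ} eq = cong₂ _++_ (stack-cong (eq ∘ suc)) (eq zero)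

stack-mapMaybe : ∀ {A B : Set} (h : A → Maybe B) {ℓ} (f : Fin ℓ → List A) →
  mapMaybe h (stack f) ≡ stack (mapMaybe h ∘ f)
stack-mapMaybe h {zero}  f = refl
stack-mapMaybe h {suc ℓ} f = trans (List.mapMaybe-++ h (stack (f ∘ suc)) (f zero))
  (cong (_++ mapMaybe h (f zero)) (stack-mapMaybe h (f ∘ suc)))

stack-∈ : ∀ {A : Set} {ℓ} (f : Fin ℓ → List A) {x} → x ∈ stack f → ∃[ j ] x ∈ f j
stack-∈ {ℓ = suc ℓ} f x∈ with ∈.∈-++⁻ (stack (f ∘ suc)) x∈
... | inj₂ x∈f = zero , x∈f
... | inj₁ x∈s with stack-∈ (f ∘ suc) x∈s
...   | j , x∈f = suc j , x∈f

two-entries : ∀ {A : Set} {m} (i : Fin m) (f : Fin (suc m) → List A) →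
  (∀ t → t ≢ inject₁ i → t ≢ suc i → f t ≡ []) →
  concat (List.tabulate f) ≡ f (inject₁ i) ++ f (suc i)
two-entries zero f empty = cong (f zero ++_)
  (trans (cong (f (suc zero) ++_) (none (λ t → f (suc (suc t))) λ t → empty (suc (suc t)) (λ ()) (λ ())))
    (List.++-identityʳ (f (suc zero))))
  where
  none : ∀ {A : Set} {m} (f : Fin m → List A) → (∀ t → f t ≡ []) → concat (List.tabulate f) ≡ []
  none {m = zero}  f e = refl
  none {m = suc m} f e = cong₂ _++_ (e zero) (none (f ∘ suc) (e ∘ suc))
two-entries (suc i) f empty = cong₂ _++_ (empty zero (λ ()) (λ ()))
  (two-entries i (f ∘ suc) λ t t≢ t≢′ → empty (suc t) (t≢ ∘ Fin.suc-injective) (t≢′ ∘ Fin.suc-injective))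

mapMaybe-concat : ∀ {A B : Set} (h : A → Maybe B) (xss : List (List A)) →
  mapMaybe h (concat xss) ≡ concat (List.map (mapMaybe h) xss)
mapMaybe-concat h []         = refl
mapMaybe-concat h (xs ∷ xss) = trans (List.mapMaybe-++ h xs (concat xss))
  (cong (mapMaybe h xs ++_) (mapMaybe-concat h xss))

mapMaybe-just : ∀ {A B : Set} (h : A → Maybe B) {x y} k → h x ≡ just y →
  mapMaybe h (replicate k x) ≡ replicate k y
mapMaybe-just h zero    eq = refl
mapMaybe-just h {x} (suc k) eq with h x | eq
... | just _ | refl = cong (_ ∷_) (mapMaybe-just h k eq)

mapMaybe-nothing : ∀ {A B : Set} (h : A → Maybe B) {x} k → h x ≡ nothing →
  mapMaybe h (replicate k x) ≡ []
mapMaybe-nothing h zero    eq = refl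
mapMaybe-nothing h {x} (suc k) eq with h x | eq
... | nothing | refl = mapMaybe-nothing h k eq

bracket-closing : ∀ {ℓ m} (i : Fin m) (j : Fin ℓ) → bracket i (j , inject₁ i) ≡ just (closing j)
bracket-closing i j with inject₁ i Fin.≟ inject₁ i | inject₁ i Fin.≟ suc i
... | yes _ | _ = refl
... | no ne | _ = contradiction refl ne

bracket-opening : ∀ {ℓ m} (i : Fin m) (j : Fin ℓ) → bracket i (j , suc i) ≡ just (opening j)
bracket-opening i j with suc i Fin.≟ inject₁ i | suc i Fin.≟ suc i
... | yes eq | _     = contradiction (trans (cong toℕ eq) (Fin.toℕ-inject₁ i)) ℕ.1+n≢n
... | no _   | yes _ = refl
... | no _   | no ne = contradiction refl ne

bracket-other : ∀ {ℓ m} (i : Fin m) (j : Fin ℓ) t → t ≢ inject₁ i → t ≢ suc i →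
  bracket i (j , t) ≡ nothing
bracket-other i j t t≢ t≢′ with t Fin.≟ inject₁ i | t Fin.≟ suc i
... | yes eq | _      = contradiction eq t≢
... | no _   | yes eq = contradiction eq t≢′
... | no _   | no _   = refl

block : ∀ {ℓ} → Fin ℓ → ℕ → ℕ → List (Bracket ℓ)
block j a b = replicate a (closing j) ++ replicate b (opening j)

brackets-≡ : ∀ {ℓ m} {θ ρ : Signature ℓ} (i : Fin m) (P : SST θ ρ (suc m)) →
  brackets i P ≡ stack (λ j → block j (mult P j (inject₁ i)) (mult P j (suc i)))
brackets-≡ i P = trans (cong (mapMaybe (bracket i)) (stack-≡ (rowWord P)))
  (trans (stack-mapMaybe (bracket i) (rowWord P)) (stack-cong blocks))
  where
  open ≡-Reasoning
  cells : ∀ j t → List (Letter _ _)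
  cells j t = replicate (mult P j t) (j , t)
  blocks : ∀ j → mapMaybe (bracket i) (rowWord P j) ≡ block j (mult P j (inject₁ i)) (mult P j (suc i))
  blocks j = begin
    mapMaybe (bracket i) (concat (List.tabulate (cells j)))
      ≡⟨ mapMaybe-concat (bracket i) (List.tabulate (cells j)) ⟩
    concat (List.map (mapMaybe (bracket i)) (List.tabulate (cells j)))
      ≡⟨ cong concat (List.map-tabulate (cells j) (mapMaybe (bracket i))) ⟩
    concat (List.tabulate (mapMaybe (bracket i) ∘ cells j))
      ≡⟨ two-entries i (mapMaybe (bracket i) ∘ cells j) (λ t t≢ t≢′ →
           mapMaybe-nothing (bracket i) (mult P j t) (bracket-other i j t t≢ t≢′)) ⟩
    mapMaybe (bracket i) (cells j (inject₁ i)) ++ mapMaybe (bracket i) (cells j (suc i))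
      ≡⟨ cong₂ _++_
           (mapMaybe-just (bracket i) (mult P j (inject₁ i)) (bracket-closing i j))
           (mapMaybe-just (bracket i) (mult P j (suc i)) (bracket-opening i j)) ⟩
    block j (mult P j (inject₁ i)) (mult P j (suc i)) ∎

cancel-∈ : ∀ {ℓ} (b : Bracket ℓ) w {x} → x ∈ cancel b w → x ≡ b ⊎ x ∈ w
cancel-∈ (opening _) (closing _ ∷ w) x∈ = inj₂ (there x∈)
cancel-∈ (opening _) [] (here eq) = inj₁ eq
cancel-∈ (opening _) (opening _ ∷ w) (here eq) = inj₁ eq
cancel-∈ (opening _) (opening _ ∷ w) (there x∈) = inj₂ x∈
cancel-∈ (closing _) w (here eq) = inj₁ eq
cancel-∈ (closing _) w (there x∈) = inj₂ x∈

foldr-∈ : ∀ {ℓ} (w r : List (Bracket ℓ)) {x} → x ∈ foldr cancel r w → x ∈ w ⊎ x ∈ r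
foldr-∈ []      r x∈ = inj₂ x∈
foldr-∈ (b ∷ w) r x∈ with cancel-∈ b (foldr cancel r w) x∈
... | inj₁ x≡b = inj₁ (here x≡b)
... | inj₂ x∈′ with foldr-∈ w r x∈′
...   | inj₁ x∈w = inj₁ (there x∈w)
...   | inj₂ x∈r = inj₂ x∈r

replicate-∈ : ∀ {A : Set} k {x y : A} → y ∈ replicate k x → y ≡ x
replicate-∈ (suc k) (here eq)  = eq
replicate-∈ (suc k) (there y∈) = replicate-∈ k y∈

closings : ∀ {ℓ} a (j : Fin ℓ) r → foldr cancel r (replicate a (closing j)) ≡ replicate a (closing j) ++ r
closings zero    j r = refl
closings (suc a) j r = cong (closing j ∷_) (closings a j r)

block-fold : ∀ {ℓ} (j : Fin ℓ) a b r → foldr cancel r (block j a b) ≡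
  replicate a (closing j) ++ foldr cancel r (replicate b (opening j))
block-fold j a b r = trans (List.foldr-++ cancel r (replicate a (closing j)) (replicate b (opening j)))
  (closings a j _)

foldr-snoc : ∀ {ℓ} b (j : Fin ℓ) r →
  foldr cancel r (replicate (suc b) (opening j)) ≡
  foldr cancel (cancel (opening j) r) (replicate b (opening j))
foldr-snoc zero    j r = refl
foldr-snoc (suc b) j r = cong (cancel (opening j)) (foldr-snoc b j r)

absorb : ∀ {ℓ} b d (j k : Fin ℓ) r →
  foldr cancel (replicate (b ℕ.+ d) (closing k) ++ r) (replicate b (opening j)) ≡
  replicate d (closing k) ++ r
absorb zero    d j k r = refl
absorb (suc b) d j k r = trans (foldr-snoc b j (replicate (suc b ℕ.+ d) (closing k) ++ r)) (absorb b d j k r)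

exhaust : ∀ {ℓ} a d (j k : Fin ℓ) r →
  foldr cancel (replicate a (closing k) ++ r) (replicate (a ℕ.+ d) (opening j)) ≡
  foldr cancel r (replicate d (opening j))
exhaust zero    d j k r = refl
exhaust (suc a) d j k r = trans (foldr-snoc (a ℕ.+ d) j (replicate (suc a) (closing k) ++ r)) (exhaust a d j k r)

previous : ∀ {h} → ℕ → (Fin h → ℕ) → Fin h → ℕ
previous A a zero    = A
previous A a (suc k) = a (inject₁ k)

previous-suc : ∀ {h} (a : Fin (suc h) → ℕ) j → previous (a zero) (a ∘ suc) j ≡ a (inject₁ j)
previous-suc a zero    = refl
previous-suc a (suc j) = refl

module _ {ℓ : ℕ} where

  Block : ∀ {h} → (Fin h → Fin ℓ) → (a b : Fin h → ℕ) → List (Bracket ℓ)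
  Block lab a b = stack (λ j → block (lab j) (a j) (b j))

  row-of : Bracket ℓ → Fin ℓ
  row-of (closing j) = j
  row-of (opening j) = j

  block-row : ∀ j a b {x} → x ∈ block j a b → row-of x ≡ j
  block-row j a b x∈ with ∈.∈-++⁻ (replicate a (closing j)) x∈
  ... | inj₁ x∈′ = cong row-of (replicate-∈ a x∈′)
  ... | inj₂ x∈′ = cong row-of (replicate-∈ b x∈′)

  Block-row : ∀ {h} (lab : Fin h → Fin ℓ) a b {x} → x ∈ Block lab a b → ∃[ j ] row-of x ≡ lab j
  Block-row lab a b x∈ with stack-∈ (λ j → block (lab j) (a j) (b j)) x∈
  ... | j , x∈′ = j , block-row (lab j) (a j) (b j) x∈′

  Injective : ∀ {h} → (Fin h → Fin ℓ) → Set
  Injective lab = ∀ {i j} → lab i ≡ lab j → i ≡ j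

  Block-foldr : ∀ {h} (lab : Fin (suc h) → Fin ℓ) a b r →
    foldr cancel r (Block lab a b) ≡
    foldr cancel
      (replicate (a zero) (closing (lab zero)) ++ foldr cancel r (replicate (b zero) (opening (lab zero))))
      (Block (lab ∘ suc) (a ∘ suc) (b ∘ suc))
  Block-foldr lab a b r = trans
    (List.foldr-++ cancel r (Block (lab ∘ suc) (a ∘ suc) (b ∘ suc)) _)
    (cong (λ s → foldr cancel s (Block (lab ∘ suc) (a ∘ suc) (b ∘ suc)))
      (block-fold (lab zero) (a zero) (b zero) r))

  below-∈ : ∀ {h} (lab : Fin (suc h) → Fin ℓ) → Injective lab → ∀ a b r {x} → row-of x ≡ lab zero →
    x ∈ foldr cancel r (Block (lab ∘ suc) a b) → x ∈ r
  below-∈ lab inj a b r {x} x≡ x∈ = go (foldr-∈ (Block (lab ∘ suc) a b) r x∈)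
    where
    go : x ∈ Block (lab ∘ suc) a b ⊎ x ∈ r → x ∈ r
    go (inj₂ x∈r) = x∈r
    go (inj₁ x∈W) = contradiction
      (inj (trans (sym x≡) (proj₂ (Block-row (lab ∘ suc) a b x∈W)))) λ ()

  open-survives : ∀ {h} (lab : Fin h → Fin ℓ) → Injective lab → ∀ a b A k r →
    (∀ j → opening (lab j) ∉ r) → ∀ j →
    opening (lab j) ∈ foldr cancel (replicate A (closing k) ++ r) (Block lab a b) →
    previous A a j ℕ.< b j
  open-survives lab inj a b A k r r∌ zero x∈ = ℕ.≰⇒> λ b≤A →
    r∌ zero (gone b≤A (∈.∈-++⁻ (replicate (a zero) (closing (lab zero)))
      (below-∈ lab inj (a ∘ suc) (b ∘ suc) _ refl
        (subst (opening (lab zero) ∈_) (Block-foldr lab a b (replicate A (closing k) ++ r)) x∈))))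
    where
    not-closing : ∀ c {j k : Fin ℓ} → opening j ∉ replicate c (closing k)
    not-closing c x∈ = contradiction (replicate-∈ c x∈) λ ()
    gone : b zero ℕ.≤ A →
      (opening (lab zero) ∈ replicate (a zero) (closing (lab zero))) ⊎
      (opening (lab zero) ∈ foldr cancel (replicate A (closing k) ++ r) (replicate (b zero) (opening (lab zero)))) →
      opening (lab zero) ∈ r
    gone b≤A (inj₁ y∈) = contradiction y∈ (not-closing (a zero))
    gone b≤A (inj₂ y∈) with ∈.∈-++⁻ (replicate (A ∸ b zero) (closing k))
      (subst (opening (lab zero) ∈_) (absorb (b zero) (A ∸ b zero) (lab zero) k r)
        (subst (λ A → opening (lab zero) ∈
            foldr cancel (replicate A (closing k) ++ r) (replicate (b zero) (opening (lab zero))))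
          (sym (ℕ.m+[n∸m]≡n b≤A)) y∈))
    ... | inj₁ z∈ = contradiction z∈ (not-closing (A ∸ b zero))
    ... | inj₂ z∈ = z∈
  open-survives lab inj a b A k r r∌ (suc j) x∈ = subst (ℕ._< b (suc j)) (previous-suc a j)
    (open-survives (lab ∘ suc) (Fin.suc-injective ∘ inj) (a ∘ suc) (b ∘ suc) (a zero) (lab zero)
      (foldr cancel (replicate A (closing k) ++ r) (replicate (b zero) (opening (lab zero)))) r′∌ j
      (subst (opening (lab (suc j)) ∈_) (Block-foldr lab a b (replicate A (closing k) ++ r)) x∈))
    where
    r′∌ : ∀ j → opening (lab (suc j)) ∉
      foldr cancel (replicate A (closing k) ++ r) (replicate (b zero) (opening (lab zero)))
    r′∌ j y∈ with foldr-∈ (replicate (b zero) (opening (lab zero))) (replicate A (closing k) ++ r) y∈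
    ... | inj₁ y∈′ = contradiction (inj (cong row-of (replicate-∈ (b zero) y∈′))) λ ()
    ... | inj₂ y∈′ with ∈.∈-++⁻ (replicate A (closing k)) y∈′
    ...   | inj₁ z∈ = contradiction (replicate-∈ A z∈) λ ()
    ...   | inj₂ z∈ = r∌ (suc j) z∈

  close-survives : ∀ {h} (lab : Fin h → Fin ℓ) → Injective lab → ∀ a b r →
    (∀ j → closing (lab j) ∉ r) → ∀ j →
    closing (lab j) ∈ foldr cancel r (Block lab a b) →
    0 ℕ.< a j × (∀ k → toℕ k ≡ suc (toℕ j) → b k ℕ.< a j)
  close-survives {suc h} lab inj a b r r∌ (suc j) x∈ =
    proj₁ ih , λ { (suc k) eq → proj₂ ih k (ℕ.suc-injective eq) }
    where
    s : List (Bracket ℓ)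
    s = replicate (a zero) (closing (lab zero)) ++ foldr cancel r (replicate (b zero) (opening (lab zero)))
    s∌ : ∀ j → closing (lab (suc j)) ∉ s
    s∌ j y∈ with ∈.∈-++⁻ (replicate (a zero) (closing (lab zero))) y∈
    ... | inj₁ z∈ = contradiction (inj (cong row-of (replicate-∈ (a zero) z∈))) λ ()
    ... | inj₂ z∈ with foldr-∈ (replicate (b zero) (opening (lab zero))) r z∈
    ...   | inj₁ u∈ = contradiction (replicate-∈ (b zero) u∈) λ ()
    ...   | inj₂ u∈ = r∌ (suc j) u∈
    ih : 0 ℕ.< a (suc j) × (∀ k → toℕ k ≡ suc (toℕ j) → b (suc k) ℕ.< a (suc j))
    ih = close-survives (lab ∘ suc) (Fin.suc-injective ∘ inj) (a ∘ suc) (b ∘ suc) s s∌ j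
      (subst (closing (lab (suc j)) ∈_) (Block-foldr lab a b r) x∈)
  close-survives {suc h} lab inj a b r r∌ zero x∈ = positive (a zero) refl , next h lab inj a b r∌ x∈
    where
    upper : ∀ {h} (lab : Fin (suc h) → Fin ℓ) → (a b : Fin (suc h) → ℕ) → List (Bracket ℓ)
    upper lab a b = foldr cancel r (replicate (b zero) (opening (lab zero)))
    upper∌ : ∀ {h} (lab : Fin (suc h) → Fin ℓ) → ∀ a b → (∀ j → closing (lab j) ∉ r) →
      closing (lab zero) ∉ upper lab a b
    upper∌ lab a b r∌ y∈ with foldr-∈ (replicate (b zero) (opening (lab zero))) r y∈
    ... | inj₁ z∈ = contradiction (replicate-∈ (b zero) z∈) λ ()
    ... | inj₂ z∈ = r∌ zero z∈
    positive : ∀ c → a zero ≡ c → 0 ℕ.< c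
    positive (suc c) _ = s≤s z≤n
    positive zero eq = ⊥-elim (upper∌ lab a b r∌
      (subst (λ c → closing (lab zero) ∈ replicate c (closing (lab zero)) ++ upper lab a b) eq
        (below-∈ lab inj (a ∘ suc) (b ∘ suc) _ refl
          (subst (closing (lab zero) ∈_) (Block-foldr lab a b r) x∈))))
    next : ∀ h (lab : Fin (suc h) → Fin ℓ) → Injective lab → ∀ a b → (∀ j → closing (lab j) ∉ r) →
      closing (lab zero) ∈ foldr cancel r (Block lab a b) →
      ∀ k → toℕ k ≡ suc zero → b k ℕ.< a zero
    next (suc h) lab inj a b r∌ x∈ (suc zero) _ = ℕ.≰⇒> λ a≤b →
      contradiction-at a≤b (∈.∈-++⁻ (replicate (a (suc zero)) (closing (lab (suc zero))))
        (below-∈ lab₂ inj₂′ (λ k → a (suc (suc k))) (λ k → b (suc (suc k))) _ refl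
          (subst (closing (lab zero) ∈_) (trans (Block-foldr lab a b r)
            (Block-foldr (lab ∘ suc) (a ∘ suc) (b ∘ suc) _)) x∈)))
      where
      -- Rows 0, 2, 3, …
      skip : Fin (suc h) → Fin (suc (suc h))
      skip zero    = zero
      skip (suc k) = suc (suc k)
      lab₂ : Fin (suc h) → Fin ℓ
      lab₂ = lab ∘ skip
      inj₂′ : Injective lab₂
      inj₂′ {zero}  {zero}  eq = refl
      inj₂′ {zero}  {suc _} eq = contradiction (inj eq) λ ()
      inj₂′ {suc _} {zero}  eq = contradiction (inj eq) λ ()
      inj₂′ {suc _} {suc _} eq = Fin.suc-injective (inj eq)
      contradiction-at : a zero ℕ.≤ b (suc zero) →
        (closing (lab zero) ∈ replicate (a (suc zero)) (closing (lab (suc zero)))) ⊎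
        (closing (lab zero) ∈ foldr cancel (replicate (a zero) (closing (lab zero)) ++ upper lab a b)
          (replicate (b (suc zero)) (opening (lab (suc zero))))) → _
      contradiction-at a≤b (inj₁ y∈) =
        contradiction (inj (cong row-of (replicate-∈ (a (suc zero)) y∈))) λ ()
      contradiction-at a≤b (inj₂ y∈) with foldr-∈ (replicate (b (suc zero) ∸ a zero) (opening (lab (suc zero))))
        (upper lab a b)
        (subst (closing (lab zero) ∈_)
          (exhaust (a zero) (b (suc zero) ∸ a zero) (lab (suc zero)) (lab zero) (upper lab a b))
          (subst (λ c → closing (lab zero) ∈
              foldr cancel (replicate (a zero) (closing (lab zero)) ++ upper lab a b)
                (replicate c (opening (lab (suc zero)))))
            (sym (ℕ.m+[n∸m]≡n a≤b)) y∈))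
      ... | inj₁ z∈ = contradiction (replicate-∈ (b (suc zero) ∸ a zero) z∈) λ ()
      ... | inj₂ z∈ = upper∌ lab a b r∌ z∈

previous-≡ : ∀ {h} (a : Fin h → ℕ) j k → toℕ j ≡ suc (toℕ k) → a k ≡ previous 0 a j
previous-≡ a (suc j) k eq = cong a (Fin.toℕ-injective
  (trans (sym (ℕ.suc-injective eq)) (sym (Fin.toℕ-inject₁ j))))

from-adjacent : ∀ {ℓ} (α v : Vec ℤ ℓ) → (∀ j → lookup α j ℤ.≤ lookup v j) →
  (∀ j k → toℕ k ≡ suc (toℕ j) → lookup v k ℤ.≤ lookup α j) →
  ∀ i j → i Fin.≤ j → lookup v j ℤ.≤ lookup v i
from-adjacent (_ ∷ α) (_ ∷ v) lo up zero zero _ = ℤ.≤-refl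
from-adjacent (_ ∷ α@(_ ∷ _)) (_ ∷ v) lo up zero (suc j) _ = ℤ.≤-trans
  (from-adjacent α v (lo ∘ suc) (λ j k eq → up (suc j) (suc k) (cong suc eq)) zero j z≤n)
  (ℤ.≤-trans (up zero (suc zero) refl) (lo zero))
from-adjacent (_ ∷ α) (_ ∷ v) lo up (suc i) (suc j) (s≤s i≤j) =
  from-adjacent α v (lo ∘ suc) (λ j k eq → up (suc j) (suc k) (cong suc eq)) i j i≤j

module Move {ℓ m : ℕ} {θ ρ : Signature ℓ} (P : SST θ ρ (suc m)) (i : Fin m) where

  α β γ : Signature ℓ
  α = layer P (inject₁ (inject₁ i))
  β = layer P (suc (inject₁ i))
  γ = layer P (suc (suc i))

  α⪯β : α ⪯ β
  α⪯β = strip P (inject₁ i)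

  β⪯γ : β ⪯ γ
  β⪯γ = strip P (suc i)

  setLayer : (σ : Signature ℓ) → .(α ⪯ σ) → .(σ ⪯ γ) → SST θ ρ (suc m)
  setLayer σ α⪯σ σ⪯γ = tableau c
    (trans (Vec.lookup∘update′ {i = zero} (λ ()) (chain P) σ) (inner≡ P))
    (trans (Vec.lookup∘update′ fromℕ≢ (chain P) σ) (outer≡ P))
    strips
    where
    at : Fin (suc (suc m))
    at = suc (inject₁ i)
    c : Vec (Signature ℓ) (suc (suc m))
    c = chain P [ at ]≔ σ
    fromℕ≢ : fromℕ (suc m) ≢ at
    fromℕ≢ eq = Fin.fromℕ≢inject₁ (Fin.suc-injective eq)
    strips : ∀ t → lookup c (inject₁ t) ⪯ lookup c (suc t)
    strips t with t Fin.≟ inject₁ i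
    ... | yes refl = subst₂ _⪯_
      (sym (Vec.lookup∘update′ (λ eq → ℕ.1+n≢n (sym (trans (sym (Fin.toℕ-inject₁ (inject₁ i))) (cong toℕ eq)))) (chain P) σ))
      (sym (Vec.lookup∘update at (chain P) σ)) (⪯-irr α⪯σ)
    ... | no t≢ with t Fin.≟ suc i
    ...   | yes refl = subst₂ _⪯_
      (sym (Vec.lookup∘update at (chain P) σ))
      (sym (Vec.lookup∘update′ (λ eq → ℕ.1+n≢n (trans (cong toℕ (Fin.suc-injective eq)) (Fin.toℕ-inject₁ i))) (chain P) σ)) (⪯-irr σ⪯γ)
    ...   | no t≢′ = subst₂ _⪯_
      (sym (Vec.lookup∘update′ (t≢′ ∘ Fin.inject₁-injective) (chain P) σ))
      (sym (Vec.lookup∘update′ (t≢ ∘ Fin.suc-injective) (chain P) σ)) (strip P t)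

  setRow : (v : Vec ℤ ℓ) →
    .(∀ k → part α k ℤ.≤ lookup v k) →
    .(∀ k l → toℕ l ≡ suc (toℕ k) → lookup v l ℤ.≤ part α k) →
    .(∀ k → lookup v k ℤ.≤ part γ k) →
    .(∀ k l → toℕ l ≡ suc (toℕ k) → part γ l ℤ.≤ lookup v k) →
    SST θ ρ (suc m)
  setRow v lo lo′ hi hi′ = setLayer (signature v (from-adjacent (parts α) v lo lo′))
    (interlace lo lo′) (interlace hi hi′)

  at-or-not : ∀ {R : ℤ → Set} (v : Vec ℤ ℓ) j (g : ℤ → ℤ) k →
    (k ≡ j → R (g (lookup v j))) → (k ≢ j → R (lookup v k)) → R (lookup (Vec.updateAt v j g) k)
  at-or-not {R} v j g k y n with k Fin.≟ j
  ... | yes refl = subst R (sym (Vec.lookup∘updateAt k v)) (y refl)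
  ... | no  k≢j  = subst R (sym (Vec.lookup∘updateAt′ k j k≢j v)) (n k≢j)

  -- The cells of row j labelled i + 1 are those in columns λ⁽ⁱ⁾ⱼ < k ≤ λ⁽ⁱ⁺¹⁾ⱼ,
  -- so relabelling the first of them by i raises λ⁽ⁱ⁾ⱼ by one; relabelling
  -- the last i by i + 1 lowers it.  Within row j, whose brackets are )…)(…(,
  -- the leftmost uncancelled "(" is the first i + 1, and the rightmost
  -- uncancelled ")" is the last i.

  raise : (j : Fin ℓ) → .(part β j + 1ℤ ℤ.≤ part γ j) →
    .(∀ k → toℕ j ≡ suc (toℕ k) → part β j + 1ℤ ℤ.≤ part α k) → SST θ ρ (suc m)
  raise j A B = setRow (Vec.updateAt (parts β) j (_+ 1ℤ))
    (λ k → at-or-not {λ z → part α k ℤ.≤ z} (parts β) j (_+ 1ℤ) k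
      (λ { refl → ℤ.≤-trans (_⪯_.below α⪯β k) (ℤ.i≤i+j _ 1ℤ) })
      (λ _ → _⪯_.below α⪯β k))
    (λ k l eq → at-or-not {λ z → z ℤ.≤ part α k} (parts β) j (_+ 1ℤ) l
      (λ { refl → B k eq })
      (λ _ → _⪯_.above α⪯β k l eq))
    (λ k → at-or-not {λ z → z ℤ.≤ part γ k} (parts β) j (_+ 1ℤ) k
      (λ { refl → A })
      (λ _ → _⪯_.below β⪯γ k))
    (λ k l eq → at-or-not {λ z → part γ l ℤ.≤ z} (parts β) j (_+ 1ℤ) k
      (λ { refl → ℤ.≤-trans (_⪯_.above β⪯γ k l eq) (ℤ.i≤i+j _ 1ℤ) })
      (λ _ → _⪯_.above β⪯γ k l eq))

  lower : (j : Fin ℓ) → .(part α j ℤ.≤ part β j - 1ℤ) →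
    .(∀ k → toℕ k ≡ suc (toℕ j) → part γ k ℤ.≤ part β j - 1ℤ) → SST θ ρ (suc m)
  lower j A B = setRow (Vec.updateAt (parts β) j (_- 1ℤ))
    (λ k → at-or-not {λ z → part α k ℤ.≤ z} (parts β) j (_- 1ℤ) k
      (λ { refl → A })
      (λ _ → _⪯_.below α⪯β k))
    (λ k l eq → at-or-not {λ z → z ℤ.≤ part α k} (parts β) j (_- 1ℤ) l
      (λ { refl → ℤ.≤-trans (ℤ.i-j≤i _ 1ℤ) (_⪯_.above α⪯β k l eq) })
      (λ _ → _⪯_.above α⪯β k l eq))
    (λ k → at-or-not {λ z → z ℤ.≤ part γ k} (parts β) j (_- 1ℤ) k
      (λ { refl → ℤ.≤-trans (ℤ.i-j≤i _ 1ℤ) (_⪯_.below β⪯γ k) })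
      (λ _ → _⪯_.below β⪯γ k))
    (λ k l eq → at-or-not {λ z → part γ l ℤ.≤ z} (parts β) j (_- 1ℤ) k
      (λ { refl → B l eq })
      (λ _ → _⪯_.above β⪯γ k l eq))

  a b : Fin ℓ → ℕ
  a j = mult P j (inject₁ i)
  b j = mult P j (suc i)

  a≡ : ∀ j → + a j ≡ part β j - part α j
  a≡ j = ℤ.0≤i⇒+∣i∣≡i (ℤ.i≤j⇒0≤j-i (_⪯_.below α⪯β j))

  b≡ : ∀ j → + b j ≡ part γ j - part β j
  b≡ j = ℤ.0≤i⇒+∣i∣≡i (ℤ.i≤j⇒0≤j-i (_⪯_.below β⪯γ j))

  <⇒+1≤ : ∀ {x y} → x ℤ.< y → x + 1ℤ ℤ.≤ y
  <⇒+1≤ {x} {y} x<y = subst (ℤ._≤ y) (ℤ.+-comm 1ℤ x) (ℤ.i<j⇒suc[i]≤j x<y)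

  <⇒≤-1 : ∀ {x y} → x ℤ.< y → x ℤ.≤ y - 1ℤ
  <⇒≤-1 {x} {y} x<y = subst (x ℤ.≤_) (ℤ.+-comm (- 1ℤ) y) (ℤ.i<j⇒i≤pred[j] x<y)

  minus-mono : ∀ {x y z w} → x ℤ.≤ y → z ℤ.≤ w → x - w ℤ.≤ y - z
  minus-mono p q = ℤ.+-mono-≤ p (ℤ.neg-mono-≤ q)

  open-cond : ∀ j → opening j ∈ reduce (brackets i P) → previous 0 a j ℕ.< b j
  open-cond j j∈ = open-survives id id a b 0 j [] (λ _ ()) j
    (subst (λ w → opening j ∈ reduce w) (brackets-≡ i P) j∈)

  close-cond : ∀ j → closing j ∈ reduce (brackets i P) →
    0 ℕ.< a j × (∀ k → toℕ k ≡ suc (toℕ j) → b k ℕ.< a j)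
  close-cond j j∈ = close-survives id id a b [] (λ _ ()) j
    (subst (λ w → closing j ∈ reduce w) (brackets-≡ i P) j∈)

  raiseA : ∀ j → opening j ∈ reduce (brackets i P) → part β j + 1ℤ ℤ.≤ part γ j
  raiseA j j∈ = <⇒+1≤ {part β j} {part γ j} (ℤ.≰⇒> λ γ≤β → ℕ.<⇒≱ (ℕ.≤-<-trans (z≤n {previous 0 a j}) (open-cond j j∈))
    (ℤ.drop‿+≤+ (subst (ℤ._≤ 0ℤ) (sym (b≡ j)) (ℤ.i≤j⇒i-j≤0 γ≤β))))

  raiseB : ∀ j → opening j ∈ reduce (brackets i P) →
    ∀ k → toℕ j ≡ suc (toℕ k) → part β j + 1ℤ ℤ.≤ part α k
  raiseB j j∈ k eq = <⇒+1≤ {part β j} {part α k} (ℤ.≰⇒> λ α≤β → ℕ.<⇒≱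
    (subst (ℕ._< b j) (sym (previous-≡ a j k eq)) (open-cond j j∈))
    (ℤ.drop‿+≤+ (subst₂ ℤ._≤_ (sym (b≡ j)) (sym (a≡ k))
      (minus-mono (_⪯_.above β⪯γ k j eq) α≤β))))

  lowerA : ∀ j → closing j ∈ reduce (brackets i P) → part α j ℤ.≤ part β j - 1ℤ
  lowerA j j∈ = <⇒≤-1 {part α j} {part β j} (ℤ.≰⇒> λ β≤α → ℕ.<⇒≱ (proj₁ (close-cond j j∈))
    (ℤ.drop‿+≤+ (subst (ℤ._≤ 0ℤ) (sym (a≡ j)) (ℤ.i≤j⇒i-j≤0 β≤α))))

  lowerB : ∀ j → closing j ∈ reduce (brackets i P) →
    ∀ k → toℕ k ≡ suc (toℕ j) → part γ k ℤ.≤ part β j - 1ℤ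
  lowerB j j∈ k eq = <⇒≤-1 {part γ k} {part β j} (ℤ.≰⇒> λ β≤γ → ℕ.<⇒≱ (proj₂ (close-cond j j∈) k eq)
    (ℤ.drop‿+≤+ (subst₂ ℤ._≤_ (sym (a≡ j)) (sym (b≡ k))
      (minus-mono β≤γ (_⪯_.above α⪯β j k eq)))))

  e-at : (r : Maybe (Fin ℓ)) → .(leftmostOpening (reduce (brackets i P)) ≡ r) → Maybe (SST θ ρ (suc m))
  e-at nothing  _  = nothing
  e-at (just j) eq = just (raise j (raiseA j (leftmostOpening-∈ _ eq)) (raiseB j (leftmostOpening-∈ _ eq)))

  f-at : (r : Maybe (Fin ℓ)) → .(rightmostClosing (reduce (brackets i P)) ≡ r) → Maybe (SST θ ρ (suc m))
  f-at nothing  _  = nothing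
  f-at (just j) eq = just (lower j (lowerA j (rightmostClosing-∈ _ eq)) (lowerB j (rightmostClosing-∈ _ eq)))

e f : ∀ {ℓ m} {θ ρ : Signature ℓ} → SST θ ρ (suc m) → Fin m → Maybe (SST θ ρ (suc m))
e P i = Move.e-at P i (leftmostOpening (reduce (brackets i P))) refl
f P i = Move.f-at P i (rightmostClosing (reduce (brackets i P))) refl

data Kind : Set where
  E F : Kind

kashiwara : ∀ {ℓ m} {θ ρ : Signature ℓ} → Kind → Fin m → SST θ ρ (suc m) → Maybe (SST θ ρ (suc m))
kashiwara E i P = e P i
kashiwara F i P = f P i

wt : ∀ {ℓ n} {θ ρ : Signature ℓ} → SST θ ρ n → Fin n → ℤ
wt P t = + length (filter (λ letter → proj₂ letter Fin.≟ t) (readingWord P))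

-- `nothing` plays the role of 𝟎.  For n = suc m, i : Fin n stands for the
-- index i ∈ {0, …, n - 1}; `K₁ E i` is E⁽¹⁾ᵢ, `K₂ F i` is F⁽²⁾ᵢ, and so on.

on₁ on₂ : ∀ {m} → Kind → Fin m → Pair (suc m) → Maybe (Pair (suc m))
on₁ k i (pair P Q) = Maybe.map (λ P′ → pair P′ Q) (kashiwara k i P)
on₂ k i (pair P Q) = Maybe.map (λ Q′ → pair P Q′) (kashiwara k i Q)

K₁ K₂ : ∀ {m} → Kind → Fin (2 ℕ.+ m) → Pair (2 ℕ.+ m) → Maybe (Pair (2 ℕ.+ m))
K₁ k zero    b = Maybe.map ι₁ (on₁ k zero (ι₁⁻¹ b))
K₁ k (suc i) b = on₁ k i b
K₂ k zero    b = Maybe.map ι₂ (on₂ k zero (ι₂⁻¹ b))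
K₂ k (suc i) b = on₂ k i b

wt₁ wt₂ : ∀ {n} → Pair n → Fin n → ℤ
wt₁ b = wt (Pair.P b)
wt₂ b = wt (Pair.Q b)

power : {B : Set} → (B → Maybe B) → ℕ → B → Maybe B
power g zero    b = just b
power g (suc k) b = power g k b >>= g

IsMax : (ℕ → Set) → ℕ → Set
IsMax S m = S m × (∀ k → S k → k ℕ.≤ m)

-- φ or ε of b, for g = Fᵢ or Eᵢ
IsStringLength : {B : Set} → (B → Maybe B) → B → ℕ → Set
IsStringLength g b = IsMax (λ k → power g k b ≢ nothing)

-- With coordinates indexed by Fin n, the standard basis vector εᵢ₊₁ of ℤⁿ is
-- `basis i`, and εᵢ is `basis (cyclicPred i)`, the convention ε₀ = εₙ included.
cyclicPred : ∀ {n} → Fin n → Fin n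
cyclicPred {suc m} zero    = fromℕ m
cyclicPred {suc m} (suc i) = inject₁ i

basis : ∀ {n} → Fin n → Fin n → ℤ
basis i t with i Fin.≟ t
... | yes _ = 1ℤ
... | no _  = 0ℤ

⟨_,_⟩ : ∀ {n} → (Fin n → ℤ) → (Fin n → ℤ) → ℤ
⟨ u , v ⟩ = foldr _+_ 0ℤ (List.tabulate λ t → u t * v t)

record IsCrystal {B : Set} {n : ℕ} (weight : B → Fin n → ℤ) (K : Kind → Fin n → B → Maybe B) : Set where
  field
    F⇔E     : ∀ i b b′ → K F i b ≡ just b′ ⇔ K E i b′ ≡ just b
    F-weight : ∀ i b b′ → K F i b ≡ just b′ → ∀ t →
      weight b′ t ≡ weight b t - basis (cyclicPred i) t + basis i t
    strings  : ∀ i b → ∃[ φ ] ∃[ ε ]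
      IsStringLength (K F i) b φ ×
      IsStringLength (K E i) b ε ×
      + φ - + ε ≡ ⟨ (λ t → basis (cyclicPred i) t - basis i t) , weight b ⟩

{-# OPTIONS --safe #-}
module Submission where

-- Read by columns, e and f change the middle term of α ⪯ β ⪯ γ by turning one bracket
-- of a bracket word indexed by ℤ, at the minimum of a height function h.  Across two
-- squares of the local rule with sides α ⪯ β ⪯ γ and α* ⪯ β* ⪯ γ*, h changes by the
-- difference of the two carries; running the rule before and after the operator, the
-- carries differ only in an interval, which shows that the operator takes effect on β*
-- as well and leaves γ* alone.  Hence on Fomin fields the operators of the first family
-- with index i act on the whole column x ≡ i mod n and fix all other columns, and those
-- of the second family act likewise on rows.  A column operator can be computed on a row
-- that a given row operator fixes, and conversely; a field is determined by one row and
-- one column, so the two commute.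

open import Defs
open import Data.Fin as Fin using (Fin; zero; suc; toℕ; inject₁)
import Data.Fin.Properties as Fin
open import Data.Integer as ℤ using (ℤ; +_; 0ℤ; 1ℤ; _-_; -_; _⊔_; _⊓_; ∣_∣)
open import Data.Integer.Divisibility.Signed as ∣ using (_∣_; divides; _∣?_)
import Data.Integer.Properties as ℤ
open import Data.Integer.Tactic.RingSolver using (solve-∀)
open import Data.List as List using (List; []; _∷_; _++_; replicate; foldr; length; head; last; drop; filter; concat)
import Data.List.Properties as List
open import Data.Maybe as Maybe using (Maybe; just; nothing; _>>=_)
import Data.Maybe.Properties as Maybe
open import Data.Nat as ℕ using (ℕ; zero; suc; _∸_; z≤n; s≤s; _+_)
import Data.Nat.Divisibility as ℕ∣
import Data.Nat.Properties as ℕ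
open import Data.Product using (∃; ∃-syntax; _×_; _,_; proj₁; proj₂)
open import Data.Sum using (_⊎_; inj₁; inj₂)
open import Data.Vec as Vec using (Vec; []; _∷_; lookup; count; _[_]≔_)
import Data.Vec.Properties as Vec
open import Function using (_∘_; id; mk⇔; Equivalence)
open import Relation.Binary.Definitions using (tri<; tri≈; tri>)
open import Relation.Binary.PropositionalEquality using (_≡_; _≢_; refl; sym; trans; cong; cong₂; subst; subst₂; module ≡-Reasoning)
open import Relation.Nullary using (¬_; Dec; yes; no; contradiction)
import Relation.Nullary.Decidable as Dec

-- The obstacle is that bracket matching is global while the local rule runs column by column, so no
-- single square shows what the operator does. Two queue invariants bridge this. Write c₁, c₂ for
-- the carries of the two squares, H for the height above its minimum, h* for the transported
-- height. Then h* = h + c₁ - c₂, and the second queue never exceeds H, so it is empty at the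
-- minimum where the operator acts. From there on the modified run has one more cell waiting in the
-- first queue and one fewer in the second, and c₂ = H exactly. The runs merge in the first column,
-- from the lift on, where the first queue of the original run is idle: the extra cell is then
-- passed on and makes good the deficit. Just before that column c₁ = 0 and c₂ = H, so h* is back at
-- the minimum of h; afterwards c₂ < H keeps h* strictly above it. This locates the operator on the
-- next level. The index 0 is not special on the cylinder: conjugation by `ι₁` or `ι₂` only moves
-- the window of n + 1 positions from which tableaux are read. The assumption n ≥ 2 ensures that two
-- neighbouring columns are never changed at once.

private variable
  ℓ rows : ℕ

-- Linear arithmetic: an equation or inequality follows from the hypotheses
-- once the difference of its sides is a combination of theirs, which the ring
-- solver checks.

diff-≡ : ∀ {x y} → x ≡ y → x - y ≡ 0ℤ
diff-≡ {x} refl = ℤ.+-inverseʳ x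

by-≡ : ∀ {x y d} → x - y ≡ d → d ≡ 0ℤ → x ≡ y
by-≡ {x} {y} e e′ = ℤ.i-j≡0⇒i≡j x y (trans e e′)

by-≤ : ∀ {x y d} → y - x ≡ d → 0ℤ ℤ.≤ d → x ℤ.≤ y
by-≤ e p = ℤ.0≤i-j⇒j≤i (subst (0ℤ ℤ.≤_) (sym e) p)

≥0 : ∀ {x y} → x ℤ.≤ y → 0ℤ ℤ.≤ y - x
≥0 = ℤ.i≤j⇒0≤j-i

infixl 6 _⟨+⟩_ _⟨-⟩_

_⟨+⟩_ : ∀ {x y} → 0ℤ ℤ.≤ x → 0ℤ ℤ.≤ y → 0ℤ ℤ.≤ x ℤ.+ y
_⟨+⟩_ = ℤ.+-mono-≤

≡0⇒≥0 : ∀ {x} → x ≡ 0ℤ → 0ℤ ℤ.≤ x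
≡0⇒≥0 refl = ℤ.≤-refl

_⟨-⟩_ : ∀ {x y} → x ≡ 0ℤ → y ≡ 0ℤ → x - y ≡ 0ℤ
refl ⟨-⟩ refl = refl

<⇒≤-1 : ∀ {x y} → x ℤ.< y → x ℤ.≤ y - 1ℤ
<⇒≤-1 {x} {y} x<y = subst (x ℤ.≤_) (ℤ.+-comm (- 1ℤ) y) (ℤ.i<j⇒i≤pred[j] x<y)

<⇒+1≤ : ∀ {x y} → x ℤ.< y → x ℤ.+ 1ℤ ℤ.≤ y
<⇒+1≤ {x} {y} x<y = subst (ℤ._≤ y) (ℤ.+-comm 1ℤ x) (ℤ.i<j⇒suc[i]≤j x<y)

+1≤⇒< : ∀ {x y} → x ℤ.+ 1ℤ ℤ.≤ y → x ℤ.< y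
+1≤⇒< {x} {y} le = ℤ.suc[i]≤j⇒i<j (subst (ℤ._≤ y) (ℤ.+-comm x 1ℤ) le)

≤-1⇒< : ∀ {x y} → x ℤ.≤ y - 1ℤ → x ℤ.< y
≤-1⇒< {x} {y} le = ℤ.≤-<-trans le (subst (y - 1ℤ ℤ.<_) (ℤ.+-identityʳ y) (ℤ.+-monoʳ-< y ℤ.-<+))

x-1<x : ∀ x → x - 1ℤ ℤ.< x
x-1<x x = ≤-1⇒< ℤ.≤-refl

x<x+1 : ∀ x → x ℤ.< x ℤ.+ 1ℤ
x<x+1 x = +1≤⇒< ℤ.≤-refl

x+1-1 : ∀ x → x ℤ.+ 1ℤ - 1ℤ ≡ x
x+1-1 = solve-∀

x-1+1 : ∀ x → x - 1ℤ ℤ.+ 1ℤ ≡ x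
x-1+1 = solve-∀

≤-offset : ∀ {x y} → x ℤ.≤ y → ∃[ k ] y ≡ x ℤ.+ + k
≤-offset {x} {y} x≤y = ∣ y - x ∣ , trans (lemma x y)
    (cong (λ t → x ℤ.+ t) (sym (ℤ.0≤i⇒+∣i∣≡i (ℤ.i≤j⇒0≤j-i x≤y))))
  where
  lemma : ∀ x y → y ≡ x ℤ.+ (y - x)
  lemma = solve-∀

≤-rec : (P : ℤ → Set) → ∀ N → P N → (∀ x → N ℤ.< x → P (x - 1ℤ) → P x) → ∀ {x} → N ℤ.≤ x → P x
≤-rec P N base step N≤x with ≤-offset N≤x
... | k , refl = go k
  where
  go : ∀ k → P (N ℤ.+ + k)
  go zero    = subst P (sym (ℤ.+-identityʳ N)) base
  go (suc k) = step (N ℤ.+ + suc k)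
    (ℤ.≤-<-trans (ℤ.≤-reflexive (sym (ℤ.+-identityʳ N))) (ℤ.+-monoʳ-< N (ℤ.+<+ (s≤s z≤n))))
    (subst P (sym (lemma N (+ k))) (go k))
    where
    lemma : ∀ N k → N ℤ.+ (1ℤ ℤ.+ k) - 1ℤ ≡ N ℤ.+ k
    lemma = solve-∀

ℤ-rec : (P : ℤ → Set) → ∀ N → (∀ x → x ℤ.≤ N → P x) → (∀ x → P (x - 1ℤ) → P x) → ∀ x → P x
ℤ-rec P N base step x with x ℤ.≤? N
... | yes x≤N = base x x≤N
... | no  x≰N = ≤-rec P N (base N ℤ.≤-refl) (λ x _ → step x) (ℤ.<⇒≤ (ℤ.≰⇒> x≰N))

-- ψ μ x = Σⱼ min(μⱼ , x) is the sum of μ′ over the columns up to x, normalised so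
-- that it is finite.

sumMin : Vec ℤ ℓ → ℤ → ℤ
sumMin []      x = 0ℤ
sumMin (p ∷ v) x = (p ⊓ x) ℤ.+ sumMin v x

total : Vec ℤ ℓ → ℤ
total []      = 0ℤ
total (p ∷ v) = p ℤ.+ total v

ψ : Signature ℓ → ℤ → ℤ
ψ μ = sumMin (parts μ)

size : Signature ℓ → ℤ
size μ = total (parts μ)

sumMin-step : ∀ (v : Vec ℤ ℓ) x → sumMin v x ≡ sumMin v (x - 1ℤ) ℤ.+ + count (x ℤ.≤?_) v
sumMin-step []      x = refl
sumMin-step (p ∷ v) x with x ℤ.≤? p
... | yes x≤p = trans
  (cong₂ ℤ._+_ (ℤ.i≥j⇒i⊓j≡j x≤p) (sumMin-step v x))
  (trans (lemma x (sumMin v (x - 1ℤ)) (+ count (x ℤ.≤?_) v))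
    (cong (λ t → t ℤ.+ sumMin v (x - 1ℤ) ℤ.+ (1ℤ ℤ.+ + count (x ℤ.≤?_) v))
      (sym (ℤ.i≥j⇒i⊓j≡j (ℤ.≤-trans (ℤ.i-j≤i x 1ℤ) x≤p)))))
  where
  lemma : ∀ x s c → x ℤ.+ (s ℤ.+ c) ≡ x - 1ℤ ℤ.+ s ℤ.+ (1ℤ ℤ.+ c)
  lemma = solve-∀
... | no x≰p = trans
  (cong₂ ℤ._+_ (ℤ.i≤j⇒i⊓j≡i (ℤ.<⇒≤ (ℤ.≰⇒> x≰p))) (sumMin-step v x))
  (trans (sym (ℤ.+-assoc p _ _))
    (cong (λ t → t ℤ.+ sumMin v (x - 1ℤ) ℤ.+ + count (x ℤ.≤?_) v)
      (sym (ℤ.i≤j⇒i⊓j≡i (<⇒≤-1 (ℤ.≰⇒> x≰p))))))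

sumMin-low : ∀ (v : Vec ℤ ℓ) x → (∀ k → x ℤ.≤ lookup v k) → sumMin v x ≡ + ℓ ℤ.* x
sumMin-low []      x le = sym (ℤ.*-zeroˡ x)
sumMin-low {suc ℓ} (p ∷ v) x le = trans
  (cong₂ ℤ._+_ (ℤ.i≥j⇒i⊓j≡j (le zero)) (sumMin-low v x (le ∘ suc)))
  (sym (ℤ.suc-* (+ ℓ) x))

sumMin-high : ∀ (v : Vec ℤ ℓ) x → (∀ k → lookup v k ℤ.≤ x) → sumMin v x ≡ total v
sumMin-high []      x le = refl
sumMin-high (p ∷ v) x le = cong₂ ℤ._+_ (ℤ.i≤j⇒i⊓j≡i (le zero)) (sumMin-high v x (le ∘ suc))

ψ-step : ∀ (μ : Signature ℓ) x → ψ μ x ≡ ψ μ (x - 1ℤ) ℤ.+ conj μ x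
ψ-step μ = sumMin-step (parts μ)

ψ-low : ∀ (μ : Signature ℓ) → ∃[ N ] ∀ x → x ℤ.≤ N → ψ μ x ≡ + ℓ ℤ.* x
ψ-low μ = proj₁ (conj-low μ) , λ x x≤N → sumMin-low (parts μ) x λ k →
  conj⇒ μ x k (subst (toℕ k ℕ.<_) (sym (proj₂ (conj-low μ) x x≤N)) (Fin.toℕ<n k))

ψ-high : ∀ (μ : Signature ℓ) → ∃[ M ] ∀ x → M ℤ.< x → ψ μ x ≡ size μ
ψ-high μ = proj₁ (conj-high μ) , λ x M<x → sumMin-high (parts μ) x λ k →
  ℤ.<⇒≤ (ℤ.≰⇒> λ x≤ → contradiction
    (subst (toℕ k ℕ.<_) (proj₂ (conj-high μ) x M<x) (conj⇐ μ x k x≤)) λ ())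

conj-ψ : ∀ (μ : Signature ℓ) x → conj μ x ≡ ψ μ x - ψ μ (x - 1ℤ)
conj-ψ μ x = trans (lemma (ψ μ (x - 1ℤ)) (conj μ x)) (cong (_- ψ μ (x - 1ℤ)) (sym (ψ-step μ x)))
  where
  lemma : ∀ s c → c ≡ s ℤ.+ c - s
  lemma = solve-∀

ψ-injective : ∀ {μ ν : Signature ℓ} → (∀ x → ψ μ x ≡ ψ ν x) → μ ≡ ν
ψ-injective {μ = μ} {ν} eq = conj-injective λ x → ℤ.+-injective
  (trans (conj-ψ μ x) (trans (cong₂ _-_ (eq x) (eq (x - 1ℤ))) (sym (conj-ψ ν x))))

module _ (α β γ δ : Signature ℓ) where

  common-low : ∃[ N ] ∀ x → x ℤ.≤ N →
    (ψ α x ≡ + ℓ ℤ.* x × ψ β x ≡ + ℓ ℤ.* x) × (ψ γ x ≡ + ℓ ℤ.* x × ψ δ x ≡ + ℓ ℤ.* x)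
  common-low = (A ⊓ B) ⊓ (C ⊓ D) , λ x x≤ →
      (proj₂ (ψ-low α) x (ℤ.≤-trans x≤ (ℤ.≤-trans (ℤ.i⊓j≤i (A ⊓ B) _) (ℤ.i⊓j≤i A B)))
      , proj₂ (ψ-low β) x (ℤ.≤-trans x≤ (ℤ.≤-trans (ℤ.i⊓j≤i (A ⊓ B) _) (ℤ.i⊓j≤j A B))))
    , (proj₂ (ψ-low γ) x (ℤ.≤-trans x≤ (ℤ.≤-trans (ℤ.i⊓j≤j (A ⊓ B) _) (ℤ.i⊓j≤i C D)))
      , proj₂ (ψ-low δ) x (ℤ.≤-trans x≤ (ℤ.≤-trans (ℤ.i⊓j≤j (A ⊓ B) _) (ℤ.i⊓j≤j C D))))
    where
    A B C D : ℤ
    A = proj₁ (ψ-low α)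
    B = proj₁ (ψ-low β)
    C = proj₁ (ψ-low γ)
    D = proj₁ (ψ-low δ)

  common-high : ∃[ M ] ∀ x → M ℤ.< x →
    (ψ α x ≡ size α × ψ β x ≡ size β) × (ψ γ x ≡ size γ × ψ δ x ≡ size δ)
  common-high = (A ⊔ B) ⊔ (C ⊔ D) , λ x <x →
      (proj₂ (ψ-high α) x (ℤ.≤-<-trans (ℤ.≤-trans (ℤ.i≤i⊔j A B) (ℤ.i≤i⊔j (A ⊔ B) _)) <x)
      , proj₂ (ψ-high β) x (ℤ.≤-<-trans (ℤ.≤-trans (ℤ.i≤j⊔i A B) (ℤ.i≤i⊔j (A ⊔ B) _)) <x))
    , (proj₂ (ψ-high γ) x (ℤ.≤-<-trans (ℤ.≤-trans (ℤ.i≤i⊔j C D) (ℤ.i≤j⊔i (A ⊔ B) _)) <x)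
      , proj₂ (ψ-high δ) x (ℤ.≤-<-trans (ℤ.≤-trans (ℤ.i≤j⊔i C D) (ℤ.i≤j⊔i (A ⊔ B) _)) <x))
    where
    A B C D : ℤ
    A = proj₁ (ψ-high α)
    B = proj₁ (ψ-high β)
    C = proj₁ (ψ-high γ)
    D = proj₁ (ψ-high δ)

-- Row by row this is min(-p, x) = min(p, -x) - p + x. The induction over columns avoids the
-- reversal of rows in `dual`, since it needs only the conjugate.
ψ-dual : ∀ (μ : Signature ℓ) x → ψ (dual μ) x ≡ ψ μ (- x) - size μ ℤ.+ + ℓ ℤ.* x
ψ-dual {ℓ} μ = ℤ-rec _ N base step
  where
  N : ℤ
  N = proj₁ (ψ-low (dual μ)) ⊓ (- proj₁ (ψ-high μ) - 1ℤ)
  base : ∀ x → x ℤ.≤ N → ψ (dual μ) x ≡ ψ μ (- x) - size μ ℤ.+ + ℓ ℤ.* x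
  base x x≤ = trans (proj₂ (ψ-low (dual μ)) x (ℤ.≤-trans x≤ (ℤ.i⊓j≤i _ _)))
    (trans (lemma (size μ) (+ ℓ ℤ.* x))
      (cong (λ t → t - size μ ℤ.+ + ℓ ℤ.* x) (sym (proj₂ (ψ-high μ) (- x) (+1≤⇒<
        (by-≤ (lemma′ (proj₁ (ψ-high μ)) x) (≥0 (ℤ.≤-trans x≤ (ℤ.i⊓j≤j (proj₁ (ψ-low (dual μ))) _)))))))))
    where
    lemma : ∀ s t → t ≡ s - s ℤ.+ t
    lemma = solve-∀
    lemma′ : ∀ M x → - x - (M ℤ.+ 1ℤ) ≡ - M - 1ℤ - x
    lemma′ = solve-∀
  step : ∀ x → ψ (dual μ) (x - 1ℤ) ≡ ψ μ (- (x - 1ℤ)) - size μ ℤ.+ + ℓ ℤ.* (x - 1ℤ) →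
         ψ (dual μ) x ≡ ψ μ (- x) - size μ ℤ.+ + ℓ ℤ.* x
  step x ih = by-≡ (lemma (ψ (dual μ) x) (ψ (dual μ) (x - 1ℤ)) (ψ μ (1ℤ - x)) (ψ μ (- x)) (size μ) (+ ℓ) x
      (conj (dual μ) x) (conj μ (1ℤ - x)))
    (diff-≡ (ψ-step (dual μ) x) ⟨-⟩ diff-≡ (sym ih′) ⟨-⟩ diff-≡ (sym (conj-dual-ℤ μ x)) ⟨-⟩ diff-≡ (sym down))
    where
    ih′ : ψ (dual μ) (x - 1ℤ) ≡ ψ μ (1ℤ - x) - size μ ℤ.+ + ℓ ℤ.* (x - 1ℤ)
    ih′ = trans ih (cong (λ t → ψ μ t - size μ ℤ.+ + ℓ ℤ.* (x - 1ℤ)) (eq x))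
      where
      eq : ∀ x → - (x - 1ℤ) ≡ 1ℤ - x
      eq = solve-∀
    down : ψ μ (1ℤ - x) ≡ ψ μ (- x) ℤ.+ conj μ (1ℤ - x)
    down = trans (ψ-step μ (1ℤ - x)) (cong (λ t → ψ μ t ℤ.+ conj μ (1ℤ - x)) (eq x))
      where
      eq : ∀ x → 1ℤ - x - 1ℤ ≡ - x
      eq = solve-∀
    lemma : ∀ A B C D s l x a c → A - (D - s ℤ.+ l ℤ.* x) ≡
      (A - (B ℤ.+ a)) - ((C - s ℤ.+ l ℤ.* (x - 1ℤ)) - B) - (l - c - a) - (D ℤ.+ c - C)
    lemma = solve-∀

-- The local rule as a queue

-- The local rule at one column: arrivals p and d join c waiting cells, and one
-- of them, if any, is served; d′ is the arrival passed on to the next square,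
-- c′ the number left waiting.
data Site : (p d c d′ c′ : ℕ) → Set where
  idle   : Site 0 0 0 0 0
  drain  : ∀ {c} → Site 0 0 (suc c) 1 c
  pass-p : ∀ {c} → Site 1 0 c 0 c
  pass-d : ∀ {c} → Site 0 1 c 1 c
  merge  : ∀ {c} → Site 1 1 c 0 (suc c)

Site-functional : ∀ {p d c d₁ d₂ c₁ c₂} → Site p d c d₁ c₁ → Site p d c d₂ c₂ → d₁ ≡ d₂ × c₁ ≡ c₂
Site-functional idle   idle   = refl , refl
Site-functional drain  drain  = refl , refl
Site-functional pass-p pass-p = refl , refl
Site-functional pass-d pass-d = refl , refl
Site-functional merge  merge  = refl , refl

data Bit : ℕ → Set where
  bit₀ : Bit 0
  bit₁ : Bit 1

-- With s = a + b + c cells present, the recursion gives c′ = max(0, s - 1), so n - k is 1 unless s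
-- = 0, and the arrival passed on is that number minus a. As a and b are bits, this leaves exactly
-- the five constructors of `Site`.
site : ∀ {a b k m l n} c c′ → Bit a → Bit b → m ≡ k ℕ.+ a → l ≡ k ℕ.+ b →
  + c′ ≡ 0ℤ ⊔ ((+ m - + k) ℤ.+ (+ l - + k) ℤ.+ + c - 1ℤ) →
  + n ≡ + m ℤ.+ + l - + k ℤ.+ + c - + c′ →
  Site (m ∸ k) (l ∸ k) c (n ∸ m) c′
site {a} {b} {k} {_} {_} {n} c c′ A B refl refl c′≡ n≡ =
  subst₂ (λ s t → Site s t c (n ∸ (k ℕ.+ a)) c′) (sym (ℕ.m+n∸m≡n k a)) (sym (ℕ.m+n∸m≡n k b))
    (go c A B (trans c′≡ (cong (λ t → 0ℤ ⊔ (t - 1ℤ)) (lemma (+ k) (+ a) (+ b) (+ c))))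
      (trans n≡ (lemma′ (+ k) (+ a) (+ b) (+ c) (+ c′))))
  where
  lemma : ∀ k a b c → (k ℤ.+ a - k) ℤ.+ (k ℤ.+ b - k) ℤ.+ c ≡ a ℤ.+ b ℤ.+ c
  lemma = solve-∀
  lemma′ : ∀ k a b c c′ → (k ℤ.+ a) ℤ.+ (k ℤ.+ b) - k ℤ.+ c - c′ ≡ k ℤ.+ (a ℤ.+ b ℤ.+ c - c′)
  lemma′ = solve-∀
  one : ∀ c → 1ℤ ℤ.+ c - c ≡ 1ℤ
  one = solve-∀
  out : ∀ {a c d′ c′} s → + s ≡ 1ℤ → a ℕ.+ d′ ≡ s → Site a b c d′ c′ → + n ≡ + k ℤ.+ + s →
    Site a b c (n ∸ (k ℕ.+ a)) c′
  out {a} {d′ = d′} s _ refl S eq = subst (λ t → Site a b _ t _)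
    (sym (trans (cong (_∸ (k ℕ.+ a)) (ℤ.+-injective eq))
      (trans (ℕ.[m+n]∸[m+o]≡n∸o k (a ℕ.+ d′) a) (ℕ.m+n∸m≡n a d′)))) S
  serve : ∀ {a c d′ c′} → Site a b c d′ c′ → a ℕ.+ d′ ≡ 1 →
    + n ≡ + k ℤ.+ (1ℤ ℤ.+ + c′ - + c′) → Site a b c (n ∸ (k ℕ.+ a)) c′
  serve {c′ = c′} S eq n≡ = out 1 refl eq S (trans n≡ (cong (λ t → + k ℤ.+ t) (one (+ c′))))
  go : ∀ {a} c → Bit a → Bit b → + c′ ≡ 0ℤ ⊔ (+ (a ℕ.+ b ℕ.+ c) - 1ℤ) →
    + n ≡ + k ℤ.+ (+ (a ℕ.+ b ℕ.+ c) - + c′) → Site a b c (n ∸ (k ℕ.+ a)) c′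
  go zero    bit₀ bit₀ refl n≡ = subst (λ t → Site 0 0 0 t 0) (sym n∸k) idle
    where
    n∸k : n ∸ (k ℕ.+ 0) ≡ 0
    n∸k = trans (cong (_∸ (k ℕ.+ 0)) (ℤ.+-injective n≡)) (ℕ.n∸n≡0 (k ℕ.+ 0))
  go (suc c) bit₀ bit₀ refl n≡ = serve drain refl n≡
  go c       bit₀ bit₁ refl n≡ = serve pass-d refl n≡
  go c       bit₁ bit₀ refl n≡ = serve pass-p refl n≡
  go c       bit₁ bit₁ refl n≡ = serve merge refl n≡

⪯-bit : ∀ {κ μ : Signature ℓ} → κ ⪯ μ → ∀ x → Bit (conjℕ μ x ∸ conjℕ κ x)
⪯-bit {κ = κ} {μ} κ⪯μ x = bit (conjℕ μ x ∸ conjℕ κ x)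
    (ℕ.m≤n+o⇒m∸n≤o (conjℕ μ x) (conjℕ κ x) (subst (conjℕ μ x ℕ.≤_) (ℕ.+-comm 1 _) (⪯⇒≤1+ κ⪯μ x)))
  where
  bit : ∀ n → n ℕ.≤ 1 → Bit n
  bit zero          _ = bit₀
  bit (suc zero)    _ = bit₁
  bit (suc (suc n)) (s≤s ())

⪯-split : ∀ {κ μ : Signature ℓ} → κ ⪯ μ → ∀ x → conjℕ μ x ≡ conjℕ κ x ℕ.+ (conjℕ μ x ∸ conjℕ κ x)
⪯-split κ⪯μ x = sym (ℕ.m+[n∸m]≡n (⪯⇒≤ κ⪯μ x))

⪯-diff : ∀ {κ μ : Signature ℓ} → κ ⪯ μ → ∀ x → + (conjℕ μ x ∸ conjℕ κ x) ≡ conj μ x - conj κ x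
⪯-diff {κ = κ} {μ} κ⪯μ x = trans (lemma (conj κ x) (+ (conjℕ μ x ∸ conjℕ κ x)))
  (cong (λ t → + t - conj κ x) (sym (⪯-split κ⪯μ x)))
  where
  lemma : ∀ k d → d ≡ k ℤ.+ d - k
  lemma = solve-∀

-- The rule itself records no interlacing of its result; the interlacing is known for the
-- constructed result and reaches ν by uniqueness.
rule-⪯ : ∀ {κ μ θ ν : Signature ℓ} → κ ⪯ μ → κ ⪯ θ → FominRule κ μ θ ν → μ ⪯ ν × θ ⪯ ν
rule-⪯ {κ = κ} {μ} {θ} {ν} κ⪯μ κ⪯θ r = transport (fomin {κ = κ} {μ} {θ} κ⪯μ κ⪯θ)
  where
  transport : (∃[ ν′ ] FominRule κ μ θ ν′ × μ ⪯ ν′ × θ ⪯ ν′) → μ ⪯ ν × θ ⪯ ν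
  transport (ν′ , r′ , μ⪯ν′ , θ⪯ν′) = subst (μ ⪯_) ν′≡ν μ⪯ν′ , subst (θ ⪯_) ν′≡ν θ⪯ν′
    where
    ν′≡ν : ν′ ≡ ν
    ν′≡ν = fomin-unique {κ = κ} {μ} {θ} r′ r

rule-swap : ∀ {κ μ θ ν : Signature ℓ} → FominRule κ μ θ ν → FominRule κ θ μ ν
rule-swap {κ = κ} {μ} {θ} {ν} r = record
  { carry      = R.carry
  ; carry-init = R.carry-init
  ; carry-step = λ x → trans (R.carry-step x) (cong (λ t → 0ℤ ⊔ (t ℤ.+ R.carry (x - 1ℤ) - 1ℤ))
      (ℤ.+-comm (conj μ x - conj κ x) (conj θ x - conj κ x)))
  ; conj-ν     = λ x → trans (R.conj-ν x) (cong (λ t → t - conj κ x ℤ.+ R.carry (x - 1ℤ) - R.carry x)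
      (ℤ.+-comm (conj μ x) (conj θ x)))
  }
  where module R = FominRule r

module Carry {κ μ θ ν : Signature ℓ} (κ⪯μ : κ ⪯ μ) (κ⪯θ : κ ⪯ θ) (r : FominRule κ μ θ ν) where

  private module R = FominRule r

  c : ℤ → ℕ
  c x = ∣ R.carry x ∣

  c≡ : ∀ x → + c x ≡ R.carry x
  c≡ x = ℤ.0≤i⇒+∣i∣≡i (subst (0ℤ ℤ.≤_) (sym (R.carry-step x)) (ℤ.i≤i⊔j 0ℤ _))

  c-low : ∃[ N ] ∀ x → x ℤ.≤ N → c x ≡ 0
  c-low = proj₁ R.carry-init , λ x x≤ → cong ∣_∣ (proj₂ R.carry-init x x≤)

  c-high : ∃[ M ] ∀ x → M ℤ.< x → c x ≡ 0
  c-high = proj₁ final , λ x <x → cong ∣_∣ (proj₂ final x <x)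
    where
    final : ∃[ M ] ∀ x → M ℤ.< x → R.carry x ≡ 0ℤ
    final = carry-final κ⪯μ κ⪯θ r

  c-site : ∀ x → Site (conjℕ μ x ∸ conjℕ κ x) (conjℕ θ x ∸ conjℕ κ x) (c (x - 1ℤ)) (conjℕ ν x ∸ conjℕ μ x) (c x)
  c-site x = site (c (x - 1ℤ)) (c x) (⪯-bit κ⪯μ x) (⪯-bit κ⪯θ x) (⪯-split κ⪯μ x) (⪯-split κ⪯θ x)
    (trans (c≡ x) (trans (R.carry-step x)
      (cong (λ t → 0ℤ ⊔ ((conj μ x - conj κ x) ℤ.+ (conj θ x - conj κ x) ℤ.+ t - 1ℤ)) (sym (c≡ (x - 1ℤ))))))
    (trans (R.conj-ν x) (cong₂ (λ s t → conj μ x ℤ.+ conj θ x - conj κ x ℤ.+ s - t)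
      (sym (c≡ (x - 1ℤ))) (sym (c≡ x))))

  -- Summed over the columns up to x, the carries in `conj-ν` telescope. This identity turns every
  -- statement on carries into one on heights.
  balance : ∀ x → ψ ν x ℤ.+ ψ κ x ℤ.+ + c x ≡ ψ μ x ℤ.+ ψ θ x
  balance = ℤ-rec _ (N ⊓ proj₁ c-low) base step
    where
    N : ℤ
    N = proj₁ (common-low κ μ θ ν)
    base : ∀ x → x ℤ.≤ N ⊓ proj₁ c-low → ψ ν x ℤ.+ ψ κ x ℤ.+ + c x ≡ ψ μ x ℤ.+ ψ θ x
    base x x≤ with proj₂ (common-low κ μ θ ν) x (ℤ.≤-trans x≤ (ℤ.i⊓j≤i N _))
    ... | (k≡ , m≡) , (t≡ , n≡) = trans
      (cong₂ ℤ._+_ (cong₂ ℤ._+_ n≡ k≡) (cong +_ (proj₂ c-low x (ℤ.≤-trans x≤ (ℤ.i⊓j≤j N _)))))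
      (trans (ℤ.+-identityʳ _) (sym (cong₂ ℤ._+_ m≡ t≡)))
    step : ∀ x → ψ ν (x - 1ℤ) ℤ.+ ψ κ (x - 1ℤ) ℤ.+ + c (x - 1ℤ) ≡ ψ μ (x - 1ℤ) ℤ.+ ψ θ (x - 1ℤ) →
           ψ ν x ℤ.+ ψ κ x ℤ.+ + c x ≡ ψ μ x ℤ.+ ψ θ x
    step x ih = begin
      ψ ν x ℤ.+ ψ κ x ℤ.+ + c x
        ≡⟨ cong₂ (λ s t → s ℤ.+ t ℤ.+ + c x) (ψ-step ν x) (ψ-step κ x) ⟩
      (ψ ν (x - 1ℤ) ℤ.+ conj ν x) ℤ.+ (ψ κ (x - 1ℤ) ℤ.+ conj κ x) ℤ.+ + c x
        ≡⟨ cong (λ t → (ψ ν (x - 1ℤ) ℤ.+ t) ℤ.+ (ψ κ (x - 1ℤ) ℤ.+ conj κ x) ℤ.+ + c x)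
             (trans (R.conj-ν x) (cong₂ (λ s t → conj μ x ℤ.+ conj θ x - conj κ x ℤ.+ s - t)
               (sym (c≡ (x - 1ℤ))) (sym (c≡ x)))) ⟩
      (ψ ν (x - 1ℤ) ℤ.+ (conj μ x ℤ.+ conj θ x - conj κ x ℤ.+ + c (x - 1ℤ) - + c x)) ℤ.+ (ψ κ (x - 1ℤ) ℤ.+ conj κ x) ℤ.+ + c x
        ≡⟨ lemma (ψ ν (x - 1ℤ)) (ψ κ (x - 1ℤ)) (conj μ x) (conj θ x) (conj κ x) (+ c (x - 1ℤ)) (+ c x) ⟩
      ψ ν (x - 1ℤ) ℤ.+ ψ κ (x - 1ℤ) ℤ.+ + c (x - 1ℤ) ℤ.+ (conj μ x ℤ.+ conj θ x)
        ≡⟨ cong (ℤ._+ (conj μ x ℤ.+ conj θ x)) ih ⟩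
      ψ μ (x - 1ℤ) ℤ.+ ψ θ (x - 1ℤ) ℤ.+ (conj μ x ℤ.+ conj θ x)
        ≡⟨ lemma′ (ψ μ (x - 1ℤ)) (ψ θ (x - 1ℤ)) (conj μ x) (conj θ x) ⟩
      (ψ μ (x - 1ℤ) ℤ.+ conj μ x) ℤ.+ (ψ θ (x - 1ℤ) ℤ.+ conj θ x)
        ≡⟨ cong₂ ℤ._+_ (sym (ψ-step μ x)) (sym (ψ-step θ x)) ⟩
      ψ μ x ℤ.+ ψ θ x ∎
      where
      open ≡-Reasoning
      lemma : ∀ n k m t k′ c c′ → (n ℤ.+ (m ℤ.+ t - k′ ℤ.+ c - c′)) ℤ.+ (k ℤ.+ k′) ℤ.+ c′ ≡ n ℤ.+ k ℤ.+ c ℤ.+ (m ℤ.+ t)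
      lemma = solve-∀
      lemma′ : ∀ a b c d → a ℤ.+ b ℤ.+ (c ℤ.+ d) ≡ (a ℤ.+ c) ℤ.+ (b ℤ.+ d)
      lemma′ = solve-∀

  size-balance : size ν ℤ.+ size κ ≡ size μ ℤ.+ size θ
  size-balance = begin
    size ν ℤ.+ size κ             ≡⟨ ℤ.+-identityʳ _ ⟨
    size ν ℤ.+ size κ ℤ.+ 0ℤ      ≡⟨ cong₂ ℤ._+_ (cong₂ ℤ._+_ (proj₂ (proj₂ sizes)) (proj₁ (proj₁ sizes)))
                                       (cong +_ (proj₂ c-high x (ℤ.≤-<-trans (ℤ.i≤j⊔i M _) (x<x+1 _)))) ⟨
    ψ ν x ℤ.+ ψ κ x ℤ.+ + c x     ≡⟨ balance x ⟩
    ψ μ x ℤ.+ ψ θ x               ≡⟨ cong₂ ℤ._+_ (proj₂ (proj₁ sizes)) (proj₁ (proj₂ sizes)) ⟩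
    size μ ℤ.+ size θ             ∎
    where
    open ≡-Reasoning
    M x : ℤ
    M = proj₁ (common-high κ μ θ ν)
    x = M ⊔ proj₁ c-high ℤ.+ 1ℤ
    sizes : (ψ κ x ≡ size κ × ψ μ x ≡ size μ) × (ψ θ x ≡ size θ × ψ ν x ≡ size ν)
    sizes = proj₂ (common-high κ μ θ ν) x (ℤ.≤-<-trans (ℤ.i≤i⊔j M _) (x<x+1 _))

-- Kashiwara operators by columns

-- For α ⪯ β ⪯ γ put a ")" in column x if β has one more cell there than α and
-- γ none more than β, and a "(" in the opposite case.  Then height α γ β x is the
-- number of "(" minus that of ")" in the columns up to x.
height : (α γ β : Signature ℓ) → ℤ → ℤ
height α γ β x = ψ γ x ℤ.+ ψ α x - (ψ β x ℤ.+ ψ β x)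

-- β̃ arises from β by turning the "(" in column col into ")", and this "(" is the
-- leftmost uncancelled one (it follows the last minimum of the height);
-- equivalently the new ")" is the rightmost uncancelled one.
record Lift (α γ β β̃ : Signature ℓ) : Set where
  field
    col          : ℤ
    ψ-before     : ∀ x → x ℤ.< col → ψ β̃ x ≡ ψ β x
    ψ-after      : ∀ x → col ℤ.≤ x → ψ β̃ x ≡ ψ β x ℤ.+ 1ℤ
    height-before : ∀ x → x ℤ.< col → height α γ β (col - 1ℤ) ℤ.≤ height α γ β x
    height-after  : ∀ x → col ℤ.≤ x → height α γ β (col - 1ℤ) ℤ.+ 1ℤ ℤ.≤ height α γ β x

height-step : ∀ {α β γ : Signature ℓ} → α ⪯ β → β ⪯ γ → ∀ x →
  height α γ β x ℤ.+ + (conjℕ β x ∸ conjℕ α x) ≡ height α γ β (x - 1ℤ) ℤ.+ + (conjℕ γ x ∸ conjℕ β x)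
height-step {α = α} {β} {γ} α⪯β β⪯γ x = begin
  height α γ β x ℤ.+ + (conjℕ β x ∸ conjℕ α x)
    ≡⟨ cong₂ (λ s t → s ℤ.+ t) (cong₂ _-_ (cong₂ ℤ._+_ (ψ-step γ x) (ψ-step α x)) (cong₂ ℤ._+_ (ψ-step β x) (ψ-step β x)))
         (⪯-diff α⪯β x) ⟩
  (ψ γ (x - 1ℤ) ℤ.+ conj γ x ℤ.+ (ψ α (x - 1ℤ) ℤ.+ conj α x) - (ψ β (x - 1ℤ) ℤ.+ conj β x ℤ.+ (ψ β (x - 1ℤ) ℤ.+ conj β x))) ℤ.+ (conj β x - conj α x)
    ≡⟨ lemma (ψ γ (x - 1ℤ)) (ψ α (x - 1ℤ)) (ψ β (x - 1ℤ)) (conj γ x) (conj α x) (conj β x) ⟩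
  height α γ β (x - 1ℤ) ℤ.+ (conj γ x - conj β x)
    ≡⟨ cong (λ t → height α γ β (x - 1ℤ) ℤ.+ t) (⪯-diff β⪯γ x) ⟨
  height α γ β (x - 1ℤ) ℤ.+ + (conjℕ γ x ∸ conjℕ β x) ∎
  where
  open ≡-Reasoning
  lemma : ∀ g a b c d e → (g ℤ.+ c ℤ.+ (a ℤ.+ d) - (b ℤ.+ e ℤ.+ (b ℤ.+ e))) ℤ.+ (e - d) ≡ (g ℤ.+ a - (b ℤ.+ b)) ℤ.+ (c - e)
  lemma = solve-∀

height-low : ∀ (α γ β : Signature ℓ) → ∃[ N ] ∀ x → x ℤ.≤ N → height α γ β x ≡ 0ℤ
height-low {ℓ} α γ β = proj₁ (common-low α γ β β) , λ x x≤ → zero-height x (proj₂ (common-low α γ β β) x x≤)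
  where
  zero-height : ∀ x → (ψ α x ≡ + ℓ ℤ.* x × ψ γ x ≡ + ℓ ℤ.* x) × (ψ β x ≡ + ℓ ℤ.* x × ψ β x ≡ + ℓ ℤ.* x) →
    height α γ β x ≡ 0ℤ
  zero-height x ((a , c) , (b , _)) = trans (cong₂ _-_ (cong₂ ℤ._+_ c a) (cong₂ ℤ._+_ b b))
    (ℤ.+-inverseʳ (+ ℓ ℤ.* x ℤ.+ + ℓ ℤ.* x))

height∞ : (α γ β : Signature ℓ) → ℤ
height∞ α γ β = size γ ℤ.+ size α - (size β ℤ.+ size β)

height-high : ∀ (α γ β : Signature ℓ) → ∃[ M ] ∀ x → M ℤ.< x → height α γ β x ≡ height∞ α γ β
height-high α γ β = proj₁ (common-high α γ β β) , λ x <x → const x (proj₂ (common-high α γ β β) x <x)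
  where
  const : ∀ x → (ψ α x ≡ size α × ψ γ x ≡ size γ) × (ψ β x ≡ size β × ψ β x ≡ size β) →
    height α γ β x ≡ height∞ α γ β
  const x ((a , c) , (b , _)) = cong₂ _-_ (cong₂ ℤ._+_ c a) (cong₂ ℤ._+_ b b)

module LiftProperties {α β γ β̃ : Signature ℓ} (α⪯β : α ⪯ β) (β⪯γ : β ⪯ γ) (L : Lift α γ β β̃) where

  open Lift L public

  private
    h : ℤ → ℤ
    h = height α γ β

  -- In one column the height changes by a difference of two bits, and `height-after` at `col`
  -- demands a rise.
  bits : conjℕ β col ∸ conjℕ α col ≡ 0 × conjℕ γ col ∸ conjℕ β col ≡ 1
  bits = go (⪯-bit α⪯β col) (⪯-bit β⪯γ col) (height-step α⪯β β⪯γ col) (height-after col ℤ.≤-refl)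
    where
    go : ∀ {p q} → Bit p → Bit q → h col ℤ.+ + p ≡ h (col - 1ℤ) ℤ.+ + q → h (col - 1ℤ) ℤ.+ 1ℤ ℤ.≤ h col → p ≡ 0 × q ≡ 1
    go bit₀ bit₁ _ _ = refl , refl
    go bit₁ bit₀ eq le = contradiction (subst (h (col - 1ℤ) ℤ.+ 1ℤ ℤ.+ 1ℤ ℤ.≤_) eq (ℤ.+-monoˡ-≤ 1ℤ le))
      (ℤ.<⇒≱ (subst (ℤ._< h (col - 1ℤ) ℤ.+ 1ℤ ℤ.+ 1ℤ) (sym (ℤ.+-identityʳ (h (col - 1ℤ))))
        (ℤ.<-trans (x<x+1 (h (col - 1ℤ))) (x<x+1 (h (col - 1ℤ) ℤ.+ 1ℤ)))))
    go bit₀ bit₀ eq le = contradiction (subst (h (col - 1ℤ) ℤ.+ 1ℤ ℤ.≤_)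
        (trans (sym (ℤ.+-identityʳ (h col))) (trans eq (ℤ.+-identityʳ (h (col - 1ℤ))))) le)
      (ℤ.<⇒≱ (x<x+1 (h (col - 1ℤ))))
    go bit₁ bit₁ eq le = contradiction (subst (h (col - 1ℤ) ℤ.+ 1ℤ ℤ.+ 1ℤ ℤ.≤_) eq (ℤ.+-monoˡ-≤ 1ℤ le))
      (ℤ.<⇒≱ (x<x+1 (h (col - 1ℤ) ℤ.+ 1ℤ)))

  height-col : h col ≡ h (col - 1ℤ) ℤ.+ 1ℤ
  height-col = trans (sym (ℤ.+-identityʳ _)) (subst₂ (λ p q → h col ℤ.+ + p ≡ h (col - 1ℤ) ℤ.+ + q)
    (proj₁ bits) (proj₂ bits) (height-step α⪯β β⪯γ col))

  conj-col : conjℕ β̃ col ≡ suc (conjℕ β col)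
  conj-col = ℤ.+-injective (trans (conj-ψ β̃ col)
    (trans (cong₂ _-_ (ψ-after col ℤ.≤-refl) (ψ-before _ (x-1<x col)))
      (trans (lemma (ψ β col) (ψ β (col - 1ℤ))) (cong (λ t → 1ℤ ℤ.+ t) (sym (conj-ψ β col))))))
    where
    lemma : ∀ a b → a ℤ.+ 1ℤ - b ≡ 1ℤ ℤ.+ (a - b)
    lemma = solve-∀

  conj-other : ∀ x → x ≢ col → conjℕ β̃ x ≡ conjℕ β x
  conj-other x x≢ with x ℤ.<? col
  ... | yes x< = ℤ.+-injective (trans (conj-ψ β̃ x)
    (trans (cong₂ _-_ (ψ-before x x<) (ψ-before _ (ℤ.<-trans (x-1<x x) x<))) (sym (conj-ψ β x))))
  ... | no x≮ = ℤ.+-injective (trans (conj-ψ β̃ x)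
    (trans (cong₂ _-_ (ψ-after x (ℤ.≮⇒≥ x≮)) (ψ-after _ (<⇒≤-1 (ℤ.≤∧≢⇒< (ℤ.≮⇒≥ x≮) (x≢ ∘ sym)))))
      (trans (lemma (ψ β x) (ψ β (x - 1ℤ))) (sym (conj-ψ β x)))))
    where
    lemma : ∀ a b → a ℤ.+ 1ℤ - (b ℤ.+ 1ℤ) ≡ a - b
    lemma = solve-∀

  private
    α-col : conjℕ β col ≡ conjℕ α col
    α-col = trans (⪯-split α⪯β col) (trans (cong (conjℕ α col ℕ.+_) (proj₁ bits)) (ℕ.+-identityʳ _))

    γ-col : conjℕ γ col ≡ suc (conjℕ β col)
    γ-col = trans (⪯-split β⪯γ col) (trans (cong (conjℕ β col ℕ.+_) (proj₂ bits)) (ℕ.+-comm _ 1))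

    at-col : (R : ℕ → ℤ → Set) → (∀ x → R (conjℕ β x) x) → R (suc (conjℕ β col)) col →
      ∀ x → R (conjℕ β̃ x) x
    at-col R other here x with x ℤ.≟ col
    ... | yes refl = subst (λ t → R t col) (sym conj-col) here
    ... | no  x≢   = subst (λ t → R t x) (sym (conj-other x x≢)) (other x)

  α⪯β̃ : α ⪯ β̃
  α⪯β̃ = conj⇒⪯
    (at-col (λ t x → conjℕ α x ℕ.≤ t) (⪯⇒≤ α⪯β) (ℕ.m≤n⇒m≤1+n (⪯⇒≤ α⪯β col)))
    (at-col (λ t x → t ℕ.≤ suc (conjℕ α x)) (⪯⇒≤1+ α⪯β) (s≤s (ℕ.≤-reflexive α-col)))

  β̃⪯γ : β̃ ⪯ γ
  β̃⪯γ = conj⇒⪯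
    (at-col (λ t x → t ℕ.≤ conjℕ γ x) (⪯⇒≤ β⪯γ) (ℕ.≤-reflexive (sym γ-col)))
    (at-col (λ t x → conjℕ γ x ℕ.≤ suc t) (⪯⇒≤1+ β⪯γ) (ℕ.≤-trans (ℕ.≤-reflexive γ-col) (ℕ.n≤1+n _)))

module _ {α γ β β̃ β̃′ : Signature ℓ} (L : Lift α γ β β̃) (L′ : Lift α γ β β̃′) where

  private
    module L  = Lift L
    module L′ = Lift L′

  -- If `L′.col` were smaller, its minimum would have to be exceeded strictly at `L.col - 1`, which
  -- is a minimum up to there.
  Lift-col-≤ : L.col ℤ.≤ L′.col
  Lift-col-≤ = ℤ.≮⇒≥ λ col′<col → ℤ.<⇒≱ (x<x+1 _)
    (ℤ.≤-trans (L′.height-after _ (<⇒≤-1 col′<col)) (L.height-before _ (ℤ.<-trans (x-1<x _) col′<col)))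

Lift-functional : ∀ {α γ β β̃ β̃′ : Signature ℓ} → Lift α γ β β̃ → Lift α γ β β̃′ → β̃ ≡ β̃′
Lift-functional {β = β} {β̃} {β̃′} L L′ = ψ-injective λ x → go x (ℤ._<?_ x L.col)
  where
  module L  = Lift L
  module L′ = Lift L′
  cols : L.col ≡ L′.col
  cols = ℤ.≤-antisym (Lift-col-≤ L L′) (Lift-col-≤ L′ L)
  go : ∀ x → Dec (x ℤ.< L.col) → ψ β̃ x ≡ ψ β̃′ x
  go x (yes x<) = trans (L.ψ-before x x<) (sym (L′.ψ-before x (subst (x ℤ.<_) cols x<)))
  go x (no  x≮) = trans (L.ψ-after x (ℤ.≮⇒≥ x≮)) (sym (L′.ψ-after x (subst (ℤ._≤ x) cols (ℤ.≮⇒≥ x≮))))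

height-dual : ∀ (α γ β : Signature ℓ) x →
  height (dual γ) (dual α) (dual β) x ≡ height α γ β (- x) - height∞ α γ β
height-dual {ℓ} α γ β x = trans
  (cong₂ _-_ (cong₂ ℤ._+_ (ψ-dual α x) (ψ-dual γ x)) (cong₂ ℤ._+_ (ψ-dual β x) (ψ-dual β x)))
  (lemma (ψ α (- x)) (size α) (ψ γ (- x)) (size γ) (ψ β (- x)) (size β) (+ ℓ ℤ.* x))
  where
  lemma : ∀ a A c C b B t → (a - A ℤ.+ t) ℤ.+ (c - C ℤ.+ t) - ((b - B ℤ.+ t) ℤ.+ (b - B ℤ.+ t)) ≡
    c ℤ.+ a - (b ℤ.+ b) - (C ℤ.+ A - (B ℤ.+ B))
  lemma = solve-∀

module _ {α β γ β̃ : Signature ℓ} (α⪯β : α ⪯ β) (β⪯γ : β ⪯ γ) (L : Lift α γ β β̃) where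

  open LiftProperties α⪯β β⪯γ L

  height̃-before : ∀ x → x ℤ.< col → height α γ β̃ x ≡ height α γ β x
  height̃-before x x< = cong (λ t → ψ γ x ℤ.+ ψ α x - (t ℤ.+ t)) (ψ-before x x<)

  height̃-after : ∀ x → col ℤ.≤ x → height α γ β̃ x ≡ height α γ β x - + 2
  height̃-after x x≥ = trans (cong (λ t → ψ γ x ℤ.+ ψ α x - (t ℤ.+ t)) (ψ-after x x≥))
    (lemma (ψ γ x ℤ.+ ψ α x) (ψ β x))
    where
    lemma : ∀ a b → a - (b ℤ.+ 1ℤ ℤ.+ (b ℤ.+ 1ℤ)) ≡ a - (b ℤ.+ b) - + 2
    lemma = solve-∀

  height̃-col : height α γ β̃ col ≡ height α γ β (col - 1ℤ) - 1ℤ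
  height̃-col = trans (height̃-after col ℤ.≤-refl) (trans (cong (_- + 2) height-col) (lemma (height α γ β (col - 1ℤ))))
    where
    lemma : ∀ a → a ℤ.+ 1ℤ - + 2 ≡ a - 1ℤ
    lemma = solve-∀

  size-lift : size β̃ ≡ size β ℤ.+ 1ℤ
  size-lift = trans (sym (proj₂ (ψ-high β̃) x (ℤ.≤-<-trans (ℤ.≤-trans (ℤ.i≤i⊔j A B) (ℤ.i≤i⊔j (A ⊔ B) col)) (x<x+1 _))))
    (trans (ψ-after x (ℤ.<⇒≤ (ℤ.≤-<-trans (ℤ.i≤j⊔i (A ⊔ B) col) (x<x+1 _))))
      (cong (ℤ._+ 1ℤ) (proj₂ (ψ-high β) x (ℤ.≤-<-trans (ℤ.≤-trans (ℤ.i≤j⊔i A B) (ℤ.i≤i⊔j (A ⊔ B) col)) (x<x+1 _)))))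
    where
    A B x : ℤ
    A = proj₁ (ψ-high β̃)
    B = proj₁ (ψ-high β)
    x = A ⊔ B ⊔ col ℤ.+ 1ℤ

  -- The height of β̃ has its first minimum at `col`, one below the last minimum of the height of β.
  -- Duality reads the columns backwards, x becoming 1 - x, so this first minimum becomes the last
  -- one of the dual height.
  Lift-dual : Lift (dual γ) (dual α) (dual β̃) (dual β)
  Lift-dual = record
    { col = 1ℤ - col
    ; ψ-before = λ x x< → by-≡
        (lemma₁ (ψ (dual β) x) (ψ (dual β̃) x) (ψ β (- x)) (ψ β̃ (- x)) (size β) (size β̃) (+ ℓ ℤ.* x))
        (diff-≡ (ψ-dual β x) ⟨-⟩ diff-≡ (ψ-dual β̃ x) ⟨-⟩ diff-≡ (ψ-after (- x) (≤- x (<⇒≤-1 x<))) ⟨-⟩ diff-≡ (sym size-lift))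
    ; ψ-after = λ x x≥ → by-≡
        (lemma₂ (ψ (dual β) x) (ψ (dual β̃) x) (ψ β (- x)) (ψ β̃ (- x)) (size β) (size β̃) (+ ℓ ℤ.* x))
        (diff-≡ (ψ-dual β x) ⟨-⟩ diff-≡ (ψ-dual β̃ x) ⟨-⟩ diff-≡ (ψ-before (- x) (-< x x≥)) ⟨-⟩ diff-≡ (sym size-lift))
    ; height-before = λ x x< → subst₂ ℤ._≤_ (sym h̃*) (sym (height-dual α γ β̃ x))
        (by-≤ (lemma₃ (height α γ β̃ (- x)) (height α γ β (- x)) (height α γ β (col - 1ℤ)) (height∞ α γ β̃))
          (≥0 (height-after (- x) (≤- x (<⇒≤-1 x<))) ⟨+⟩ ≡0⇒≥0 (diff-≡ (height̃-after (- x) (≤- x (<⇒≤-1 x<))))))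
    ; height-after = λ x x≥ → subst₂ ℤ._≤_ (cong (ℤ._+ 1ℤ) (sym h̃*)) (sym (height-dual α γ β̃ x))
        (by-≤ (lemma₄ (height α γ β̃ (- x)) (height α γ β (- x)) (height α γ β (col - 1ℤ)) (height∞ α γ β̃))
          (≥0 (height-before (- x) (-< x x≥)) ⟨+⟩ ≡0⇒≥0 (diff-≡ (height̃-before (- x) (-< x x≥)))))
    }
    where
    ≤- : ∀ x → x ℤ.≤ 1ℤ - col - 1ℤ → col ℤ.≤ - x
    ≤- x le = by-≤ (lemma x col) (≥0 le)
      where
      lemma : ∀ x c → - x - c ≡ 1ℤ - c - 1ℤ - x
      lemma = solve-∀
    -< : ∀ x → 1ℤ - col ℤ.≤ x → - x ℤ.< col
    -< x le = ≤-1⇒< (by-≤ (lemma x col) (≥0 le))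
      where
      lemma : ∀ x c → c - 1ℤ - - x ≡ x - (1ℤ - c)
      lemma = solve-∀
    h̃* : height (dual γ) (dual α) (dual β̃) (1ℤ - col - 1ℤ) ≡ height α γ β (col - 1ℤ) - 1ℤ - height∞ α γ β̃
    h̃* = trans (height-dual α γ β̃ (1ℤ - col - 1ℤ))
      (cong (_- height∞ α γ β̃) (trans (cong (height α γ β̃) (lemma col)) height̃-col))
      where
      lemma : ∀ c → - (1ℤ - c - 1ℤ) ≡ c
      lemma = solve-∀
    lemma₁ : ∀ a a′ b b′ s s′ t → a - a′ ≡
      (a - (b - s ℤ.+ t)) - (a′ - (b′ - s′ ℤ.+ t)) - (b′ - (b ℤ.+ 1ℤ)) - ((s ℤ.+ 1ℤ) - s′)
    lemma₁ = solve-∀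
    lemma₂ : ∀ a a′ b b′ s s′ t → a - (a′ ℤ.+ 1ℤ) ≡
      (a - (b - s ℤ.+ t)) - (a′ - (b′ - s′ ℤ.+ t)) - (b′ - b) - ((s ℤ.+ 1ℤ) - s′)
    lemma₂ = solve-∀
    lemma₃ : ∀ h̃ h m i → (h̃ - i) - (m - 1ℤ - i) ≡ (h - (m ℤ.+ 1ℤ)) ℤ.+ (h̃ - (h - + 2))
    lemma₃ = solve-∀
    lemma₄ : ∀ h̃ h m i → (h̃ - i) - (m - 1ℤ - i ℤ.+ 1ℤ) ≡ (h - m) ℤ.+ (h̃ - h)
    lemma₄ = solve-∀

-- Two squares side by side, with carries c₁, c₂ and arrivals (p , d), (q , d′).
second-carry : ∀ {p q d c₁ c₂ d′ c₁′ d″ c₂′} → Site p d c₁ d′ c₁′ → Site q d′ c₂ d″ c₂′ →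
  c₂′ + p ℕ.≤ (c₂ + q) ℕ.⊔ p
second-carry idle   idle                = z≤n
second-carry pass-p idle                = ℕ.≤-refl
second-carry merge  idle                = ℕ.≤-refl
second-carry idle   (drain {c})         = ℕ.n≤1+n (c + 0)
second-carry pass-p (drain {c})         = ℕ.m≤n⇒m≤n⊔o 1 (ℕ.≤-reflexive (ℕ.+-suc c 0))
second-carry merge  (drain {c})         = ℕ.m≤n⇒m≤n⊔o 1 (ℕ.≤-reflexive (ℕ.+-suc c 0))
second-carry idle   (pass-p {c})        = ℕ.m≤n⇒m≤n⊔o 0 (ℕ.+-monoʳ-≤ c z≤n)
second-carry pass-p (pass-p {c})        = ℕ.m≤m⊔n (c + 1) 1
second-carry merge  (pass-p {c})        = ℕ.m≤m⊔n (c + 1) 1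
second-carry drain  (pass-d {c})        = ℕ.m≤m⊔n (c + 0) 0
second-carry pass-d (pass-d {c})        = ℕ.m≤m⊔n (c + 0) 0
second-carry drain  (merge {c})         = ℕ.m≤n⇒m≤n⊔o 0 (ℕ.≤-reflexive (sym (ℕ.+-suc c 0)))
second-carry pass-d (merge {c})         = ℕ.m≤n⇒m≤n⊔o 0 (ℕ.≤-reflexive (sym (ℕ.+-suc c 0)))

-- This step keeps the second queue below the height H over its minimum. The margin k is 0 before
-- the lift and 1 after the runs have merged; the alternative p in `second-carry` is where k ≤ H′
-- enters.
carry≤height : ∀ k {p q d c₁ c₂ d′ c₁′ d″ c₂′ H H′} → Site p d c₁ d′ c₁′ → Site q d′ c₂ d″ c₂′ →
  k + c₂ ℕ.≤ H → k ℕ.≤ H′ → H′ + p ≡ H + q → k + c₂′ ℕ.≤ H′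
carry≤height k {p} {q} {c₂ = c₂} {c₂′ = c₂′} {H} {H′} S T le k≤ eq = ℕ.+-cancelʳ-≤ p (k + c₂′) H′ (begin
  k + c₂′ + p               ≡⟨ ℕ.+-assoc k c₂′ p ⟩
  k + (c₂′ + p)             ≤⟨ ℕ.+-monoʳ-≤ k (second-carry S T) ⟩
  k + ((c₂ + q) ℕ.⊔ p)      ≡⟨ ℕ.+-distribˡ-⊔ k (c₂ + q) p ⟩
  (k + (c₂ + q)) ℕ.⊔ (k + p)
    ≤⟨ ℕ.⊔-lub (ℕ.≤-trans (ℕ.≤-reflexive (sym (ℕ.+-assoc k c₂ q))) (ℕ.+-monoˡ-≤ q le))
         (ℕ.≤-trans (ℕ.+-monoˡ-≤ p k≤) (ℕ.≤-reflexive eq)) ⟩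
  H + q                     ≡⟨ sym eq ⟩
  H′ + p                    ∎)
  where open ℕ.≤-Reasoning

-- The tilde marks a second run of the rule, with (p , q) = (0 , 1) replaced by (1 , 0)
-- in the column of the lift; afterwards the runs either agree or differ by 1 in both
-- carries until they merge.
lift-site : ∀ {d c₁ d′ c₁′ d″ c₂′ d̃′ c̃₁′ d̃″ c̃₂′} →
  Site 0 d c₁ d′ c₁′ → Site 1 d′ 0 d″ c₂′ → Site 1 d c₁ d̃′ c̃₁′ → Site 0 d̃′ 0 d̃″ c̃₂′ →
  (c̃₁′ ≡ suc c₁′ × c₂′ ≡ suc c̃₂′ × c₂′ ≡ 1) ⊎ (c₁ ≡ 0 × c̃₁′ ≡ c₁′ × c̃₂′ ≡ c₂′ × c₂′ ≡ 0)
lift-site idle   pass-p pass-p idle = inj₂ (refl , refl , refl , refl)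
lift-site drain  merge  pass-p idle = inj₁ (refl , refl , refl)
lift-site pass-d merge  merge  idle = inj₁ (refl , refl , refl)

-- The merging cases are those where the first queue of the original run is `idle`: the modified run
-- still has one cell there, which is served and replaces the cell that its second queue lacks.
during-site : ∀ {p q d c₁ c₂ d′ c₁′ d″ c₂′ d̃′ c̃₁′ d̃″ c̃₂′ H′} →
  Site p d c₁ d′ c₁′ → Site q d′ (suc c₂) d″ c₂′ →
  Site p d (suc c₁) d̃′ c̃₁′ → Site q d̃′ c₂ d̃″ c̃₂′ → H′ + p ≡ suc c₂ + q → 1 ℕ.≤ H′ →
  (c̃₁′ ≡ suc c₁′ × c₂′ ≡ suc c̃₂′ × c₂′ ≡ H′) ⊎ (c₁ ≡ 0 × c̃₁′ ≡ c₁′ × c̃₂′ ≡ c₂′ × suc c₂′ ℕ.≤ H′)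
during-site {c₂ = c₂} {H′ = H′} idle drain drain pass-d eq _ =
  inj₂ (refl , refl , refl , ℕ.≤-reflexive (trans (sym (ℕ.+-identityʳ (suc c₂))) (trans (sym eq) (ℕ.+-identityʳ H′))))
during-site {c₂ = c₂} {H′ = H′} idle pass-p drain merge eq _ =
  inj₂ (refl , refl , refl , ℕ.≤-reflexive (trans (ℕ.+-comm 1 (suc c₂)) (trans (sym eq) (ℕ.+-identityʳ H′))))
during-site {c₂ = c₂} {H′ = H′} drain pass-d drain pass-d eq _ =
  inj₁ (refl , refl , trans (sym (ℕ.+-identityʳ (suc c₂))) (trans (sym eq) (ℕ.+-identityʳ H′)))
during-site {c₂ = c₂} {H′ = H′} drain merge drain merge eq _ =
  inj₁ (refl , refl , trans (ℕ.+-comm 1 (suc c₂)) (trans (sym eq) (ℕ.+-identityʳ H′)))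
during-site {c₂ = c₂} {H′ = H′} pass-d pass-d pass-d pass-d eq _ =
  inj₁ (refl , refl , trans (sym (ℕ.+-identityʳ (suc c₂))) (trans (sym eq) (ℕ.+-identityʳ H′)))
during-site {c₂ = c₂} {H′ = H′} pass-d merge pass-d merge eq _ =
  inj₁ (refl , refl , trans (ℕ.+-comm 1 (suc c₂)) (trans (sym eq) (ℕ.+-identityʳ H′)))
during-site {c₂ = suc c₂} {H′ = H′} pass-p drain pass-p drain eq _ = inj₁ (refl , refl ,
  sym (ℕ.suc-injective (trans (ℕ.+-comm 1 H′) (trans eq (ℕ.+-identityʳ _)))))
-- Here the height would return to its minimum after the lift, against `1 ≤ H′`.
during-site {c₂ = zero} {H′ = suc H′} pass-p drain pass-p idle eq _ = contradiction (ℕ.suc-injective eq) λ e →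
  contradiction (trans (ℕ.+-comm 1 H′) e) λ ()
during-site {c₂ = zero} {H′ = suc H′} merge drain merge idle eq _ = contradiction (ℕ.suc-injective eq) λ e →
  contradiction (trans (ℕ.+-comm 1 H′) e) λ ()
during-site {c₂ = suc c₂} {H′ = H′} merge drain merge drain eq _ = inj₁ (refl , refl ,
  sym (ℕ.suc-injective (trans (ℕ.+-comm 1 H′) (trans eq (ℕ.+-identityʳ _)))))
during-site {c₂ = c₂} {H′ = H′} pass-p pass-p pass-p pass-p eq _ = inj₁ (refl , refl , sym (ℕ.+-cancelʳ-≡ 1 H′ (suc c₂) eq))
during-site {c₂ = c₂} {H′ = H′} merge pass-p merge pass-p eq _ = inj₁ (refl , refl , sym (ℕ.+-cancelʳ-≡ 1 H′ (suc c₂) eq))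

-- Transport of a lift across two squares

module LocalMove {α β γ β̃ α* β* γ* β̃* γ̃* : Signature ℓ}
  (α⪯β : α ⪯ β) (β⪯γ : β ⪯ γ) (α⪯α* : α ⪯ α*) (L : Lift α γ β β̃)
  (r₁ : FominRule α β α* β*) (r₂ : FominRule β γ β* γ*)
  (r̃₁ : FominRule α β̃ α* β̃*) (r̃₂ : FominRule β̃ γ β̃* γ̃*) where

  open LiftProperties α⪯β β⪯γ L

  private
    module C₁ = Carry α⪯β α⪯α* r₁
    module C₂ = Carry β⪯γ (proj₁ (rule-⪯ α⪯β α⪯α* r₁)) r₂
    module C̃₁ = Carry α⪯β̃ α⪯α* r̃₁
    module C̃₂ = Carry β̃⪯γ (proj₁ (rule-⪯ α⪯β̃ α⪯α* r̃₁)) r̃₂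

    M : ℤ
    M = height α γ β (col - 1ℤ)

    M≤ : ∀ x → M ℤ.≤ height α γ β x
    M≤ x with x ℤ.<? col
    ... | yes x< = height-before x x<
    ... | no  x≮ = ℤ.≤-trans (ℤ.i≤i+j M 1ℤ) (height-after x (ℤ.≮⇒≥ x≮))

    H : ℤ → ℕ
    H x = ∣ height α γ β x - M ∣

    H≡ : ∀ x → + H x ≡ height α γ β x - M
    H≡ x = ℤ.0≤i⇒+∣i∣≡i (≥0 (M≤ x))

    H-step : ∀ x → H x + (conjℕ β x ∸ conjℕ α x) ≡ H (x - 1ℤ) + (conjℕ γ x ∸ conjℕ β x)
    H-step x = ℤ.+-injective (by-≡
      (lemma (+ H x) (+ H (x - 1ℤ)) (height α γ β x) (height α γ β (x - 1ℤ)) M _ _)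
      (diff-≡ (H≡ x) ⟨-⟩ diff-≡ (H≡ (x - 1ℤ)) ⟨-⟩ diff-≡ (sym (height-step α⪯β β⪯γ x))))
      where
      lemma : ∀ H H′ h h′ m p q → (H ℤ.+ p) - (H′ ℤ.+ q) ≡
        (H - (h - m)) - (H′ - (h′ - m)) - ((h′ ℤ.+ q) - (h ℤ.+ p))
      lemma = solve-∀

    H-col : H (col - 1ℤ) ≡ 0
    H-col = cong ∣_∣ (ℤ.+-inverseʳ M)

    1≤H : ∀ x → col ℤ.≤ x → 1 ℕ.≤ H x
    1≤H x x≥ = ℤ.drop‿+≤+ (subst (1ℤ ℤ.≤_) (sym (H≡ x)) (by-≤ (lemma (height α γ β x) M) (≥0 (height-after x x≥))))
      where
      lemma : ∀ h m → h - m - 1ℤ ≡ h - (m ℤ.+ 1ℤ)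
      lemma = solve-∀

    -- The equality c₂ = H in `during`, rather than the inequality of `before`, is what brings the
    -- transported height down to M at the end of this phase.
    data Unmerged (x : ℤ) : Set where
      before : x ℤ.< col → C̃₁.c x ≡ C₁.c x → C̃₂.c x ≡ C₂.c x → C₂.c x ℕ.≤ H x → Unmerged x
      during : col ℤ.≤ x → C̃₁.c x ≡ suc (C₁.c x) → C₂.c x ≡ suc (C̃₂.c x) → C₂.c x ≡ H x → Unmerged x

    record Merged (x : ℤ) : Set where
      constructor merged
      field
        col≤  : col ℤ.≤ x
        c₁≡   : C̃₁.c x ≡ C₁.c x
        c₂≡   : C̃₂.c x ≡ C₂.c x
        bound : suc (C₂.c x) ℕ.≤ H x

    exclusive : ∀ {x} → Unmerged x → ¬ Merged x
    exclusive (before x< _ _ _) m = ℤ.<⇒≱ x< (Merged.col≤ m)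
    exclusive (during _ e _ _) m = ℕ.1+n≢n (trans (sym e) (Merged.c₁≡ m))

    p≡ : ∀ x → x ≢ col → conjℕ β̃ x ∸ conjℕ α x ≡ conjℕ β x ∸ conjℕ α x
    p≡ x x≢ = cong (_∸ conjℕ α x) (conj-other x x≢)

    q≡ : ∀ x → x ≢ col → conjℕ γ x ∸ conjℕ β̃ x ≡ conjℕ γ x ∸ conjℕ β x
    q≡ x x≢ = cong (conjℕ γ x ∸_) (conj-other x x≢)

    p̃-col : conjℕ β̃ col ∸ conjℕ α col ≡ 1
    p̃-col = trans (cong (_∸ conjℕ α col) conj-col) (trans (ℕ.+-∸-assoc 1 (⪯⇒≤ α⪯β col)) (cong suc (proj₁ bits)))

    q̃-col : conjℕ γ col ∸ conjℕ β̃ col ≡ 0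
    q̃-col = trans (cong (conjℕ γ col ∸_) conj-col) (trans (sym (ℕ.pred[m∸n]≡m∸[1+n] (conjℕ γ col) (conjℕ β col)))
      (cong ℕ.pred (proj₂ bits)))

    Site-cong : ∀ {p p′ d c c̃ d′ c′} → p ≡ p′ → c ≡ c̃ → Site p d c d′ c′ → Site p′ d c̃ d′ c′
    Site-cong refl refl s = s

    same-runs : ∀ x → x ≢ col → C̃₁.c (x - 1ℤ) ≡ C₁.c (x - 1ℤ) → C̃₂.c (x - 1ℤ) ≡ C₂.c (x - 1ℤ) →
      C̃₁.c x ≡ C₁.c x × C̃₂.c x ≡ C₂.c x
    same-runs x x≢ e₁ e₂ = go (C₁.c-site x) (C₂.c-site x)
      (Site-cong (p≡ x x≢) e₁ (C̃₁.c-site x)) (Site-cong (q≡ x x≢) e₂ (C̃₂.c-site x))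
      where
      go : ∀ {p q d c₁ c₂ d′ c₁′ d″ c₂′ d̃′ c̃₁′ d̃″ c̃₂′} → Site p d c₁ d′ c₁′ → Site q d′ c₂ d″ c₂′ →
        Site p d c₁ d̃′ c̃₁′ → Site q d̃′ c₂ d̃″ c̃₂′ → c̃₁′ ≡ c₁′ × c̃₂′ ≡ c₂′
      go S T S̃ T̃ with Site-functional S̃ S
      ... | refl , refl = refl , proj₂ (Site-functional T̃ T)

    merged-step : ∀ x → Merged (x - 1ℤ) → Merged x
    merged-step x (merged le e₁ e₂ b) = merged x≥ (proj₁ both) (proj₂ both)
        (carry≤height 1 (C₁.c-site x) (C₂.c-site x) b (1≤H x x≥) (H-step x))
      where
      col<x : col ℤ.< x
      col<x = ≤-1⇒< le
      x≥ : col ℤ.≤ x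
      x≥ = ℤ.<⇒≤ col<x
      both : C̃₁.c x ≡ C₁.c x × C̃₂.c x ≡ C₂.c x
      both = same-runs x (λ eq → ℤ.<⇒≢ col<x (sym eq)) e₁ e₂

    -- The two equations concern the column just before the merger and say that the transported
    -- height equals M there.
    record Merging (x : ℤ) : Set where
      constructor merging
      field
        c₁≡0 : C₁.c (x - 1ℤ) ≡ 0
        c₂≡H : C₂.c (x - 1ℤ) ≡ H (x - 1ℤ)
        here : Merged x

    unmerged-step : ∀ x → Unmerged (x - 1ℤ) → Unmerged x ⊎ Merging x
    unmerged-step x (before x< e₁ e₂ b) with x ℤ.≟ col
    ... | no x≢ = inj₁ (before (ℤ.≤∧≢⇒< (ℤ.≮⇒≥ λ col< → ℤ.<⇒≱ x< (<⇒≤-1 col<)) x≢) (proj₁ both) (proj₂ both)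
        (carry≤height 0 (C₁.c-site x) (C₂.c-site x) b z≤n (H-step x)))
      where
      both : C̃₁.c x ≡ C₁.c x × C̃₂.c x ≡ C₂.c x
      both = same-runs x x≢ e₁ e₂
    ... | yes refl = classify (lift-site
        (Site-cong (proj₁ bits) refl (C₁.c-site x)) (Site-cong (proj₂ bits) c₂≡0 (C₂.c-site x))
        (Site-cong p̃-col e₁ (C̃₁.c-site x)) (Site-cong q̃-col (trans e₂ c₂≡0) (C̃₂.c-site x)))
      where
      -- Just before `col` the height is at its minimum, so the invariant c₂ ≤ H empties the second
      -- queue and `lift-site` applies.
      c₂≡0 : C₂.c (x - 1ℤ) ≡ 0
      c₂≡0 = ℕ.n≤0⇒n≡0 (subst (C₂.c (x - 1ℤ) ℕ.≤_) H-col b)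
      H≡1 : H x ≡ 1
      H≡1 = trans (sym (ℕ.+-identityʳ (H x))) (trans (cong (λ t → H x + t) (sym (proj₁ bits)))
        (trans (H-step x) (cong₂ _+_ H-col (proj₂ bits))))
      classify : _ → Unmerged x ⊎ Merging x
      classify (inj₁ (f₁ , f₂ , f₃)) = inj₁ (during ℤ.≤-refl f₁ f₂ (trans f₃ (sym H≡1)))
      classify (inj₂ (f₁ , f₂ , f₃ , f₄)) = inj₂ (merging f₁ (trans c₂≡0 (sym H-col))
        (merged ℤ.≤-refl f₂ f₃ (subst (λ t → suc t ℕ.≤ H x) (sym f₄) (ℕ.≤-reflexive (sym H≡1)))))
    unmerged-step x (during le e₁ e₂ b) = classify (during-site (C₁.c-site x)
        (Site-cong refl e₂ (C₂.c-site x)) (Site-cong (p≡ x x≢) e₁ (C̃₁.c-site x)) (Site-cong (q≡ x x≢) refl (C̃₂.c-site x))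
        (trans (H-step x) (cong (λ t → t + (conjℕ γ x ∸ conjℕ β x)) (trans (sym b) e₂))) (1≤H x x≥))
      where
      col<x : col ℤ.< x
      col<x = ≤-1⇒< le
      x≥ : col ℤ.≤ x
      x≥ = ℤ.<⇒≤ col<x
      x≢ : x ≢ col
      x≢ eq = ℤ.<⇒≢ col<x (sym eq)
      classify : _ → Unmerged x ⊎ Merging x
      classify (inj₁ (f₁ , f₂ , f₃)) = inj₁ (during x≥ f₁ f₂ f₃)
      classify (inj₂ (f₁ , f₂ , f₃ , f₄)) = inj₂ (merging f₁ b (merged x≥ f₂ f₃ f₄))

    phase : ∀ x → Unmerged x ⊎ Merged x
    phase = ℤ-rec _ N base step
      where
      N : ℤ
      N = (proj₁ C₁.c-low ⊓ proj₁ C₂.c-low) ⊓ ((proj₁ C̃₁.c-low ⊓ proj₁ C̃₂.c-low) ⊓ (col - 1ℤ))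
      base : ∀ x → x ℤ.≤ N → Unmerged x ⊎ Merged x
      base x x≤ = inj₁ (before (≤-1⇒< (ℤ.≤-trans x≤B (ℤ.i⊓j≤j (A₁ ⊓ A₂) _)))
        (trans (proj₂ C̃₁.c-low x (ℤ.≤-trans x≤B (ℤ.≤-trans (ℤ.i⊓j≤i (A₁ ⊓ A₂) _) (ℤ.i⊓j≤i A₁ A₂)))) (sym c₁))
        (trans (proj₂ C̃₂.c-low x (ℤ.≤-trans x≤B (ℤ.≤-trans (ℤ.i⊓j≤i (A₁ ⊓ A₂) _) (ℤ.i⊓j≤j A₁ A₂)))) (sym c₂))
        (subst (ℕ._≤ H x) (sym c₂) z≤n))
        where
        B₁ B₂ A₁ A₂ : ℤ
        B₁ = proj₁ C₁.c-low
        B₂ = proj₁ C₂.c-low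
        A₁ = proj₁ C̃₁.c-low
        A₂ = proj₁ C̃₂.c-low
        x≤A : x ℤ.≤ B₁ ⊓ B₂
        x≤A = ℤ.≤-trans x≤ (ℤ.i⊓j≤i (B₁ ⊓ B₂) _)
        x≤B : x ℤ.≤ (A₁ ⊓ A₂) ⊓ (col - 1ℤ)
        x≤B = ℤ.≤-trans x≤ (ℤ.i⊓j≤j (B₁ ⊓ B₂) _)
        c₁ : C₁.c x ≡ 0
        c₁ = proj₂ C₁.c-low x (ℤ.≤-trans x≤A (ℤ.i⊓j≤i B₁ B₂))
        c₂ : C₂.c x ≡ 0
        c₂ = proj₂ C₂.c-low x (ℤ.≤-trans x≤A (ℤ.i⊓j≤j B₁ B₂))
      step : ∀ x → Unmerged (x - 1ℤ) ⊎ Merged (x - 1ℤ) → Unmerged x ⊎ Merged x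
      step x (inj₂ m) = inj₂ (merged-step x m)
      step x (inj₁ u) with unmerged-step x u
      ... | inj₁ u′ = inj₁ u′
      ... | inj₂ m  = inj₂ (Merging.here m)

    Merged-≤ : ∀ {x y} → x ℤ.≤ y → Merged x → Merged y
    Merged-≤ {x} x≤y m = ≤-rec Merged x m (λ y _ → merged-step y) x≤y

    -- Far to the right both first carries vanish, which excludes the phase `during`. The search
    -- then runs leftwards from a merged column and must stop, since no column before `col` is
    -- merged.
    merging-point : ∃[ x ] Merging x × Unmerged (x - 1ℤ)
    merging-point = search k (subst Merged k≡ (top (phase x₀)))
      where
      A₁ A₂ x₀ : ℤ
      A₁ = proj₁ C₁.c-high
      A₂ = proj₁ C̃₁.c-high
      x₀ = A₁ ⊔ A₂ ⊔ col ℤ.+ 1ℤ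
      col≤x₀ : col ℤ.≤ x₀
      col≤x₀ = ℤ.<⇒≤ (ℤ.≤-<-trans (ℤ.i≤j⊔i (A₁ ⊔ A₂) col) (x<x+1 _))
      k : ℕ
      k = proj₁ (≤-offset col≤x₀)
      k≡ : x₀ ≡ col ℤ.+ + k
      k≡ = proj₂ (≤-offset col≤x₀)
      top : Unmerged x₀ ⊎ Merged x₀ → Merged x₀
      top (inj₂ m) = m
      top (inj₁ (before x< _ _ _)) = contradiction col≤x₀ (ℤ.<⇒≱ x<)
      top (inj₁ (during _ e _ _)) = contradiction (trans (sym e)
          (proj₂ C̃₁.c-high x₀ (ℤ.≤-<-trans (ℤ.≤-trans (ℤ.i≤j⊔i A₁ A₂) (ℤ.i≤i⊔j (A₁ ⊔ A₂) col)) (x<x+1 _)))) λ ()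
      at : ∀ x → Unmerged (x - 1ℤ) → Merged x → ∃[ x ] Merging x × Unmerged (x - 1ℤ)
      at x u m with unmerged-step x u
      ... | inj₁ u′ = contradiction m (exclusive u′)
      ... | inj₂ m′ = x , m′ , u
      search : ∀ k → Merged (col ℤ.+ + k) → ∃[ x ] Merging x × Unmerged (x - 1ℤ)
      search k m with phase (col ℤ.+ + k - 1ℤ)
      search k m       | inj₁ u = at _ u m
      search zero m    | inj₂ m′ = contradiction (Merged.col≤ m′)
        (ℤ.<⇒≱ (subst (ℤ._< col) (cong (_- 1ℤ) (sym (ℤ.+-identityʳ col))) (x-1<x col)))
      search (suc k) m | inj₂ m′ = search k (subst Merged (lemma col (+ k)) m′)
        where
        lemma : ∀ c k → c ℤ.+ (1ℤ ℤ.+ k) - 1ℤ ≡ c ℤ.+ k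
        lemma = solve-∀

    col* : ℤ
    col* = proj₁ merging-point

    open Merging (proj₁ (proj₂ merging-point))

    unmerged : ∀ x → x ℤ.< col* → Unmerged x
    unmerged x x< with phase x
    ... | inj₁ u = u
    ... | inj₂ m = contradiction (Merged-≤ (<⇒≤-1 x<) m) (exclusive (proj₂ (proj₂ merging-point)))

    all-merged : ∀ x → col* ℤ.≤ x → Merged x
    all-merged x x≥ = Merged-≤ x≥ here

    ψβ* : ∀ x → ψ β̃* x - ψ β* x ≡ (ψ β̃ x - ψ β x) - (+ C̃₁.c x - + C₁.c x)
    ψβ* x = by-≡ (lemma (ψ β̃* x) (ψ β* x) (ψ β̃ x) (ψ β x) (+ C̃₁.c x) (+ C₁.c x) (ψ α x) (ψ α* x))
      (diff-≡ (C̃₁.balance x) ⟨-⟩ diff-≡ (C₁.balance x))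
      where
      lemma : ∀ b̃* b* b̃ b c̃ c a a* → (b̃* - b*) - ((b̃ - b) - (c̃ - c)) ≡
        ((b̃* ℤ.+ a ℤ.+ c̃) - (b̃ ℤ.+ a*)) - ((b* ℤ.+ a ℤ.+ c) - (b ℤ.+ a*))
      lemma = solve-∀

    ψγ* : ∀ x → ψ γ̃* x - ψ γ* x ≡ (ψ β̃* x - ψ β* x) - (ψ β̃ x - ψ β x) - (+ C̃₂.c x - + C₂.c x)
    ψγ* x = by-≡ (lemma (ψ γ̃* x) (ψ γ* x) (ψ β̃* x) (ψ β* x) (ψ β̃ x) (ψ β x) (+ C̃₂.c x) (+ C₂.c x) (ψ γ x))
      (diff-≡ (C̃₂.balance x) ⟨-⟩ diff-≡ (C₂.balance x))
      where
      lemma : ∀ g̃ g b̃* b* b̃ b c̃ c k → (g̃ - g) - ((b̃* - b*) - (b̃ - b) - (c̃ - c)) ≡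
        ((g̃ ℤ.+ b̃ ℤ.+ c̃) - (k ℤ.+ b̃*)) - ((g ℤ.+ b ℤ.+ c) - (k ℤ.+ b*))
      lemma = solve-∀

    -- The second balance minus the first. Lower bounds on H - c₂ thus become lower bounds on the
    -- transported height, because c₁ is nonnegative.
    height* : ∀ x → height α* γ* β* x ≡ M ℤ.+ (+ H x - + C₂.c x) ℤ.+ + C₁.c x
    height* x = by-≡
      (lemma (ψ γ* x) (ψ α* x) (ψ β* x) (ψ γ x) (ψ α x) (ψ β x) (+ C₁.c x) (+ C₂.c x) M (+ H x))
      (diff-≡ (C₂.balance x) ⟨-⟩ diff-≡ (C₁.balance x) ⟨-⟩ diff-≡ (H≡ x))
      where
      lemma : ∀ g* a* b* g a b c₁ c₂ m H → (g* ℤ.+ a* - (b* ℤ.+ b*)) - (m ℤ.+ (H - c₂) ℤ.+ c₁) ≡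
        ((g* ℤ.+ b ℤ.+ c₂) - (g ℤ.+ b*)) - ((b* ℤ.+ a ℤ.+ c₁) - (b ℤ.+ a*)) - (H - ((g ℤ.+ a - (b ℤ.+ b)) - m))
      lemma = solve-∀

    Δ : ∀ {a b d} → a - b ≡ d → a ≡ b ℤ.+ d
    Δ {a} {b} eq = trans (lemma a b) (cong (λ t → b ℤ.+ t) eq)
      where
      lemma : ∀ a b → a ≡ b ℤ.+ (a - b)
      lemma = solve-∀

    same⇒0 : ∀ {m n} → m ≡ n → + m - + n ≡ 0ℤ
    same⇒0 {m} refl = ℤ.+-inverseʳ (+ m)

    suc⇒1 : ∀ {m n} → m ≡ suc n → + m - + n ≡ 1ℤ
    suc⇒1 {n = n} refl = lemma (+ n)
      where
      lemma : ∀ n → 1ℤ ℤ.+ n - n ≡ 1ℤ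
      lemma = solve-∀

    Δ+1 : ∀ {a b} → a ≡ b ℤ.+ 1ℤ → a - b ≡ 1ℤ
    Δ+1 {b = b} refl = lemma b
      where
      lemma : ∀ b → b ℤ.+ 1ℤ - b ≡ 1ℤ
      lemma = solve-∀

    unmerged-ψ : ∀ {x} → Unmerged x → ψ β̃* x - ψ β* x ≡ 0ℤ × ψ γ̃* x - ψ γ* x ≡ 0ℤ
    unmerged-ψ {x} (before x< e₁ e₂ _) = eq , trans (ψγ* x) (cong₂ _-_ (cong₂ _-_ eq (diff-≡ (ψ-before x x<))) (same⇒0 e₂))
      where
      eq : ψ β̃* x - ψ β* x ≡ 0ℤ
      eq = trans (ψβ* x) (cong₂ _-_ (diff-≡ (ψ-before x x<)) (same⇒0 e₁))
    unmerged-ψ {x} (during x≥ e₁ e₂ _) = eq , trans (ψγ* x) (cong₂ _-_ (cong₂ _-_ eq (Δ+1 (ψ-after x x≥)))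
        (trans (lemma (+ C̃₂.c x) (+ C₂.c x)) (cong -_ (suc⇒1 e₂))))
      where
      lemma : ∀ a b → a - b ≡ - (b - a)
      lemma = solve-∀
      eq : ψ β̃* x - ψ β* x ≡ 0ℤ
      eq = trans (ψβ* x) (cong₂ _-_ (Δ+1 (ψ-after x x≥)) (suc⇒1 e₁))

    merged-ψ : ∀ {x} → Merged x → ψ β̃* x - ψ β* x ≡ 1ℤ × ψ γ̃* x - ψ γ* x ≡ 0ℤ
    merged-ψ {x} (merged x≥ e₁ e₂ _) = eq , trans (ψγ* x) (cong₂ _-_ (cong₂ _-_ eq (Δ+1 (ψ-after x x≥))) (same⇒0 e₂))
      where
      eq : ψ β̃* x - ψ β* x ≡ 1ℤ
      eq = trans (ψβ* x) (cong₂ _-_ (Δ+1 (ψ-after x x≥)) (same⇒0 e₁))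

    c₂≤H : ∀ {x} → Unmerged x → C₂.c x ℕ.≤ H x
    c₂≤H (before _ _ _ b) = b
    c₂≤H (during _ _ _ b) = ℕ.≤-reflexive b

    height*-col : height α* γ* β* (col* - 1ℤ) ≡ M
    height*-col = trans (height* (col* - 1ℤ)) (trans
      (cong₂ (λ s t → M ℤ.+ s ℤ.+ + t) (same⇒0 (sym c₂≡H)) c₁≡0)
      (trans (ℤ.+-identityʳ _) (ℤ.+-identityʳ _)))

    height*-≥ : ∀ k x → k + C₂.c x ℕ.≤ H x → M ℤ.+ + k ℤ.≤ height α* γ* β* x
    height*-≥ k x le = by-≤ (lemma (height α* γ* β* x) M (+ k) (+ H x) (+ C₂.c x) (+ C₁.c x))
      (≡0⇒≥0 (diff-≡ (height* x)) ⟨+⟩ ≥0 (ℤ.+≤+ le) ⟨+⟩ ℤ.+≤+ (z≤n {C₁.c x}))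
      where
      lemma : ∀ h m k H c₂ c₁ → h - (m ℤ.+ k) ≡ (h - (m ℤ.+ (H - c₂) ℤ.+ c₁)) ℤ.+ (H - (k ℤ.+ c₂)) ℤ.+ c₁
      lemma = solve-∀

  lift* : Lift α* γ* β* β̃*
  lift* = record
    { col           = col*
    ; ψ-before      = λ x x< → trans (Δ (proj₁ (unmerged-ψ (unmerged x x<)))) (ℤ.+-identityʳ _)
    ; ψ-after       = λ x x≥ → Δ (proj₁ (merged-ψ (all-merged x x≥)))
    ; height-before = λ x x< → ℤ.≤-trans (ℤ.≤-reflexive (trans height*-col (sym (ℤ.+-identityʳ M))))
        (height*-≥ 0 x (c₂≤H (unmerged x x<)))
    ; height-after  = λ x x≥ → ℤ.≤-trans (ℤ.≤-reflexive (cong (ℤ._+ 1ℤ) height*-col))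
        (height*-≥ 1 x (Merged.bound (all-merged x x≥)))
    }

  γ̃*≡γ* : γ̃* ≡ γ*
  γ̃*≡γ* = ψ-injective λ x → go x (phase x)
    where
    go : ∀ x → Unmerged x ⊎ Merged x → ψ γ̃* x ≡ ψ γ* x
    go x (inj₁ u) = ℤ.i-j≡0⇒i≡j _ _ (proj₂ (unmerged-ψ u))
    go x (inj₂ m) = ℤ.i-j≡0⇒i≡j _ _ (proj₂ (merged-ψ m))

-- Raising and lowering, and their transport in both directions

LiftOf : Kind → (α γ β σ : Signature ℓ) → Set
LiftOf E α γ β σ = Lift α γ β σ
LiftOf F α γ β σ = Lift α γ σ β

-- σ is the result of the Kashiwara operator k on the middle term β of α ⪯ β ⪯ γ.
record Acts (k : Kind) (α γ β σ : Signature ℓ) : Set where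
  constructor acts
  field
    liftOf : LiftOf k α γ β σ
    α⪯σ    : α ⪯ σ
    σ⪯γ    : σ ⪯ γ

flip : Kind → Kind
flip E = F
flip F = E

move-flip : ∀ k {α γ β σ : Signature ℓ} → α ⪯ β → β ⪯ γ → Acts k α γ β σ → Acts (flip k) α γ σ β
move-flip E α⪯β β⪯γ (acts L _ _) = acts L α⪯β β⪯γ
move-flip F α⪯β β⪯γ (acts L _ _) = acts L α⪯β β⪯γ

move-dual : ∀ k {α γ β σ : Signature ℓ} → α ⪯ β → β ⪯ γ → Acts k α γ β σ →
  Acts (flip k) (dual γ) (dual α) (dual β) (dual σ)
move-dual E α⪯β β⪯γ (acts L α⪯σ σ⪯γ) = acts (Lift-dual α⪯β β⪯γ L) (dual-⪯ σ⪯γ) (dual-⪯ α⪯σ)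
move-dual F α⪯β β⪯γ (acts L α⪯σ σ⪯γ) = acts (Lift-dual α⪯σ σ⪯γ L) (dual-⪯ σ⪯γ) (dual-⪯ α⪯σ)

dual-injective : ∀ {μ ν : Signature ℓ} → dual μ ≡ dual ν → μ ≡ ν
dual-injective {μ = μ} {ν} eq = trans (sym (dual-involutive μ)) (trans (cong dual eq) (dual-involutive ν))

-- A lift determines its target, which settles `E`; for `F` the unknown is the source, and duality
-- exchanges source and target.
Acts-functional : ∀ k {α γ β σ σ′ : Signature ℓ} → Acts k α γ β σ → Acts k α γ β σ′ → σ ≡ σ′
Acts-functional E (acts L _ _) (acts L′ _ _) = Lift-functional L L′
Acts-functional F (acts L α⪯σ σ⪯γ) (acts L′ α⪯σ′ σ′⪯γ) =
  dual-injective (Lift-functional (Lift-dual α⪯σ σ⪯γ L) (Lift-dual α⪯σ′ σ′⪯γ L′))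

record Transport (k : Kind) (α γ σ α* γ* β* : Signature ℓ) : Set where
  constructor transport
  field
    {σ*} : Signature ℓ
    move* : Acts k α* γ* β* σ*
    left  : FominRule α σ α* σ*
    right : FominRule σ γ σ* γ*

module _ {α β γ σ α* β* γ* : Signature ℓ} (α⪯β : α ⪯ β) (β⪯γ : β ⪯ γ) (α⪯α* : α ⪯ α*)
  (r₁ : FominRule α β α* β*) (r₂ : FominRule β γ β* γ*) where

  private
    complete : ∀ {σ* γ̃*} k → Acts k α γ β σ → FominRule α σ α* σ* → FominRule σ γ σ* γ̃* →
      LiftOf k α* γ* β* σ* × γ̃* ≡ γ*
    complete E (acts L _ _) s₁ s₂ = M.lift* , M.γ̃*≡γ*
      where module M = LocalMove α⪯β β⪯γ α⪯α* L r₁ r₂ s₁ s₂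
    -- Now β lies above σ, so the run through σ is the original one and the run through β the
    -- modified one.
    complete {σ*} {γ̃*} F (acts L α⪯σ σ⪯γ) s₁ s₂ =
      subst (λ γ → Lift α* γ σ* β*) (sym M.γ̃*≡γ*) M.lift* , sym M.γ̃*≡γ*
      where module M = LocalMove α⪯σ σ⪯γ α⪯α* L s₁ s₂ r₁ r₂

  move-up : ∀ k → Acts k α γ β σ → Transport k α γ σ α* γ* β*
  move-up k m@(acts L α⪯σ σ⪯γ) = first (fomin {κ = α} {σ} {α*} α⪯σ α⪯α*)
    where
    first : (∃[ σ* ] FominRule α σ α* σ* × σ ⪯ σ* × α* ⪯ σ*) → Transport k α γ σ α* γ* β*
    first (σ* , s₁ , σ⪯σ* , α*⪯σ*) = second (fomin {κ = σ} {γ} {σ*} σ⪯γ σ⪯σ*)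
      where
      second : (∃[ γ̃* ] FominRule σ γ σ* γ̃* × γ ⪯ γ̃* × σ* ⪯ γ̃*) → Transport k α γ σ α* γ* β*
      second (γ̃* , s₂ , _ , σ*⪯γ̃*) = finish (complete k m s₁ s₂)
        where
        finish : LiftOf k α* γ* β* σ* × γ̃* ≡ γ* → Transport k α γ σ α* γ* β*
        finish (L* , refl) = transport (acts L* α*⪯σ* σ*⪯γ̃*) s₁ s₂

-- The transport is reversible because the local rule is carried to its inverse by dual,
-- which exchanges the two kinds of brackets.
move-down : ∀ k {α β γ α* β* γ* σ* : Signature ℓ} → α ⪯ β → β ⪯ γ → α ⪯ α* → γ ⪯ γ* →
  FominRule α β α* β* → FominRule β γ β* γ* → Acts k α* γ* β* σ* →
  ∃[ σ ] Acts k α γ β σ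
move-down k {α} {β} {γ} {α*} {β*} {γ*} {σ*} α⪯β β⪯γ α⪯α* γ⪯γ* r₁ r₂ m = finish
  -- Duality turns the pair of squares by a half-turn: the starred row becomes the lower one and γ
  -- its left end. `rule-swap` restores the order of the two middle corners.
  (move-up (dual-⪯ β*⪯γ*) (dual-⪯ α*⪯β*) (dual-⪯ γ⪯γ*)
    (rule-swap (dual-rule β⪯γ β⪯β* r₂)) (rule-swap (dual-rule α⪯β α⪯α* r₁))
    (flip k) (move-dual k α*⪯β* β*⪯γ* m))
  where
  β⪯β* : β ⪯ β*
  β⪯β* = proj₁ (rule-⪯ α⪯β α⪯α* r₁)
  α*⪯β* : α* ⪯ β*
  α*⪯β* = proj₂ (rule-⪯ α⪯β α⪯α* r₁)
  β*⪯γ* : β* ⪯ γ*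
  β*⪯γ* = proj₂ (rule-⪯ β⪯γ β⪯β* r₂)
  undual : ∀ k {σ} → Acts (flip (flip k)) (dual (dual α)) (dual (dual γ)) (dual (dual β)) (dual σ) →
    Acts k α γ β (dual σ)
  undual E {σ} m = subst₂ (λ α γ → Acts E α γ β (dual σ)) (dual-involutive α) (dual-involutive γ)
    (subst (λ β → Acts E (dual (dual α)) (dual (dual γ)) β (dual σ)) (dual-involutive β) m)
  undual F {σ} m = subst₂ (λ α γ → Acts F α γ β (dual σ)) (dual-involutive α) (dual-involutive γ)
    (subst (λ β → Acts F (dual (dual α)) (dual (dual γ)) β (dual σ)) (dual-involutive β) m)
  finish : Transport (flip k) (dual γ*) (dual α*) (dual σ*) (dual γ) (dual α) (dual β) → ∃[ σ ] Acts k α γ β σ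
  finish t = dual (Transport.σ* t) , undual k {Transport.σ* t}
    (move-dual (flip k) {dual γ} {dual α} {dual β} {Transport.σ* t} (dual-⪯ β⪯γ) (dual-⪯ α⪯β) (Transport.move* t))

-- Operators on Fomin fields

module _ {n ℓ : ℕ} (Λ : FominField n ℓ) where

  open FominField Λ

  at-e₁⁻ : ∀ x y → at (x - 1ℤ) y ⪯ at x y
  at-e₁⁻ x y = subst (λ t → at (x - 1ℤ) y ⪯ at t y) (x-1+1 x) (at-e₁ (x - 1ℤ) y)

  square⁻ : ∀ x y → FominRule (at (x - 1ℤ) y) (at x y) (at (x - 1ℤ) (y ℤ.+ 1ℤ)) (at x (y ℤ.+ 1ℤ))
  square⁻ x y = subst (λ t → FominRule (at (x - 1ℤ) y) (at t y) (at (x - 1ℤ) (y ℤ.+ 1ℤ)) (at t (y ℤ.+ 1ℤ)))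
    (x-1+1 x) (square (x - 1ℤ) y)

ActsAt : ∀ {n ℓ} → Kind → FominField n ℓ → ℤ → ℤ → Signature ℓ → Set
ActsAt k Λ x y = Acts k (at (x - 1ℤ) y) (at (x ℤ.+ 1ℤ) y) (at x y)
  where open FominField Λ

-- A record rather than a bare divisibility, so that the two columns can be inferred from a proof.
record OnColumn (n : ℕ) (x₀ x : ℤ) : Set where
  constructor column
  field
    divides-offset : + n ∣ x - x₀

onColumn? : ∀ n x₀ x → Dec (OnColumn n x₀ x)
onColumn? n x₀ x = Dec.map′ column OnColumn.divides-offset (+ n ∣? x - x₀)

-- Λ̃ arises from Λ by the operator k in the column of x₀ on the cylinder.
record FieldActs {n ℓ} (k : Kind) (x₀ : ℤ) (Λ Λ̃ : FominField n ℓ) : Set where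
  field
    off-column : ∀ x y → ¬ OnColumn n x₀ x → FominField.at Λ̃ x y ≡ FominField.at Λ x y
    on-column  : ∀ x y → OnColumn n x₀ x → ActsAt k Λ x y (FominField.at Λ̃ x y)

ℤ-ind : (P : ℤ → Set) → ∀ y₀ → P y₀ → (∀ y → P y → P (y ℤ.+ 1ℤ)) → (∀ y → P (y ℤ.+ 1ℤ) → P y) → ∀ y → P y
ℤ-ind P y₀ base up down y with ℤ.≤-total y₀ y
... | inj₁ y₀≤y = ≤-rec P y₀ base (λ x _ p → subst P (x-1+1 x) (up (x - 1ℤ) p)) y₀≤y
... | inj₂ y≤y₀ = subst P (ℤ.neg-involutive y) (≤-rec (P ∘ -_) (- y₀) (subst P (sym (ℤ.neg-involutive y₀)) base)
    (λ x _ p → down (- x) (subst P (lemma x) p)) (ℤ.neg-mono-≤ y≤y₀))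
  where
  lemma : ∀ x → - (x - 1ℤ) ≡ - x ℤ.+ 1ℤ
  lemma = solve-∀

module _ {n : ℕ} {x₀ : ℤ} where

  onColumn-shift : ∀ {x} k → OnColumn n x₀ x → OnColumn n x₀ (x ℤ.+ k ℤ.* + n)
  onColumn-shift {x} k (column (divides q eq)) = column (divides (q ℤ.+ k)
    (trans (lemma x k x₀ (+ n)) (trans (cong (ℤ._+ k ℤ.* + n) eq) (sym (ℤ.*-distribʳ-+ (+ n) q k)))))
    where
    lemma : ∀ x k x₀ n → x ℤ.+ k ℤ.* n - x₀ ≡ x - x₀ ℤ.+ k ℤ.* n
    lemma = solve-∀

  onColumn-unshift : ∀ {x} k → OnColumn n x₀ (x ℤ.+ k ℤ.* + n) → OnColumn n x₀ x
  onColumn-unshift {x} k on = subst (OnColumn n x₀) (lemma x k (+ n)) (onColumn-shift (- k) on)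
    where
    lemma : ∀ x k n → x ℤ.+ k ℤ.* n ℤ.+ - k ℤ.* n ≡ x
    lemma = solve-∀

  onColumn-offset : ∀ {x x′} → OnColumn n x₀ x → OnColumn n x₀ x′ → ∃[ k ] x′ ≡ x ℤ.+ k ℤ.* + n
  onColumn-offset {x} {x′} (column (divides q eq)) (column (divides q′ eq′)) = q′ - q , by-≡ (lemma x x′ x₀ q q′ (+ n)) (diff-≡ eq′ ⟨-⟩ diff-≡ eq)
    where
    lemma : ∀ x x′ x₀ q q′ n → x′ - (x ℤ.+ (q′ - q) ℤ.* n) ≡ (x′ - x₀ - q′ ℤ.* n) - (x - x₀ - q ℤ.* n)
    lemma = solve-∀

  onColumn-near : ∀ {x} k → OnColumn n x₀ x → suc k ℕ.< n → ¬ OnColumn n x₀ (x ℤ.+ + suc k)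
  onColumn-near {x} k (column on) k<n (column on′) = ℕ.<⇒≱ k<n (ℕ∣.∣⇒≤
    (∣.∣⇒∣ᵤ (∣.∣m+n∣m⇒∣n {m = x - x₀} (subst (+ n ∣_) (lemma x (+ suc k) x₀) on′) on)))
    where
    lemma : ∀ x k x₀ → x ℤ.+ k - x₀ ≡ x - x₀ ℤ.+ k
    lemma = solve-∀

  onColumn-next : ∀ {x} → 2 ℕ.≤ n → OnColumn n x₀ x → ¬ OnColumn n x₀ (x ℤ.+ 1ℤ)
  onColumn-next 2≤n on = onColumn-near 0 on 2≤n

  onColumn-previous : ∀ {x} → 2 ℕ.≤ n → OnColumn n x₀ x → ¬ OnColumn n x₀ (x - 1ℤ)
  onColumn-previous {x} 2≤n on on′ = onColumn-next 2≤n on′ (subst (OnColumn n x₀) (sym (x-1+1 x)) on)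

module Extension {n ℓ : ℕ} (2≤n : 2 ℕ.≤ n) (Λ : FominField n ℓ) (k : Kind) (x₀ : ℤ) where

  open FominField Λ

  private
    On : ℤ → Set
    On = OnColumn n x₀

    in-column : ∀ {x y σ} → ActsAt k Λ x y σ → ∀ y′ → ∃[ σ′ ] ActsAt k Λ x y′ σ′
    in-column {x} {y} {σ} a = ℤ-ind (λ y′ → ∃[ σ′ ] ActsAt k Λ x y′ σ′) y (σ , a)
      (λ y (_ , a) → _ , Transport.move* (move-up (at-e₁⁻ Λ x y) (at-e₁ x y) (at-e₂ (x - 1ℤ) y) (square⁻ Λ x y) (square x y) k a))
      (λ y (_ , a) → move-down k (at-e₁⁻ Λ x y) (at-e₁ x y) (at-e₂ (x - 1ℤ) y) (at-e₂ (x ℤ.+ 1ℤ) y) (square⁻ Λ x y) (square x y) a)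

    wrapped : ∀ q {x y z σ} → z ≡ y - q ℤ.* + n → ActsAt k Λ x y σ → ActsAt k Λ (x ℤ.+ q ℤ.* + n) z σ
    wrapped q {x} {y} {_} {σ} refl a = replace
        (sym (shifted (x - 1ℤ) (lemma₁ x (q ℤ.* + n)))) (sym (shifted (x ℤ.+ 1ℤ) (lemma₂ x (q ℤ.* + n)))) (sym (periodic x y q)) a
      where
      replace : ∀ {α α′ γ γ′ β β′} → α ≡ α′ → γ ≡ γ′ → β ≡ β′ → Acts k α γ β σ → Acts k α′ γ′ β′ σ
      replace refl refl refl a = a
      shifted : ∀ u {v} → v ≡ u ℤ.+ q ℤ.* + n → at v (y - q ℤ.* + n) ≡ at u y
      shifted u refl = periodic u y q
      lemma₁ : ∀ x t → x ℤ.+ t - 1ℤ ≡ x - 1ℤ ℤ.+ t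
      lemma₁ = solve-∀
      lemma₂ : ∀ x t → x ℤ.+ t ℤ.+ 1ℤ ≡ x ℤ.+ 1ℤ ℤ.+ t
      lemma₂ = solve-∀

    -- One point suffices: transport up and down reaches its whole column, and periodicity
    -- identifies all columns of the class.
    spread : ∀ {x y σ} → On x → ActsAt k Λ x y σ → ∀ x′ y′ → On x′ → ∃[ σ′ ] ActsAt k Λ x′ y′ σ′
    spread {x} {y} {σ} on a x′ y′ on′ = from (onColumn-offset {n} {x₀} {x} {x′} on on′)
      where
      from : ∃[ q ] x′ ≡ x ℤ.+ q ℤ.* + n → ∃[ σ′ ] ActsAt k Λ x′ y′ σ′
      from (q , refl) = _ , wrapped q (lemma y′ (q ℤ.* + n)) (proj₂ (in-column {x} {y} {σ} a (y′ ℤ.+ q ℤ.* + n)))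
        where
        lemma : ∀ y t → y ≡ y ℤ.+ t - t
        lemma = solve-∀

  module _ (everywhere : ∀ x y → On x → ∃[ σ ] ActsAt k Λ x y σ) where

    private
      value : ∀ x y → Dec (On x) → Signature ℓ
      value x y (yes on) = proj₁ (everywhere x y on)
      value x y (no  _)  = at x y

      at̃ : ℤ → ℤ → Signature ℓ
      at̃ x y = value x y (onColumn? n x₀ x)

      on-at̃ : ∀ {x} y → On x → ActsAt k Λ x y (at̃ x y)
      on-at̃ {x} y on = go (onColumn? n x₀ x)
        where
        go : (d : Dec (On x)) → ActsAt k Λ x y (value x y d)
        go (yes on) = proj₂ (everywhere x y on)
        go (no ¬on) = contradiction on ¬on

      off-at̃ : ∀ {x} y → ¬ On x → at̃ x y ≡ at x y
      off-at̃ {x} y ¬on = go (onColumn? n x₀ x)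
        where
        go : (d : Dec (On x)) → value x y d ≡ at x y
        go (yes on) = contradiction on ¬on
        go (no _)   = refl

      periodic̃ : ∀ x y q → at̃ (x ℤ.+ q ℤ.* + n) (y - q ℤ.* + n) ≡ at̃ x y
      periodic̃ x y q = go (onColumn? n x₀ x)
        where
        go : Dec (On x) → at̃ (x ℤ.+ q ℤ.* + n) (y - q ℤ.* + n) ≡ at̃ x y
        go (yes on) = Acts-functional k (on-at̃ _ (onColumn-shift q on)) (wrapped q refl (on-at̃ y on))
        go (no ¬on) = trans (off-at̃ _ (¬on ∘ onColumn-unshift q)) (trans (periodic x y q) (sym (off-at̃ y ¬on)))

      record Squares (x y : ℤ) : Set where
        field
          left  : FominRule (at (x - 1ℤ) y) (at̃ x y) (at (x - 1ℤ) (y ℤ.+ 1ℤ)) (at̃ x (y ℤ.+ 1ℤ))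
          right : FominRule (at̃ x y) (at (x ℤ.+ 1ℤ) y) (at̃ x (y ℤ.+ 1ℤ)) (at (x ℤ.+ 1ℤ) (y ℤ.+ 1ℤ))

      -- Transport produces some new signature one row higher together with both squares;
      -- functionality of the action identifies it with the value already chosen there.
      squares : ∀ {x} y → On x → Squares x y
      squares {x} y on = from (move-up (at-e₁⁻ Λ x y) (at-e₁ x y) (at-e₂ (x - 1ℤ) y) (square⁻ Λ x y) (square x y) k (on-at̃ y on))
        where
        from : Transport k (at (x - 1ℤ) y) (at (x ℤ.+ 1ℤ) y) (at̃ x y)
                 (at (x - 1ℤ) (y ℤ.+ 1ℤ)) (at (x ℤ.+ 1ℤ) (y ℤ.+ 1ℤ)) (at x (y ℤ.+ 1ℤ)) → Squares x y
        from t = record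
          { left  = subst (FominRule (at (x - 1ℤ) y) (at̃ x y) (at (x - 1ℤ) (y ℤ.+ 1ℤ))) same (Transport.left t)
          ; right = subst (λ τ → FominRule (at̃ x y) (at (x ℤ.+ 1ℤ) y) τ (at (x ℤ.+ 1ℤ) (y ℤ.+ 1ℤ))) same (Transport.right t)
          }
          where
          same : Transport.σ* t ≡ at̃ x (y ℤ.+ 1ℤ)
          same = Acts-functional k (Transport.move* t) (on-at̃ (y ℤ.+ 1ℤ) on)

      e₁̃ : ∀ x y → at̃ x y ⪯ at̃ (x ℤ.+ 1ℤ) y
      e₁̃ x y = go (onColumn? n x₀ x) (onColumn? n x₀ (x ℤ.+ 1ℤ))
        where
        go : Dec (On x) → Dec (On (x ℤ.+ 1ℤ)) → at̃ x y ⪯ at̃ (x ℤ.+ 1ℤ) y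
        -- Excluded by n ≥ 2. In the remaining cases at most one side of the pair is modified, as
        -- `Acts` and `Squares` require.
        go (yes on) (yes on′) = contradiction on′ (onColumn-next 2≤n on)
        go (yes on) (no ¬on′) = subst (at̃ x y ⪯_) (sym (off-at̃ y ¬on′)) (Acts.σ⪯γ (on-at̃ y on))
        go (no ¬on) (yes on′) = subst (_⪯ at̃ (x ℤ.+ 1ℤ) y)
          (trans (cong (λ t → at t y) (x+1-1 x)) (sym (off-at̃ y ¬on))) (Acts.α⪯σ (on-at̃ y on′))
        go (no ¬on) (no ¬on′) = subst₂ _⪯_ (sym (off-at̃ y ¬on)) (sym (off-at̃ y ¬on′)) (at-e₁ x y)

      e₂̃ : ∀ x y → at̃ x y ⪯ at̃ x (y ℤ.+ 1ℤ)
      e₂̃ x y = go (onColumn? n x₀ x)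
        where
        go : Dec (On x) → at̃ x y ⪯ at̃ x (y ℤ.+ 1ℤ)
        go (yes on) = proj₁ (rule-⪯ (Acts.α⪯σ (on-at̃ y on)) (at-e₂ (x - 1ℤ) y) (Squares.left (squares y on)))
        go (no ¬on) = subst₂ _⪯_ (sym (off-at̃ y ¬on)) (sym (off-at̃ (y ℤ.+ 1ℤ) ¬on)) (at-e₂ x y)

      squarẽ : ∀ x y → FominRule (at̃ x y) (at̃ (x ℤ.+ 1ℤ) y) (at̃ x (y ℤ.+ 1ℤ)) (at̃ (x ℤ.+ 1ℤ) (y ℤ.+ 1ℤ))
      squarẽ x y = go (onColumn? n x₀ x) (onColumn? n x₀ (x ℤ.+ 1ℤ))
        where
        Rule : (κ μ θ ν : Signature ℓ) → Set
        Rule = FominRule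
        replace : ∀ {κ κ′ μ μ′ θ θ′ ν ν′} → κ ≡ κ′ → μ ≡ μ′ → θ ≡ θ′ → ν ≡ ν′ → Rule κ μ θ ν → Rule κ′ μ′ θ′ ν′
        replace refl refl refl refl r = r
        go : Dec (On x) → Dec (On (x ℤ.+ 1ℤ)) → Rule (at̃ x y) (at̃ (x ℤ.+ 1ℤ) y) (at̃ x (y ℤ.+ 1ℤ)) (at̃ (x ℤ.+ 1ℤ) (y ℤ.+ 1ℤ))
        go (yes on) (yes on′) = contradiction on′ (onColumn-next 2≤n on)
        go (yes on) (no ¬on′) = replace refl (sym (off-at̃ y ¬on′)) refl (sym (off-at̃ (y ℤ.+ 1ℤ) ¬on′)) (Squares.right (squares y on))
        go (no ¬on) (yes on′) = replace
          (trans (cong (λ t → at t y) (x+1-1 x)) (sym (off-at̃ y ¬on))) refl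
          (trans (cong (λ t → at t (y ℤ.+ 1ℤ)) (x+1-1 x)) (sym (off-at̃ (y ℤ.+ 1ℤ) ¬on))) refl (Squares.left (squares y on′))
        go (no ¬on) (no ¬on′) = replace (sym (off-at̃ y ¬on)) (sym (off-at̃ y ¬on′))
          (sym (off-at̃ (y ℤ.+ 1ℤ) ¬on)) (sym (off-at̃ (y ℤ.+ 1ℤ) ¬on′)) (square x y)

    modified : FominField n ℓ
    modified = record { at = at̃ ; periodic = periodic̃ ; at-e₁ = e₁̃ ; at-e₂ = e₂̃ ; square = squarẽ }

    modified-acts : FieldActs k x₀ Λ modified
    modified-acts = record { off-column = λ x y → off-at̃ y ; on-column = λ x y → on-at̃ y }

  extend : ∀ {x y σ} → On x → ActsAt k Λ x y σ → ∃[ Λ̃ ] FieldActs k x₀ Λ Λ̃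
  extend on a = modified (spread on a) , modified-acts (spread on a)

module _ {n ℓ : ℕ} {k : Kind} {x₀ : ℤ} where

  FieldActs-functional : {Λ Λ̃ Λ̃′ : FominField n ℓ} → FieldActs k x₀ Λ Λ̃ → FieldActs k x₀ Λ Λ̃′ →
    ∀ x y → FominField.at Λ̃ x y ≡ FominField.at Λ̃′ x y
  FieldActs-functional a a′ x y with onColumn? n x₀ x
  ... | yes on = Acts-functional k (FieldActs.on-column a x y on) (FieldActs.on-column a′ x y on)
  ... | no ¬on = trans (FieldActs.off-column a x y ¬on) (sym (FieldActs.off-column a′ x y ¬on))

  FieldActs-flip : {Λ Λ̃ : FominField n ℓ} → 2 ℕ.≤ n → FieldActs k x₀ Λ Λ̃ → FieldActs (flip k) x₀ Λ̃ Λ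
  FieldActs-flip {Λ} {Λ̃} 2≤n a = record
    { off-column = λ x y ¬on → sym (FieldActs.off-column a x y ¬on)
    ; on-column  = λ x y on → subst₂ (λ α γ → Acts (flip k) α γ (FominField.at Λ̃ x y) (FominField.at Λ x y))
        (sym (FieldActs.off-column a _ y (onColumn-previous 2≤n on)))
        (sym (FieldActs.off-column a _ y (onColumn-next 2≤n on)))
        (move-flip k (at-e₁⁻ Λ x y) (FominField.at-e₁ Λ x y) (FieldActs.on-column a x y on))
    }

-- Reading words

-- A reduced word )...)(...(, given by the rows of its surviving brackets.
shape : List (Fin ℓ) → List (Fin ℓ) → List (Bracket ℓ)
shape js ks = List.map closing js ++ List.map opening ks

cancel-opening : ∀ (j : Fin ℓ) ks → cancel (opening j) (List.map opening ks) ≡ List.map opening (j ∷ ks)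
cancel-opening j []      = refl
cancel-opening j (_ ∷ _) = refl

replicate-∷ : ∀ {A : Set} b (j : A) ks → replicate b j ++ j ∷ ks ≡ j ∷ replicate b j ++ ks
replicate-∷ zero    j ks = refl
replicate-∷ (suc b) j ks = cong (j ∷_) (replicate-∷ b j ks)

openings-shape : ∀ b (j : Fin ℓ) js ks → foldr cancel (shape js ks) (replicate b (opening j)) ≡
  shape (drop b js) (replicate (b ∸ length js) j ++ ks)
openings-shape zero    j js       ks = cong (λ b → shape js (replicate b j ++ ks)) (sym (ℕ.0∸n≡0 (length js)))
openings-shape (suc b) j []       ks = begin
  foldr cancel (List.map opening ks) (replicate (suc b) (opening j))
    ≡⟨ foldr-snoc b j (List.map opening ks) ⟩
  foldr cancel (cancel (opening j) (List.map opening ks)) (replicate b (opening j))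
    ≡⟨ cong (λ w → foldr cancel w (replicate b (opening j))) (cancel-opening j ks) ⟩
  foldr cancel (shape [] (j ∷ ks)) (replicate b (opening j))
    ≡⟨ openings-shape b j [] (j ∷ ks) ⟩
  shape (drop b []) (replicate b j ++ j ∷ ks)
    ≡⟨ cong₂ shape (List.drop-[] b) (replicate-∷ b j ks) ⟩
  shape [] (replicate (suc b) j ++ ks) ∎
  where open ≡-Reasoning
openings-shape (suc b) j (k ∷ js) ks = trans (foldr-snoc b j (shape (k ∷ js) ks)) (openings-shape b j js ks)

block-shape : ∀ (j : Fin ℓ) a b js ks → foldr cancel (shape js ks) (block j a b) ≡
  shape (replicate a j ++ drop b js) (replicate (b ∸ length js) j ++ ks)
block-shape j a b js ks = begin
  foldr cancel (shape js ks) (block j a b)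
    ≡⟨ block-fold j a b (shape js ks) ⟩
  replicate a (closing j) ++ foldr cancel (shape js ks) (replicate b (opening j))
    ≡⟨ cong₂ _++_ (sym (List.map-replicate closing a j)) (openings-shape b j js ks) ⟩
  List.map closing (replicate a j) ++ (List.map closing (drop b js) ++ List.map opening ks′)
    ≡⟨ List.++-assoc (List.map closing (replicate a j)) _ _ ⟨
  (List.map closing (replicate a j) ++ List.map closing (drop b js)) ++ List.map opening ks′
    ≡⟨ cong (_++ List.map opening ks′) (List.map-++ closing (replicate a j) (drop b js)) ⟨
  shape (replicate a j ++ drop b js) ks′ ∎
  where
  open ≡-Reasoning
  ks′ : List _
  ks′ = replicate (b ∸ length js) j ++ ks

leftmost-shape : ∀ (js ks : List (Fin ℓ)) → leftmostOpening (shape js ks) ≡ head ks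
leftmost-shape (_ ∷ js) ks      = leftmost-shape js ks
leftmost-shape []       []      = refl
leftmost-shape []       (_ ∷ _) = refl

rightmost-shape : ∀ (js ks : List (Fin ℓ)) → rightmostClosing (shape js ks) ≡ last js
rightmost-shape []            []       = refl
rightmost-shape []            (_ ∷ ks) = rightmost-shape [] ks
rightmost-shape (j ∷ [])      ks       = cong (Maybe._<∣> just j) (rightmost-shape [] ks)
rightmost-shape (j ∷ k ∷ js)  ks       = trans (cong (Maybe._<∣> just j) (rightmost-shape (k ∷ js) ks)) (last-just k js)
  where
  last-just : ∀ {A : Set} {j : A} k js → (last (k ∷ js) Maybe.<∣> just j) ≡ last (k ∷ js)
  last-just k []       = refl
  last-just k (l ∷ js) = last-just l js

last-++ : ∀ {A : Set} (js : List A) k ks → last (js ++ k ∷ ks) ≡ last (k ∷ ks)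
last-++ []           k ks = refl
last-++ (j ∷ [])     k ks = refl
last-++ (j ∷ i ∷ js) k ks = last-++ (i ∷ js) k ks

-- Read a word )^aₕ(^bₕ … )^a₀(^b₀ from its right end, counting 1 for "(" and -1 for ")".
-- The count starts at t; peak t a b k is its value just left of the "(" of row k.

peak : ℤ → (a b : Fin rows → ℕ) → Fin rows → ℤ
peak t a b zero    = t ℤ.+ + b zero
peak t a b (suc k) = peak (t ℤ.+ + b zero - + a zero) (a ∘ suc) (b ∘ suc) k

final : ℤ → (a b : Fin rows → ℕ) → ℤ
final {zero}  t a b = t
final {suc rows} t a b = final (t ℤ.+ + b zero - + a zero) (a ∘ suc) (b ∘ suc)

-- The leftmost "(" surviving belongs to the first row where the count attains its maximum.
FirstPeak : (T : Fin rows → ℤ) → ℤ → (Fin rows → Fin ℓ) → Maybe (Fin ℓ) → Maybe (Fin ℓ) → Set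
FirstPeak T m lab default r =
  (r ≡ default × (∀ k → T k ℤ.≤ m)) ⊎
  (∃[ j ] r ≡ just (lab j) × m ℤ.< T j × (∀ k → k Fin.< j → T k ℤ.< T j) × (∀ k → T k ℤ.≤ T j))

-- The rightmost ")" surviving belongs to the last such row, unless the count ends there.
LastPeak : (T : Fin rows → ℤ) → (end m : ℤ) → (Fin rows → Fin ℓ) → Maybe (Fin ℓ) → Maybe (Fin ℓ) → Set
LastPeak T end m lab default r =
  (∃[ j ] r ≡ just (lab j) × end ℤ.< T j × m ℤ.≤ T j × (∀ k → j Fin.< k → T k ℤ.< T j) × (∀ k → T k ℤ.≤ T j)) ⊎
  (∃[ i ] default ≡ just i × r ≡ just i × (∀ k → T k ℤ.< m) × end ℤ.< m) ⊎
  (r ≡ nothing × (∀ k → T k ℤ.≤ end) × m ℤ.≤ end)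

Fin-cases : {P : Fin (suc rows) → Set} → P zero → (∀ k → P (suc k)) → ∀ k → P k
Fin-cases z s zero    = z
Fin-cases z s (suc k) = s k

module Records {m : ℤ} (t : ℤ) (a b n : ℕ) (m≡ : m ≡ t ℤ.+ + n) where

  record-kept : b ℕ.≤ n → m ≡ (t ℤ.+ + b - + a) ℤ.+ + (a + (n ∸ b))
  record-kept b≤n = trans m≡ (trans (cong (λ c → t ℤ.+ + c) (sym (ℕ.m+[n∸m]≡n b≤n)))
    (lemma t (+ a) (+ b) (+ (n ∸ b))))
    where
    lemma : ∀ t a b c → t ℤ.+ (b ℤ.+ c) ≡ (t ℤ.+ b - a) ℤ.+ (a ℤ.+ c)
    lemma = solve-∀

  record-broken : n ℕ.≤ b → t ℤ.+ + b ≡ (t ℤ.+ + b - + a) ℤ.+ + (a + (n ∸ b))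
  record-broken n≤b = trans (lemma t (+ a) (+ b))
    (cong (λ c → (t ℤ.+ + b - + a) ℤ.+ (+ a ℤ.+ + c)) (sym (ℕ.m≤n⇒m∸n≡0 n≤b)))
    where
    lemma : ∀ t a b → t ℤ.+ b ≡ (t ℤ.+ b - a) ℤ.+ (a ℤ.+ 0ℤ)
    lemma = solve-∀

  peak≤record : b ℕ.≤ n → t ℤ.+ + b ℤ.≤ m
  peak≤record b≤n = ℤ.≤-trans (ℤ.+-monoʳ-≤ t (ℤ.+≤+ b≤n)) (ℤ.≤-reflexive (sym m≡))

  peak<record : b ℕ.< n → t ℤ.+ + b ℤ.< m
  peak<record b<n = ℤ.<-≤-trans (ℤ.+-monoʳ-< t (ℤ.+<+ b<n)) (ℤ.≤-reflexive (sym m≡))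

  record<peak : n ℕ.< b → m ℤ.< t ℤ.+ + b
  record<peak n<b = ℤ.≤-<-trans (ℤ.≤-reflexive m≡) (ℤ.+-monoʳ-< t (ℤ.+<+ n<b))

  record≤peak : n ℕ.≤ b → m ℤ.≤ t ℤ.+ + b
  record≤peak n≤b = ℤ.≤-trans (ℤ.≤-reflexive m≡) (ℤ.+-monoʳ-≤ t (ℤ.+≤+ n≤b))

length-js : ∀ {A : Set} a b (j : A) js → length (replicate a j ++ drop b js) ≡ a + (length js ∸ b)
length-js a b j js = trans (List.length-++ (replicate a j)) (cong₂ _+_ (List.length-replicate a) (List.length-drop b js))

scan-shape : ∀ (lab : Fin (suc rows) → Fin ℓ) a b js ks →
  foldr cancel (shape js ks) (Block lab a b) ≡
  foldr cancel (shape (replicate (a zero) (lab zero) ++ drop (b zero) js) (replicate (b zero ∸ length js) (lab zero) ++ ks))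
    (Block (lab ∘ suc) (a ∘ suc) (b ∘ suc))
scan-shape lab a b js ks = trans (List.foldr-++ cancel (shape js ks) (Block (lab ∘ suc) (a ∘ suc) (b ∘ suc)) _)
  (cong (λ s → foldr cancel s (Block (lab ∘ suc) (a ∘ suc) (b ∘ suc))) (block-shape (lab zero) (a zero) (b zero) js ks))

-- A "(" survives exactly if it takes the count to a new record, so the leftmost survivor is the
-- step that first attains the maximum. Invariant: m is the record so far, and the ")" that can
-- still be cancelled, listed in `js`, number m - t. The answer so far is `head ks`.
scan-first : ∀ (lab : Fin rows → Fin ℓ) a b js ks t m → m ≡ t ℤ.+ + length js →
  FirstPeak (peak t a b) m lab (head ks) (leftmostOpening (foldr cancel (shape js ks) (Block lab a b)))
scan-first {zero}  lab a b js ks t m m≡ = inj₁ (leftmost-shape js ks , λ ())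
scan-first {suc rows} lab a b js ks t m m≡ = go (b zero ℕ.≤? length js)
  where
  open Records t (a zero) (b zero) (length js) m≡
  js′ ks′ : List _
  js′ = replicate (a zero) (lab zero) ++ drop (b zero) js
  ks′ = replicate (b zero ∸ length js) (lab zero) ++ ks
  r : Maybe _
  r = leftmostOpening (foldr cancel (shape js′ ks′) (Block (lab ∘ suc) (a ∘ suc) (b ∘ suc)))
  t′ T₀ : ℤ
  t′ = t ℤ.+ + b zero - + a zero
  T₀ = t ℤ.+ + b zero
  T : Fin (suc rows) → ℤ
  T = peak t a b
  rest : ∀ m′ → m′ ≡ t′ ℤ.+ + (a zero + (length js ∸ b zero)) →
    FirstPeak (peak t′ (a ∘ suc) (b ∘ suc)) m′ (lab ∘ suc) (head ks′) r
  rest m′ eq = scan-first (lab ∘ suc) (a ∘ suc) (b ∘ suc) js′ ks′ t′ m′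
    (trans eq (cong (λ c → t′ ℤ.+ + c) (sym (length-js (a zero) (b zero) (lab zero) js))))
  kept : b zero ℕ.≤ length js → FirstPeak (peak t′ (a ∘ suc) (b ∘ suc)) m (lab ∘ suc) (head ks′) r →
    FirstPeak T m lab (head ks) r
  kept b≤ (inj₁ (r≡ , ≤m)) = inj₁
    (trans r≡ (cong (λ c → head (replicate c (lab zero) ++ ks)) (ℕ.m≤n⇒m∸n≡0 b≤)) , Fin-cases (peak≤record b≤) ≤m)
  kept b≤ (inj₂ (j , r≡ , m< , <j , ≤j)) = inj₂ (suc j , r≡ , m<
    , Fin-cases (λ _ → ℤ.≤-<-trans (peak≤record b≤) m<) (λ k k< → <j k (ℕ.s≤s⁻¹ k<))
    , Fin-cases (ℤ.≤-trans (peak≤record b≤) (ℤ.<⇒≤ m<)) ≤j)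
  broken : length js ℕ.< b zero → FirstPeak (peak t′ (a ∘ suc) (b ∘ suc)) T₀ (lab ∘ suc) (head ks′) r →
    FirstPeak T m lab (head ks) r
  broken <b (inj₁ (r≡ , ≤T₀)) = inj₂ (zero , trans r≡ (first-of (ℕ.m<n⇒0<n∸m <b)) , record<peak <b
    , (λ _ ()) , Fin-cases ℤ.≤-refl ≤T₀)
    where
    first-of : ∀ {c} → 0 ℕ.< c → head (replicate c (lab zero) ++ ks) ≡ just (lab zero)
    first-of (s≤s _) = refl
  broken <b (inj₂ (j , r≡ , T₀< , <j , ≤j)) = inj₂ (suc j , r≡ , ℤ.<-trans (record<peak <b) T₀<
    , Fin-cases (λ _ → T₀<) (λ k k< → <j k (ℕ.s≤s⁻¹ k<)) , Fin-cases (ℤ.<⇒≤ T₀<) ≤j)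
  go : Dec (b zero ℕ.≤ length js) → _
  go d = subst (λ w → FirstPeak T m lab (head ks) (leftmostOpening w)) (sym (scan-shape lab a b js ks)) (cases d)
    where
    cases : Dec (b zero ℕ.≤ length js) → FirstPeak T m lab (head ks) r
    cases (yes b≤) = kept b≤ (rest m (record-kept b≤))
    cases (no b≰)  = broken (ℕ.≰⇒> b≰) (rest T₀ (record-broken (ℕ.<⇒≤ (ℕ.≰⇒> b≰))))

-- The rightmost surviving ")" is the step by which the count leaves its maximum for good; hence a
-- later row wins ties, and nothing survives if the count ends at its maximum. The answer so far is
-- `last js`.
scan-last : ∀ (lab : Fin rows → Fin ℓ) a b js ks t m → m ≡ t ℤ.+ + length js →
  LastPeak (peak t a b) (final t a b) m lab (last js) (rightmostClosing (foldr cancel (shape js ks) (Block lab a b)))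
scan-last {zero} lab a b []       ks t m m≡ = inj₂ (inj₂ (rightmost-shape [] ks , (λ ()) , ℤ.≤-reflexive (trans m≡ (ℤ.+-identityʳ t))))
scan-last {zero} lab a b (j ∷ js) ks t m m≡ = inj₂ (inj₁ (proj₁ (nonempty j js) , proj₂ (nonempty j js) ,
    trans (rightmost-shape (j ∷ js) ks) (proj₂ (nonempty j js)) , (λ ()) ,
    ℤ.<-≤-trans (ℤ.≤-<-trans (ℤ.≤-reflexive (sym (ℤ.+-identityʳ t))) (ℤ.+-monoʳ-< t (ℤ.+<+ (s≤s z≤n)))) (ℤ.≤-reflexive (sym m≡))))
  where
  nonempty : ∀ {A : Set} (j : A) js → ∃[ i ] last (j ∷ js) ≡ just i
  nonempty j []       = j , refl
  nonempty j (k ∷ js) = nonempty k js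
scan-last {suc rows} lab a b js ks t m m≡ = go (b zero ℕ.<? length js)
  where
  open Records t (a zero) (b zero) (length js) m≡
  js′ ks′ : List _
  js′ = replicate (a zero) (lab zero) ++ drop (b zero) js
  ks′ = replicate (b zero ∸ length js) (lab zero) ++ ks
  r : Maybe _
  r = rightmostClosing (foldr cancel (shape js′ ks′) (Block (lab ∘ suc) (a ∘ suc) (b ∘ suc)))
  t′ T₀ end : ℤ
  t′ = t ℤ.+ + b zero - + a zero
  T₀ = t ℤ.+ + b zero
  end = final t′ (a ∘ suc) (b ∘ suc)
  T : Fin (suc rows) → ℤ
  T = peak t a b
  rest : ∀ m′ → m′ ≡ t′ ℤ.+ + (a zero + (length js ∸ b zero)) →
    LastPeak (peak t′ (a ∘ suc) (b ∘ suc)) end m′ (lab ∘ suc) (last js′) r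
  rest m′ eq = scan-last (lab ∘ suc) (a ∘ suc) (b ∘ suc) js′ ks′ t′ m′
    (trans eq (cong (λ c → t′ ℤ.+ + c) (sym (length-js (a zero) (b zero) (lab zero) js))))
  kept : b zero ℕ.< length js → LastPeak (peak t′ (a ∘ suc) (b ∘ suc)) end m (lab ∘ suc) (last js′) r →
    LastPeak T end m lab (last js) r
  kept b< (inj₁ (j , r≡ , end< , m≤ , >j , ≤j)) = inj₁ (suc j , r≡ , end< , m≤
    , Fin-cases (λ ()) (λ k j<k → >j k (ℕ.s≤s⁻¹ j<k)) , Fin-cases (ℤ.≤-trans (ℤ.<⇒≤ (peak<record b<)) m≤) ≤j)
  kept b< (inj₂ (inj₁ (i , last≡ , r≡ , <m , end<))) = inj₂ (inj₁ (i , trans (sym (last-drop (a zero) (b zero) js b<)) last≡ , r≡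
    , Fin-cases (peak<record b<) <m , end<))
    where
    last-drop : ∀ a b js → b ℕ.< length js → last (replicate a (lab zero) ++ drop b js) ≡ last js
    last-drop a zero    (j ∷ js)     _ = last-++ (replicate a (lab zero)) j js
    last-drop a (suc b) (j ∷ [])     (s≤s ())
    last-drop a (suc b) (j ∷ k ∷ js) (s≤s b<) = last-drop a b (k ∷ js) b<
  kept b< (inj₂ (inj₂ (r≡ , ≤end , m≤))) = inj₂ (inj₂ (r≡ , Fin-cases (ℤ.≤-trans (ℤ.<⇒≤ (peak<record b<)) m≤) ≤end , m≤))
  broken : length js ℕ.≤ b zero → LastPeak (peak t′ (a ∘ suc) (b ∘ suc)) end T₀ (lab ∘ suc) (last js′) r →
    LastPeak T end m lab (last js) r
  broken ≤b (inj₁ (j , r≡ , end< , T₀≤ , >j , ≤j)) = inj₁ (suc j , r≡ , end< , ℤ.≤-trans (record≤peak ≤b) T₀≤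
    , Fin-cases (λ ()) (λ k j<k → >j k (ℕ.s≤s⁻¹ j<k)) , Fin-cases T₀≤ ≤j)
  -- Every older ")" has been cancelled by the "(" of this row, so the ")" kept by the rest of the
  -- scan belongs to row zero.
  broken ≤b (inj₂ (inj₁ (i , last≡ , r≡ , <T₀ , end<))) = inj₁ (zero
    , trans r≡ (only (a zero) (trans (cong (λ js → last (replicate (a zero) (lab zero) ++ js)) (sym (List.drop-all (b zero) js ≤b))) last≡))
    , end< , record≤peak ≤b , Fin-cases (λ ()) (λ k _ → <T₀ k) , Fin-cases ℤ.≤-refl (λ k → ℤ.<⇒≤ (<T₀ k)))
    where
    only : ∀ {i} c → last (replicate c (lab zero) ++ []) ≡ just i → just i ≡ just (lab zero)
    only (suc zero)    eq = sym eq
    only (suc (suc c)) eq = only (suc c) eq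
  broken ≤b (inj₂ (inj₂ (r≡ , ≤end , T₀≤))) = inj₂ (inj₂ (r≡ , Fin-cases T₀≤ ≤end , ℤ.≤-trans (record≤peak ≤b) T₀≤))
  go : Dec (b zero ℕ.< length js) → _
  go d = subst (λ w → LastPeak T end m lab (last js) (rightmostClosing w)) (sym (scan-shape lab a b js ks)) (cases d)
    where
    cases : Dec (b zero ℕ.< length js) → LastPeak T end m lab (last js) r
    cases (yes b<) = kept b< (rest m (record-kept (ℕ.<⇒≤ b<)))
    cases (no b≮)  = broken (ℕ.≮⇒≥ b≮) (rest T₀ (record-broken (ℕ.≮⇒≥ b≮)))

-- From the count along the rows to the height along the columns

sumMin-raise-before : ∀ (v : Vec ℤ ℓ) j {x} → x ℤ.≤ lookup v j → sumMin (Vec.updateAt v j (ℤ._+ 1ℤ)) x ≡ sumMin v x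
sumMin-raise-before (p ∷ v) zero    {x} x≤p = cong (ℤ._+ sumMin v x)
  (trans (ℤ.i≥j⇒i⊓j≡j (ℤ.≤-trans x≤p (ℤ.i≤i+j p 1ℤ))) (sym (ℤ.i≥j⇒i⊓j≡j x≤p)))
sumMin-raise-before (p ∷ v) (suc j) {x} x≤p = cong (λ t → p ⊓ x ℤ.+ t) (sumMin-raise-before v j x≤p)

sumMin-raise-after : ∀ (v : Vec ℤ ℓ) j {x} → lookup v j ℤ.+ 1ℤ ℤ.≤ x →
  sumMin (Vec.updateAt v j (ℤ._+ 1ℤ)) x ≡ sumMin v x ℤ.+ 1ℤ
sumMin-raise-after (p ∷ v) zero    {x} p< = trans
  (cong (ℤ._+ sumMin v x) (trans (ℤ.i≤j⇒i⊓j≡i p<) (cong (ℤ._+ 1ℤ) (sym (ℤ.i≤j⇒i⊓j≡i (ℤ.≤-trans (ℤ.i≤i+j p 1ℤ) p<))))))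
  (lemma (p ⊓ x) (sumMin v x))
  where
  lemma : ∀ a b → a ℤ.+ 1ℤ ℤ.+ b ≡ a ℤ.+ b ℤ.+ 1ℤ
  lemma = solve-∀
sumMin-raise-after (p ∷ v) (suc j) {x} p< = trans (cong (λ t → p ⊓ x ℤ.+ t) (sumMin-raise-after v j p<))
  (sym (ℤ.+-assoc (p ⊓ x) (sumMin v x) 1ℤ))

-- In a row before k all three minima equal x and cancel, leaving b - a. Row k, where β ends at x,
-- leaves b. In a row after k the minima are the full parts and nothing is left.
peak-sum : ∀ (α β γ : Vec ℤ ℓ) (a b : Fin ℓ → ℕ) →
  (∀ j → + a j ≡ lookup β j - lookup α j) → (∀ j → + b j ≡ lookup γ j - lookup β j) →
  ∀ t k x → lookup β k ≡ x → (∀ s → s Fin.< k → x ℤ.≤ lookup α s) → (∀ s → k Fin.< s → lookup γ s ℤ.≤ x) →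
  t ℤ.+ (total γ ℤ.+ total α - (total β ℤ.+ total β)) - (sumMin γ x ℤ.+ sumMin α x - (sumMin β x ℤ.+ sumMin β x)) ≡ peak t a b k
peak-sum (p ∷ α) (q ∷ β) (r ∷ γ) a b a≡ b≡ t zero x refl left right = by-≡
  (lemma t r (total γ) p (total α) q (total β) (r ⊓ q) (sumMin γ q) (p ⊓ q) (sumMin α q) (q ⊓ q) (sumMin β q) (+ b zero))
  (diff-≡ (sym (b≡ zero)) ⟨-⟩ diff-≡ (ℤ.i≥j⇒i⊓j≡j q≤r) ⟨-⟩ diff-≡ (ℤ.i≤j⇒i⊓j≡i p≤q)
    ⟨-⟩ diff-≡ (sym (ℤ.⊓-idem q)) ⟨-⟩ diff-≡ (sym (ℤ.⊓-idem q))
    ⟨-⟩ diff-≡ (sumMin-high γ q γ≤) ⟨-⟩ diff-≡ (sumMin-high α q α≤)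
    ⟨-⟩ diff-≡ (sym (sumMin-high β q β≤)) ⟨-⟩ diff-≡ (sym (sumMin-high β q β≤)))
  where
  q≤r : q ℤ.≤ r
  q≤r = ℤ.0≤i-j⇒j≤i (subst (0ℤ ℤ.≤_) (b≡ zero) (ℤ.+≤+ z≤n))
  p≤q : p ℤ.≤ q
  p≤q = ℤ.0≤i-j⇒j≤i (subst (0ℤ ℤ.≤_) (a≡ zero) (ℤ.+≤+ z≤n))
  γ≤ : ∀ s → lookup γ s ℤ.≤ q
  γ≤ s = right (suc s) (s≤s z≤n)
  β≤ : ∀ s → lookup β s ℤ.≤ q
  β≤ s = ℤ.≤-trans (ℤ.0≤i-j⇒j≤i (subst (0ℤ ℤ.≤_) (b≡ (suc s)) (ℤ.+≤+ z≤n))) (γ≤ s)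
  α≤ : ∀ s → lookup α s ℤ.≤ q
  α≤ s = ℤ.≤-trans (ℤ.0≤i-j⇒j≤i (subst (0ℤ ℤ.≤_) (a≡ (suc s)) (ℤ.+≤+ z≤n))) (β≤ s)
  lemma : ∀ t r g p a q b r′ g′ p′ a′ q′ b′ b₀ →
    t ℤ.+ (r ℤ.+ g ℤ.+ (p ℤ.+ a) - (q ℤ.+ b ℤ.+ (q ℤ.+ b))) - (r′ ℤ.+ g′ ℤ.+ (p′ ℤ.+ a′) - (q′ ℤ.+ b′ ℤ.+ (q′ ℤ.+ b′)))
      - (t ℤ.+ b₀) ≡
    (r - q - b₀) - (r′ - q) - (p′ - p) - (q - q′) - (q - q′) - (g′ - g) - (a′ - a) - (b - b′) - (b - b′)
  lemma = solve-∀
peak-sum (p ∷ α) (q ∷ β) (r ∷ γ) a b a≡ b≡ t (suc k) x eq left right = by-≡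
  (lemma t r (total γ) p (total α) q (total β) x (r ⊓ x) (sumMin γ x) (p ⊓ x) (sumMin α x) (q ⊓ x) (sumMin β x)
    (+ a zero) (+ b zero) (peak (t ℤ.+ + b zero - + a zero) (a ∘ suc) (b ∘ suc) k))
  (diff-≡ (peak-sum α β γ (a ∘ suc) (b ∘ suc) (a≡ ∘ suc) (b≡ ∘ suc) (t ℤ.+ + b zero - + a zero) k x eq
      (λ s s< → left (suc s) (s≤s s<)) (λ s k<s → right (suc s) (s≤s k<s)))
    ⟨-⟩ diff-≡ (b≡ zero) ⟨-⟩ diff-≡ (sym (a≡ zero))
    ⟨-⟩ diff-≡ (ℤ.i≥j⇒i⊓j≡j (ℤ.≤-trans x≤q q≤r)) ⟨-⟩ diff-≡ (ℤ.i≥j⇒i⊓j≡j x≤p)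
    ⟨-⟩ diff-≡ (sym (ℤ.i≥j⇒i⊓j≡j x≤q)) ⟨-⟩ diff-≡ (sym (ℤ.i≥j⇒i⊓j≡j x≤q)))
  where
  x≤p : x ℤ.≤ p
  x≤p = left zero (s≤s z≤n)
  q≤r : q ℤ.≤ r
  q≤r = ℤ.0≤i-j⇒j≤i (subst (0ℤ ℤ.≤_) (b≡ zero) (ℤ.+≤+ z≤n))
  x≤q : x ℤ.≤ q
  x≤q = ℤ.≤-trans x≤p (ℤ.0≤i-j⇒j≤i (subst (0ℤ ℤ.≤_) (a≡ zero) (ℤ.+≤+ z≤n)))
  lemma : ∀ t r g p a q b x r′ g′ p′ a′ q′ b′ a₀ b₀ s →
    t ℤ.+ (r ℤ.+ g ℤ.+ (p ℤ.+ a) - (q ℤ.+ b ℤ.+ (q ℤ.+ b))) - (r′ ℤ.+ g′ ℤ.+ (p′ ℤ.+ a′) - (q′ ℤ.+ b′ ℤ.+ (q′ ℤ.+ b′))) - s ≡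
    (t ℤ.+ b₀ - a₀ ℤ.+ (g ℤ.+ a - (b ℤ.+ b)) - (g′ ℤ.+ a′ - (b′ ℤ.+ b′)) - s)
      - (b₀ - (r - q)) - (q - p - a₀) - (r′ - x) - (p′ - x) - (x - q′) - (x - q′)
  lemma = solve-∀

final-sum : ∀ (α β γ : Vec ℤ ℓ) (a b : Fin ℓ → ℕ) →
  (∀ j → + a j ≡ lookup β j - lookup α j) → (∀ j → + b j ≡ lookup γ j - lookup β j) →
  ∀ t → t ℤ.+ (total γ ℤ.+ total α - (total β ℤ.+ total β)) ≡ final t a b
final-sum [] [] [] a b a≡ b≡ t = ℤ.+-identityʳ t
final-sum (p ∷ α) (q ∷ β) (r ∷ γ) a b a≡ b≡ t = trans (lemma t r (total γ) p (total α) q (total β))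
  (trans (cong₂ (λ A B → t ℤ.+ B - A ℤ.+ (total γ ℤ.+ total α - (total β ℤ.+ total β))) (sym (a≡ zero)) (sym (b≡ zero)))
    (final-sum α β γ (a ∘ suc) (b ∘ suc) (a≡ ∘ suc) (b≡ ∘ suc) _))
  where
  lemma : ∀ t r g p a q b → t ℤ.+ (r ℤ.+ g ℤ.+ (p ℤ.+ a) - (q ℤ.+ b ℤ.+ (q ℤ.+ b))) ≡ t ℤ.+ (r - q) - (q - p) ℤ.+ (g ℤ.+ a - (b ℤ.+ b))
  lemma = solve-∀

-- Row ends as local minima of the height

module Valleys {α β γ : Signature ℓ} (α⪯β : α ⪯ β) (β⪯γ : β ⪯ γ) where

  h : ℤ → ℤ
  h = height α γ β

  p q : ℤ → ℕ
  p x = conjℕ β x ∸ conjℕ α x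
  q x = conjℕ γ x ∸ conjℕ β x

  left-≥ : ∀ k s → s Fin.< k → part β k ℤ.≤ part α s
  left-≥ k s s<k = conj⇒ α _ s (ℕ.≤-trans s<k (ℕ.s≤s⁻¹ (ℕ.≤-trans (conj⇐ β _ k ℤ.≤-refl) (⪯⇒≤1+ α⪯β (part β k)))))

  right-≤ : ∀ k s → k Fin.< s → part γ s ℤ.≤ part β k
  right-≤ k s k<s = ℤ.≮⇒≥ λ β<γ → ℤ.<⇒≱ (x<x+1 (part β k))
    (conj⇒ β (part β k ℤ.+ 1ℤ) k (ℕ.≤-trans k<s
      (ℕ.s≤s⁻¹ (ℕ.≤-trans (conj⇐ γ _ s (<⇒+1≤ β<γ)) (⪯⇒≤1+ β⪯γ (part β k ℤ.+ 1ℤ))))))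

  rise : ∀ {u v} → u ℤ.≤ v → (∀ y → u ℤ.< y → y ℤ.≤ v → p y ℕ.≤ q y) → h u ℤ.≤ h v
  rise {u} {v} u≤v p≤q = ≤-rec (λ y → y ℤ.≤ v → h u ℤ.≤ h y) u (λ _ → ℤ.≤-refl)
    (λ y u<y ih y≤v → ℤ.≤-trans (ih (ℤ.≤-trans (ℤ.i-j≤i y 1ℤ) y≤v))
      (by-≤ (lemma (h y) (h (y - 1ℤ)) (+ p y) (+ q y))
        (≡0⇒≥0 (diff-≡ (height-step α⪯β β⪯γ y)) ⟨+⟩ ≥0 (ℤ.+≤+ (p≤q y u<y y≤v))))) u≤v ℤ.≤-refl
    where
    lemma : ∀ h h′ p q → h - h′ ≡ (h ℤ.+ p - (h′ ℤ.+ q)) ℤ.+ (q - p)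
    lemma = solve-∀

  fall : ∀ {u v} → u ℤ.≤ v → (∀ y → u ℤ.< y → y ℤ.≤ v → q y ℕ.≤ p y) → h v ℤ.≤ h u
  fall {u} {v} u≤v q≤p = ≤-rec (λ y → y ℤ.≤ v → h y ℤ.≤ h u) u (λ _ → ℤ.≤-refl)
    (λ y u<y ih y≤v → ℤ.≤-trans
      (by-≤ (lemma (h y) (h (y - 1ℤ)) (+ p y) (+ q y))
        (≡0⇒≥0 (diff-≡ (sym (height-step α⪯β β⪯γ y))) ⟨+⟩ ≥0 (ℤ.+≤+ (q≤p y u<y y≤v))))
      (ih (ℤ.≤-trans (ℤ.i-j≤i y 1ℤ) y≤v))) u≤v ℤ.≤-refl
    where
    lemma : ∀ h h′ p q → h′ - h ≡ (h′ ℤ.+ q - (h ℤ.+ p)) ℤ.+ (p - q)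
    lemma = solve-∀

  -- The height has its local minima at the ends of the rows of β.
  data Valley (x : ℤ) : Set where
    rising  : ∀ k → part β k ℤ.< x → toℕ k ≡ conjℕ β x →
      (∀ y → part β k ℤ.≤ y → y ℤ.≤ x → h y ℤ.≤ h x) → Valley x
    falling : ∀ k → x ℤ.≤ part β k → suc (toℕ k) ≡ conjℕ β x →
      (∀ y → x ℤ.≤ y → y ℤ.≤ part β k → h y ℤ.≤ h x) → Valley x
    empty   : ℓ ≡ 0 → Valley x

  -- If β exceeds α in column x, then the conjugate of α is too small for them to agree again before
  -- the end of the lowest row of β that reaches x, so the height does not rise up to there. If they
  -- agree in column x, they agree back to the end of the next row, which lies left of x, and the
  -- height does not fall from there to x.
  valley : ∀ x → Valley x
  valley x = go (conjℕ β x) refl (p x) refl (⪯-bit α⪯β x)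
    where
    row : ∀ {m} → m ℕ.< ℓ → Fin ℓ
    row m<ℓ = Fin.fromℕ< m<ℓ
    fallen : ∀ {m} (m<ℓ : m ℕ.< ℓ) → conjℕ β x ≡ suc m →
      (∀ y → x ℤ.< y → y ℤ.≤ part β (row m<ℓ) → q y ℕ.≤ p y) → Valley x
    fallen {m} m<ℓ m≡ q≤p = falling (row m<ℓ)
      (conj⇒ β x (row m<ℓ) (subst₂ ℕ._<_ (sym (Fin.toℕ-fromℕ< m<ℓ)) (sym m≡) ℕ.≤-refl))
      (trans (cong suc (Fin.toℕ-fromℕ< m<ℓ)) (sym m≡))
      (λ y x≤y y≤ → fall x≤y (λ z x<z z≤y → q≤p z x<z (ℤ.≤-trans z≤y y≤)))
    above : ∀ {m} (m<ℓ : m ℕ.< ℓ) y → y ℤ.≤ part β (row m<ℓ) → suc m ℕ.≤ conjℕ β y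
    above m<ℓ y y≤ = subst (λ t → suc t ℕ.≤ conjℕ β y) (Fin.toℕ-fromℕ< m<ℓ) (conj⇐ β y (row m<ℓ) y≤)
    α-conj : ∀ c → p x ≡ c → conjℕ β x ≡ conjℕ α x + c
    α-conj c eq = trans (⪯-split α⪯β x) (cong (λ t → conjℕ α x + t) eq)
    go : ∀ m → conjℕ β x ≡ m → ∀ c → p x ≡ c → Bit c → Valley x
    go m m≡ .1 p≡ bit₁ = one m m≡
      where
      one : ∀ m → conjℕ β x ≡ m → Valley x
      one zero    m≡ = contradiction (trans (sym m≡) (trans (α-conj 1 p≡) (ℕ.+-comm (conjℕ α x) 1))) λ ()
      one (suc m) m≡ = fallen m<ℓ m≡ λ y x<y y≤ → ℕ.≤-trans (q≤1 y) (1≤p y x<y y≤)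
        where
        m<ℓ : m ℕ.< ℓ
        m<ℓ = subst (ℕ._≤ ℓ) m≡ (conj≤ β x)
        q≤1 : ∀ y → q y ℕ.≤ 1
        q≤1 y with q y | ⪯-bit β⪯γ y
        ... | _ | bit₀ = z≤n
        ... | _ | bit₁ = s≤s z≤n
        αx : conjℕ α x ≡ m
        αx = ℕ.suc-injective (trans (ℕ.+-comm 1 _) (trans (sym (α-conj 1 p≡)) m≡))
        1≤p : ∀ y → x ℤ.< y → y ℤ.≤ part β (row m<ℓ) → 1 ℕ.≤ p y
        1≤p y x<y y≤ = ℕ.m<n⇒0<n∸m (ℕ.≤-<-trans (conj-antitone α (ℤ.<⇒≤ x<y)) (subst (ℕ._< conjℕ β y) (sym αx) (above m<ℓ y y≤)))
    go m m≡ .0 p≡ bit₀ with m ℕ.<? ℓ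
    ... | yes m<ℓ = rising (row m<ℓ)
        (ℤ.≰⇒> λ x≤ → ℕ.<⇒≱ (above m<ℓ x x≤) (ℕ.≤-reflexive m≡))
        (trans (Fin.toℕ-fromℕ< m<ℓ) (sym m≡))
        (λ y ≤y y≤x → rise y≤x (λ z y<z z≤x → subst (ℕ._≤ q z) (sym (flat z (ℤ.≤-<-trans ≤y y<z) z≤x)) z≤n))
      where
      flat : ∀ z → part β (row m<ℓ) ℤ.< z → z ℤ.≤ x → p z ≡ 0
      flat z <z z≤x = ℕ.m≤n⇒m∸n≡0 (ℕ.≤-trans
        (ℕ.≮⇒≥ λ m< → ℤ.<⇒≱ <z (conj⇒ β z (row m<ℓ) (subst (ℕ._< conjℕ β z) (sym (Fin.toℕ-fromℕ< m<ℓ)) m<)))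
        (ℕ.≤-trans (ℕ.≤-reflexive (trans (sym m≡) (trans (α-conj 0 p≡) (ℕ.+-identityʳ _)))) (conj-antitone α z≤x)))
    -- Every row of β reaches x, so no row ends to the left. Up to the end of the last row the
    -- columns of β are full and γ can add nothing.
    ... | no m≮ℓ = full m m≡ (ℕ.≤-antisym (subst (ℕ._≤ ℓ) m≡ (conj≤ β x)) (ℕ.≮⇒≥ m≮ℓ))
      where
      full : ∀ m → conjℕ β x ≡ m → m ≡ ℓ → Valley x
      full zero    m≡ eq = empty (sym eq)
      full (suc m) m≡ eq = fallen (ℕ.≤-reflexive eq) m≡ λ y x<y y≤ →
        subst (ℕ._≤ p y) (sym (ℕ.m≤n⇒m∸n≡0 (ℕ.≤-trans (conj≤ γ y) (ℕ.≤-trans (ℕ.≤-reflexive (sym eq)) (above (ℕ.≤-reflexive eq) y y≤))))) z≤n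

  height-empty : ℓ ≡ 0 → ∀ x → h x ≡ 0ℤ
  height-empty refl x with parts α | parts β | parts γ
  ... | [] | [] | [] = refl

  height∞-empty : ℓ ≡ 0 → height∞ α γ β ≡ 0ℤ
  height∞-empty refl with parts α | parts β | parts γ
  ... | [] | [] | [] = refl

module Rows {α β γ : Signature ℓ} (α⪯β : α ⪯ β) (β⪯γ : β ⪯ γ) where

  open Valleys α⪯β β⪯γ

  Raised : Fin ℓ → Signature ℓ → Set
  Raised j σ = parts σ ≡ Vec.updateAt (parts β) j (ℤ._+ 1ℤ)

  Lowered : Fin ℓ → Signature ℓ → Set
  Lowered j σ = parts σ ≡ Vec.updateAt (parts β) j (_- 1ℤ)

  -- By `valley` the height at any x is at least its value at some row end, so bounds at row ends
  -- suffice. Right of the new cell this is the end of an earlier row, where the bound is strict, or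
  -- of row j itself.
  raised-acts : ∀ j {σ} → Raised j σ → α ⪯ σ → σ ⪯ γ →
    (∀ k → k Fin.< j → h (part β j) ℤ.+ 1ℤ ℤ.≤ h (part β k)) → (∀ k → h (part β j) ℤ.≤ h (part β k)) →
    Acts E α γ β σ
  raised-acts j {σ} σ≡ α⪯σ σ⪯γ <j ≤j = acts (record
    { col = X ; ψ-before = ψ-before ; ψ-after = ψ-after
    ; height-before = λ x x< → subst (ℤ._≤ h x) (cong h (sym X-1)) (all x (valley x))
    ; height-after  = λ x x≥ → subst (λ t → h t ℤ.+ 1ℤ ℤ.≤ h x) (sym X-1) (after x x≥ (valley x))
    }) α⪯σ σ⪯γ
    where
    X : ℤ
    X = part β j ℤ.+ 1ℤ
    X-1 : X - 1ℤ ≡ part β j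
    X-1 = x+1-1 (part β j)
    ψ-before : ∀ x → x ℤ.< X → ψ σ x ≡ ψ β x
    ψ-before x x< = trans (cong (λ v → sumMin v x) σ≡)
      (sumMin-raise-before (parts β) j (subst (x ℤ.≤_) X-1 (<⇒≤-1 x<)))
    ψ-after : ∀ x → X ℤ.≤ x → ψ σ x ≡ ψ β x ℤ.+ 1ℤ
    ψ-after x x≥ = trans (cong (λ v → sumMin v x) σ≡) (sumMin-raise-after (parts β) j x≥)
    all : ∀ x → Valley x → h (part β j) ℤ.≤ h x
    all x (rising k k< _ low)   = ℤ.≤-trans (≤j k) (low (part β k) ℤ.≤-refl (ℤ.<⇒≤ k<))
    all x (falling k k≥ _ low)  = ℤ.≤-trans (≤j k) (low (part β k) k≥ ℤ.≤-refl)
    all x (empty ℓ≡0)           = contradiction (subst Fin ℓ≡0 j) λ ()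
    conj-X : conjℕ σ X ≡ suc (conjℕ β X)
    conj-X = ℤ.+-injective (trans (conj-ψ σ X) (trans (cong₂ _-_ (ψ-after X ℤ.≤-refl) (ψ-before _ (x-1<x X)))
      (trans (lemma (ψ β X) (ψ β (X - 1ℤ))) (cong (λ t → 1ℤ ℤ.+ t) (sym (conj-ψ β X))))))
      where
      lemma : ∀ a b → a ℤ.+ 1ℤ - b ≡ 1ℤ ℤ.+ (a - b)
      lemma = solve-∀
    climb : h X ≡ h (X - 1ℤ) ℤ.+ 1ℤ
    climb = go (p X) (q X) (⪯-bit β⪯γ X)
      (ℕ.m≤n⇒m∸n≡0 (ℕ.s≤s⁻¹ (subst (ℕ._≤ suc (conjℕ α X)) conj-X (⪯⇒≤1+ α⪯σ X))))
      (ℕ.m<n⇒0<n∸m (subst (ℕ._≤ conjℕ γ X) conj-X (⪯⇒≤ σ⪯γ X))) (height-step α⪯β β⪯γ X)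
      where
      go : ∀ p q → Bit q → p ≡ 0 → 0 ℕ.< q → h X ℤ.+ + p ≡ h (X - 1ℤ) ℤ.+ + q → h X ≡ h (X - 1ℤ) ℤ.+ 1ℤ
      go _ _ bit₁ refl _ eq = trans (sym (ℤ.+-identityʳ _)) eq
    below-row : ∀ x k → X ℤ.≤ x → x ℤ.≤ part β k → k Fin.< j
    below-row x k x≥ x≤ = ℕ.≰⇒> λ j≤k → ℤ.<⇒≱ (x<x+1 (part β j)) (ℤ.≤-trans x≥ (ℤ.≤-trans x≤ (decr β j k j≤k)))
    after : ∀ x → X ℤ.≤ x → Valley x → h (part β j) ℤ.+ 1ℤ ℤ.≤ h x
    after x x≥ (empty ℓ≡0) = contradiction (subst Fin ℓ≡0 j) λ ()
    after x x≥ (falling k k≥ _ low) = ℤ.≤-trans (<j k (below-row x k x≥ k≥)) (low (part β k) k≥ ℤ.≤-refl)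
    after x x≥ (rising k k< k≡ low) with ℕ.<-cmp (toℕ k) (toℕ j)
    ... | tri< k<j _ _ = ℤ.≤-trans (<j k k<j) (low (part β k) ℤ.≤-refl (ℤ.<⇒≤ k<))
    -- Here x lies on the slope rising from the end of row j. The column X of the new cell holds a
    -- "(", so the height has already gained 1 there.
    ... | tri≈ _ k≡j _ = subst (ℤ._≤ h x) (trans climb (cong (λ t → h t ℤ.+ 1ℤ) X-1))
        (low X (ℤ.≤-trans (ℤ.≤-reflexive (cong (part β) (Fin.toℕ-injective k≡j))) (ℤ.i≤i+j _ 1ℤ)) x≥)
    ... | tri> _ _ j<k = contradiction (ℤ.≤-trans x≥ (conj⇒ β x j (subst (toℕ j ℕ.<_) k≡ j<k))) (ℤ.<⇒≱ (x<x+1 _))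

  lowered-acts : ∀ j {σ} → Lowered j σ → α ⪯ σ → σ ⪯ γ →
    (∀ k → j Fin.< k → h (part β j) ℤ.+ 1ℤ ℤ.≤ h (part β k)) → (∀ k → h (part β j) ℤ.≤ h (part β k)) →
    Acts F α γ β σ
  lowered-acts j {σ} σ≡ α⪯σ σ⪯γ >j ≤j = acts (record
    { col = X ; ψ-before = ψ-before ; ψ-after = ψ-after
    ; height-before = λ x x< → subst₂ ℤ._≤_ (sym hσ-X) (sym (hσ-before x x<)) (before x x< (valley x))
    ; height-after  = λ x x≥ → subst₂ ℤ._≤_ (cong (ℤ._+ 1ℤ) (sym hσ-X)) (sym (hσ-after x x≥))
        (by-≤ (lemma₂ (h x) (h X)) (≥0 (all x (valley x))))
    }) α⪯σ σ⪯γ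
    where
    X : ℤ
    X = part β j
    β≡ : parts β ≡ Vec.updateAt (parts σ) j (ℤ._+ 1ℤ)
    β≡ = sym (trans (cong (λ v → Vec.updateAt v j (ℤ._+ 1ℤ)) σ≡)
      (trans (Vec.updateAt-updateAt j (parts β)) (Vec.updateAt-id-local j (parts β) (x-1+1 _))))
    σj : part σ j ≡ X - 1ℤ
    σj = trans (cong (λ v → lookup v j) σ≡) (Vec.lookup∘updateAt j (parts β))
    ψ-before : ∀ x → x ℤ.< X → ψ β x ≡ ψ σ x
    ψ-before x x< = trans (cong (λ v → sumMin v x) β≡)
      (sumMin-raise-before (parts σ) j (subst (x ℤ.≤_) (sym σj) (<⇒≤-1 x<)))
    ψ-after : ∀ x → X ℤ.≤ x → ψ β x ≡ ψ σ x ℤ.+ 1ℤ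
    ψ-after x x≥ = trans (cong (λ v → sumMin v x) β≡)
      (sumMin-raise-after (parts σ) j (subst (ℤ._≤ x) (sym (trans (cong (ℤ._+ 1ℤ) σj) (x-1+1 X))) x≥))
    hσ-before : ∀ x → x ℤ.< X → height α γ σ x ≡ h x
    hσ-before x x< = cong (λ t → ψ γ x ℤ.+ ψ α x - (t ℤ.+ t)) (sym (ψ-before x x<))
    hσ-after : ∀ x → X ℤ.≤ x → height α γ σ x ≡ h x ℤ.+ + 2
    hσ-after x x≥ = trans (lemma (ψ γ x ℤ.+ ψ α x) (ψ σ x))
      (cong (λ t → ψ γ x ℤ.+ ψ α x - (t ℤ.+ t) ℤ.+ + 2) (sym (ψ-after x x≥)))
      where
      lemma : ∀ a b → a - (b ℤ.+ b) ≡ a - (b ℤ.+ 1ℤ ℤ.+ (b ℤ.+ 1ℤ)) ℤ.+ + 2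
      lemma = solve-∀
    conj-X : conjℕ β X ≡ suc (conjℕ σ X)
    conj-X = ℤ.+-injective (trans (conj-ψ β X) (trans (cong₂ _-_ (ψ-after X ℤ.≤-refl) (ψ-before _ (x-1<x X)))
      (trans (lemma (ψ σ X) (ψ σ (X - 1ℤ))) (cong (λ t → 1ℤ ℤ.+ t) (sym (conj-ψ σ X))))))
      where
      lemma : ∀ a b → a ℤ.+ 1ℤ - b ≡ 1ℤ ℤ.+ (a - b)
      lemma = solve-∀
    descent : h (X - 1ℤ) ≡ h X ℤ.+ 1ℤ
    descent = go (p X) (q X) (⪯-bit α⪯β X)
      (ℕ.m<n⇒0<n∸m (ℕ.≤-trans (s≤s (⪯⇒≤ α⪯σ X)) (ℕ.≤-reflexive (sym conj-X))))
      (ℕ.m≤n⇒m∸n≡0 (ℕ.≤-trans (⪯⇒≤1+ σ⪯γ X) (ℕ.≤-reflexive (sym conj-X)))) (height-step α⪯β β⪯γ X)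
      where
      go : ∀ p q → Bit p → 0 ℕ.< p → q ≡ 0 → h X ℤ.+ + p ≡ h (X - 1ℤ) ℤ.+ + q → h (X - 1ℤ) ≡ h X ℤ.+ 1ℤ
      go _ _ bit₁ _ refl eq = trans (sym (ℤ.+-identityʳ _)) (sym eq)
    hσ-X : height α γ σ (X - 1ℤ) ≡ h X ℤ.+ 1ℤ
    hσ-X = trans (hσ-before _ (x-1<x X)) descent
    all : ∀ x → Valley x → h X ℤ.≤ h x
    all x (rising k k< _ low)   = ℤ.≤-trans (≤j k) (low (part β k) ℤ.≤-refl (ℤ.<⇒≤ k<))
    all x (falling k k≥ _ low)  = ℤ.≤-trans (≤j k) (low (part β k) k≥ ℤ.≤-refl)
    all x (empty ℓ≡0)           = contradiction (subst Fin ℓ≡0 j) λ ()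
    lemma₂ : ∀ a b → a ℤ.+ + 2 - (b ℤ.+ 1ℤ ℤ.+ 1ℤ) ≡ a - b
    lemma₂ = solve-∀
    before : ∀ x → x ℤ.< X → Valley x → h X ℤ.+ 1ℤ ℤ.≤ h x
    before x x< (empty ℓ≡0) = contradiction (subst Fin ℓ≡0 j) λ ()
    before x x< (rising k k< k≡ low) = ℤ.≤-trans
      (>j k (ℕ.≰⇒> λ k≤j → ℤ.<⇒≱ (ℤ.<-trans k< x<) (decr β k j k≤j)))
      (low (part β k) ℤ.≤-refl (ℤ.<⇒≤ k<))
    before x x< (falling k k≥ k≡ low) with ℕ.<-cmp (toℕ j) (toℕ k)
    ... | tri< j<k _ _ = ℤ.≤-trans (>j k j<k) (low (part β k) k≥ ℤ.≤-refl)
    ... | tri≈ _ j≡k _ = subst (ℤ._≤ h x) descent (low (X - 1ℤ) (<⇒≤-1 x<)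
        (ℤ.≤-trans (ℤ.i-j≤i X 1ℤ) (ℤ.≤-reflexive (cong (part β) (Fin.toℕ-injective j≡k)))))
    ... | tri> _ _ k<j = contradiction (conj⇐ β x j (ℤ.<⇒≤ x<)) (ℕ.≤⇒≯ (subst (ℕ._≤ toℕ j) k≡ k<j))

  no-raise : (∀ k → height∞ α γ β ℤ.≤ h (part β k)) → ∀ x → height∞ α γ β ℤ.≤ h x
  no-raise low x with valley x
  ... | rising k k< _ ≤x  = ℤ.≤-trans (low k) (≤x (part β k) ℤ.≤-refl (ℤ.<⇒≤ k<))
  ... | falling k k≥ _ ≤x = ℤ.≤-trans (low k) (≤x (part β k) k≥ ℤ.≤-refl)
  ... | empty ℓ≡0         = ℤ.≤-reflexive (trans (height∞-empty ℓ≡0) (sym (height-empty ℓ≡0 x)))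

  no-lower : (∀ k → 0ℤ ℤ.≤ h (part β k)) → ∀ x → 0ℤ ℤ.≤ h x
  no-lower low x with valley x
  ... | rising k k< _ ≤x  = ℤ.≤-trans (low k) (≤x (part β k) ℤ.≤-refl (ℤ.<⇒≤ k<))
  ... | falling k k≥ _ ≤x = ℤ.≤-trans (low k) (≤x (part β k) k≥ ℤ.≤-refl)
  ... | empty ℓ≡0         = ℤ.≤-reflexive (sym (height-empty ℓ≡0 x))

-- The value the height must not fall below for the operator to vanish
floor : Kind → (α γ β : Signature ℓ) → ℤ
floor E α γ β = height∞ α γ β
floor F α γ β = 0ℤ

-- Raising needs an uncancelled "(", so the height must end, at `height∞`, strictly above its
-- minimum. Lowering needs an uncancelled ")", so it must start, at 0, strictly above its minimum.
floor⇒¬Acts : ∀ k {α β γ σ : Signature ℓ} → α ⪯ β → β ⪯ γ →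
  (∀ x → floor k α γ β ℤ.≤ height α γ β x) → ¬ Acts k α γ β σ
floor⇒¬Acts E {α} {β} {γ} α⪯β β⪯γ low (acts L _ _) = ℤ.<⇒≱ (x<x+1 _)
  (ℤ.≤-trans (Lift.height-after L x (ℤ.<⇒≤ (ℤ.≤-<-trans (ℤ.i≤j⊔i M _) (x<x+1 _))))
    (ℤ.≤-trans (ℤ.≤-reflexive (proj₂ (height-high α γ β) x (ℤ.≤-<-trans (ℤ.i≤i⊔j M _) (x<x+1 _)))) (low _)))
  where
  M x : ℤ
  M = proj₁ (height-high α γ β)
  x = M ⊔ Lift.col L ℤ.+ 1ℤ
floor⇒¬Acts F {α} {β} {γ} {σ} α⪯β β⪯γ low (acts L α⪯σ σ⪯γ) = ℤ.<⇒≱ (x<x+1 _)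
  (ℤ.≤-trans (subst (0ℤ ℤ.+ 1ℤ ℤ.≤_) (x-1+1 _) (ℤ.+-monoˡ-≤ 1ℤ
      (subst (0ℤ ℤ.≤_) (height̃-col α⪯σ σ⪯γ L) (low (Lift.col L)))))
    (subst (height α γ σ (Lift.col L - 1ℤ) ℤ.≤_) (proj₂ (height-low α γ σ) x (ℤ.i⊓j≤i N _))
      (Lift.height-before L x (≤-1⇒< (ℤ.i⊓j≤j N _)))))
  where
  N x : ℤ
  N = proj₁ (height-low α γ σ)
  x = N ⊓ (Lift.col L - 1ℤ)

module _ {ℓ m : ℕ} {θ ρ : Signature ℓ} (P : SST θ ρ (suc m)) (i : Fin m) where

  open Move P i using (α; β; γ; α⪯β; β⪯γ; a; b; a≡; b≡; raise; lower; raiseA; raiseB; lowerA; lowerB)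
  private
    at : Fin (suc (suc m))
    at = suc (inject₁ i)
    h : ℤ → ℤ
    h = height α γ β
    h∞ : ℤ
    h∞ = height∞ α γ β

  open Rows α⪯β β⪯γ

  -- The count runs from the right end of the word, the height from the left, and each is the rest
  -- of the other up to the total. Maxima of the count are minima of the height, and the first row
  -- of a maximum gives the last column of a minimum, since earlier rows are longer.
  peak≡ : ∀ k → peak 0ℤ a b k ≡ h∞ - h (part β k)
  peak≡ k = trans (sym (peak-sum (parts α) (parts β) (parts γ) a b a≡ b≡ 0ℤ k (part β k) refl
      (V.left-≥ k) (V.right-≤ k))) (cong (_- h (part β k)) (ℤ.+-identityˡ h∞))
    where module V = Valleys α⪯β β⪯γ

  final≡ : final 0ℤ a b ≡ h∞
  final≡ = trans (sym (final-sum (parts α) (parts β) (parts γ) a b a≡ b≡ 0ℤ)) (ℤ.+-identityˡ h∞)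

  peak-≤ : ∀ j k → peak 0ℤ a b k ℤ.≤ peak 0ℤ a b j → h (part β j) ℤ.≤ h (part β k)
  peak-≤ j k le = by-≤ (lemma h∞ (h (part β j)) (h (part β k))) (≥0 (subst₂ ℤ._≤_ (peak≡ k) (peak≡ j) le))
    where
    lemma : ∀ t a b → b - a ≡ t - a - (t - b)
    lemma = solve-∀

  peak-< : ∀ j k → peak 0ℤ a b k ℤ.< peak 0ℤ a b j → h (part β j) ℤ.+ 1ℤ ℤ.≤ h (part β k)
  peak-< j k lt = by-≤ (lemma h∞ (h (part β j)) (h (part β k))) (≥0 (subst₂ (λ s t → s ℤ.+ 1ℤ ℤ.≤ t) (peak≡ k) (peak≡ j) (<⇒+1≤ lt)))
    where
    lemma : ∀ t a b → b - (a ℤ.+ 1ℤ) ≡ t - a - (t - b ℤ.+ 1ℤ)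
    lemma = solve-∀

  updated-⪯ : ∀ {P′ : SST θ ρ (suc m)} {σ} → chain P′ ≡ chain P [ at ]≔ σ → α ⪯ σ × σ ⪯ γ
  updated-⪯ {P′} {σ} eq =
      subst₂ _⪯_
        (trans (cong (λ c → lookup c (inject₁ (inject₁ i))) eq) (Vec.lookup∘update′ before≢ (chain P) σ))
        (trans (cong (λ c → lookup c at) eq) (Vec.lookup∘update at (chain P) σ))
        (strip P′ (inject₁ i))
    , subst₂ _⪯_
        (trans (cong (λ c → lookup c at) eq) (Vec.lookup∘update at (chain P) σ))
        (trans (cong (λ c → lookup c (suc (suc i))) eq) (Vec.lookup∘update′ after≢ (chain P) σ))
        (strip P′ (suc i))
    where
    before≢ : inject₁ (inject₁ i) ≢ at
    before≢ eq = ℕ.1+n≢n (sym (trans (sym (Fin.toℕ-inject₁ (inject₁ i))) (cong toℕ eq)))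
    after≢ : suc (suc i) ≢ at
    after≢ eq = ℕ.1+n≢n (trans (cong toℕ (Fin.suc-injective eq)) (Fin.toℕ-inject₁ i))

  Outcome : Kind → Maybe (SST θ ρ (suc m)) → Set
  Outcome k (just P′) = ∃[ σ ] chain P′ ≡ chain P [ at ]≔ σ × Acts k α γ β σ
  Outcome k nothing   = ∀ x → floor k α γ β ℤ.≤ height α γ β x

  private
    e-outcome : ∀ r .(eq : leftmostOpening (reduce (brackets i P)) ≡ r) →
      FirstPeak (peak 0ℤ a b) 0ℤ id nothing r → Outcome E (Move.e-at P i r eq)
    e-outcome nothing eq (inj₁ (_ , ≤0)) = no-raise λ k →
        by-≤ (lemma h∞ (h (part β k))) (≥0 (subst (ℤ._≤ 0ℤ) (peak≡ k) (≤0 k)))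
      where
      lemma : ∀ a b → b - a ≡ 0ℤ - (a - b)
      lemma = solve-∀
    e-outcome (just j) eq (inj₂ (.j , refl , _ , <j , ≤j)) = _ , refl ,
        raised-acts j refl (proj₁ ⪯s) (proj₂ ⪯s) (λ k k<j → peak-< j k (<j k k<j)) (λ k → peak-≤ j k (≤j k))
      where
      P′ : SST θ ρ (suc m)
      P′ = raise j (raiseA j (leftmostOpening-∈ _ eq)) (raiseB j (leftmostOpening-∈ _ eq))
      ⪯s : α ⪯ _ × _ ⪯ γ
      ⪯s = updated-⪯ {P′} refl
    e-outcome nothing eq (inj₂ (_ , () , _))
    e-outcome (just j) eq (inj₁ (() , _))

    f-outcome : ∀ r .(eq : rightmostClosing (reduce (brackets i P)) ≡ r) →
      LastPeak (peak 0ℤ a b) (final 0ℤ a b) 0ℤ id nothing r → Outcome F (Move.f-at P i r eq)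
    f-outcome nothing eq (inj₂ (inj₂ (_ , ≤end , _))) = no-lower λ k →
        by-≤ (lemma h∞ (h (part β k))) (≥0 (subst₂ ℤ._≤_ (peak≡ k) final≡ (≤end k)))
      where
      lemma : ∀ a b → b - 0ℤ ≡ a - (a - b)
      lemma = solve-∀
    f-outcome (just j) eq (inj₁ (.j , refl , _ , _ , >j , ≤j)) = _ , refl ,
        lowered-acts j refl (proj₁ ⪯s) (proj₂ ⪯s) (λ k j<k → peak-< j k (>j k j<k)) (λ k → peak-≤ j k (≤j k))
      where
      P′ : SST θ ρ (suc m)
      P′ = lower j (lowerA j (rightmostClosing-∈ _ eq)) (lowerB j (rightmostClosing-∈ _ eq))
      ⪯s : α ⪯ _ × _ ⪯ γ
      ⪯s = updated-⪯ {P′} refl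
    f-outcome nothing eq (inj₁ (_ , () , _))
    f-outcome nothing eq (inj₂ (inj₁ (_ , () , _)))
    f-outcome (just j) eq (inj₂ (inj₁ (_ , () , _)))
    f-outcome (just j) eq (inj₂ (inj₂ (() , _)))

  kashiwara-outcome : ∀ k → Outcome k (kashiwara k i P)
  kashiwara-outcome E = e-outcome _ refl (subst (λ w → FirstPeak (peak 0ℤ a b) 0ℤ id nothing (leftmostOpening (reduce w)))
    (sym (brackets-≡ i P)) (scan-first id a b [] [] 0ℤ 0ℤ refl))
  kashiwara-outcome F = f-outcome _ refl (subst (λ w → LastPeak (peak 0ℤ a b) (final 0ℤ a b) 0ℤ id nothing (rightmostClosing (reduce w)))
    (sym (brackets-≡ i P)) (scan-last id a b [] [] 0ℤ 0ℤ refl))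

-- Operators on pairs as column operators on fields

onColumn-base : ∀ {n} x → OnColumn n x x
onColumn-base x = column (divides 0ℤ (ℤ.+-inverseʳ x))

onColumn-sym : ∀ {n x y} → OnColumn n x y → OnColumn n y x
onColumn-sym {n} {x} {y} (column d) = column (subst (+ n ∣_) (lemma x y) (∣.∣m⇒∣-m d))
  where
  lemma : ∀ x y → - (y - x) ≡ x - y
  lemma = solve-∀

module _ {n : ℕ} (x : ℤ) where

  private
    split : ∀ {s t} → s ℕ.< t → ∃[ d ] suc d + s ≡ t
    split {s} s<t with ℕ.m≤n⇒∃[o]m+o≡n s<t
    ... | d , eq = d , trans (cong suc (ℕ.+-comm d s)) eq

    off-before : ∀ {s t} → s ℕ.< t → t ℕ.< n + s → ¬ OnColumn n (x ℤ.+ + s) (x ℤ.+ + t)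
    off-before {s} {t} s<t t< on with split s<t
    ... | d , eq = onColumn-near d (onColumn-base (x ℤ.+ + s)) (ℕ.+-cancelʳ-< s (suc d) n (subst (ℕ._< n + s) (sym eq) t<))
      (subst (OnColumn n (x ℤ.+ + s)) (trans (cong (λ t → x ℤ.+ + t) (trans (sym eq) (ℕ.+-comm (suc d) s))) (sym (ℤ.+-assoc x (+ s) (+ suc d)))) on)

  off-apart : ∀ s t → s ≢ t → s ℕ.< n + t → t ℕ.< n + s → ¬ OnColumn n (x ℤ.+ + s) (x ℤ.+ + t)
  off-apart s t s≢t s< t< with ℕ.<-cmp s t
  ... | tri≈ _ s≡t _ = contradiction s≡t s≢t
  ... | tri< s<t _ _ = off-before s<t t<
  ... | tri> _ _ t<s = off-before t<s s< ∘ onColumn-sym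

-- As 1 ≤ i + 1 ≤ n - 1, no other position among 0, ..., n is congruent to i + 1 mod n. In
-- particular both ends of the chain stay, and so does the column that carries the second tableau.
off-window : ∀ {m} (i : Fin (suc m)) x t → t ℕ.≤ 2 + m → t ≢ suc (toℕ i) →
  ¬ OnColumn (2 + m) (x ℤ.+ + suc (toℕ i)) (x ℤ.+ + t)
off-window {m} i x t t≤ t≢ = off-apart x (suc (toℕ i)) t (t≢ ∘ sym)
  (ℕ.≤-trans (s≤s (s≤s (ℕ.s≤s⁻¹ (Fin.toℕ<n i)))) (ℕ.m≤m+n (2 + m) t))
  (ℕ.≤-<-trans t≤ (ℕ.m<m+n (2 + m) (s≤s z≤n)))

-- The operator k is undefined at (x , y).
Low : ∀ {n ℓ} → Kind → FominField n ℓ → ℤ → ℤ → Set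
Low k Λ x y = ∀ z → floor k (at (x - 1ℤ) y) (at (x ℤ.+ 1ℤ) y) (at x y) ℤ.≤ height (at (x - 1ℤ) y) (at (x ℤ.+ 1ℤ) y) (at x y) z
  where open FominField Λ

low⇒undefined : ∀ {n ℓ k x y} {Λ : FominField n ℓ} → Low k Λ x y → ∀ Λ̃ → ¬ FieldActs k x Λ Λ̃
low⇒undefined {k = k} {x} {y} {Λ} low Λ̃ a = floor⇒¬Acts k (at-e₁⁻ Λ x y) (FominField.at-e₁ Λ x y) low
  (FieldActs.on-column a x y (onColumn-base x))

module _ {m ℓ : ℕ} (k : Kind) (i : Fin (suc m)) (Λ : FominField (2 + m) ℓ) (x y : ℤ) where

  open FominField Λ

  private
    n : ℕ
    n = 2 + m
    x₀ : ℤ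
    x₀ = x ℤ.+ + suc (toℕ i)
    P : SST (at (x ℤ.+ + n) y) (at x y) n
    P = read₁ Λ x y
    s : Fin (suc n)
    s = suc (inject₁ i)

    layer≡ : ∀ t → layer P t ≡ at (x ℤ.+ + toℕ t) y
    layer≡ = Vec.lookup∘tabulate (λ t → at (x ℤ.+ + toℕ t) y)

    x₀≡ : x ℤ.+ + toℕ s ≡ x₀
    x₀≡ = cong (λ t → x ℤ.+ + suc t) (Fin.toℕ-inject₁ i)

    α≡ : layer P (inject₁ (inject₁ i)) ≡ at (x₀ - 1ℤ) y
    α≡ = trans (layer≡ (inject₁ (inject₁ i))) (cong (λ t → at t y)
      (trans (cong (λ t → x ℤ.+ + t) (trans (Fin.toℕ-inject₁ (inject₁ i)) (Fin.toℕ-inject₁ i))) (lemma x (+ toℕ i))))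
      where
      lemma : ∀ x i → x ℤ.+ i ≡ x ℤ.+ (1ℤ ℤ.+ i) - 1ℤ
      lemma = solve-∀

    β≡ : layer P s ≡ at x₀ y
    β≡ = trans (layer≡ s) (cong (λ t → at t y) x₀≡)

    γ≡ : layer P (suc (suc i)) ≡ at (x₀ ℤ.+ 1ℤ) y
    γ≡ = trans (layer≡ (suc (suc i))) (cong (λ t → at t y) (lemma x (+ toℕ i)))
      where
      lemma : ∀ x i → x ℤ.+ (1ℤ ℤ.+ (1ℤ ℤ.+ i)) ≡ x ℤ.+ (1ℤ ℤ.+ i) ℤ.+ 1ℤ
      lemma = solve-∀

    Acts-cong : ∀ {α α′ γ γ′ β β′ σ : Signature ℓ} → α ≡ α′ → γ ≡ γ′ → β ≡ β′ → Acts k α γ β σ → Acts k α′ γ′ β′ σ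
    Acts-cong refl refl refl a = a

  WindowOutcome : Maybe (Pair n) → Set
  WindowOutcome (just b′) = ∃[ Λ̃ ] FieldActs k x₀ Λ Λ̃ × b′ ≡ read Λ̃ x y
  WindowOutcome nothing   = Low k Λ x₀ y

  window-outcome : WindowOutcome (on₁ k i (read Λ x y))
  window-outcome = go (kashiwara k i P) (kashiwara-outcome P i k)
    where
    go : ∀ r → Outcome P i k r → WindowOutcome (Maybe.map (λ P′ → pair P′ (read₂ Λ x y)) r)
    go nothing low = replace α≡ γ≡ β≡ low
      where
      replace : ∀ {α α′ γ γ′ β β′ : Signature ℓ} → α ≡ α′ → γ ≡ γ′ → β ≡ β′ →
        (∀ z → floor k α γ β ℤ.≤ height α γ β z) → ∀ z → floor k α′ γ′ β′ ℤ.≤ height α′ γ′ β′ z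
      replace refl refl refl low = low
    go (just P′) (σ , chain≡ , a) = finish (Extension.extend (s≤s (s≤s z≤n)) Λ k x₀ (onColumn-base x₀) here)
      where
      here : ActsAt k Λ x₀ y σ
      here = Acts-cong α≡ γ≡ β≡ a
      finish : ∃[ Λ̃ ] FieldActs k x₀ Λ Λ̃ → ∃[ Λ̃ ] FieldActs k x₀ Λ Λ̃ × pair P′ (read₂ Λ x y) ≡ read Λ̃ x y
      finish (Λ̃ , fa) = Λ̃ , fa , pair-≡
          (trans chain≡ (trans (sym (Vec.tabulate∘lookup (chain P Vec.[ s ]≔ σ))) (Vec.tabulate-cong row)))
          (Vec.tabulate-cong λ t → sym (FieldActs.off-column fa x (y ℤ.+ + toℕ t)
            (subst (λ u → ¬ OnColumn n x₀ u) (ℤ.+-identityʳ x) (off-window i x 0 z≤n λ ()))))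
        where
        row : ∀ t → lookup (chain P Vec.[ s ]≔ σ) t ≡ FominField.at Λ̃ (x ℤ.+ + toℕ t) y
        row t with t Fin.≟ s
        ... | yes refl = trans (Vec.lookup∘update s (chain P) σ) (trans
          (Acts-functional k here (FieldActs.on-column fa x₀ y (onColumn-base x₀)))
          (cong (λ u → FominField.at Λ̃ u y) (sym x₀≡)))
        ... | no t≢ = trans (Vec.lookup∘update′ t≢ (chain P) σ) (trans (layer≡ t)
          (sym (FieldActs.off-column fa _ y (off-window i x (toℕ t) (ℕ.s≤s⁻¹ (Fin.toℕ<n t))
            λ eq → t≢ (Fin.toℕ-injective (trans eq (cong suc (sym (Fin.toℕ-inject₁ i)))))))))

read-shift : ∀ {m ℓ} (Λ : FominField (suc m) ℓ) x y x′ y′ →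
  read λ[ read Λ x y ] x′ y′ ≡ read Λ (x ℤ.+ x′) (y ℤ.+ y′)
read-shift Λ x y x′ y′ = read-cong λ[ read Λ x y ] Λ
  (λ i → trans (field-read Λ x y (x′ ℤ.+ + i) y′) (cong (λ t → at t (y ℤ.+ y′)) (sym (ℤ.+-assoc x x′ (+ i)))))
  (λ i → trans (field-read Λ x y x′ (y′ ℤ.+ + i)) (cong (at (x ℤ.+ x′)) (sym (ℤ.+-assoc y y′ (+ i)))))
  where open FominField Λ

ColumnOutcome : ∀ {n ℓ} → Kind → ℤ → FominField n ℓ → Maybe (Pair n) → Set
ColumnOutcome k x₀ Λ (just b′) = ∃[ Λ̃ ] FieldActs k x₀ Λ Λ̃ × b′ ≡ read Λ̃ 0ℤ 0ℤ
ColumnOutcome k x₀ Λ nothing   = Low k Λ x₀ 0ℤ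

-- For i = 0, `ι₁⁻¹` makes the window start at column -1, so the first inner position is column 0;
-- `ι₁` moves the window back.
K₁-outcome : ∀ {m ℓ} k (i : Fin (2 + m)) (Λ : FominField (2 + m) ℓ) →
  ColumnOutcome k (+ toℕ i) Λ (K₁ k i (read Λ 0ℤ 0ℤ))
K₁-outcome k (suc i) Λ = same (on₁ k i (read Λ 0ℤ 0ℤ)) (window-outcome k i Λ 0ℤ 0ℤ)
  where
  same : ∀ r → WindowOutcome k i Λ 0ℤ 0ℤ r → ColumnOutcome k (+ suc (toℕ i)) Λ r
  same (just _) o = o
  same nothing  o = o
K₁-outcome k zero Λ = subst (λ b → ColumnOutcome k 0ℤ Λ (Maybe.map ι₁ (on₁ k zero b))) (sym (read-shift Λ 0ℤ 0ℤ (- 1ℤ) 0ℤ))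
  (same (on₁ k zero (read Λ (- 1ℤ) 0ℤ)) (window-outcome k zero Λ (- 1ℤ) 0ℤ))
  where
  same : ∀ r → WindowOutcome k zero Λ (- 1ℤ) 0ℤ r → ColumnOutcome k 0ℤ Λ (Maybe.map ι₁ r)
  same (just _) (Λ̃ , a , b′≡) = Λ̃ , a , trans (cong ι₁ b′≡) (read-shift Λ̃ (- 1ℤ) 0ℤ 1ℤ 0ℤ)
  same nothing  o = o

read-≈ : ∀ {n ℓ} {Λ Λ̃ : FominField n ℓ} → (∀ x y → FominField.at Λ x y ≡ FominField.at Λ̃ x y) →
  ∀ x y → read Λ x y ≡ read Λ̃ x y
read-≈ {Λ = Λ} {Λ̃} eq x y = read-cong Λ Λ̃ (λ i → eq (x ℤ.+ + i) y) (λ i → eq x (y ℤ.+ + i))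

outcome-just : ∀ {n ℓ k x₀} {Λ Λ̃ : FominField n ℓ} {r} → ColumnOutcome k x₀ Λ r → FieldActs k x₀ Λ Λ̃ → r ≡ just (read Λ̃ 0ℤ 0ℤ)
outcome-just {Λ̃ = Λ̃} {r = nothing} low a = contradiction a (low⇒undefined low Λ̃)
outcome-just {Λ̃ = Λ̃} {r = just _} (Λ̃′ , a′ , b′≡) a = cong just (trans b′≡ (read-≈ {Λ = Λ̃′} {Λ̃} (FieldActs-functional a′ a) 0ℤ 0ℤ))

-- Exchange of rows and columns

transpose : ∀ {n} → FominField n ℓ → FominField n ℓ
transpose {n = n} Λ = record
  { at       = λ x y → at y x
  ; periodic = λ x y k → trans (cong₂ at (lemma₁ y k (+ n)) (lemma₂ x k (+ n))) (periodic y x (- k))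
  ; at-e₁    = λ x y → at-e₂ y x
  ; at-e₂    = λ x y → at-e₁ y x
  ; square   = λ x y → rule-swap (square y x)
  }
  where
  open FominField Λ
  lemma₁ : ∀ y k n → y - k ℤ.* n ≡ y ℤ.+ - k ℤ.* n
  lemma₁ = solve-∀
  lemma₂ : ∀ x k n → x ℤ.+ k ℤ.* n ≡ x - - k ℤ.* n
  lemma₂ = solve-∀

swap : ∀ {n} → Pair n → Pair n
swap (pair P Q) = pair Q P

read-transpose : ∀ {n} (Λ : FominField n ℓ) x y → read (transpose Λ) y x ≡ swap (read Λ x y)
read-transpose Λ x y = pair-≡ refl refl

on₂-swap : ∀ {m} k (i : Fin m) b → on₂ k i b ≡ Maybe.map swap (on₁ k i (swap b))
on₂-swap k i (pair P Q) = Maybe.map-∘ (kashiwara k i Q)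

λ-transpose : ∀ {m} (b : Pair (suc m)) x y → FominField.at λ[ swap b ] x y ≡ FominField.at λ[ b ] y x
λ-transpose b@(pair P Q) = field-unique λ[ swap b ] (transpose λ[ b ])
  (λ i i≤ → subst (λ t → FominField.at λ[ swap b ] (+ t) 0ℤ ≡ FominField.at λ[ b ] 0ℤ (+ t)) (Fin.toℕ-fromℕ< (s≤s i≤))
    (trans (field-P (swap b) (Fin.fromℕ< (s≤s i≤))) (sym (field-Q b (Fin.fromℕ< (s≤s i≤))))))
  (λ i i≤ → subst (λ t → FominField.at λ[ swap b ] 0ℤ (+ t) ≡ FominField.at λ[ b ] (+ t) 0ℤ) (Fin.toℕ-fromℕ< (s≤s i≤))
    (trans (field-Q (swap b) (Fin.fromℕ< (s≤s i≤))) (sym (field-P b (Fin.fromℕ< (s≤s i≤))))))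

read-λ-swap : ∀ {m} (b : Pair (suc m)) x y → read λ[ swap b ] y x ≡ swap (read λ[ b ] x y)
read-λ-swap b@(pair P Q) x y = trans (read-≈ {Λ = λ[ swap b ]} {transpose λ[ b ]} (λ-transpose b) y x) (read-transpose λ[ b ] x y)

swap-involutive : ∀ {n} (b : Pair n) → swap (swap b) ≡ b
swap-involutive (pair P Q) = refl

K₂-swap : ∀ {m} k (j : Fin (2 + m)) b → K₂ k j b ≡ Maybe.map swap (K₁ k j (swap b))
K₂-swap k (suc j) b = on₂-swap k j b
K₂-swap {m} k zero b = begin
  Maybe.map ι₂ (on₂ k zero (ι₂⁻¹ b))
    ≡⟨ cong (Maybe.map ι₂) (on₂-swap k zero (ι₂⁻¹ b)) ⟩
  Maybe.map ι₂ (Maybe.map swap (on₁ k zero (swap (ι₂⁻¹ b))))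
    ≡⟨ cong (λ c → Maybe.map ι₂ (Maybe.map swap (on₁ k zero c))) (sym (read-λ-swap b 0ℤ (- 1ℤ))) ⟩
  Maybe.map ι₂ (Maybe.map swap (on₁ k zero (ι₁⁻¹ (swap b))))
    ≡⟨ Maybe.map-∘ (on₁ k zero (ι₁⁻¹ (swap b))) ⟨
  Maybe.map (ι₂ ∘ swap) (on₁ k zero (ι₁⁻¹ (swap b)))
    ≡⟨ Maybe.map-cong ι₂-swap (on₁ k zero (ι₁⁻¹ (swap b))) ⟩
  Maybe.map (swap ∘ ι₁) (on₁ k zero (ι₁⁻¹ (swap b)))
    ≡⟨ Maybe.map-∘ (on₁ k zero (ι₁⁻¹ (swap b))) ⟩
  Maybe.map swap (Maybe.map ι₁ (on₁ k zero (ι₁⁻¹ (swap b)))) ∎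
  where
  open ≡-Reasoning
  ι₂-swap : ∀ (c : Pair (2 + m)) → ι₂ (swap c) ≡ swap (ι₁ c)
  ι₂-swap c@(pair _ _) = read-λ-swap c 1ℤ 0ℤ

RowActs : ∀ {n ℓ} → Kind → ℤ → FominField n ℓ → FominField n ℓ → Set
RowActs k y₀ Λ Λ̃ = FieldActs k y₀ (transpose Λ) (transpose Λ̃)

-- Transposing twice returns the same map `at` but not the same proof of periodicity, so the two
-- fields are not identified by computation; the action sees only `at`.
untranspose : ∀ {n ℓ k x₀} {Λ Λ̃ : FominField n ℓ} → FieldActs k x₀ Λ Λ̃ → FieldActs k x₀ Λ (transpose (transpose Λ̃))
untranspose a = record { off-column = FieldActs.off-column a ; on-column = FieldActs.on-column a }

RowOutcome : ∀ {n ℓ} → Kind → ℤ → FominField n ℓ → Maybe (Pair n) → Set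
RowOutcome k y₀ Λ (just b′) = ∃[ Λ̃ ] RowActs k y₀ Λ Λ̃ × b′ ≡ read Λ̃ 0ℤ 0ℤ
RowOutcome k y₀ Λ nothing   = ∀ Λ̃ → ¬ RowActs k y₀ Λ Λ̃

K₂-outcome : ∀ {m ℓ} k (j : Fin (2 + m)) (Λ : FominField (2 + m) ℓ) →
  RowOutcome k (+ toℕ j) Λ (K₂ k j (read Λ 0ℤ 0ℤ))
K₂-outcome k j Λ = subst (RowOutcome k (+ toℕ j) Λ) (sym eq)
    (swapped (K₁ k j (read (transpose Λ) 0ℤ 0ℤ)) (K₁-outcome k j (transpose Λ)))
  where
  eq : K₂ k j (read Λ 0ℤ 0ℤ) ≡ Maybe.map swap (K₁ k j (read (transpose Λ) 0ℤ 0ℤ))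
  eq = trans (K₂-swap k j (read Λ 0ℤ 0ℤ)) (cong (λ c → Maybe.map swap (K₁ k j c)) (sym (read-transpose Λ 0ℤ 0ℤ)))
  swapped : ∀ r → ColumnOutcome k (+ toℕ j) (transpose Λ) r → RowOutcome k (+ toℕ j) Λ (Maybe.map swap r)
  swapped (just _) (Λ̃ , a , b′≡) = transpose Λ̃ , untranspose a , trans (cong swap b′≡) (sym (read-transpose Λ̃ 0ℤ 0ℤ))
  swapped nothing  low Λ̃ a = low⇒undefined low (transpose Λ̃) a

row-outcome-just : ∀ {n ℓ k y₀} {Λ Λ̃ : FominField n ℓ} {r} → RowOutcome k y₀ Λ r → RowActs k y₀ Λ Λ̃ → r ≡ just (read Λ̃ 0ℤ 0ℤ)
row-outcome-just {Λ̃ = Λ̃} {r = nothing} none a = contradiction a (none Λ̃)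
row-outcome-just {Λ̃ = Λ̃} {r = just _} (Λ̃′ , a′ , b′≡) a =
  cong just (trans b′≡ (read-≈ {Λ = Λ̃′} {Λ̃} (λ x y → FieldActs-functional a′ a y x) 0ℤ 0ℤ))

-- Whether an operator is defined on a field, and its effect on row y, can be read off from row y.
acts-by-row : ∀ {n ℓ k x₀} {Λ Λ₁ Λ₂ : FominField n ℓ} → 2 ℕ.≤ n → ∀ y →
  (∀ x → FominField.at Λ₂ x y ≡ FominField.at Λ x y) → FieldActs k x₀ Λ Λ₁ →
  ∃[ Λ₁₂ ] FieldActs k x₀ Λ₂ Λ₁₂ × (∀ x → FominField.at Λ₁₂ x y ≡ FominField.at Λ₁ x y)
acts-by-row {n} {ℓ} {k} {x₀} {Λ} {Λ₁} {Λ₂} 2≤n y same a =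
    finish (Extension.extend 2≤n Λ₂ k x₀ (onColumn-base x₀) (on-row x₀ (onColumn-base x₀)))
  where
  on-row : ∀ x → OnColumn n x₀ x → ActsAt k Λ₂ x y (FominField.at Λ₁ x y)
  on-row x on = replace (sym (same (x - 1ℤ))) (sym (same (x ℤ.+ 1ℤ))) (sym (same x)) (FieldActs.on-column a x y on)
    where
    replace : ∀ {α α′ γ γ′ β β′ σ : Signature ℓ} → α ≡ α′ → γ ≡ γ′ → β ≡ β′ → Acts k α γ β σ → Acts k α′ γ′ β′ σ
    replace refl refl refl a = a
  finish : ∃[ Λ₁₂ ] FieldActs k x₀ Λ₂ Λ₁₂ → ∃[ Λ₁₂ ] FieldActs k x₀ Λ₂ Λ₁₂ × (∀ x → FominField.at Λ₁₂ x y ≡ FominField.at Λ₁ x y)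
  finish (Λ₁₂ , a₂) = Λ₁₂ , a₂ , λ x → row x (onColumn? n x₀ x)
    where
    row : ∀ x → Dec (OnColumn n x₀ x) → FominField.at Λ₁₂ x y ≡ FominField.at Λ₁ x y
    row x (yes on) = Acts-functional k (FieldActs.on-column a₂ x y on) (on-row x on)
    row x (no ¬on) = trans (FieldActs.off-column a₂ x y ¬on) (trans (same x) (sym (FieldActs.off-column a x y ¬on)))

-- Commutation of a row operator with a column operator

module Commutation {m ℓ : ℕ} (k k′ : Kind) (x₀ y₀ : ℤ) {Λ : FominField (2 + m) ℓ} where

  private
    n : ℕ
    n = 2 + m

    2≤n : 2 ℕ.≤ n
    2≤n = s≤s (s≤s z≤n)

    next : ∀ z → ¬ OnColumn n z (z ℤ.+ 1ℤ)
    next z = onColumn-next 2≤n (onColumn-base z)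

  module _ {Λ₂ : FominField n ℓ} (a₂ : RowActs k′ y₀ Λ Λ₂) where

    off-row : ∀ x → FominField.at Λ₂ x (y₀ ℤ.+ 1ℤ) ≡ FominField.at Λ x (y₀ ℤ.+ 1ℤ)
    off-row x = FieldActs.off-column a₂ (y₀ ℤ.+ 1ℤ) x (next y₀)

    -- Row y₀ + 1 is common to Λ and Λ₂, so a column operator defined on Λ₂ is defined on Λ as well.
    column-undefined : (∀ Λ̃ → ¬ FieldActs k x₀ Λ Λ̃) → ∀ Λ̃ → ¬ FieldActs k x₀ Λ₂ Λ̃
    column-undefined none Λ̃ a = none _ (proj₁ (proj₂ (acts-by-row 2≤n (y₀ ℤ.+ 1ℤ) (λ x → sym (off-row x)) a)))

  module _ {Λ₁ : FominField n ℓ} (a₁ : FieldActs k x₀ Λ Λ₁) where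

    off-col : ∀ y → FominField.at Λ₁ (x₀ ℤ.+ 1ℤ) y ≡ FominField.at Λ (x₀ ℤ.+ 1ℤ) y
    off-col y = FieldActs.off-column a₁ (x₀ ℤ.+ 1ℤ) y (next x₀)

    row-undefined : (∀ Λ̃ → ¬ RowActs k′ y₀ Λ Λ̃) → ∀ Λ̃ → ¬ RowActs k′ y₀ Λ₁ Λ̃
    row-undefined none Λ̃ a = undefined (acts-by-row {Λ = transpose Λ₁} {transpose Λ̃} {transpose Λ} 2≤n (x₀ ℤ.+ 1ℤ) (λ y → sym (off-col y)) a)
      where
      undefined : ¬ (∃[ Λ′ ] FieldActs k′ y₀ (transpose Λ) Λ′ × (∀ y → FominField.at Λ′ y (x₀ ℤ.+ 1ℤ) ≡ FominField.at Λ̃ (x₀ ℤ.+ 1ℤ) y))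
      undefined (Λ′ , a′ , _) = none (transpose Λ′) (untranspose a′)

  -- The column operator does not see row y₀ when computed on row y₀ + 1, nor the row operator
  -- column x₀ on column x₀ + 1; a field is determined by these two lines.
  commute : ∀ {Λ₁ Λ₂} → FieldActs k x₀ Λ Λ₁ → RowActs k′ y₀ Λ Λ₂ →
    ∃[ Λ₁₂ ] ∃[ Λ₂₁ ] FieldActs k x₀ Λ₂ Λ₁₂ × RowActs k′ y₀ Λ₁ Λ₂₁ × read Λ₁₂ 0ℤ 0ℤ ≡ read Λ₂₁ 0ℤ 0ℤ
  commute {Λ₁} {Λ₂} a₁ a₂ = finish (acts-by-row {Λ = Λ} {Λ₁} {Λ₂} 2≤n Y (off-row {Λ₂} a₂) a₁)
      (acts-by-row {Λ = transpose Λ} {transpose Λ₂} {transpose Λ₁} 2≤n X (off-col {Λ₁} a₁) a₂)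
    where
    X Y : ℤ
    X = x₀ ℤ.+ 1ℤ
    Y = y₀ ℤ.+ 1ℤ
    finish : ∃[ Λ₁₂ ] FieldActs k x₀ Λ₂ Λ₁₂ × (∀ x → FominField.at Λ₁₂ x Y ≡ FominField.at Λ₁ x Y) →
      ∃[ Λ₂₁ ] FieldActs k′ y₀ (transpose Λ₁) Λ₂₁ × (∀ y → FominField.at Λ₂₁ y X ≡ FominField.at Λ₂ X y) →
      ∃[ Λ₁₂ ] ∃[ Λ₂₁ ] FieldActs k x₀ Λ₂ Λ₁₂ × RowActs k′ y₀ Λ₁ Λ₂₁ × read Λ₁₂ 0ℤ 0ℤ ≡ read Λ₂₁ 0ℤ 0ℤ
    finish (Λ₁₂ , a₁₂ , row) (Λ₂₁ , a₂₁ , col) = Λ₁₂ , transpose Λ₂₁ , a₁₂ , untranspose a₂₁ ,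
        read-≈ {Λ = Λ₁₂} {transpose Λ₂₁} same 0ℤ 0ℤ
      where
      same : ∀ x y → FominField.at Λ₁₂ x y ≡ FominField.at Λ₂₁ y x
      same x y = subst₂ (λ x y → FominField.at Λ₁₂ x y ≡ FominField.at Λ₂₁ y x) (recenter X x) (recenter Y y)
        -- On row Y both fields agree with Λ₁, on column X both agree with Λ₂. The shift makes these
        -- two lines the axes to which `field-unique` refers.
        (field-unique (shift Λ₁₂ X Y) (shift (transpose Λ₂₁) X Y)
          (λ i _ → subst (λ y → FominField.at Λ₁₂ (X ℤ.+ + i) y ≡ FominField.at Λ₂₁ y (X ℤ.+ + i)) (sym (ℤ.+-identityʳ Y))
            (trans (row (X ℤ.+ + i)) (sym (FieldActs.off-column a₂₁ Y (X ℤ.+ + i) (next y₀)))))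
          (λ i _ → subst (λ x → FominField.at Λ₁₂ x (Y ℤ.+ + i) ≡ FominField.at Λ₂₁ (Y ℤ.+ + i) x) (sym (ℤ.+-identityʳ X))
            (trans (FieldActs.off-column a₁₂ X (Y ℤ.+ + i) (next x₀)) (sym (col (Y ℤ.+ + i)))))
          (x - X) (y - Y))
        where
        recenter : ∀ X x → X ℤ.+ (x - X) ≡ x
        recenter = solve-∀

operators-commute : ∀ {m} (k k′ : Kind) (i j : Fin (2 + m)) (b : Pair (2 + m)) →
  (K₂ k′ j b >>= K₁ k i) ≡ (K₁ k i b >>= K₂ k′ j)
operators-commute {m} k k′ i j b = subst (λ b → (K₂ k′ j b >>= K₁ k i) ≡ (K₁ k i b >>= K₂ k′ j)) (read-field b)
    (go (K₁ k i b₀) (K₂ k′ j b₀) (K₁-outcome k i Λ) (K₂-outcome k′ j Λ))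
  where
  Λ : FominField (2 + m) (Pair.size b)
  Λ = λ[ b ]
  b₀ : Pair (2 + m)
  b₀ = read Λ 0ℤ 0ℤ
  x₀ y₀ : ℤ
  x₀ = + toℕ i
  y₀ = + toℕ j
  open Commutation {m} {Pair.size b} k k′ x₀ y₀ {Λ}
  undefined₁ : ∀ (Λ₂ : FominField (2 + m) (Pair.size b)) r → ColumnOutcome k x₀ Λ₂ r → (∀ Λ̃ → ¬ FieldActs k x₀ Λ₂ Λ̃) → r ≡ nothing
  undefined₁ Λ₂ nothing  _ _ = refl
  undefined₁ Λ₂ (just _) (Λ̃ , a , _) none = contradiction a (none Λ̃)
  undefined₂ : ∀ (Λ₁ : FominField (2 + m) (Pair.size b)) r → RowOutcome k′ y₀ Λ₁ r → (∀ Λ̃ → ¬ RowActs k′ y₀ Λ₁ Λ̃) → r ≡ nothing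
  undefined₂ Λ₁ nothing  _ _ = refl
  undefined₂ Λ₁ (just _) (Λ̃ , a , _) none = contradiction a (none Λ̃)
  go : ∀ r₁ r₂ → ColumnOutcome k x₀ Λ r₁ → RowOutcome k′ y₀ Λ r₂ → (r₂ >>= K₁ k i) ≡ (r₁ >>= K₂ k′ j)
  go nothing nothing _ _ = refl
  go nothing (just _) low (Λ₂ , a₂ , refl) = undefined₁ Λ₂ _ (K₁-outcome k i Λ₂) (column-undefined a₂ (low⇒undefined low))
  go (just _) nothing (Λ₁ , a₁ , refl) none = sym (undefined₂ Λ₁ _ (K₂-outcome k′ j Λ₁) (row-undefined a₁ none))
  go (just _) (just _) (Λ₁ , a₁ , refl) (Λ₂ , a₂ , refl) = finish (commute {Λ₁} {Λ₂} a₁ a₂)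
    where
    finish : ∃[ Λ₁₂ ] ∃[ Λ₂₁ ] FieldActs k x₀ Λ₂ Λ₁₂ × RowActs k′ y₀ Λ₁ Λ₂₁ × read Λ₁₂ 0ℤ 0ℤ ≡ read Λ₂₁ 0ℤ 0ℤ →
      K₁ k i (read Λ₂ 0ℤ 0ℤ) ≡ K₂ k′ j (read Λ₁ 0ℤ 0ℤ)
    finish (Λ₁₂ , Λ₂₁ , a₁₂ , a₂₁ , eq) = trans (outcome-just (K₁-outcome k i Λ₂) a₁₂)
      (trans (cong just eq) (sym (row-outcome-just {Λ = Λ₁} {Λ₂₁} (K₂-outcome k′ j Λ₁) a₂₁)))

-- Weights and string lengths

count-label : ∀ {ℓ n} → Fin n → List (Letter ℓ n) → ℕ
count-label t w = length (filter (λ letter → proj₂ letter Fin.≟ t) w)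

count-++ : ∀ {ℓ n} (t : Fin n) (v w : List (Letter ℓ n)) → count-label t (v ++ w) ≡ count-label t v + count-label t w
count-++ t v w = trans (cong length (List.filter-++ _ v w)) (List.length-++ (filter _ v))

count-same : ∀ {ℓ n} (t : Fin n) (j : Fin ℓ) c → count-label t (replicate c (j , t)) ≡ c
count-same t j zero    = refl
count-same t j (suc c) = trans (cong length (List.filter-accept (λ letter → proj₂ letter Fin.≟ t) refl)) (cong suc (count-same t j c))

count-other : ∀ {ℓ n} {t s : Fin n} (j : Fin ℓ) c → s ≢ t → count-label t (replicate c (j , s)) ≡ 0
count-other j zero    s≢t = refl
count-other {t = t} j (suc c) s≢t = trans (cong length (List.filter-reject (λ letter → proj₂ letter Fin.≟ t) s≢t)) (count-other j c s≢t)

count-row : ∀ {ℓ n h} (j : Fin ℓ) (t : Fin h) (lab : Fin h → Fin n) → (∀ {s s′} → lab s ≡ lab s′ → s ≡ s′) → (c : Fin h → ℕ) →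
  count-label (lab t) (concat (List.tabulate λ s → replicate (c s) (j , lab s))) ≡ c t
count-row j zero lab inj c = trans (count-++ (lab zero) (replicate (c zero) (j , lab zero)) _)
  (trans (cong₂ _+_ (count-same (lab zero) j (c zero)) (absent (lab ∘ suc) (c ∘ suc) λ s eq → contradiction (inj eq) λ ()))
    (ℕ.+-identityʳ (c zero)))
  where
  absent : ∀ {h} (lab′ : Fin h → Fin _) (c : Fin h → ℕ) → (∀ s → lab′ s ≢ lab zero) →
    count-label (lab zero) (concat (List.tabulate λ s → replicate (c s) (j , lab′ s))) ≡ 0
  absent {zero}  lab′ c ne = refl
  absent {suc h} lab′ c ne = trans (count-++ (lab zero) (replicate (c zero) (j , lab′ zero)) _)
    (cong₂ _+_ (count-other j (c zero) (ne zero)) (absent (lab′ ∘ suc) (c ∘ suc) (ne ∘ suc)))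
count-row j (suc t) lab inj c = trans (count-++ (lab (suc t)) (replicate (c zero) (j , lab zero)) _)
  (cong₂ _+_ (count-other j (c zero) (λ eq → contradiction (inj eq) λ ()))
    (count-row j t (lab ∘ suc) (λ eq → Fin.suc-injective (inj eq)) (c ∘ suc)))

count-stack : ∀ {ℓ n h} (t : Fin n) (w : Fin h → List (Letter ℓ n)) (u v : Vec ℤ h) →
  (∀ j → + count-label t (w j) ≡ lookup u j - lookup v j) → + count-label t (stack w) ≡ total u - total v
count-stack t w [] [] eq = refl
count-stack t w (p ∷ u) (q ∷ v) eq = trans (cong +_ (count-++ t (stack (w ∘ suc)) (w zero)))
  (trans (cong₂ ℤ._+_ (count-stack t (w ∘ suc) u v (eq ∘ suc)) (eq zero)) (lemma (total u) (total v) p q))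
  where
  lemma : ∀ u v p q → u - v ℤ.+ (p - q) ≡ p ℤ.+ u - (q ℤ.+ v)
  lemma = solve-∀

wt-size : ∀ {ℓ n} {θ ρ : Signature ℓ} (P : SST θ ρ n) t → wt P t ≡ size (layer P (suc t)) - size (layer P (inject₁ t))
wt-size P t = trans (cong (λ w → + count-label t w) (stack-≡ (rowWord P)))
  (count-stack t (rowWord P) (parts (layer P (suc t))) (parts (layer P (inject₁ t))) λ j →
    trans (cong +_ (count-row j t id id (mult P j)))
      (ℤ.0≤i⇒+∣i∣≡i (≥0 (_⪯_.below (strip P t) j))))

sizeAt : ∀ {n ℓ} → FominField n ℓ → ℤ → ℤ → ℤ
sizeAt Λ x y = size (FominField.at Λ x y)

wt₁-read : ∀ {n ℓ} (Λ : FominField n ℓ) t → wt₁ (read Λ 0ℤ 0ℤ) t ≡ sizeAt Λ (+ suc (toℕ t)) 0ℤ - sizeAt Λ (+ toℕ t) 0ℤ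
wt₁-read Λ t = trans (wt-size (read₁ Λ 0ℤ 0ℤ) t) (cong₂ (λ σ τ → size σ - size τ)
  (Vec.lookup∘tabulate (λ t → at (0ℤ ℤ.+ + toℕ t) 0ℤ) (suc t))
  (trans (Vec.lookup∘tabulate (λ t → at (0ℤ ℤ.+ + toℕ t) 0ℤ) (inject₁ t)) (cong (λ u → at (+ u) 0ℤ) (Fin.toℕ-inject₁ t))))
  where open FominField Λ

-- By `size-balance` opposite sides of a square have equal size differences. This is used where a
-- weight has to be carried around the cylinder.
size-conserved : ∀ {n ℓ} (Λ : FominField n ℓ) x y →
  sizeAt Λ (x ℤ.+ 1ℤ) y - sizeAt Λ x y ≡ sizeAt Λ (x ℤ.+ 1ℤ) 0ℤ - sizeAt Λ x 0ℤ
size-conserved Λ x = ℤ-ind (λ y → D y ≡ D 0ℤ) 0ℤ refl (λ y ih → trans (step y) ih) (λ y ih → trans (sym (step y)) ih)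
  where
  open FominField Λ
  D : ℤ → ℤ
  D y = sizeAt Λ (x ℤ.+ 1ℤ) y - sizeAt Λ x y
  step : ∀ y → D (y ℤ.+ 1ℤ) ≡ D y
  step y = by-≡ (lemma (sizeAt Λ (x ℤ.+ 1ℤ) (y ℤ.+ 1ℤ)) (sizeAt Λ x (y ℤ.+ 1ℤ)) (sizeAt Λ (x ℤ.+ 1ℤ) y) (sizeAt Λ x y))
    (diff-≡ (Carry.size-balance (at-e₁ x y) (at-e₂ x y) (square x y)))
    where
    lemma : ∀ ν θ μ κ → ν - θ - (μ - κ) ≡ ν ℤ.+ κ - (μ ℤ.+ θ)
    lemma = solve-∀

Σ[_] : ∀ {n} → (Fin n → ℤ) → ℤ
Σ[ u ] = foldr ℤ._+_ 0ℤ (List.tabulate u)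

basis-suc : ∀ {n} (i t : Fin n) → basis (suc i) (suc t) ≡ basis i t
basis-suc i t with i Fin.≟ t
... | yes _ = refl
... | no _  = refl

Σ-basis : ∀ {n} (i : Fin n) (v : Fin n → ℤ) → Σ[ (λ t → basis i t ℤ.* v t) ] ≡ v i
Σ-basis zero    v = trans (cong₂ ℤ._+_ (ℤ.*-identityˡ (v zero)) (zeros (v ∘ suc))) (ℤ.+-identityʳ (v zero))
  where
  zeros : ∀ {n} (v : Fin n → ℤ) → Σ[ (λ t → 0ℤ ℤ.* v t) ] ≡ 0ℤ
  zeros {zero}  v = refl
  zeros {suc n} v = cong₂ ℤ._+_ (ℤ.*-zeroˡ (v zero)) (zeros (v ∘ suc))
Σ-basis (suc i) v = trans (cong₂ ℤ._+_ (ℤ.*-zeroˡ (v zero))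
  (cong (foldr ℤ._+_ 0ℤ) (List.tabulate-cong λ t → cong (ℤ._* v (suc t)) (basis-suc i t))))
  (trans (ℤ.+-identityˡ _) (Σ-basis i (v ∘ suc)))

Σ-difference : ∀ {n} (u v : Fin n → ℤ) → Σ[ (λ t → u t - v t) ] ≡ Σ[ u ] - Σ[ v ]
Σ-difference {zero}  u v = refl
Σ-difference {suc n} u v = trans (cong (λ s → u zero - v zero ℤ.+ s) (Σ-difference (u ∘ suc) (v ∘ suc)))
  (lemma (u zero) (v zero) Σ[ u ∘ suc ] Σ[ v ∘ suc ])
  where
  lemma : ∀ a b s t → a - b ℤ.+ (s - t) ≡ a ℤ.+ s - (b ℤ.+ t)
  lemma = solve-∀

simple-root-pairing : ∀ {n} (i j : Fin n) v → ⟨ (λ t → basis i t - basis j t) , v ⟩ ≡ v i - v j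
simple-root-pairing i j v = trans
  (cong (foldr ℤ._+_ 0ℤ) (List.tabulate-cong λ t → lemma (basis i t) (basis j t) (v t)))
  (trans (Σ-difference (λ t → basis i t ℤ.* v t) (λ t → basis j t ℤ.* v t)) (cong₂ _-_ (Σ-basis i v) (Σ-basis j v)))
  where
  lemma : ∀ a b v → (a - b) ℤ.* v ≡ a ℤ.* v - b ℤ.* v
  lemma = solve-∀

record Minimum (f : ℤ → ℤ) (m : ℤ) : Set where
  constructor minimum
  field
    bound    : ∀ x → m ℤ.≤ f x
    point    : ℤ
    attained : f point ≡ m

Minimum-unique : ∀ {f m m′} → Minimum f m → Minimum f m′ → m ≡ m′
Minimum-unique {f} (minimum b x eq) (minimum b′ x′ eq′) = ℤ.≤-antisym
  (subst (_ ℤ.≤_) eq′ (b x′)) (subst (_ ℤ.≤_) eq (b′ x))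

minimum-exists : ∀ (f : ℤ → ℤ) N M {c d} → (∀ x → x ℤ.≤ N → f x ≡ c) → (∀ x → M ℤ.< x → f x ≡ d) → ∃ (Minimum f)
minimum-exists f N M {c} {d} low high = from (search ∣ M ⊔ N ℤ.+ 1ℤ - N ∣)
  where
  N≤ : N ℤ.≤ M ⊔ N ℤ.+ 1ℤ
  N≤ = ℤ.≤-trans (ℤ.i≤j⊔i M N) (ℤ.i≤i+j _ 1ℤ)
  reach : N ℤ.+ + ∣ M ⊔ N ℤ.+ 1ℤ - N ∣ ≡ M ⊔ N ℤ.+ 1ℤ
  reach = trans (cong (λ t → N ℤ.+ t) (ℤ.0≤i⇒+∣i∣≡i (≥0 N≤))) (lemma N (M ⊔ N ℤ.+ 1ℤ))
    where
    lemma : ∀ a b → a ℤ.+ (b - a) ≡ b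
    lemma = solve-∀
  Least : ℕ → Set
  Least k = ∃[ p ] (∀ j → j ℕ.≤ k → f p ℤ.≤ f (N ℤ.+ + j))
  search : ∀ k → Least k
  search zero = N ℤ.+ 0ℤ , λ { .zero z≤n → ℤ.≤-refl }
  search (suc k) with search k
  ... | p , p≤ with ℤ.≤-total (f p) (f (N ℤ.+ + suc k))
  ...   | inj₁ le = p , λ j j≤ → extend j (ℕ.m≤n⇒m<n∨m≡n j≤)
    where
    extend : ∀ j → j ℕ.< suc k ⊎ j ≡ suc k → f p ℤ.≤ f (N ℤ.+ + j)
    extend j (inj₁ (s≤s j≤k)) = p≤ j j≤k
    extend j (inj₂ refl)      = le
  ...   | inj₂ ge = N ℤ.+ + suc k , λ j j≤ → extend j (ℕ.m≤n⇒m<n∨m≡n j≤)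
    where
    extend : ∀ j → j ℕ.< suc k ⊎ j ≡ suc k → f (N ℤ.+ + suc k) ℤ.≤ f (N ℤ.+ + j)
    extend j (inj₁ (s≤s j≤k)) = ℤ.≤-trans ge (p≤ j j≤k)
    extend j (inj₂ refl)      = ℤ.≤-refl
  from : Least ∣ M ⊔ N ℤ.+ 1ℤ - N ∣ → ∃ (Minimum f)
  from (p , p≤) = f p , minimum bound p refl
    where
    bound : ∀ x → f p ℤ.≤ f x
    bound x with ℤ.≤-total x N
    ... | inj₁ x≤N = subst (f p ℤ.≤_) (trans (cong f (ℤ.+-identityʳ N)) (trans (low N ℤ.≤-refl) (sym (low x x≤N)))) (p≤ 0 z≤n)
    ... | inj₂ N≤x with ≤-offset N≤x
    ...   | j , refl with j ℕ.≤? ∣ M ⊔ N ℤ.+ 1ℤ - N ∣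
    ...     | yes j≤ = p≤ j j≤
    ...     | no j≰  = subst (f p ℤ.≤_) (trans (cong f reach) (trans (high _ (ℤ.≤-<-trans (ℤ.i≤i⊔j M N) (x<x+1 _)))
        (sym (high _ (ℤ.<-trans (ℤ.≤-<-trans (ℤ.i≤i⊔j M N) (x<x+1 _))
          (subst (ℤ._< N ℤ.+ + j) reach (ℤ.+-monoʳ-< N (ℤ.+<+ (ℕ.≰⇒> j≰))))))))) (p≤ _ ℕ.≤-refl)

-- The operator k can be applied r times to the middle term of α ⪯ β ⪯ γ.
Depth : Kind → (α γ β : Signature ℓ) → ℕ → Set
Depth k α γ β r = ∃[ m ] Minimum (height α γ β) m × floor k α γ β ≡ m ℤ.+ + r

module _ {α β γ β̃ : Signature ℓ} (α⪯β : α ⪯ β) (β⪯γ : β ⪯ γ) (L : Lift α γ β β̃) where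

  open LiftProperties α⪯β β⪯γ L

  private
    M : ℤ
    M = height α γ β (col - 1ℤ)

  lower-minimum : Minimum (height α γ β) M
  lower-minimum = minimum bound (col - 1ℤ) refl
    where
    bound : ∀ x → M ℤ.≤ height α γ β x
    bound x with x ℤ.<? col
    ... | yes x< = height-before x x<
    ... | no  x≮ = ℤ.≤-trans (ℤ.i≤i+j M 1ℤ) (height-after x (ℤ.≮⇒≥ x≮))

  upper-minimum : Minimum (height α γ β̃) (M - 1ℤ)
  upper-minimum = minimum bound col (height̃-col α⪯β β⪯γ L)
    where
    lemma : ∀ h m → h - + 2 - (m - 1ℤ) ≡ h - (m ℤ.+ 1ℤ)
    lemma = solve-∀
    bound : ∀ x → M - 1ℤ ℤ.≤ height α γ β̃ x
    bound x with x ℤ.<? col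
    ... | yes x< = ℤ.≤-trans (ℤ.i-j≤i M 1ℤ) (subst (M ℤ.≤_) (sym (height̃-before α⪯β β⪯γ L x x<)) (height-before x x<))
    ... | no  x≮ = subst (M - 1ℤ ℤ.≤_) (sym (height̃-after α⪯β β⪯γ L x (ℤ.≮⇒≥ x≮)))
      (by-≤ (lemma (height α γ β x) M) (≥0 (height-after x (ℤ.≮⇒≥ x≮))))

  height∞-lift : height∞ α γ β̃ ≡ height∞ α γ β - + 2
  height∞-lift = trans (cong (λ t → size γ ℤ.+ size α - (t ℤ.+ t)) (size-lift α⪯β β⪯γ L)) (lemma (size γ ℤ.+ size α) (size β))
    where
    lemma : ∀ a b → a - (b ℤ.+ 1ℤ ℤ.+ (b ℤ.+ 1ℤ)) ≡ a - (b ℤ.+ b) - + 2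
    lemma = solve-∀

  M<height∞ : M ℤ.+ 1ℤ ℤ.≤ height∞ α γ β
  M<height∞ = subst (M ℤ.+ 1ℤ ℤ.≤_) (proj₂ (height-high α γ β) x (ℤ.≤-<-trans (ℤ.i≤i⊔j A col) (x<x+1 _)))
    (height-after x (ℤ.<⇒≤ (ℤ.≤-<-trans (ℤ.i≤j⊔i A col) (x<x+1 _))))
    where
    A x : ℤ
    A = proj₁ (height-high α γ β)
    x = A ⊔ col ℤ.+ 1ℤ

  M≤0 : M ℤ.≤ 0ℤ
  M≤0 = subst (M ℤ.≤_) (proj₂ (height-low α γ β) x (ℤ.i⊓j≤i A _)) (height-before x (≤-1⇒< (ℤ.i⊓j≤j A _)))
    where
    A x : ℤ
    A = proj₁ (height-low α γ β)
    x = A ⊓ (col - 1ℤ)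

depth-step : ∀ {f f̃ : ℤ → ℤ} {M M̃ c c̃ r} → Minimum f M → Minimum f̃ M̃ → ∃[ m ] Minimum f m × c ≡ m ℤ.+ + r →
  c̃ - M̃ ≡ c - M - 1ℤ → 1ℤ ℤ.≤ c - M → ∃[ r′ ] r ≡ suc r′ × ∃[ m ] Minimum f̃ m × c̃ ≡ m ℤ.+ + r′
depth-step {M = M} {M̃} {c} {c̃} {r} min miñ (m , min′ , c≡) rel le with Minimum-unique min min′
... | refl = go r (trans (cong (_- M) c≡) (lemma M (+ r))) le
  where
  lemma : ∀ m r → m ℤ.+ r - m ≡ r
  lemma = solve-∀
  go : ∀ r → c - M ≡ + r → 1ℤ ℤ.≤ c - M → ∃[ r′ ] r ≡ suc r′ × ∃[ m ] Minimum _ m × c̃ ≡ m ℤ.+ + r′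
  go zero    eq le = contradiction (subst (1ℤ ℤ.≤_) eq le) λ { (ℤ.+≤+ ()) }
  go (suc r) eq le = r , refl , M̃ , miñ , by-≡ (lemma′ c̃ M̃ c M (+ r)) (diff-≡ rel ⟨-⟩ diff-≡ (sym eq))
    where
    lemma′ : ∀ c̃ m̃ c m r → c̃ - (m̃ ℤ.+ r) ≡ (c̃ - m̃ - (c - m - 1ℤ)) - (1ℤ ℤ.+ r - (c - m))
    lemma′ = solve-∀

-- A lift lowers the minimum by 1 and `height∞` by 2 and leaves the starting value 0. Hence floor
-- minus minimum falls by 1 along `E`; along `F`, which undoes a lift, the minimum rises by 1 under
-- the fixed floor 0.
acts-depth : ∀ k {α β γ σ : Signature ℓ} {r} → α ⪯ β → β ⪯ γ → Acts k α γ β σ → Depth k α γ β r →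
  ∃[ r′ ] r ≡ suc r′ × Depth k α γ σ r′
acts-depth E {α} {β} {γ} {σ} α⪯β β⪯γ (acts L _ _) d = depth-step (lower-minimum α⪯β β⪯γ L) (upper-minimum α⪯β β⪯γ L) d
  (trans (cong (_- (M - 1ℤ)) (height∞-lift α⪯β β⪯γ L)) (lemma (height∞ α γ β) M))
  (by-≤ (lemma′ (height∞ α γ β) M) (≥0 (M<height∞ α⪯β β⪯γ L)))
  where
  M : ℤ
  M = height α γ β (Lift.col L - 1ℤ)
  lemma : ∀ h m → h - + 2 - (m - 1ℤ) ≡ h - m - 1ℤ
  lemma = solve-∀
  lemma′ : ∀ h m → h - m - 1ℤ ≡ h - (m ℤ.+ 1ℤ)
  lemma′ = solve-∀
acts-depth F {α} {β} {γ} {σ} α⪯β β⪯γ (acts L α⪯σ σ⪯γ) d = depth-step (upper-minimum α⪯σ σ⪯γ L) (lower-minimum α⪯σ σ⪯γ L) d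
  (lemma M) (by-≤ (lemma′ M) (≥0 (M≤0 α⪯σ σ⪯γ L)))
  where
  M : ℤ
  M = height α γ σ (Lift.col L - 1ℤ)
  lemma : ∀ m → 0ℤ - m ≡ 0ℤ - (m - 1ℤ) - 1ℤ
  lemma = solve-∀
  lemma′ : ∀ m → 0ℤ - (m - 1ℤ) - 1ℤ ≡ 0ℤ - m
  lemma′ = solve-∀

floor⇒depth-0 : ∀ k {α β γ : Signature ℓ} {r} → (∀ x → floor k α γ β ℤ.≤ height α γ β x) → Depth k α γ β r → r ≡ 0
floor⇒depth-0 k {r = r} low (m , minimum _ p attained , eq) = go r (ℤ.≤-trans (ℤ.≤-reflexive (sym eq)) (subst (_ ℤ.≤_) attained (low p)))
  where
  go : ∀ r → m ℤ.+ + r ℤ.≤ m → r ≡ 0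
  go zero    _  = refl
  go (suc r) le = contradiction le (ℤ.<⇒≱ (ℤ.≤-<-trans (ℤ.≤-reflexive (sym (ℤ.+-identityʳ m))) (ℤ.+-monoʳ-< m (ℤ.+<+ (s≤s z≤n)))))

height-minimum : ∀ (α γ β : Signature ℓ) → ∃ (Minimum (height α γ β))
height-minimum α γ β = minimum-exists (height α γ β) _ _ (proj₂ (height-low α γ β)) (proj₂ (height-high α γ β))

minimum≤floor : ∀ k {α γ β : Signature ℓ} {m} → Minimum (height α γ β) m → m ℤ.≤ floor k α γ β
minimum≤floor E {α} {γ} {β} min = subst (_ ℤ.≤_) (proj₂ (height-high α γ β) _ (x<x+1 _)) (Minimum.bound min _)
minimum≤floor F {α} {γ} {β} min = subst (_ ℤ.≤_) (proj₂ (height-low α γ β) _ ℤ.≤-refl) (Minimum.bound min _)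

module StringLength {B : Set} (g : B → Maybe B) (R : B → ℕ → Set)
  (stop : ∀ {b r} → g b ≡ nothing → R b r → r ≡ 0)
  (step : ∀ {b b′ r} → g b ≡ just b′ → R b r → ∃[ r′ ] r ≡ suc r′ × R b′ r′) where

  power-suc : ∀ k b → power g (suc k) b ≡ (g b >>= power g k)
  power-suc zero    b with g b
  ... | just _  = refl
  ... | nothing = refl
  power-suc (suc k) b = trans (cong (_>>= g) (power-suc k b)) (assoc (g b))
    where
    assoc : ∀ r → ((r >>= power g k) >>= g) ≡ (r >>= power g (suc k))
    assoc (just _) = refl
    assoc nothing  = refl

  -- The rank falls by exactly 1 with each application and is 0 wherever `g` is undefined, so the
  -- string can neither stop early nor run on.
  stringLength : ∀ r b → R b r → IsStringLength g b r
  stringLength r b R-b = reached r b R-b , λ k → bounded k r b R-b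
    where
    reached : ∀ r b → R b r → power g r b ≢ nothing
    reached zero    b R-b ()
    reached (suc r) b R-b eq = go (g b) refl
      where
      go : ∀ s → g b ≡ s → _
      go nothing  gb = contradiction (stop gb R-b) λ ()
      go (just b′) gb with step gb R-b
      ... | .r , refl , R-b′ = reached r b′ R-b′ (trans (cong (_>>= power g r) (sym gb)) (trans (sym (power-suc r b)) eq))
    bounded : ∀ k r b → R b r → power g k b ≢ nothing → k ℕ.≤ r
    bounded zero    r b R-b _  = z≤n
    bounded (suc k) r b R-b ne = go (g b) refl
      where
      go : ∀ s → g b ≡ s → suc k ℕ.≤ r
      go nothing  gb = contradiction (trans (power-suc k b) (cong (_>>= power g k) gb)) ne
      go (just b′) gb with step gb R-b
      ... | r′ , refl , R-b′ = s≤s (bounded k r′ b′ R-b′ λ eq → ne (trans (power-suc k b) (trans (cong (_>>= power g k) gb) eq)))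

-- Crystal axioms for the first family

module Crystal₁ {m : ℕ} where

  private
    n : ℕ
    n = 2 + m

    2≤n : 2 ℕ.≤ n
    2≤n = s≤s (s≤s z≤n)

  K₁-just : ∀ k (i : Fin n) (b : Pair n) {b′} → K₁ k i b ≡ just b′ → ∃[ Λ̃ ] FieldActs k (+ toℕ i) λ[ b ] Λ̃ × b′ ≡ read Λ̃ 0ℤ 0ℤ
  K₁-just k i b eq = subst (ColumnOutcome k (+ toℕ i) λ[ b ]) (trans (cong (K₁ k i) (read-field b)) eq) (K₁-outcome k i λ[ b ])

  K₁-nothing : ∀ k (i : Fin n) (b : Pair n) → K₁ k i b ≡ nothing → Low k λ[ b ] (+ toℕ i) 0ℤ
  K₁-nothing k i b eq = subst (ColumnOutcome k (+ toℕ i) λ[ b ]) (trans (cong (K₁ k i) (read-field b)) eq) (K₁-outcome k i λ[ b ])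

  K₁-flip : ∀ k (i : Fin n) (b b′ : Pair n) → K₁ k i b ≡ just b′ → K₁ (flip k) i b′ ≡ just b
  K₁-flip k i b b′ eq = reverse (K₁-just k i b eq)
    where
    reverse : ∃[ Λ̃ ] FieldActs k (+ toℕ i) λ[ b ] Λ̃ × b′ ≡ read Λ̃ 0ℤ 0ℤ → K₁ (flip k) i b′ ≡ just b
    reverse (Λ̃ , a , b′≡) = trans (cong (K₁ (flip k) i) b′≡)
      (trans (outcome-just (K₁-outcome (flip k) i Λ̃) (FieldActs-flip {Λ = λ[ b ]} {Λ̃} 2≤n a)) (cong just (read-field b)))

  private
    indicator-off : ∀ (i t : Fin n) → i ≢ t → ¬ OnColumn n (+ toℕ i) (+ toℕ t)
    indicator-off i t i≢t = off-apart 0ℤ (toℕ i) (toℕ t) (i≢t ∘ Fin.toℕ-injective)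
      (ℕ.≤-trans (Fin.toℕ<n i) (ℕ.m≤m+n n (toℕ t))) (ℕ.≤-trans (Fin.toℕ<n t) (ℕ.m≤m+n n (toℕ i)))

    next-on : ∀ (i t : Fin n) → cyclicPred i ≡ t → OnColumn n (+ toℕ i) (+ suc (toℕ t))
    -- Label n lies between columns n - 1 and n, and column n is in the class of column 0: the
    -- convention ε₀ = εₙ.
    next-on zero    t refl = subst (λ s → OnColumn n 0ℤ (+ suc s)) (sym (Fin.toℕ-fromℕ (suc m)))
      (subst (OnColumn n 0ℤ) (trans (ℤ.+-identityˡ (1ℤ ℤ.* + n)) (ℤ.*-identityˡ (+ n))) (onColumn-shift 1ℤ (onColumn-base 0ℤ)))
    next-on (suc i) t refl = subst (λ s → OnColumn n (+ suc (toℕ i)) (+ suc s)) (sym (Fin.toℕ-inject₁ i)) (onColumn-base (+ suc (toℕ i)))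

    next-off : ∀ (i t : Fin n) → cyclicPred i ≢ t → ¬ OnColumn n (+ toℕ i) (+ suc (toℕ t))
    next-off zero    t ne = off-apart 0ℤ 0 (suc (toℕ t)) (λ ()) (s≤s z≤n)
      (ℕ.<-≤-trans (s≤s (ℕ.≤∧≢⇒< (ℕ.s≤s⁻¹ (Fin.toℕ<n t)) λ eq → ne (Fin.toℕ-injective (trans (Fin.toℕ-fromℕ (suc m)) (sym eq)))))
        (ℕ.≤-reflexive (sym (ℕ.+-identityʳ n))))
    next-off (suc i) t ne = off-apart 0ℤ (suc (toℕ i)) (suc (toℕ t))
      (λ eq → ne (Fin.toℕ-injective (trans (Fin.toℕ-inject₁ i) (ℕ.suc-injective eq))))
      (ℕ.≤-trans (s≤s (Fin.toℕ<n i)) (ℕ.m≤m+n n (suc (toℕ t))))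
      (ℕ.≤-<-trans (Fin.toℕ<n t) (ℕ.m<m+n n (s≤s z≤n)))

    size-drop : ∀ {ℓ} {i : Fin n} {Λ Λ̃ : FominField n ℓ} {s} (t : Fin n) → FieldActs F (+ toℕ i) Λ Λ̃ → (j : Fin n) →
      (j ≡ t → OnColumn n (+ toℕ i) s) → (j ≢ t → ¬ OnColumn n (+ toℕ i) s) →
      sizeAt Λ̃ s 0ℤ ≡ sizeAt Λ s 0ℤ - basis j t
    size-drop {Λ = Λ} {Λ̃} {s} t a j yes-on no-off with j Fin.≟ t
    ... | no j≢t  = trans (cong size (FieldActs.off-column a s 0ℤ (no-off j≢t))) (sym (ℤ.+-identityʳ _))
    ... | yes j≡t = lowered (FieldActs.on-column a s 0ℤ (yes-on j≡t))
      where
      lowered : ActsAt F Λ s 0ℤ (FominField.at Λ̃ s 0ℤ) → sizeAt Λ̃ s 0ℤ ≡ sizeAt Λ s 0ℤ - 1ℤ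
      lowered (acts L p q) = trans (sym (x+1-1 (sizeAt Λ̃ s 0ℤ))) (cong (_- 1ℤ) (sym (size-lift p q L)))

  F-weight : ∀ (i : Fin n) (b b′ : Pair n) → K₁ F i b ≡ just b′ → ∀ t → wt₁ b′ t ≡ wt₁ b t - basis (cyclicPred i) t ℤ.+ basis i t
  F-weight i b b′ eq t = from (K₁-just F i b eq)
    where
    from : ∃[ Λ̃ ] FieldActs F (+ toℕ i) λ[ b ] Λ̃ × b′ ≡ read Λ̃ 0ℤ 0ℤ → wt₁ b′ t ≡ wt₁ b t - basis (cyclicPred i) t ℤ.+ basis i t
    from (Λ̃ , a , b′≡) = begin
      wt₁ b′ t                                                          ≡⟨ cong (λ b → wt₁ b t) b′≡ ⟩
      wt₁ (read Λ̃ 0ℤ 0ℤ) t                                              ≡⟨ wt₁-read Λ̃ t ⟩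
      sizeAt Λ̃ (+ suc (toℕ t)) 0ℤ - sizeAt Λ̃ (+ toℕ t) 0ℤ
        ≡⟨ cong₂ _-_ (size-drop {i = i} {λ[ b ]} {Λ̃} {+ suc (toℕ t)} t a (cyclicPred i) (next-on i t) (next-off i t))
             (size-drop {i = i} {λ[ b ]} {Λ̃} {+ toℕ t} t a i (λ { refl → onColumn-base _ }) (indicator-off i t)) ⟩
      (S (+ suc (toℕ t)) - basis (cyclicPred i) t) - (S (+ toℕ t) - basis i t)
        ≡⟨ lemma (S (+ suc (toℕ t))) (S (+ toℕ t)) (basis (cyclicPred i) t) (basis i t) ⟩
      (S (+ suc (toℕ t)) - S (+ toℕ t)) - basis (cyclicPred i) t ℤ.+ basis i t
        ≡⟨ cong (λ w → w - basis (cyclicPred i) t ℤ.+ basis i t) (sym (wt₁-read λ[ b ] t)) ⟩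
      wt₁ (read λ[ b ] 0ℤ 0ℤ) t - basis (cyclicPred i) t ℤ.+ basis i t
        ≡⟨ cong (λ b → wt₁ b t - basis (cyclicPred i) t ℤ.+ basis i t) (read-field b) ⟩
      wt₁ b t - basis (cyclicPred i) t ℤ.+ basis i t ∎
      where
      open ≡-Reasoning
      S : ℤ → ℤ
      S x = sizeAt λ[ b ] x 0ℤ
      lemma : ∀ s r p q → (s - p) - (r - q) ≡ (s - r) - p ℤ.+ q
      lemma = solve-∀

  DepthAt : ∀ {ℓ} → Kind → ℤ → FominField n ℓ → ℕ → Set
  DepthAt k x Λ = Depth k (at (x - 1ℤ) 0ℤ) (at (x ℤ.+ 1ℤ) 0ℤ) (at x 0ℤ)
    where open FominField Λ

  DepthAt-step : ∀ {ℓ k x} {Λ Λ̃ : FominField n ℓ} {r} → FieldActs k x Λ Λ̃ → DepthAt k x Λ r →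
    ∃[ r′ ] r ≡ suc r′ × DepthAt k x Λ̃ r′
  DepthAt-step {k = k} {x} {Λ} {Λ̃} {r} a d = retarget
      (acts-depth k (at-e₁⁻ Λ x 0ℤ) (FominField.at-e₁ Λ x 0ℤ) (FieldActs.on-column a x 0ℤ (onColumn-base x)) d)
    where
    retarget : ∃[ r′ ] r ≡ suc r′ × Depth k (FominField.at Λ (x - 1ℤ) 0ℤ) (FominField.at Λ (x ℤ.+ 1ℤ) 0ℤ) (FominField.at Λ̃ x 0ℤ) r′ →
      ∃[ r′ ] r ≡ suc r′ × DepthAt k x Λ̃ r′
    retarget (r′ , r≡ , d′) = r′ , r≡ , subst₂ (λ α γ → Depth k α γ (FominField.at Λ̃ x 0ℤ) r′)
      (sym (FieldActs.off-column a (x - 1ℤ) 0ℤ (onColumn-previous 2≤n (onColumn-base x))))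
      (sym (FieldActs.off-column a (x ℤ.+ 1ℤ) 0ℤ (onColumn-next 2≤n (onColumn-base x)))) d′

  strings : ∀ (i : Fin n) (b : Pair n) → ∃[ φ ] ∃[ ε ]
    IsStringLength (K₁ F i) b φ × IsStringLength (K₁ E i) b ε ×
    + φ - + ε ≡ ⟨ (λ t → basis (cyclicPred i) t - basis i t) , wt₁ b ⟩
  strings i b = from (height-minimum α γ β)
    where
    x : ℤ
    x = + toℕ i
    Λ : FominField n (Pair.size b)
    Λ = λ[ b ]
    open FominField Λ
    α β γ : Signature (Pair.size b)
    α = at (x - 1ℤ) 0ℤ
    β = at x 0ℤ
    γ = at (x ℤ.+ 1ℤ) 0ℤ

    R : Kind → Pair n → ℕ → Set
    R k b r = DepthAt k x λ[ b ] r

    stop : ∀ k {b r} → K₁ k i b ≡ nothing → R k b r → r ≡ 0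
    stop k {b} eq d = floor⇒depth-0 k (K₁-nothing k i b eq) d

    DepthAt-≈ : ∀ {ℓ k r} {Λ Λ′ : FominField n ℓ} → (∀ x y → FominField.at Λ x y ≡ FominField.at Λ′ x y) → DepthAt k x Λ r → DepthAt k x Λ′ r
    DepthAt-≈ {k = k} {r} {Λ} {Λ′} eq = replace (eq (x - 1ℤ) 0ℤ) (eq (x ℤ.+ 1ℤ) 0ℤ) (eq x 0ℤ)
      where
      replace : ∀ {ℓ} {α α′ γ γ′ β β′ : Signature ℓ} → α ≡ α′ → γ ≡ γ′ → β ≡ β′ → Depth k α γ β r → Depth k α′ γ′ β′ r
      replace refl refl refl d = d

    step : ∀ k {b b′ r} → K₁ k i b ≡ just b′ → R k b r → ∃[ r′ ] r ≡ suc r′ × R k b′ r′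
    step k {b} {b′} {r} eq d = forward (K₁-just k i b eq)
      where
      forward : ∃[ Λ̃ ] FieldActs k x λ[ b ] Λ̃ × b′ ≡ read Λ̃ 0ℤ 0ℤ → ∃[ r′ ] r ≡ suc r′ × R k b′ r′
      forward (Λ̃ , a , refl) with DepthAt-step {k = k} {x} {λ[ b ]} {Λ̃} a d
      ... | r′ , r≡ , d′ = r′ , r≡ , DepthAt-≈ {k = k} {r′} {Λ̃} {λ[ read Λ̃ 0ℤ 0ℤ ]} (λ u v →
        sym (trans (field-read Λ̃ 0ℤ 0ℤ u v) (cong₂ (FominField.at Λ̃) (ℤ.+-identityˡ u) (ℤ.+-identityˡ v)))) d′

    length-of : ∀ k r → R k b r → IsStringLength (K₁ k i) b r
    length-of k = λ r → StringLength.stringLength (K₁ k i) (R k) (λ {b} {r} → stop k {b} {r}) (λ {b} {b′} {r} → step k {b} {b′} {r}) r b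

    wt-b : ∀ t → wt₁ b t ≡ sizeAt Λ (+ suc (toℕ t)) 0ℤ - sizeAt Λ (+ toℕ t) 0ℤ
    wt-b t = trans (cong (λ b → wt₁ b t) (sym (read-field b))) (wt₁-read Λ t)

    wt-i : wt₁ b i ≡ size γ - size β
    wt-i = trans (wt-b i) (cong (λ u → sizeAt Λ (+ u) 0ℤ - size β) (ℕ.+-comm 1 (toℕ i)))

    wt-pred : wt₁ b (cyclicPred i) ≡ size β - size α
    wt-pred = trans (wt-b (cyclicPred i)) (pred i)
      where
      pred : ∀ i → sizeAt Λ (+ suc (toℕ (cyclicPred i))) 0ℤ - sizeAt Λ (+ toℕ (cyclicPred i)) 0ℤ ≡ sizeAt Λ (+ toℕ i) 0ℤ - sizeAt Λ (+ toℕ i - 1ℤ) 0ℤ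
      pred (suc i) = cong₂ (λ u v → sizeAt Λ (+ suc u) 0ℤ - sizeAt Λ (+ v) 0ℤ) (Fin.toℕ-inject₁ i) (Fin.toℕ-inject₁ i)
      -- Column -1 is outside the window that gives the weight. The points (n, 0) and (n - 1, 0) are
      -- (0, n) and (-1, n) on the cylinder, and `size-conserved` brings these down to row 0.
      pred zero = trans (cong (λ u → sizeAt Λ (+ suc u) 0ℤ - sizeAt Λ (+ u) 0ℤ) (Fin.toℕ-fromℕ (suc m)))
        (trans (cong₂ _-_ (around 0ℤ (ℤ.+-identityˡ (+ n))) (around (- 1ℤ) refl)) (size-conserved Λ (- 1ℤ) (+ n)))
        where
        around : ∀ u {v} → u ℤ.+ + n ≡ v → sizeAt Λ v 0ℤ ≡ sizeAt Λ u (+ n)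
        around u refl = cong size (trans (cong₂ at (cong (λ t → u ℤ.+ t) (sym (ℤ.*-identityˡ (+ n)))) (sym (lemma (+ n)))) (periodic u (+ n) 1ℤ))
          where
          lemma : ∀ n → n - 1ℤ ℤ.* n ≡ 0ℤ
          lemma = solve-∀

    from : ∃ (Minimum (height α γ β)) → _
    -- φ and ε are the distances from the two ends of the height, 0 on the left and `height∞` on the
    -- right, down to its minimum; their difference is minus `height∞`, a second difference of
    -- sizes.
    from (μ , min) = φ , ε , length-of F φ (μ , min , depth F φ≡) , length-of E ε (μ , min , depth E ε≡) , (begin
      + φ - + ε                        ≡⟨ cong₂ _-_ φ≡ ε≡ ⟩
      (0ℤ - μ) - (height∞ α γ β - μ)   ≡⟨ lemma μ (size α) (size β) (size γ) ⟩
      (size β - size α) - (size γ - size β) ≡⟨ cong₂ _-_ wt-pred wt-i ⟨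
      wt₁ b (cyclicPred i) - wt₁ b i   ≡⟨ simple-root-pairing (cyclicPred i) i (wt₁ b) ⟨
      ⟨ (λ t → basis (cyclicPred i) t - basis i t) , wt₁ b ⟩ ∎)
      where
      open ≡-Reasoning
      rank : Kind → ℕ
      rank k = ∣ floor k α γ β - μ ∣
      φ ε : ℕ
      φ = rank F
      ε = rank E
      rank≡ : ∀ k → + rank k ≡ floor k α γ β - μ
      rank≡ k = ℤ.0≤i⇒+∣i∣≡i (≥0 (minimum≤floor k min))
      φ≡ : + φ ≡ 0ℤ - μ
      φ≡ = rank≡ F
      ε≡ : + ε ≡ height∞ α γ β - μ
      ε≡ = rank≡ E
      depth : ∀ k {r} → + r ≡ floor k α γ β - μ → floor k α γ β ≡ μ ℤ.+ + r
      depth k {r} eq = by-≡ (lemma′ (floor k α γ β) μ (+ r)) (diff-≡ (sym eq))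
        where
        lemma′ : ∀ f m r → f - (m ℤ.+ r) ≡ f - m - r
        lemma′ = solve-∀
      lemma : ∀ m a b c → (0ℤ - m) - (c ℤ.+ a - (b ℤ.+ b) - m) ≡ (b - a) - (c - b)
      lemma = solve-∀

  crystal₁ : IsCrystal {Pair n} wt₁ K₁
  crystal₁ = record
    { F⇔E      = λ i b b′ → mk⇔ (K₁-flip F i b b′) (K₁-flip E i b′ b)
    ; F-weight = F-weight
    ; strings  = strings
    }

-- The second family, by exchanging the two tableaux

module Crystal₂ {m : ℕ} where

  private
    n : ℕ
    n = 2 + m

    module C₁ = IsCrystal (Crystal₁.crystal₁ {m})

    wt-swap : ∀ (b : Pair n) t → wt₂ b t ≡ wt₁ (swap b) t
    wt-swap (pair P Q) t = refl

    K₁-swap : ∀ k (i : Fin n) b b′ → K₂ k i b ≡ just b′ → K₁ k i (swap b) ≡ just (swap b′)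
    K₁-swap k i b b′ eq = unmap (K₁ k i (swap b)) (trans (sym (K₂-swap k i b)) eq)
      where
      unmap : ∀ r → Maybe.map swap r ≡ just b′ → r ≡ just (swap b′)
      unmap (just c) refl = cong just (sym (swap-involutive c))

    K₂-from-K₁ : ∀ k (i : Fin n) b b′ → K₁ k i (swap b) ≡ just (swap b′) → K₂ k i b ≡ just b′
    K₂-from-K₁ k i b b′ eq = trans (K₂-swap k i b) (trans (cong (Maybe.map swap) eq) (cong just (swap-involutive b′)))

    power-swap : ∀ k (i : Fin n) r b → power (K₂ k i) r b ≡ Maybe.map swap (power (K₁ k i) r (swap b))
    power-swap k i zero    b = cong just (sym (swap-involutive b))
    power-swap k i (suc r) b = trans (cong (_>>= K₂ k i) (power-swap k i r b)) (bind (power (K₁ k i) r (swap b)))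
      where
      bind : ∀ s → (Maybe.map swap s >>= K₂ k i) ≡ Maybe.map swap (s >>= K₁ k i)
      bind nothing  = refl
      bind (just c) = trans (K₂-swap k i (swap c)) (cong (λ d → Maybe.map swap (K₁ k i d)) (swap-involutive c))

    length-swap : ∀ k (i : Fin n) b r → IsStringLength (K₁ k i) (swap b) r → IsStringLength (K₂ k i) b r
    length-swap k i b r (reached , bounded) =
        (λ eq → reached (unmap (power (K₁ k i) r (swap b)) (trans (sym (power-swap k i r b)) eq)))
      , (λ s ne → bounded s λ eq → ne (trans (power-swap k i s b) (cong (Maybe.map swap) eq)))
      where
      unmap : ∀ s → Maybe.map swap s ≡ nothing → s ≡ nothing
      unmap nothing _ = refl

  crystal₂ : IsCrystal {Pair n} wt₂ K₂
  crystal₂ = record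
    { F⇔E      = λ i b b′ → mk⇔
        (λ eq → K₂-from-K₁ E i b′ b (Equivalence.to (C₁.F⇔E i (swap b) (swap b′)) (K₁-swap F i b b′ eq)))
        (λ eq → K₂-from-K₁ F i b b′ (Equivalence.from (C₁.F⇔E i (swap b) (swap b′)) (K₁-swap E i b′ b eq)))
    ; F-weight = λ i b b′ eq t → trans (wt-swap b′ t) (trans (C₁.F-weight i (swap b) (swap b′) (K₁-swap F i b b′ eq) t)
        (cong (λ w → w - basis (cyclicPred i) t ℤ.+ basis i t) (sym (wt-swap b t))))
    ; strings  = λ i b → from i b (C₁.strings i (swap b))
    }
    where
    from : ∀ (i : Fin n) (b : Pair n) → ∃[ φ ] ∃[ ε ]
      IsStringLength (K₁ F i) (swap b) φ × IsStringLength (K₁ E i) (swap b) ε ×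
      + φ - + ε ≡ ⟨ (λ t → basis (cyclicPred i) t - basis i t) , wt₁ (swap b) ⟩ → ∃[ φ ] ∃[ ε ]
      IsStringLength (K₂ F i) b φ × IsStringLength (K₂ E i) b ε ×
      + φ - + ε ≡ ⟨ (λ t → basis (cyclicPred i) t - basis i t) , wt₂ b ⟩
    from i b@(pair _ _) (φ , ε , φ-max , ε-max , eq) = φ , ε , length-swap F i b φ φ-max , length-swap E i b ε ε-max , eq

theorem6p8 : ∀ (m : ℕ) →
    let n = 2 + m in
    (∀ (k k′ : Kind) (i j : Fin n) (b : Pair n) →
    (K₂ k′ j b >>= K₁ k i) ≡ (K₁ k i b >>= K₂ k′ j))
    × IsCrystal {Pair n} wt₁ K₁
    × IsCrystal {Pair n} wt₂ K₂
theorem6p8 m = operators-commute , Crystal₁.crystal₁ , Crystal₂.crystal₂
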